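{- The $\mathrm{TF}\Sigma^p_2$ problems $\textsc{$\mathrm{P}^{\mathrm{NP}}$ computation}$ and $\textsc{Least number}$ are equivalent under counterexample reductions: each is counterexample reducible to the other.
   Context: Strings are binary. A $\mathrm{TF}\Sigma^p_2$ problem is given by a polynomial-time ternary relation $R(x,y,z)$ and polynomials $p,q$ such that for every $x$ there is $y\in[2^{p(|x|)}]$ with $R(x,y,z)$ for all $z\in[2^{q(|x|)}]$; the task is, given $x$, to find such $y$ (a $z$ with $\neg R(x,y,z)$ is called a counterexample to $y$). For $\mathrm{TF}\Sigma^p_2$ problems $Q(u,v,w)$ and $R(x,y,z)$, $Q$ is counterexample reducible to $R$ if there are polynomial-time functions $f,g,h$ such that for all $u,y,w$: $R(f(u),y,h(u,y,w))\rightarrow Q(u,g(u,y),w)$. $\textsc{$\mathrm{P}^{\mathrm{NP}}$ computation}$: given a machine $M$ with an oracle tape for an NP-complete problem and a unary time bound $1^t$, find a computation $w$ of $M$ running for time $t$ which lists all oracle queries with YES/NO replies, every YES reply accompanied by a correct NP witness; a counterexample to $w$ is a witness showing that some NO reply in $w$ is false. $\textsc{Least number}$: given a circuit defining a set $S$ of strings and a string $x\in S$, find $y\in S$ such that there is no $z<y$ (lexicographically) in $S$; a counterexample to $y$ is such a $z\in S$ with $z<y$. -}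

module Defs where

open import Data.Bool using (Bool; true; false; if_then_else_)
open import Data.Nat using (ℕ; zero; suc; _*_; _^_)
open import Data.Fin using (Fin; _≟_)
open import Data.List using (List; []; _∷_; _++_; length; reverse; concatMap; replicate; map)
open import Data.Vec using (Vec; fromList)
import Data.Vec as V
open import Data.Maybe using (Maybe; just; nothing)
open import Data.Product using (Σ; ∃; _×_; _,_; proj₁; proj₂)
open import Data.Empty using (⊥)
open import Relation.Nullary using (¬_; yes; no)
open import Relation.Binary.PropositionalEquality using (_≡_; subst)

Str : Set
Str = List Bool

-- self-delimiting encoding of a string: every bit doubled, then 0 1
encStr : Str → Str
encStr x = concatMap (λ b → b ∷ b ∷ []) x ++ (false ∷ true ∷ [])

encℕ : ℕ → Str
encℕ n = replicate n true ++ (false ∷ [])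

encFin : ∀ {n} → Fin n → Str
encFin i = encℕ (Data.Fin.toℕ i)

data _<lex_ : Str → Str → Set where
  nil   : ∀ {b ys} → [] <lex (b ∷ ys)
  here  : ∀ {xs ys} → (false ∷ xs) <lex (true ∷ ys)
  there : ∀ {b xs ys} → xs <lex ys → (b ∷ xs) <lex (b ∷ ys)

Sym : Set
Sym = Maybe Bool      -- nothing = blank

encSym : Sym → Str
encSym nothing      = false ∷ false ∷ []
encSym (just false) = true ∷ false ∷ []
encSym (just true)  = true ∷ true ∷ []

data Move : Set where
  mvL mvR mvS : Move

encMove : Move → Str
encMove mvL = false ∷ false ∷ []
encMove mvR = true ∷ false ∷ []
encMove mvS = true ∷ true ∷ []

-- one-way infinite tape (left end = cell 0), as a zipper
record Tape : Set where
  constructor tape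
  field
    left  : List Sym     -- cells left of the head, nearest first
    head  : Sym
    right : List Sym     -- cells right of the head (rest blank)

open Tape public

moveTape : Move → Tape → Tape
moveTape mvL (tape [] h r)      = tape [] h r
moveTape mvL (tape (s ∷ l) h r) = tape l s (h ∷ r)
moveTape mvR (tape l h [])      = tape (h ∷ l) nothing []
moveTape mvR (tape l h (s ∷ r)) = tape (h ∷ l) s r
moveTape mvS t                  = t

writeMove : Sym → Move → Tape → Tape
writeMove s m (tape l _ r) = moveTape m (tape l s r)

blankTape : Tape
blankTape = tape [] nothing []

inputTape : Str → Tape
inputTape []      = blankTape
inputTape (b ∷ x) = tape [] (just b) (map just x)

boolPrefix : List Sym → Str
boolPrefix []             = []
boolPrefix (nothing ∷ _)  = []
boolPrefix (just b ∷ xs)  = b ∷ boolPrefix xs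

output : Tape → Str
output t = boolPrefix (head t ∷ right t)

fromLeftEnd : Tape → Str
fromLeftEnd t = boolPrefix (reverse (left t) ++ head t ∷ right t)

record TM : Set where
  field
    nQ    : ℕ
    start : Fin nQ
    halt  : Fin nQ
    δ     : Fin nQ → Sym → Fin nQ × Sym × Move

record Conf (M : TM) : Set where
  constructor conf
  field
    state : Fin (TM.nQ M)
    tp    : Tape

step : (M : TM) → Conf M → Conf M
step M (conf q t) with q ≟ TM.halt M
... | yes _ = conf q t
... | no  _ with TM.δ M q (head t)
...   | (q' , s , m) = conf q' (writeMove s m t)

run : (M : TM) → ℕ → Conf M → Conf M
run M zero    c = c
run M (suc k) c = run M k (step M c)

ComputesIn : TM → ℕ → ℕ → (Str → Str) → Set
ComputesIn M c k f =
  ∀ x → let fin = run M (c * (suc (length x)) ^ k + c) (conf (TM.start M) (inputTape x))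
        in (Conf.state fin ≡ TM.halt M) × (output (Conf.tp fin) ≡ f x)
  where open Data.Nat using (_+_)

FP : (Str → Str) → Set
FP f = Σ TM λ M → Σ ℕ λ c → Σ ℕ λ k → ComputesIn M c k f

pair : Str → Str → Str
pair u y = encStr u ++ y

triple : Str → Str → Str → Str
triple u y w = encStr u ++ encStr y ++ w

FP₂ : (Str → Str → Str) → Set
FP₂ g = Σ (Str → Str) λ G → FP G × (∀ u y → G (pair u y) ≡ g u y)

FP₃ : (Str → Str → Str → Str) → Set
FP₃ h = Σ (Str → Str) λ H → FP H × (∀ u y w → H (triple u y w) ≡ h u y w)

Problem : Set₁
Problem = Str → Str → Str → Set

CexReducible : Problem → Problem → Set
CexReducible Q R =
  Σ (Str → Str) λ f → Σ (Str → Str → Str) λ g → Σ (Str → Str → Str → Str) λ h →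
    FP f × FP₂ g × FP₃ h ×
    (∀ u y w → R (f u) y (h u y w) → Q u (g u y) w)

-- Boolean circuits (straight-line programs over AND/OR/NOT)
-- Gates m : remaining program when m wires are available
-- (wire 0 = most recently computed wire); the inputs are the first wires.

data Gates : ℕ → Set where
  out  : ∀ {m} → Fin m → Gates m
  and  : ∀ {m} → Fin m → Fin m → Gates (suc m) → Gates m
  or   : ∀ {m} → Fin m → Fin m → Gates (suc m) → Gates m
  not  : ∀ {m} → Fin m → Gates (suc m) → Gates m

Circuit : ℕ → Set
Circuit n = Gates n

evalG : ∀ {m} → Gates m → Vec Bool m → Bool
evalG (out i)     v = V.lookup v i
evalG (and i j g) v = evalG g ((V.lookup v i Data.Bool.∧ V.lookup v j) V.∷ v)
evalG (or i j g)  v = evalG g ((V.lookup v i Data.Bool.∨ V.lookup v j) V.∷ v)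
evalG (not i g)   v = evalG g (Data.Bool.not (V.lookup v i) V.∷ v)

-- the input x = x₁…xₙ is the initial wire vector (x₁ = wire 0); fixed convention
-- x belongs to the set defined by C
InSet : ∀ {n} → Circuit n → Str → Set
InSet {n} C x = Σ (length x ≡ n) λ e → evalG C (subst (Vec Bool) e (fromList x)) ≡ true

encGates : ∀ {m} → Gates m → Str
encGates (out i)     = false ∷ false ∷ encFin i
encGates (and i j g) = false ∷ true ∷ encFin i ++ encFin j ++ encGates g
encGates (or i j g)  = true ∷ false ∷ encFin i ++ encFin j ++ encGates g
encGates (not i g)   = true ∷ true ∷ encFin i ++ encGates g

encCircuit : ∀ {n} → Circuit n → Str
encCircuit {n} C = encℕ n ++ encGates C

encLN : ∀ {n} → Circuit n → Str → Str
encLN C x = encCircuit C ++ encStr x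

-- inputs not of the form (C, x) with x ∈ S, are trivial (every y is a solution)
LeastNumber : Problem
LeastNumber u y z =
  ∀ n (C : Circuit n) x → encLN C x ≡ u → InSet C x →
    InSet C y × ¬ (InSet C z × (z <lex y))

-- The NP-complete oracle problem: Circuit-SAT.
-- A query q is YES iff q encodes a satisfiable circuit; a witness is a
-- satisfying assignment.

SatWitness : Str → Str → Set
SatWitness q a = Σ ℕ λ n → Σ (Circuit n) λ C → (encCircuit C ≡ q) × InSet C a

-- Oracle Turing machines: a work tape and an oracle tape, both initially
-- blank (no input).  In state qry the query is the string written on the
-- oracle tape from its left end; the machine then moves to state yes or
-- no according to the reply.  The state halt is absorbing.

record OTM : Set where
  field
    nQ    : ℕ
    start : Fin nQ
    halt  : Fin nQ
    qry   : Fin nQ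
    yesQ  : Fin nQ
    noQ   : Fin nQ
    δ     : Fin nQ → Sym → Sym → Fin nQ × (Sym × Move) × (Sym × Move)

record OConf (M : OTM) : Set where
  constructor oconf
  field
    state : Fin (OTM.nQ M)
    work  : Tape
    orac  : Tape

oinit : (M : OTM) → OConf M
oinit M = oconf (OTM.start M) blankTape blankTape

-- a non-query step
ostep : (M : OTM) → OConf M → OConf M
ostep M (oconf q w o) with q ≟ OTM.halt M
... | yes _ = oconf q w o
... | no  _ with OTM.δ M q (head w) (head o)
...   | (q' , (s , m) , (s' , m')) = oconf q' (writeMove s m w) (writeMove s' m' o)

-- a reply: just a = YES with witness a, nothing = NO
Reply : Set
Reply = Maybe Str

answer : (M : OTM) → OConf M → Reply → OConf M
answer M (oconf _ w o) (just _) = oconf (OTM.yesQ M) w o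
answer M (oconf _ w o) nothing  = oconf (OTM.noQ M) w o

Entry : Set
Entry = Str × Reply

Consistent : (M : OTM) → ℕ → OConf M → List Entry → Set
Consistent M zero c L = L ≡ []
Consistent M (suc t) c L with OConf.state c ≟ OTM.qry M
... | no _ = Consistent M t (ostep M c) L
Consistent M (suc t) c []            | yes _ = ⊥
Consistent M (suc t) c ((q , r) ∷ L) | yes _ =
  (q ≡ fromLeftEnd (OConf.orac c)) × Consistent M t (answer M c r) L

YesCorrect : List Entry → Set
YesCorrect []                     = Data.Unit.⊤ where import Data.Unit
YesCorrect ((q , nothing) ∷ L)    = YesCorrect L
YesCorrect ((q , just a) ∷ L)     = SatWitness q a × YesCorrect L

entryAt : List Entry → ℕ → Maybe Entry
entryAt []      _       = nothing
entryAt (e ∷ L) zero    = just e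
entryAt (e ∷ L) (suc i) = entryAt L i

encReply : Reply → Str
encReply nothing  = false ∷ []
encReply (just a) = true ∷ encStr a

encEntries : List Entry → Str
encEntries []            = false ∷ []
encEntries ((q , r) ∷ L) = true ∷ encStr q ++ encReply r ++ encEntries L

encOTM : OTM → Str
encOTM M =
  encℕ nQ ++ encFin start ++ encFin halt ++ encFin qry ++ encFin yesQ ++ encFin noQ
  ++ concatMap (λ q → concatMap (λ a → concatMap (λ b → encOut (δ q a b)) syms) syms)
               (Data.List.allFin nQ)
  where
    open OTM M
    syms : List Sym
    syms = nothing ∷ just false ∷ just true ∷ []
    encOut : Fin nQ × (Sym × Move) × (Sym × Move) → Str
    encOut (q' , (s , m) , (s' , m')) = encFin q' ++ encSym s ++ encMove m ++ encSym s' ++ encMove m'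

encPNP : OTM → ℕ → Str
encPNP M t = encOTM M ++ encStr (replicate t true)

encCex : ℕ → Str → Str
encCex i a = encℕ i ++ encStr a

Refutes : List Entry → Str → Set
Refutes L z = Σ ℕ λ i → Σ Str λ a → Σ Str λ q →
  (encCex i a ≡ z) × (entryAt L i ≡ just (q , nothing)) × SatWitness q a

PNPComputation : Problem
PNPComputation u w z =
  ∀ (M : OTM) t → encPNP M t ≡ u →
    Σ (List Entry) λ L →
      (encEntries L ≡ w) × Consistent M t (oinit M) L × YesCorrect L × ¬ Refutes L z

-- Polynomial-time functions are obtained from structured single-tape programs
-- on a stack of registers: such programs are closed under composition, case
-- distinction and recursion with bounded results, with their time bounds.
--
-- PNPComputation to LeastNumber. The candidates are sequences of reply blocks,
-- 0 followed by a witness for YES and 1 for NO, and S consists of those for which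
-- all YES replies of the machine run on them are right. Changing a false NO to
-- YES and all later replies to NO gives a smaller element of S. The circuit for S
-- is a Cook-Levin tableau of a verifier, wound up helically: each cell is computed
-- by the same gates from its predecessor and from three cells of the row before,
-- at constant distances, so the circuit is essentially one string repeated.
--
-- LeastNumber to PNPComputation. The machine asks for each bit in turn whether S
-- has an element in which this bit and all bits with reply YES are 0. The last
-- witness y lies in S; if w in S is smaller, then at the first difference y has a 1,
-- so the reply there was NO, and w refutes it.
module Submission where

open import Defs
open import Data.Bool using (Bool; true; false; if_then_else_; _∧_; _∨_)
open import Data.Nat hiding (_/_; _%_)
open import Data.Nat.DivMod using (_/_; _%_; [m+kn]%n≡m%n; m<n⇒m%n≡m; +-distrib-/-∣ʳ; m<n⇒m/n≡0; m*n/n≡m; m<n*o⇒m/o<n; m%n<n; m≡m%n+[m/n]*n)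
open import Data.Nat.Divisibility using (divides)
open import Data.Nat.Properties
open import Data.Fin using (Fin; toℕ; _↑ˡ_; _↑ʳ_; splitAt)
import Data.Fin as F
import Data.Fin.Properties as FP
open import Data.List using (List; []; _∷_; _++_; length; reverse; concatMap; replicate; map; _ʳ++_)
import Data.List as List
open import Data.List.Properties hiding (≡-dec)
open import Data.Vec using (Vec; []; _∷_; toList; fromList)
import Data.Vec as V
open import Data.Maybe using (Maybe; just; nothing; maybe)
open import Data.Product using (Σ; ∃; _×_; _,_; proj₁; proj₂)
open import Data.Sum using (_⊎_; inj₁; inj₂)
open import Data.Unit using (⊤; tt)
open import Data.Empty using (⊥; ⊥-elim)
open import Function using (_∘_; case_of_)
open import Relation.Nullary using (¬_; yes; no; Dec)
open import Relation.Binary.PropositionalEquality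

open import Data.Nat.Tactic.RingSolver using (solve-∀)
import Data.Vec.Properties as VP

-- Structured single-tape programs and their compilation to Turing machines

-- Two demands shape the data: every function must run on strings, and a reduction speaks about all
-- encoded objects. No injectivity of circuit or machine encodings is invoked. Decoders are shown to
-- invert encoders, and two circuits with the same code are compared through the evaluator `evalS`,
-- which works on strings. The helix answers the first demand. Wires are addressed by their distance
-- from the newest one, so if every cell costs the same number `G` of gates, all cells of the
-- tableau get literally the same gates; the row length enters only through the parameter `ζ`. The
-- seam, where the end of one row meets the start of the next, is harmless because rows are longer
-- than the running time and cell 0 carries a flag. In the other direction the oracle machine has no
-- input, so the circuit is built into its states. Clearing a bit of the argument means turning one
-- gate from `or` (code 10) into `and` (code 01) with the same operands. The queries are thus
-- obtained by editing one tape in place. A constant must be computed from some wire; hence the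
-- spare input bit of both kinds of circuits.

data Cmd : Set where
  op   : (Sym → Sym × Move) → Cmd
  _⨾_  : Cmd → Cmd → Cmd
  cond : Cmd → Cmd → Cmd → Cmd
  loop : Cmd → Cmd → Cmd

infixr 5 _⨾_

act : (Sym → Sym × Move) → Tape → Tape
act f t = writeMove (proj₁ (f (head t))) (proj₂ (f (head t))) t

pick3 : {A : Set} → A → A → A → Sym → A
pick3 a b c nothing      = a
pick3 a b c (just false) = b
pick3 a b c (just true)  = c

bit : {A : Set} → A → A → Bool → A
bit a b false = a
bit a b true  = b

-- Exec c t k t′: started on t, c ends on t′ after at most k steps.
data Exec : Cmd → Tape → ℕ → Tape → Set where
  opE   : ∀ {f t} → Exec (op f) t 1 (act f t)
  seqE  : ∀ {c d t k t′ l t″} → Exec c t k t′ → Exec d t′ l t″ → Exec (c ⨾ d) t (k + l) t″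
  condE : ∀ {a b c t k t′} → Exec (pick3 a b c (head t)) t k t′ → Exec (cond a b c) t (suc k) t′
  loop0 : ∀ {b c t} → head t ≡ nothing → Exec (loop b c) t 1 t
  loop1 : ∀ {b c t k t′ l t″ x} → head t ≡ just x → Exec (bit b c x) t k t′ →
          Exec (loop b c) t′ l t″ → Exec (loop b c) t (suc (k + l)) t″
  leE   : ∀ {c t k l t′} → k ≤ l → Exec c t k t′ → Exec c t l t′

-- Control points inside the program only. The exit is the `nothing` of `Maybe (States c)`, so that
-- the enclosing program decides through `redirect` where it leads.
States : Cmd → Set
States (op f)       = ⊤
States (c ⨾ d)      = States c ⊎ States d
States (cond a b c) = ⊤ ⊎ (States a ⊎ (States b ⊎ States c))
States (loop b c)   = ⊤ ⊎ (States b ⊎ States c)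

entry : ∀ c → States c
entry (op f)       = tt
entry (c ⨾ d)      = inj₁ (entry c)
entry (cond a b c) = inj₁ tt
entry (loop b c)   = inj₁ tt

Out : Set → Set
Out A = Maybe A × Sym × Move

redirect : {A B : Set} → (A → B) → Maybe B → Out A → Out B
redirect f e (q , o) = maybe (just ∘ f) e q , o

trans-fn : ∀ c → States c → Sym → Out (States c)
trans-fn (op f)       tt       s = nothing , f s
trans-fn (c ⨾ d)      (inj₁ q) s = redirect inj₁ (just (inj₂ (entry d))) (trans-fn c q s)
trans-fn (c ⨾ d)      (inj₂ q) s = redirect inj₂ nothing (trans-fn d q s)
trans-fn (cond a b c) (inj₁ _) s =
  just (inj₂ (pick3 (inj₁ (entry a)) (inj₂ (inj₁ (entry b))) (inj₂ (inj₂ (entry c))) s)) , s , mvS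
trans-fn (cond a b c) (inj₂ (inj₁ q)) s = redirect (inj₂ ∘ inj₁) nothing (trans-fn a q s)
trans-fn (cond a b c) (inj₂ (inj₂ (inj₁ q))) s = redirect (inj₂ ∘ inj₂ ∘ inj₁) nothing (trans-fn b q s)
trans-fn (cond a b c) (inj₂ (inj₂ (inj₂ q))) s = redirect (inj₂ ∘ inj₂ ∘ inj₂) nothing (trans-fn c q s)
trans-fn (loop b c) (inj₁ _) s =
  pick3 nothing (just (inj₂ (inj₁ (entry b)))) (just (inj₂ (inj₂ (entry c)))) s , s , mvS
trans-fn (loop b c) (inj₂ (inj₁ q)) s = redirect (inj₂ ∘ inj₁) (just (inj₁ tt)) (trans-fn b q s)
trans-fn (loop b c) (inj₂ (inj₂ q)) s = redirect (inj₂ ∘ inj₂) (just (inj₁ tt)) (trans-fn c q s)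

applyOut : {A : Set} → Out A → Tape → Tape
applyOut (_ , s , m) t = writeMove s m t

data Steps {A : Set} (δ : A → Sym → Out A) : Maybe A → Tape → ℕ → Maybe A → Tape → Set where
  []  : ∀ {q t} → Steps δ q t 0 q t
  _∷_ : ∀ {q t q₁ o k q′ t′} → δ q (head t) ≡ (q₁ , o) →
        Steps δ q₁ (applyOut {A} (q₁ , o) t) k q′ t′ → Steps δ (just q) t (suc k) q′ t′

_∷ʳ_ : ∀ {A} {δ : A → Sym → Out A} {q t k q′ t′ l q″ t″} →
       Steps δ q t k q′ t′ → Steps δ q′ t′ l q″ t″ → Steps δ q t (k + l) q″ t″
[]       ∷ʳ r = r
(e ∷ s) ∷ʳ r = e ∷ (s ∷ʳ r)

liftS : ∀ {A B} {δ : A → Sym → Out A} {δ′ : B → Sym → Out B} (f : A → B) (e : Maybe B) →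
        (∀ q s → δ′ (f q) s ≡ redirect f e (δ q s)) →
        ∀ {q t k q′ t′} → Steps δ q t k q′ t′ →
        Steps δ′ (maybe (just ∘ f) e q) t k (maybe (just ∘ f) e q′) t′
liftS f e h [] = []
liftS f e h (_∷_ {q = q} {t = t} eq s) =
  trans (h q (head t)) (cong (redirect f e) eq) ∷ liftS f e h s

-- Because of `leE` an `Exec` bounds the time from above, whereas `Steps` counts exactly; hence the
-- actual number `j` is existential.
Done : ∀ c → States c → Tape → ℕ → Tape → Set
Done c q t k t′ = ∃ λ j → j ≤ k × Steps (trans-fn c) (just q) t j nothing t′

stay : ∀ t → writeMove (head t) mvS t ≡ t
stay (tape l h r) = refl

compile : ∀ {c t k t′} → Exec c t k t′ → Done c (entry c) t k t′
compile opE = 1 , ≤-refl , (refl ∷ [])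
compile (seqE e e′) with compile e | compile e′
... | j , p , s | j′ , p′ , s′ = j + j′ , +-mono-≤ p p′ ,
  (liftS inj₁ _ (λ _ _ → refl) s ∷ʳ liftS inj₂ nothing (λ _ _ → refl) s′)
compile (condE {a} {b} {c} {t} e) = go (head t) refl e
  where
  prep : ∀ {q k t′} → trans-fn (cond a b c) (inj₁ tt) (head t) ≡ (just q , head t , mvS) →
         Done (cond a b c) q t k t′ → Done (cond a b c) (inj₁ tt) t (suc k) t′
  prep {q} eq (j , p , s) = suc j , s≤s p ,
    (eq ∷ subst (λ z → Steps _ _ z j nothing _) (sym (stay t)) s)
  go : ∀ {k t′} x → head t ≡ x → Exec (pick3 a b c x) t k t′ → Done (cond a b c) (inj₁ tt) t (suc k) t′
  go nothing eq e with compile e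
  ... | j , p , s = prep (cong (λ x → just (inj₂ (pick3 _ _ _ x)) , head t , mvS) eq) (j , p , liftS (inj₂ ∘ inj₁) nothing (λ _ _ → refl) s)
  go (just false) eq e with compile e
  ... | j , p , s = prep (cong (λ x → just (inj₂ (pick3 _ _ _ x)) , head t , mvS) eq) (j , p , liftS (inj₂ ∘ inj₂ ∘ inj₁) nothing (λ _ _ → refl) s)
  go (just true) eq e with compile e
  ... | j , p , s = prep (cong (λ x → just (inj₂ (pick3 _ _ _ x)) , head t , mvS) eq) (j , p , liftS (inj₂ ∘ inj₂ ∘ inj₂) nothing (λ _ _ → refl) s)
compile (loop0 {b} {c} {t} eq) = 1 , ≤-refl ,
  (cong (λ x → pick3 nothing _ _ x , head t , mvS) eq ∷
   subst (λ z → Steps _ _ z 0 nothing t) (sym (stay t)) [])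
compile (loop1 {b} {c} {t} {x = x} eq e e′) = go x eq e
  where
  rest = compile e′
  prep : ∀ {q k t′} → trans-fn (loop b c) (inj₁ tt) (head t) ≡ (just q , head t , mvS) →
         Done (loop b c) q t k t′ → Done (loop b c) (inj₁ tt) t (suc k) t′
  prep {q} eq (j , p , s) = suc j , s≤s p ,
    (eq ∷ subst (λ z → Steps _ _ z j nothing _) (sym (stay t)) s)
  go : ∀ {k} x → head t ≡ just x → Exec (bit b c x) t k _ → Done (loop b c) (inj₁ tt) t (suc (k + _)) _
  go false eq e with compile e | rest
  ... | j , p , s | j′ , p′ , s′ = prep (cong (λ x → pick3 nothing _ _ x , head t , mvS) eq)
        (j + j′ , +-mono-≤ p p′ , (liftS (inj₂ ∘ inj₁) (just (inj₁ tt)) (λ _ _ → refl) s ∷ʳ s′))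
  go true eq e with compile e | rest
  ... | j , p , s | j′ , p′ , s′ = prep (cong (λ x → pick3 nothing _ _ x , head t , mvS) eq)
        (j + j′ , +-mono-≤ p p′ , (liftS (inj₂ ∘ inj₂) (just (inj₁ tt)) (λ _ _ → refl) s ∷ʳ s′))
compile (leE k≤l e) with compile e
... | j , p , s = j , ≤-trans p k≤l , s

card : Cmd → ℕ
card (op f)       = 1
card (c ⨾ d)      = card c + card d
card (cond a b c) = 1 + (card a + (card b + card c))
card (loop b c)   = 1 + (card b + card c)

toF⊎ : ∀ {A B : Set} {m n} → (A → Fin m) → (B → Fin n) → A ⊎ B → Fin (m + n)
toF⊎ {n = n} f g (inj₁ a) = f a ↑ˡ n
toF⊎ {m = m} f g (inj₂ b) = m ↑ʳ g b

fromF⊎ : ∀ {A B : Set} m {n} → (Fin m → A) → (Fin n → B) → Fin (m + n) → A ⊎ B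
fromF⊎ m f g i with splitAt m i
... | inj₁ a = inj₁ (f a)
... | inj₂ b = inj₂ (g b)

toF : ∀ c → States c → Fin (card c)
toF (op f)       = λ _ → F.zero
toF (c ⨾ d)      = toF⊎ (toF c) (toF d)
toF (cond a b c) = toF⊎ {m = 1} (λ _ → F.zero) (toF⊎ (toF a) (toF⊎ (toF b) (toF c)))
toF (loop b c)   = toF⊎ {m = 1} (λ _ → F.zero) (toF⊎ (toF b) (toF c))

fromF : ∀ c → Fin (card c) → States c
fromF (op f)       = λ _ → tt
fromF (c ⨾ d)      = fromF⊎ _ (fromF c) (fromF d)
fromF (cond a b c) = fromF⊎ 1 (λ _ → tt) (fromF⊎ _ (fromF a) (fromF⊎ _ (fromF b) (fromF c)))
fromF (loop b c)   = fromF⊎ 1 (λ _ → tt) (fromF⊎ _ (fromF b) (fromF c))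

from∘to⊎ : ∀ {A B : Set} {m n} (f : A → Fin m) (g : B → Fin n) (f′ : Fin m → A) (g′ : Fin n → B) →
           (∀ a → f′ (f a) ≡ a) → (∀ b → g′ (g b) ≡ b) →
           ∀ x → fromF⊎ m f′ g′ (toF⊎ f g x) ≡ x
from∘to⊎ {m = m} {n} f g f′ g′ p q (inj₁ a) rewrite FP.splitAt-↑ˡ m (f a) n = cong inj₁ (p a)
from∘to⊎ {m = m} {n} f g f′ g′ p q (inj₂ b) rewrite FP.splitAt-↑ʳ m n (g b) = cong inj₂ (q b)

from∘to : ∀ c q → fromF c (toF c q) ≡ q
from∘to (op f)       tt = refl
from∘to (c ⨾ d)      = from∘to⊎ (toF c) _ _ _ (from∘to c) (from∘to d)
from∘to (cond a b c) = from∘to⊎ {m = 1} (λ _ → F.zero) _ _ _ (λ _ → refl)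
  (from∘to⊎ (toF a) _ _ _ (from∘to a) (from∘to⊎ (toF b) _ _ _ (from∘to b) (from∘to c)))
from∘to (loop b c)   = from∘to⊎ {m = 1} (λ _ → F.zero) _ _ _ (λ _ → refl)
  (from∘to⊎ (toF b) _ _ _ (from∘to b) (from∘to c))

machine : Cmd → TM
machine c = record
  { nQ = suc (card c) ; start = F.suc (toF c (entry c)) ; halt = F.zero
  ; δ = λ { F.zero    s → F.zero , s , mvS
          ; (F.suc i) s → let (q , o) = trans-fn c (fromF c i) s in maybe (F.suc ∘ toF c) F.zero q , o } }

run-+ : ∀ M j k c → run M (j + k) c ≡ run M k (run M j c)
run-+ M zero    k c = refl
run-+ M (suc j) k c = run-+ M j k (step M c)

-- Surplus steps do no harm, so an upper bound on the running time can be used as the step count.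
run-halted : ∀ M k t → run M k (conf (TM.halt M) t) ≡ conf (TM.halt M) t
run-halted M zero    t = refl
run-halted M (suc k) t with TM.halt M F.≟ TM.halt M
... | yes _ = run-halted M k t
... | no ne = ⊥-elim (ne refl)

module _ (c : Cmd) where

  stateOf : Maybe (States c) → Fin (suc (card c))
  stateOf = maybe (F.suc ∘ toF c) F.zero

  step-machine : ∀ q t {q₁ o} → trans-fn c q (head t) ≡ (q₁ , o) →
                 step (machine c) (conf (stateOf (just q)) t) ≡ conf (stateOf q₁) (applyOut (q₁ , o) t)
  step-machine q t eq rewrite from∘to c q | eq = refl

  run-steps : ∀ {q t j q′ t′} → Steps (trans-fn c) q t j q′ t′ →
              run (machine c) j (conf (stateOf q) t) ≡ conf (stateOf q′) t′
  run-steps [] = refl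
  run-steps (_∷_ {q = q} {t = t} {k = k} eq s) = trans (cong (run (machine c) k) (step-machine q t eq)) (run-steps s)

  run-machine : ∀ {t k t′} → Exec c t k t′ →
                run (machine c) k (conf (TM.start (machine c)) t) ≡ conf (TM.halt (machine c)) t′
  run-machine {k = k} e with compile e
  ... | j , p , s = begin
      run (machine c) k _                      ≡⟨ cong (λ z → run (machine c) z _) (sym (m+[n∸m]≡n p)) ⟩
      run (machine c) (j + (k ∸ j)) _          ≡⟨ run-+ (machine c) j (k ∸ j) _ ⟩
      run (machine c) (k ∸ j) (run (machine c) j _) ≡⟨ cong (run (machine c) (k ∸ j)) (run-steps s) ⟩
      run (machine c) (k ∸ j) (conf F.zero _)    ≡⟨ run-halted (machine c) (k ∸ j) _ ⟩
      conf F.zero _ ∎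
    where open ≡-Reasoning

-- Stacks of registers: the tape holds the registers separated by blanks, the
-- topmost one rightmost and with its first bit rightmost; the head rests on
-- the blank after it.

encOn : List Str → List Sym → List Sym
encOn []       l = l
encOn (s ∷ ss) l = map just s ++ nothing ∷ encOn ss l

encOn-++ : ∀ w v l → encOn (w ++ v) l ≡ encOn w (encOn v l)
encOn-++ []      v l = refl
encOn-++ (s ∷ w) v l = cong (λ z → map just s ++ nothing ∷ z) (encOn-++ w v l)

size : List Str → ℕ
size []       = 0
size (s ∷ ss) = suc (length s) + size ss

size-++ : ∀ w v → size (w ++ v) ≡ size w + size v
size-++ []      v = refl
size-++ (s ∷ w) v = trans (cong (suc (length s) +_) (size-++ w v)) (sym (+-assoc (suc (length s)) (size w) (size v)))

blanks : ℕ → List Sym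
blanks m = replicate m nothing

cfg : List Str → ℕ → Tape
cfg rs m = tape (encOn rs []) nothing (blanks m)

focusL focusR : List Sym → List Sym → Tape
focusL []      r = tape [] nothing r
focusL (h ∷ l) r = tape l h r
focusR l []      = tape l nothing []
focusR l (h ∷ r) = tape l h r

mvl mvr skip goL goR : Cmd
mvl  = op (λ s → s , mvL)
mvr  = op (λ s → s , mvR)
skip = op (λ s → s , mvS)
goL  = mvl ⨾ loop mvl mvl
goR  = mvr ⨾ loop mvr mvr

wr : Sym → Move → Cmd
wr s m = op (λ _ → s , m)

-- The nesting follows the traversal: going left, the top register is passed first; going right, it
-- is passed last. Both inductions then peel off the top register.
repL repR : ℕ → Cmd → Cmd
repL zero    c = skip
repL (suc n) c = c ⨾ repL n c
repR zero    c = skip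
repR (suc n) c = repR n c ⨾ c

-- The registers w as seen from their left end.
rEnc : List Str → List Sym → List Sym
rEnc []      r = r
rEnc (s ∷ w) r = rEnc w (map just s ʳ++ nothing ∷ r)

rEnc-snoc : ∀ w x r → rEnc (w ++ x ∷ []) r ≡ map just x ʳ++ nothing ∷ rEnc w r
rEnc-snoc []      x r = refl
rEnc-snoc (s ∷ w) x r = rEnc-snoc w x _

bitE : ∀ {c t k t′} b → Exec c t k t′ → Exec (bit c c b) t k t′
bitE false e = e
bitE true  e = e

moveR-focus : ∀ l h r → moveTape mvR (tape l h r) ≡ focusR (h ∷ l) r
moveR-focus l h []      = refl
moveR-focus l h (x ∷ r) = refl

moveL-focus : ∀ s l h r → moveTape mvL (tape (map just s ++ nothing ∷ l) h r) ≡ focusL (map just s ++ nothing ∷ l) (h ∷ r)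
moveL-focus []      l h r = refl
moveL-focus (b ∷ s) l h r = refl

opE≡ : ∀ {f t t′} → act f t ≡ t′ → Exec (op f) t 1 t′
opE≡ refl = opE

fromE : ∀ {c t t₁ k t′} → t ≡ t₁ → Exec c t₁ k t′ → Exec c t k t′
fromE refl e = e

toE : ∀ {c t k t₁ t′} → t₁ ≡ t′ → Exec c t k t₁ → Exec c t k t′
toE refl e = e

castE : ∀ {c t k l t′} → k ≡ l → Exec c t k t′ → Exec c t l t′
castE refl e = e

scanL : ∀ s l r → Exec (loop mvl mvl) (focusL (map just s ++ nothing ∷ l) r) (suc (2 * length s))
                       (tape l nothing (map just s ʳ++ r))
scanL []      l r = loop0 refl
scanL (b ∷ s) l r = castE (arith (length s))
  (loop1 refl (bitE b (opE≡ (moveL-focus s l (just b) r))) (scanL s l (just b ∷ r)))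
  where
  arith : ∀ n → suc (1 + suc (2 * n)) ≡ suc (2 * suc n)
  arith = solve-∀

scanR : ∀ s l r → Exec (loop mvr mvr) (focusR l (map just s ++ nothing ∷ r)) (suc (2 * length s))
                       (tape (map just s ʳ++ l) nothing r)
scanR []      l r = loop0 refl
scanR (b ∷ s) l r = castE (arith (length s))
  (loop1 refl (bitE b (opE≡ (moveR-focus l (just b) _))) (scanR s (just b ∷ l) r))
  where
  arith : ∀ n → suc (1 + suc (2 * n)) ≡ suc (2 * suc n)
  arith = solve-∀

goL-E : ∀ s l r → Exec goL (tape (map just s ++ nothing ∷ l) nothing r) (2 * suc (length s))
                           (tape l nothing (map just s ʳ++ nothing ∷ r))
goL-E s l r = castE (arith (length s)) (seqE (opE≡ (moveL-focus s l nothing r)) (scanL s l _))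
  where
  arith : ∀ n → 1 + suc (2 * n) ≡ 2 * suc n
  arith = solve-∀

map-reverse-++ : ∀ (s : Str) (l : List Sym) → map just (reverse s) ++ l ≡ map just s ʳ++ l
map-reverse-++ s l = trans (cong (_++ l) (reverse-map just s)) (sym (ʳ++-defn (map just s)))

map-reverse-ʳ++ : ∀ (s : Str) (l : List Sym) → map just (reverse s) ʳ++ l ≡ map just s ++ l
map-reverse-ʳ++ s l = trans (sym (map-reverse-++ (reverse s) l)) (cong (λ z → map just z ++ l) (reverse-involutive s))

goR-E : ∀ s l r → Exec goR (tape l nothing (map just s ʳ++ nothing ∷ r)) (2 * suc (length s))
                           (tape (map just s ++ nothing ∷ l) nothing r)
goR-E s l r = subst₂ (λ x y → Exec goR (tape l nothing x) _ (tape y nothing r))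
    (map-reverse-++ s _) (map-reverse-ʳ++ s _)
    (castE (trans (cong (λ n → 1 + suc (2 * n)) (length-reverse s)) (arith (length s)))
      (seqE (opE≡ (moveR-focus l nothing _)) (scanR (reverse s) (nothing ∷ l) r)))
  where
  arith : ∀ n → 1 + suc (2 * n) ≡ 2 * suc n
  arith = solve-∀

goLs : ∀ w {n} → length w ≡ n → ∀ l r →
       Exec (repL n goL) (tape (encOn w l) nothing r) (1 + 2 * size w) (tape l nothing (rEnc w r))
goLs []      refl l r = opE
goLs (s ∷ w) refl l r = castE (arith (length s) (size w)) (seqE (goL-E s _ r) (goLs w refl l _))
  where
  arith : ∀ a b → 2 * suc a + (1 + 2 * b) ≡ 1 + 2 * (suc a + b)
  arith = solve-∀

goRs : ∀ w {n} → length w ≡ n → ∀ l r →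
       Exec (repR n goR) (tape l nothing (rEnc w r)) (1 + 2 * size w) (tape (encOn w l) nothing r)
goRs []      refl l r = opE
goRs (s ∷ w) refl l r = castE (arith (length s) (size w)) (seqE (goRs w refl l _) (goR-E s _ r))
  where
  arith : ∀ a b → (1 + 2 * b) + 2 * suc a ≡ 1 + 2 * (suc a + b)
  arith = solve-∀

-- Copying a register bit by bit: the bit being copied is replaced by a blank,
-- so that during the trip the register counts as two.

copyBit : ℕ → Bool → Cmd
copyBit j b = wr nothing mvS ⨾ repR (2 + j) goR ⨾ wr (just b) mvR ⨾ repL (2 + j) goL ⨾ wr (just b) mvR

pick : ℕ → Cmd
pick j = mvr ⨾ repL (2 + j) goL ⨾ mvr ⨾ loop (copyBit j false) (copyBit j true) ⨾ repR (1 + j) goR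

bit-copyBit : ∀ {j t k t′} b → Exec (copyBit j b) t k t′ → Exec (bit (copyBit j false) (copyBit j true) b) t k t′
bit-copyBit false e = e
bit-copyBit true  e = e

length-snoc : ∀ {A : Set} (w : List A) x → length (w ++ x ∷ []) ≡ suc (length w)
length-snoc []      x = refl
length-snoc (_ ∷ w) x = cong suc (length-snoc w x)

moveR-blanks : ∀ l h m → moveTape mvR (tape l h (blanks m)) ≡ tape (h ∷ l) nothing (blanks (pred m))
moveR-blanks l h zero    = refl
moveR-blanks l h (suc m) = refl

module _ (w : List Str) (F : List Sym) where

  private j = length w

  copyCost : ℕ → ℕ
  copyCost K = 7 + 4 * (size w + (2 + K))

  -- Blanking the bit splits the register: `s` to the left of the hole is already copied, and the
  -- rest, which is `reverse ρ` as a register, lies between the hole and `w`. The copy made so far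
  -- is the top register. Hence `2 + j` registers are crossed on each trip.
  copyBit-E : ∀ b ρ s m {K} → length ρ + length s ≤ K →
    let A = map just s ++ nothing ∷ F in
    Exec (copyBit j b)
         (tape A (just b) (map just ρ ++ nothing ∷ rEnc (s ∷ w) (blanks m)))
         (copyCost K)
         (focusR (just b ∷ A) (map just ρ ++ nothing ∷ rEnc ((b ∷ s) ∷ w) (blanks (pred m))))
  copyBit-E b ρ s m {K} le =
    leE bound (seqE opE (seqE toRight (seqE (opE≡ (moveR-blanks (encOn W A) (just b) m))
                 (seqE toLeft (opE≡ (moveR-focus A (just b) _))))))
    where
    A = map just s ++ nothing ∷ F
    x = reverse ρ
    W = s ∷ w ++ x ∷ []
    W⁺ = (b ∷ s) ∷ w ++ x ∷ []
    len : length W ≡ 2 + j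
    len = cong suc (length-snoc w x)
    shape : ∀ y n → map just ρ ++ nothing ∷ rEnc (y ∷ w) (blanks n) ≡ rEnc (y ∷ w ++ x ∷ []) (blanks n)
    shape y n = sym (trans (rEnc-snoc (y ∷ w) x _) (map-ρ _))
      where
      map-ρ : ∀ l → map just x ʳ++ l ≡ map just ρ ++ l
      map-ρ = map-reverse-ʳ++ ρ
    toRight : Exec (repR (2 + j) goR) (tape A nothing (map just ρ ++ nothing ∷ rEnc (s ∷ w) (blanks m)))
                 (1 + 2 * size W) (tape (encOn W A) nothing (blanks m))
    toRight = fromE (cong (tape A nothing) (shape s m)) (goRs W len A (blanks m))
    toLeft : Exec (repL (2 + j) goL) (tape (encOn W⁺ A) nothing (blanks (pred m)))
                (1 + 2 * size W⁺) (tape A nothing (map just ρ ++ nothing ∷ rEnc ((b ∷ s) ∷ w) (blanks (pred m))))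
    toLeft = toE (cong (tape A nothing) (sym (shape (b ∷ s) _))) (goLs W⁺ len A (blanks (pred m)))
    sz : ∀ y → size (y ∷ w ++ x ∷ []) ≡ suc (length y) + (size w + (suc (length ρ) + 0))
    sz y = cong (suc (length y) +_) (trans (size-++ w (x ∷ [])) (cong (λ n → size w + (suc n + 0)) (length-reverse ρ)))
    arith : ∀ a b c → 1 + ((1 + 2 * (suc b + (a + (suc c + 0)))) + (1 + ((1 + 2 * (suc (suc b) + (a + (suc c + 0)))) + 1)))
                      ≡ 7 + 4 * (a + (2 + (c + b)))
    arith = solve-∀
    bound : 1 + ((1 + 2 * size W) + (1 + ((1 + 2 * size W⁺) + 1))) ≤ copyCost K
    bound = ≤-trans (≤-reflexive (trans (cong₂ (λ p q → 1 + ((1 + 2 * p) + (1 + ((1 + 2 * q) + 1)))) (sz s) (sz (b ∷ s)))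
                                        (arith (size w) (length s) (length ρ))))
                    (+-monoʳ-≤ 7 (*-monoʳ-≤ 4 (+-monoʳ-≤ (size w) (+-monoʳ-≤ 2 le))))

  copyLoop : ∀ ρ s m K → length ρ + length s ≤ K → ∃ λ m′ →
    Exec (loop (copyBit j false) (copyBit j true))
         (focusR (map just s ++ nothing ∷ F) (map just ρ ++ nothing ∷ rEnc (s ∷ w) (blanks m)))
         (suc (length ρ * suc (copyCost K)))
         (tape (map just (ρ ʳ++ s) ++ nothing ∷ F) nothing (rEnc ((ρ ʳ++ s) ∷ w) (blanks m′)))
  copyLoop []      s m K le = m , loop0 refl
  copyLoop (b ∷ ρ) s m K le with copyLoop ρ (b ∷ s) (pred m) K (≤-trans (≤-reflexive (+-suc (length ρ) (length s))) le)
  ... | m′ , e = m′ , castE (arith (copyCost K) (length ρ * suc (copyCost K)))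
          (loop1 refl (bit-copyBit b (copyBit-E b ρ s m (≤-trans (n≤1+n _) le))) e)
    where
    arith : ∀ c d → suc (c + suc d) ≡ suc (suc c + d)
    arith = solve-∀

opaque
  pickCost : ℕ → ℕ
  pickCost N = 10 + (16 * N + 4 * (N * N))

  pick-E : ∀ w s F N → size w + suc (length s) ≤ N → ∀ m → ∃ λ m′ →
    Exec (pick (length w)) (tape (encOn w (map just s ++ nothing ∷ F)) nothing (blanks m)) (pickCost N)
         (tape (encOn (s ∷ w) (map just s ++ nothing ∷ F)) nothing (blanks m′))
  pick-E w s F N le m with copyLoop w F (reverse s) [] (pred m) (length s) (≤-reflexive (trans (+-identityʳ _) (length-reverse s)))
  ... | m′ , e = m′ , leE bound
        (seqE (opE≡ (moveR-blanks _ nothing m))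
        (seqE (toE (cong (tape F nothing) (rEnc-snoc ([] ∷ w) s _))
                 (fromE (cong (λ z → tape (nothing ∷ z) nothing (blanks (pred m))) (sym (encOn-++ w (s ∷ []) F)))
                   (goLs ([] ∷ w ++ s ∷ []) (cong suc (length-snoc w s)) F (blanks (pred m)))))
        (seqE (opE≡ (moveR-focus F nothing _))
        (seqE (fromE (cong (focusR (nothing ∷ F)) (sym (map-reverse-++ s _)))
               (toE (cong (λ z → tape (map just z ++ nothing ∷ F) nothing (rEnc (z ∷ w) (blanks m′))) ss) e))
              (goRs (s ∷ w) refl (map just s ++ nothing ∷ F) (blanks m′))))))
    where
    ss : reverse s ʳ++ [] ≡ s
    ss = trans (ʳ++-defn (reverse s)) (trans (++-identityʳ _) (reverse-involutive s))
    A B : ℕ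
    A = size w
    B = length s
    arith : ∀ a b → 1 + ((1 + 2 * (1 + (a + (suc b + 0)))) + (1 + (suc (b * suc (7 + 4 * (a + (2 + b)))) + (1 + 2 * (suc b + a)))))
                    ≡ (5 + 2 * (1 + (a + suc b)) + 2 * (a + suc b)) + b * (12 + 4 * (a + suc b))
    arith = solve-∀
    arith₂ : ∀ n → (5 + 2 * (1 + n) + 2 * n) + n * (12 + 4 * n) + 3 ≡ 10 + (16 * n + 4 * (n * n))
    arith₂ = solve-∀
    mono : ∀ n → n ≤ N → B ≤ N → (5 + 2 * (1 + n) + 2 * n) + B * (12 + 4 * n) ≤ (5 + 2 * (1 + N) + 2 * N) + N * (12 + 4 * N)
    mono n p q = +-mono-≤ (+-mono-≤ (+-monoʳ-≤ 5 (*-monoʳ-≤ 2 (s≤s p))) (*-monoʳ-≤ 2 p)) (*-mono-≤ q (+-monoʳ-≤ 12 (*-monoʳ-≤ 4 p)))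
    bound : 1 + ((1 + 2 * size ([] ∷ w ++ s ∷ [])) + (1 + (suc (length (reverse s) * suc (copyCost w F B)) + (1 + 2 * size (s ∷ w))))) ≤ pickCost N
    bound = ≤-trans (≤-reflexive (trans (cong₂ (λ p q → 1 + ((1 + 2 * suc p) + (1 + (suc (q * suc (7 + 4 * (A + (2 + B)))) + (1 + 2 * (suc B + A))))))
                                        (size-++ w (s ∷ [])) (length-reverse s)) (arith A B)))
            (≤-trans (mono (A + suc B) le (≤-trans (n≤1+n B) (≤-trans (m≤n+m (suc B) A) le)))
            (≤-trans (m≤m+n _ 3) (≤-reflexive (arith₂ N))))

  pickCost-def : ∀ N → pickCost N ≡ 10 + (16 * N + 4 * (N * N))
  pickCost-def N = refl

-- Deleting a register: each of its bits leaves a hole that is closed by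
-- shifting everything to its right by one cell.

shiftBit : Bool → Cmd
shiftBit b = mvl ⨾ wr (just b) mvR ⨾ mvr

shift : Cmd
shift = mvr ⨾ loop (shiftBit false) (shiftBit true) ⨾ mvl ⨾ wr nothing mvR

dropBit : ℕ → Cmd
dropBit j = shift ⨾ repR j shift ⨾ mvl ⨾ repL j goL ⨾ mvl

del : ℕ → Cmd
del j = repL j goL ⨾ mvl ⨾ loop (dropBit j) (dropBit j) ⨾ mvr ⨾ repR j shift ⨾ mvl

shiftBit-E : ∀ b g l r → Exec (bit (shiftBit false) (shiftBit true) b) (tape (g ∷ l) (just b) r) 3 (focusR (just b ∷ just b ∷ l) r)
shiftBit-E false g l r = seqE opE (seqE opE (opE≡ (moveR-focus _ _ r)))
shiftBit-E true  g l r = seqE opE (seqE opE (opE≡ (moveR-focus _ _ r)))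

shiftLoop : ∀ ρ g l r → ∃ λ g′ → Exec (loop (shiftBit false) (shiftBit true))
              (focusR (g ∷ l) (map just ρ ++ nothing ∷ r)) (suc (4 * length ρ))
              (tape (g′ ∷ (map just ρ ʳ++ l)) nothing r)
shiftLoop []      g l r = g , loop0 refl
shiftLoop (b ∷ ρ) g l r with shiftLoop ρ (just b) (just b ∷ l) r
... | g′ , e = g′ , castE (arith (length ρ)) (loop1 refl (shiftBit-E b g l _) e)
  where
  arith : ∀ n → suc (3 + suc (4 * n)) ≡ suc (4 * suc n)
  arith = solve-∀

shift-E : ∀ ρ g l r → Exec shift (tape l g (map just ρ ++ nothing ∷ r)) (4 * suc (length ρ))
                                 (tape (nothing ∷ (map just ρ ʳ++ l)) nothing r)
shift-E ρ g l r with shiftLoop ρ g l r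
... | g′ , e = castE (arith (length ρ)) (seqE (opE≡ (moveR-focus l g _)) (seqE e (seqE opE opE)))
  where
  arith : ∀ n → 1 + (suc (4 * n) + 2) ≡ 4 * suc n
  arith = solve-∀

-- The stack after a sweep of shifts: the hole has travelled past the registers, so each separator
-- now precedes its register instead of following it.
shifted : List Str → List Sym → List Sym
shifted []      l = l
shifted (s ∷ w) l = nothing ∷ map just s ++ shifted w l

shifted-enc : ∀ w l → shifted w (nothing ∷ l) ≡ nothing ∷ encOn w l
shifted-enc []      l = refl
shifted-enc (s ∷ w) l = cong (λ z → nothing ∷ map just s ++ z) (shifted-enc w l)

shifts : ∀ w {n} → length w ≡ n → ∀ l r →
         Exec (repR n shift) (tape l nothing (rEnc w r)) (1 + 4 * size w) (tape (shifted w l) nothing r)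
shifts []      refl l r = opE
shifts (s ∷ w) refl l r = castE (trans (cong (λ n → (1 + 4 * size w) + 4 * suc n) (length-reverse s)) (arith (length s) (size w)))
  (seqE (shifts w refl l _)
    (fromE (cong (tape (shifted w l) nothing) (sym (map-reverse-++ s _)))
    (toE (cong (λ z → tape (nothing ∷ z) nothing r) (map-reverse-ʳ++ s _)) (shift-E (reverse s) nothing _ r))))
  where
  arith : ∀ a b → (1 + 4 * b) + 4 * suc a ≡ 1 + 4 * (suc a + b)
  arith = solve-∀

module _ (w : List Str) (F : List Sym) where

  private j = length w

  dropBit-E : ∀ b s m → Exec (dropBit j) (tape (map just s ++ nothing ∷ F) (just b) (nothing ∷ rEnc w (blanks m)))
                             (8 + 6 * size w)
                             (focusL (map just s ++ nothing ∷ F) (nothing ∷ rEnc w (blanks (suc m))))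
  dropBit-E b s m = castE (arith (size w))
      (seqE (shift-E [] (just b) l _) (seqE (shifts w refl (nothing ∷ l) (blanks m))
      (seqE (fromE (cong (λ z → tape z nothing (blanks m)) (shifted-enc w l)) opE)
      (seqE (goLs w refl l (blanks (suc m))) (opE≡ (moveL-focus s F nothing _))))))
    where
    l = map just s ++ nothing ∷ F
    arith : ∀ a → 4 * 1 + ((1 + 4 * a) + (1 + ((1 + 2 * a) + 1))) ≡ 8 + 6 * a
    arith = solve-∀

  dropLoop : ∀ s m → ∃ λ m′ → Exec (loop (dropBit j) (dropBit j))
    (focusL (map just s ++ nothing ∷ F) (nothing ∷ rEnc w (blanks m)))
    (suc (length s * (9 + 6 * size w))) (tape F nothing (nothing ∷ rEnc w (blanks m′)))
  dropLoop []      m = m , loop0 refl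
  dropLoop (b ∷ s) m with dropLoop s (suc m)
  ... | m′ , e = m′ , castE (arith (size w) (length s * (9 + 6 * size w))) (loop1 refl (bitE b (dropBit-E b s m)) e)
    where
    arith : ∀ c d → suc ((8 + 6 * c) + suc d) ≡ suc ((9 + 6 * c) + d)
    arith = solve-∀

opaque
  delCost : ℕ → ℕ
  delCost N = 6 + (15 * N + 6 * (N * N))

  del-E : ∀ w s F N → size w + suc (length s) ≤ N → ∀ m → ∃ λ m′ →
    Exec (del (length w)) (tape (encOn w (map just s ++ nothing ∷ F)) nothing (blanks m)) (delCost N)
         (tape (encOn w F) nothing (blanks m′))
  del-E w s F N le m with dropLoop w F s m
  ... | m′ , e = suc m′ , leE bound
        (seqE (goLs w refl _ (blanks m)) (seqE (opE≡ (moveL-focus s F nothing _)) (seqE e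
        (seqE opE (seqE (shifts w refl (nothing ∷ F) (blanks m′))
          (fromE (cong (λ z → tape z nothing (blanks m′)) (shifted-enc w F)) opE))))))
    where
    A B : ℕ
    A = size w
    B = length s
    arith : ∀ a b → (1 + 2 * a) + (1 + (suc (b * (9 + 6 * a)) + (1 + ((1 + 4 * a) + 1)))) ≡ 6 + (6 * a + b * (9 + 6 * a))
    arith = solve-∀
    arith₂ : ∀ n → 6 + (6 * n + n * (9 + 6 * n)) ≡ 6 + (15 * n + 6 * (n * n))
    arith₂ = solve-∀
    A≤ : A ≤ N
    A≤ = ≤-trans (m≤m+n A _) le
    B≤ : B ≤ N
    B≤ = ≤-trans (n≤1+n B) (≤-trans (m≤n+m (suc B) A) le)
    bound : (1 + 2 * A) + (1 + (suc (B * (9 + 6 * A)) + (1 + ((1 + 4 * A) + 1)))) ≤ delCost N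
    bound = ≤-trans (≤-reflexive (arith A B))
            (≤-trans (+-monoʳ-≤ 6 (+-mono-≤ (*-monoʳ-≤ 6 A≤) (*-mono-≤ B≤ (+-monoʳ-≤ 9 (*-monoʳ-≤ 6 A≤)))))
            (≤-reflexive (arith₂ N)))

  delCost-def : ∀ N → delCost N ≡ 6 + (15 * N + 6 * (N * N))
  delCost-def N = refl

-- A zipper remembers which blank cells were visited, so the same stack can sit on different tapes.
-- Any number of trailing blanks is allowed before, and some number after.
record Runs (c : Cmd) (rs : List Str) (k : ℕ) (rs′ : List Str) : Set where
  constructor mkRuns
  field exec : ∀ m → ∃ λ m′ → Exec c (cfg rs m) k (cfg rs′ m′)
open Runs public

infixr 4 _⟫_
_⟫_ : ∀ {c d rs k rs′ l rs″} → Runs c rs k rs′ → Runs d rs′ l rs″ → Runs (c ⨾ d) rs (k + l) rs″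
(r ⟫ r′) .exec m with exec r m
... | m′ , e with exec r′ m′
... | m″ , e′ = m″ , seqE e e′

runs≤ : ∀ {c rs k l rs′} → k ≤ l → Runs c rs k rs′ → Runs c rs l rs′
runs≤ p r .exec m = let (m′ , e) = exec r m in m′ , leE p e

runs-skip : ∀ {rs} → Runs skip rs 1 rs
runs-skip .exec m = m , opE

runs-push : ∀ b {s fr} → Runs (wr (just b) mvR) (s ∷ fr) 1 ((b ∷ s) ∷ fr)
runs-push b {s} {fr} .exec m = pred m , opE≡ (moveR-blanks _ (just b) m)

runs-new : ∀ {fr} → Runs mvr fr 1 ([] ∷ fr)
runs-new .exec m = pred m , opE≡ (moveR-blanks _ nothing m)

runs-pick : ∀ w s fr {j N} → length w ≡ j → size w + suc (length s) ≤ N →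
            Runs (pick j) (w ++ s ∷ fr) (pickCost N) (s ∷ w ++ s ∷ fr)
runs-pick w s fr refl le .exec m with pick-E w s (encOn fr []) _ le m
... | m′ , e = m′ , fromE (cong (λ z → tape z nothing (blanks m)) (encOn-++ w (s ∷ fr) []))
                   (toE (cong (λ z → tape (map just s ++ nothing ∷ z) nothing (blanks m′)) (sym (encOn-++ w (s ∷ fr) []))) e)

runs-del : ∀ w s fr {j N} → length w ≡ j → size w + suc (length s) ≤ N →
           Runs (del j) (w ++ s ∷ fr) (delCost N) (w ++ fr)
runs-del w s fr refl le .exec m with del-E w s (encOn fr []) _ le m
... | m′ , e = m′ , fromE (cong (λ z → tape z nothing (blanks m)) (encOn-++ w (s ∷ fr) []))
                   (toE (cong (λ z → tape z nothing (blanks m′)) (sym (encOn-++ w fr []))) e)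

-- Deepest register first: each copy pushes the next source down by one, while that source lies one
-- higher in its block, so every `pick` reaches to the same depth.
copies : ℕ → ℕ → Cmd
copies a zero    = skip
copies a (suc k) = copies (suc a) k ⨾ pick (k + a)

dels : ℕ → ℕ → Cmd
dels a zero    = skip
dels a (suc k) = del a ⨾ dels a k

runs-copies : ∀ A v fr {a n N} → length A ≡ a → length v ≡ n → size A + size v ≤ N →
              Runs (copies a n) (A ++ v ++ fr) (1 + n * pickCost N) (v ++ A ++ v ++ fr)
runs-copies A []      fr {N = N} refl refl le = runs-skip
runs-copies A (x ∷ v) fr {N = N} refl refl le = runs≤ (≤-reflexive (arith (length v * pickCost N) (pickCost N))) (step₁ ⟫ step₂)
  where
  arith : ∀ a b → (1 + a) + b ≡ 1 + (b + a)
  arith = solve-∀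
  comm : ∀ a b c → (b + (c + 0)) + a ≡ b + (c + a)
  comm = solve-∀
  le′ : size (A ++ x ∷ []) + size v ≤ N
  le′ = ≤-trans (≤-reflexive (trans (cong (_+ size v) (size-++ A (x ∷ []))) (comm (size v) (size A) (suc (length x))))) le
  comm₂ : ∀ a b c → (a + b) + c ≡ b + (c + a)
  comm₂ = solve-∀
  le″ : size (v ++ A) + suc (length x) ≤ N
  le″ = ≤-trans (≤-reflexive (trans (cong (_+ suc (length x)) (size-++ v A)) (comm₂ (size v) (size A) (suc (length x))))) le

  step₁ : Runs (copies (suc (length A)) (length v)) (A ++ x ∷ v ++ fr) (1 + length v * pickCost N) (v ++ A ++ x ∷ v ++ fr)
  step₁ = subst₂ (λ y z → Runs (copies (suc (length A)) (length v)) y (1 + length v * pickCost N) (v ++ z))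
            (++-assoc A (x ∷ []) (v ++ fr)) (++-assoc A (x ∷ []) (v ++ fr))
            (runs-copies (A ++ x ∷ []) v fr {N = N} (length-snoc A x) refl le′)
  step₂ : Runs (pick (length v + length A)) (v ++ A ++ x ∷ v ++ fr) (pickCost N) (x ∷ v ++ A ++ x ∷ v ++ fr)
  step₂ = subst (λ z → Runs (pick (length v + length A)) z (pickCost N) (x ∷ z)) (++-assoc v A (x ∷ v ++ fr))
            (runs-pick (v ++ A) x (v ++ fr) {N = N} (length-++ v) le″)

runs-dels : ∀ A v fr {a n N} → length A ≡ a → length v ≡ n → size A + size v ≤ N →
            Runs (dels a n) (A ++ v ++ fr) (1 + n * delCost N) (A ++ fr)
runs-dels A []      fr refl refl le = runs-skip
runs-dels A (x ∷ v) fr {N = N} refl refl le = runs≤ (≤-reflexive (arith (length v * delCost N) (delCost N))) (step₁ ⟫ step₂)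
  where
  arith : ∀ a b → b + (1 + a) ≡ 1 + (b + a)
  arith = solve-∀
  step₁ : Runs (del (length A)) (A ++ x ∷ v ++ fr) (delCost N) (A ++ v ++ fr)
  step₁ = runs-del A x (v ++ fr) {N = N} refl (≤-trans (+-monoʳ-≤ (size A) (m≤m+n _ (size v))) le)
  step₂ : Runs (dels (length A) (length v)) (A ++ v ++ fr) (1 + length v * delCost N) (A ++ fr)
  step₂ = runs-dels A v fr {N = N} refl refl (≤-trans (+-monoʳ-≤ (size A) (m≤n+m (size v) _)) le)

-- Polynomials as bounds on time and size

mutual
  -- `fn` admits a function under its own name, together with a polynomial that it equals. In this
  -- way the costs of `pick` and `del` stay opaque inside larger bounds.
  data Pol : Set where
    K           : ℕ → Pol
    X           : Pol
    _⊕_ _⊗_ _⊚_ : Pol → Pol → Pol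
    fn          : (f : ℕ → ℕ) (q : Pol) → (∀ n → f n ≡ ⟦ q ⟧ n) → Pol

  ⟦_⟧ : Pol → ℕ → ℕ
  ⟦ K a ⟧      n = a
  ⟦ X ⟧        n = n
  ⟦ p ⊕ q ⟧    n = ⟦ p ⟧ n + ⟦ q ⟧ n
  ⟦ p ⊗ q ⟧    n = ⟦ p ⟧ n * ⟦ q ⟧ n
  ⟦ p ⊚ q ⟧    n = ⟦ p ⟧ (⟦ q ⟧ n)
  ⟦ fn f _ _ ⟧ n = f n

infixr 6 _⊕_
infixr 7 _⊗_
infixr 8 _⊚_

pickPol delPol : Pol
pickPol = fn pickCost (K 10 ⊕ K 16 ⊗ X ⊕ K 4 ⊗ X ⊗ X) pickCost-def
delPol  = fn delCost  (K 6 ⊕ K 15 ⊗ X ⊕ K 6 ⊗ X ⊗ X) delCost-def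

pol-mono : ∀ p {m n} → m ≤ n → ⟦ p ⟧ m ≤ ⟦ p ⟧ n
pol-mono (K a)       le = ≤-refl
pol-mono X           le = le
pol-mono (p ⊕ q)     le = +-mono-≤ (pol-mono p le) (pol-mono q le)
pol-mono (p ⊗ q)     le = *-mono-≤ (pol-mono p le) (pol-mono q le)
pol-mono (p ⊚ q)     le = pol-mono p (pol-mono q le)
pol-mono (fn f q eq) {m} {n} le = subst₂ _≤_ (sym (eq m)) (sym (eq n)) (pol-mono q le)

pow-mono : ∀ n {j k} → j ≤ k → suc n ^ j ≤ suc n ^ k
pow-mono n le = ^-monoʳ-≤ (suc n) le

pow≥1 : ∀ n k → 1 ≤ suc n ^ k
pow≥1 n k = ≤-trans (≤-reflexive refl) (pow-mono n {0} {k} z≤n)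

*-^ : ∀ a b k → (a * b) ^ k ≡ a ^ k * b ^ k
*-^ a b zero    = refl
*-^ a b (suc k) = trans (cong (a * b *_) (*-^ a b k)) (arith a b (a ^ k) (b ^ k))
  where
  arith : ∀ a b x y → a * b * (x * y) ≡ a * x * (b * y)
  arith = solve-∀

-- Brings a bound into the monomial form from which `ComputesIn` is met. Composition works because
-- `1 ≤ suc n ^ l` absorbs the successor in `suc (⟦ q ⟧ n)`.
pol-bound : ∀ p → ∃ λ c → ∃ λ k → ∀ n → ⟦ p ⟧ n ≤ c * suc n ^ k
pol-bound (K a) = a , 0 , λ n → ≤-reflexive (sym (*-identityʳ a))
pol-bound X     = 1 , 1 , λ n → ≤-trans (n≤1+n n) (≤-reflexive (sym (trans (+-identityʳ _) (*-identityʳ (suc n)))))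
pol-bound (p ⊕ q) with pol-bound p | pol-bound q
... | c , k , f | d , l , g = c + d , k + l , λ n →
  ≤-trans (+-mono-≤ (≤-trans (f n) (*-monoʳ-≤ c (pow-mono n (m≤m+n k l))))
                    (≤-trans (g n) (*-monoʳ-≤ d (pow-mono n (m≤n+m l k)))))
          (≤-reflexive (sym (*-distribʳ-+ (suc n ^ (k + l)) c d)))
pol-bound (p ⊗ q) with pol-bound p | pol-bound q
... | c , k , f | d , l , g = c * d , k + l , λ n →
  ≤-trans (*-mono-≤ (f n) (g n)) (≤-reflexive (trans (arith c (suc n ^ k) d (suc n ^ l)) (cong (c * d *_) (sym (^-distribˡ-+-* (suc n) k l)))))
  where
  arith : ∀ a x b y → a * x * (b * y) ≡ a * b * (x * y)
  arith = solve-∀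
pol-bound (p ⊚ q) with pol-bound p | pol-bound q
... | c , k , f | d , l , g = c * suc d ^ k , l * k , λ n → begin
    ⟦ p ⟧ (⟦ q ⟧ n)                     ≤⟨ f _ ⟩
    c * suc (⟦ q ⟧ n) ^ k                ≤⟨ *-monoʳ-≤ c (^-monoˡ-≤ k (+-mono-≤ (pow≥1 n l) (g n))) ⟩
    c * (suc d * suc n ^ l) ^ k          ≡⟨ cong (c *_) (*-^ (suc d) (suc n ^ l) k) ⟩
    c * (suc d ^ k * (suc n ^ l) ^ k)    ≡⟨ cong (λ z → c * (suc d ^ k * z)) (^-*-assoc (suc n) l k) ⟩
    c * (suc d ^ k * suc n ^ (l * k))    ≡⟨ sym (*-assoc c _ _) ⟩
    c * suc d ^ k * suc n ^ (l * k) ∎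
  where open ≤-Reasoning
pol-bound (fn f q eq) with pol-bound q
... | c , k , g = c , k , λ n → ≤-trans (≤-reflexive (eq n)) (g n)

-- Polynomial-time functions on tuples of strings

szV : ∀ {n} → Vec Str n → ℕ
szV v = size (toList v)

-- One polynomial bounds both time and size of the result, at every `N` above the size of the
-- arguments. The arguments stay below the results and any stack `fr` below them is untouched; this
-- makes the programs composable.
record P {n m} (S : Vec Str n → Vec Str m) : Set where
  constructor mkP
  field
    code    : Cmd
    pol     : Pol
    bounded : ∀ v N → szV v ≤ N → szV (S v) ≤ ⟦ pol ⟧ N
    runs    : ∀ v fr N → szV v ≤ N → Runs code (toList v ++ fr) (⟦ pol ⟧ N) (toList (S v) ++ toList v ++ fr)
open P public

len-toList : ∀ {n} (v : Vec Str n) → length (toList v) ≡ n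
len-toList []      = refl
len-toList (x ∷ v) = cong suc (len-toList v)

toList-++ : ∀ {m n} (v : Vec Str m) (w : Vec Str n) → toList (v V.++ w) ≡ toList v ++ toList w
toList-++ []      w = refl
toList-++ (x ∷ v) w = cong (x ∷_) (toList-++ v w)

szV-++ : ∀ {m n} (v : Vec Str m) (w : Vec Str n) → szV (v V.++ w) ≡ szV v + szV w
szV-++ v w = trans (cong size (toList-++ v w)) (size-++ (toList v) (toList w))

runsFrom : ∀ {c rs₁ rs k rs′} → rs₁ ≡ rs → Runs c rs k rs′ → Runs c rs₁ k rs′
runsFrom refl r = r

runsTo : ∀ {c rs k rs₁ rs′} → rs₁ ≡ rs′ → Runs c rs k rs₁ → Runs c rs k rs′
runsTo refl r = r

P-ext : ∀ {n m} {S T : Vec Str n → Vec Str m} → (∀ v → S v ≡ T v) → P S → P T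
P-ext eq s .code = code s
P-ext eq s .pol = pol s
P-ext eq s .bounded v N le = subst (λ z → szV z ≤ _) (eq v) (bounded s v N le)
P-ext eq s .runs v fr N le = runsTo (cong (λ z → toList z ++ toList v ++ fr) (eq v)) (runs s v fr N le)

splitLookup : ∀ {n} (v : Vec Str n) i → ∃ λ w → ∃ λ u → toList v ≡ w ++ V.lookup v i ∷ u × length w ≡ toℕ i
splitLookup (x ∷ v) F.zero    = [] , toList v , refl , refl
splitLookup (x ∷ v) (F.suc i) with splitLookup v i
... | w , u , eq , len = x ∷ w , u , cong (x ∷_) eq , cong suc len

split-size : ∀ w s u {rs N} → rs ≡ w ++ s ∷ u → size rs ≤ N → size w + suc (length s) ≤ N
split-size w s u refl le = ≤-trans (+-monoʳ-≤ (size w) (m≤m+n _ (size u))) (≤-trans (≤-reflexive (sym (size-++ w (s ∷ u)))) le)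

var-P : ∀ {n} (i : Fin n) → P (λ v → V.lookup v i ∷ [])
var-P i .code = pick (toℕ i)
var-P i .pol = pickPol ⊕ X
var-P i .bounded v N le with splitLookup v i
... | w , u , eq , _ = ≤-trans (≤-reflexive (+-identityʳ _)) (≤-trans (m≤n+m _ (size w))
        (≤-trans (split-size w (V.lookup v i) u eq le) (m≤n+m N _)))
var-P i .runs v fr N le with splitLookup v i
... | w , u , eq , len = runs≤ (m≤m+n (pickCost N) N)
  (runsFrom eq′ (runsTo (cong (V.lookup v i ∷_) (sym eq′)) (runs-pick w (V.lookup v i) (u ++ fr) {N = N} len (split-size w (V.lookup v i) u eq le))))
  where
  eq′ : toList v ++ fr ≡ w ++ V.lookup v i ∷ u ++ fr
  eq′ = trans (cong (_++ fr) eq) (++-assoc w _ fr)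

nil-P : ∀ {n} → P {n} (λ v → [] ∷ [])
nil-P .code = mvr
nil-P .pol = K 1
nil-P .bounded v N le = ≤-refl
nil-P .runs v fr N le = runs-new

cons-P : ∀ b → P {1} (λ v → (b ∷ V.head v) ∷ [])
cons-P b .code = pick 0 ⨾ wr (just b) mvR
cons-P b .pol = (pickPol ⊕ K 1) ⊕ X
cons-P b .bounded (x ∷ []) N le = ≤-trans (+-monoʳ-≤ 1 le) (+-monoˡ-≤ N (m≤n+m 1 (pickCost N)))
cons-P b .runs (x ∷ []) fr N le = runs≤ (m≤m+n (pickCost N + 1) N)
  (runs-pick [] x fr {N = N} refl (≤-trans (≤-reflexive (sym (+-identityʳ _))) le) ⟫ runs-push b)

empty-P : ∀ {n} → P {n} (λ v → [])
empty-P .code = skip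
empty-P .pol = K 1
empty-P .bounded v N le = z≤n
empty-P .runs v fr N le = runs-skip

infixr 9 _∘P_
_∘P_ : ∀ {n m k} {T : Vec Str m → Vec Str k} {S : Vec Str n → Vec Str m} → P T → P S → P (λ v → T (S v))
_∘P_ {n} {m} {k} {T} {S} t s = record
  { code = code s ⨾ code t ⨾ dels k m
  ; pol = pol s ⊕ pol t ⊚ pol s ⊕ (K 1 ⊕ K m ⊗ delPol ⊚ (pol t ⊚ pol s ⊕ pol s))
  ; bounded = λ v N le → ≤-trans (bounded t (S v) _ (bounded s v N le))
                (≤-trans (m≤m+n _ _) (m≤n+m _ (⟦ pol s ⟧ N)))
  ; runs = λ v fr N le → runs s v fr N le ⟫ runs t (S v) (toList v ++ fr) _ (bounded s v N le)
      ⟫ runs-dels (toList (T (S v))) (toList (S v)) (toList v ++ fr) (len-toList (T (S v))) (len-toList (S v))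
          (+-mono-≤ (bounded t (S v) _ (bounded s v N le)) (bounded s v N le)) }

fork-P : ∀ {n m k} {S : Vec Str n → Vec Str m} {T : Vec Str n → Vec Str k} → P S → P T → P (λ v → S v V.++ T v)
fork-P {n} {m} {k} {S} {T} s t = record
  { code = code t ⨾ copies k n ⨾ code s ⨾ dels m n
  ; pol = pol t ⊕ (K 1 ⊕ K n ⊗ pickPol ⊚ (pol t ⊕ X)) ⊕ pol s ⊕ (K 1 ⊕ K n ⊗ delPol ⊚ (pol s ⊕ X))
  ; bounded = λ v N le → ≤-trans (≤-reflexive (szV-++ (S v) (T v)))
      (≤-trans (+-mono-≤ (bounded s v N le) (bounded t v N le)) (arith₁ (⟦ pol s ⟧ N) (⟦ pol t ⟧ N) (1 + n * ⟦ pickPol ⊚ (pol t ⊕ X) ⟧ N) (1 + n * ⟦ delPol ⊚ (pol s ⊕ X) ⟧ N)))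
  ; runs = λ v fr N le → runs t v fr N le
      ⟫ runs-copies (toList (T v)) (toList v) fr (len-toList (T v)) (len-toList v) (+-mono-≤ (bounded t v N le) le)
      ⟫ runs s v _ N le
      ⟫ runsTo (trans (sym (++-assoc (toList (S v)) (toList (T v)) _)) (cong (_++ toList v ++ fr) (sym (toList-++ (S v) (T v)))))
          (runs-dels (toList (S v)) (toList v) (toList (T v) ++ toList v ++ fr) (len-toList (S v)) (len-toList v) (+-mono-≤ (bounded s v N le) le)) }
  where
  arith₁ : ∀ a b c d → a + b ≤ b + (c + (a + d))
  arith₁ a b c d = ≤-trans (≤-reflexive (+-comm a b)) (+-monoʳ-≤ b (≤-trans (m≤m+n a d) (m≤n+m (a + d) c)))

-- Case distinction and bounded iteration on registers

popped : Str → List Str → ℕ → Tape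
popped x rs m = focusL (map just x ++ nothing ∷ encOn rs []) (nothing ∷ blanks m)

pop-E : ∀ x rs m → Exec mvl (cfg (x ∷ rs) m) 1 (popped x rs m)
pop-E x rs m = opE≡ (moveL-focus x (encOn rs []) nothing (blanks m))

erase : Cmd
erase = wr nothing mvS

-- One step left from the blank after the top register reaches its first bit, which is erased, or,
-- if the register is empty, the separator below, which pops it. Either way the head rests on the
-- blank after the new stack.
popCase : Cmd → Cmd → Cmd → Cmd
popCase a b c = mvl ⨾ cond a (erase ⨾ b) (erase ⨾ c)

runs-pop[] : ∀ {a b c rs k rs′} → Runs a rs k rs′ → Runs (popCase a b c) ([] ∷ rs) (1 + suc k) rs′
runs-pop[] {rs = rs} r .exec m with exec r (suc m)
... | m′ , e = m′ , seqE (pop-E [] rs m) (condE e)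

runs-pop∷ : ∀ {a b c x t rs k rs′} → Runs (bit b c x) (t ∷ rs) k rs′ →
            Runs (popCase a b c) ((x ∷ t) ∷ rs) (1 + suc (1 + k)) rs′
runs-pop∷ {x = false} {t} {rs} r .exec m with exec r (suc m)
... | m′ , e = m′ , seqE (pop-E (false ∷ t) rs m) (condE (seqE opE e))
runs-pop∷ {x = true} {t} {rs} r .exec m with exec r (suc m)
... | m′ , e = m′ , seqE (pop-E (true ∷ t) rs m) (condE (seqE opE e))

caseV : ∀ {n} {A : Set} → (Vec Str n → A) → (Vec Str (suc n) → A) → (Vec Str (suc n) → A) → Vec Str (suc n) → A
caseV e f g ([] ∷ v)          = e v
caseV e f g ((false ∷ x) ∷ v) = f (x ∷ v)
caseV e f g ((true ∷ x) ∷ v)  = g (x ∷ v)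

module _ {n k} {S : Vec Str (suc n) → Vec Str k} (s : P S) where

  branch : Cmd
  branch = copies 2 n ⨾ pick n ⨾ code s ⨾ dels k (suc n) ⨾ dels k 1

  branchPol : Pol
  branchPol = (K 1 ⊕ K n ⊗ pickPol ⊚ (X ⊕ X)) ⊕ pickPol ⊕ pol s ⊕ (K 1 ⊕ K (suc n) ⊗ delPol ⊚ (pol s ⊕ X))
              ⊕ (K 1 ⊕ K 1 ⊗ delPol ⊚ (pol s ⊕ X))

  runs-branch : ∀ t x v fr N → suc (length t) ≤ length x → szV (x ∷ v) ≤ N →
    Runs branch (t ∷ x ∷ toList v ++ fr) (⟦ branchPol ⟧ N) (toList (S (t ∷ v)) ++ x ∷ toList v ++ fr)
  runs-branch t x v fr N lt le =
      runs-copies (t ∷ x ∷ []) (toList v) fr refl (len-toList v) le₁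
    ⟫ runs-pick (toList v) t (x ∷ toList v ++ fr) (len-toList v) le₂
    ⟫ runs s (t ∷ v) (t ∷ x ∷ toList v ++ fr) N le₃
    ⟫ runs-dels (toList (S (t ∷ v))) (t ∷ toList v) (t ∷ x ∷ toList v ++ fr) (len-toList (S (t ∷ v))) (cong suc (len-toList v))
        (+-mono-≤ (bounded s (t ∷ v) N le₃) le₃)
    ⟫ runs-dels (toList (S (t ∷ v))) (t ∷ []) (x ∷ toList v ++ fr) (len-toList (S (t ∷ v))) refl
        (+-mono-≤ (bounded s (t ∷ v) N le₃) (≤-trans (+-monoʳ-≤ (suc (length t)) z≤n) le₃))
    where
    le₃ : szV (t ∷ v) ≤ N
    le₃ = ≤-trans (+-monoˡ-≤ (szV v) (≤-trans lt (n≤1+n _))) le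
    le₂ : szV v + suc (length t) ≤ N
    le₂ = ≤-trans (≤-reflexive (+-comm (szV v) _)) le₃
    le₁ : size (t ∷ x ∷ []) + szV v ≤ N + N
    le₁ = ≤-trans (≤-reflexive (arith (suc (length t)) (suc (length x)) (szV v)))
            (+-mono-≤ (≤-trans (m≤m+n _ (szV v)) le₃) le)
      where
      arith : ∀ a b c → (a + (b + 0)) + c ≡ a + (b + c)
      arith = solve-∀

case-P : ∀ {n k} {E : Vec Str n → Vec Str k} {A B} → P E → P A → P B → P (caseV E A B)
case-P {n} {k} {E} {A} {B} e a b = record
  { code = pick 0 ⨾ popCase (copies 1 n ⨾ code e ⨾ dels k n) (branch a) (branch b)
  ; pol = pickPol ⊕ K 3 ⊕ (ePol ⊕ branchPol a ⊕ branchPol b) ⊕ (pol e ⊕ pol a ⊕ pol b)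
  ; bounded = bd
  ; runs = rn }
  where
  ePol : Pol
  ePol = (K 1 ⊕ K n ⊗ pickPol ⊚ X) ⊕ pol e ⊕ (K 1 ⊕ K n ⊗ delPol ⊚ (pol e ⊕ X))
  total : ℕ → ℕ
  total N = pickCost N + (3 + ((⟦ ePol ⟧ N + (⟦ branchPol a ⟧ N + ⟦ branchPol b ⟧ N)) + (⟦ pol e ⟧ N + (⟦ pol a ⟧ N + ⟦ pol b ⟧ N))))
  out≤ : ∀ {z} N → z ≤ ⟦ pol e ⟧ N + (⟦ pol a ⟧ N + ⟦ pol b ⟧ N) → z ≤ total N
  out≤ N p = ≤-trans p (≤-trans (≤-trans (m≤n+m _ (⟦ ePol ⟧ N + (⟦ branchPol a ⟧ N + ⟦ branchPol b ⟧ N))) (m≤n+m _ 3)) (m≤n+m _ (pickCost N)))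
  bd : ∀ v N → szV v ≤ N → szV (caseV E A B v) ≤ total N
  bd ([] ∷ v) N le = out≤ N (≤-trans (bounded e v N (≤-trans (n≤1+n _) le)) (m≤m+n _ _))
  bd ((false ∷ x) ∷ v) N le = out≤ N (≤-trans (bounded a (x ∷ v) N (≤-trans (n≤1+n (szV (x ∷ v))) le)) (≤-trans (m≤m+n (⟦ pol a ⟧ N) (⟦ pol b ⟧ N)) (m≤n+m (⟦ pol a ⟧ N + ⟦ pol b ⟧ N) (⟦ pol e ⟧ N))))
  bd ((true ∷ x) ∷ v) N le = out≤ N (≤-trans (bounded b (x ∷ v) N (≤-trans (n≤1+n (szV (x ∷ v))) le)) (≤-trans (m≤n+m _ _) (m≤n+m _ (⟦ pol e ⟧ N))))
  cost≤ : ∀ {z} N → z ≤ ⟦ ePol ⟧ N + (⟦ branchPol a ⟧ N + ⟦ branchPol b ⟧ N) → pickCost N + (1 + suc (1 + z)) ≤ total N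
  cost≤ N p = +-monoʳ-≤ (pickCost N) (+-monoʳ-≤ 3 (≤-trans p (m≤m+n _ _)))
  dup : ∀ x (v : Vec Str n) fr N → szV (x ∷ v) ≤ N → Runs (pick 0) (x ∷ toList v ++ fr) (pickCost N) (x ∷ x ∷ toList v ++ fr)
  dup x v fr N le = runs-pick [] x (toList v ++ fr) refl (≤-trans (m≤m+n (suc (length x)) (szV v)) le)
  rn : ∀ v fr N → szV v ≤ N → Runs _ (toList v ++ fr) (total N) (toList (caseV E A B v) ++ toList v ++ fr)
  rn ([] ∷ v) fr N le = runs≤ (≤-trans (+-monoʳ-≤ (pickCost N) (n≤1+n _)) (cost≤ N (m≤m+n (⟦ ePol ⟧ N) (⟦ branchPol a ⟧ N + ⟦ branchPol b ⟧ N))))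
    (dup [] v fr N le ⟫ runs-pop[] (runs-copies ([] ∷ []) (toList v) fr refl (len-toList v) le
      ⟫ runs e v ([] ∷ toList v ++ fr) N (≤-trans (n≤1+n _) le)
      ⟫ runs-dels (toList (E v)) (toList v) ([] ∷ toList v ++ fr) (len-toList (E v)) (len-toList v)
         (+-mono-≤ (bounded e v N (≤-trans (n≤1+n _) le)) (≤-trans (n≤1+n _) le))))
  rn ((false ∷ x) ∷ v) fr N le = runs≤ (cost≤ N (≤-trans (m≤m+n (⟦ branchPol a ⟧ N) (⟦ branchPol b ⟧ N)) (m≤n+m (⟦ branchPol a ⟧ N + ⟦ branchPol b ⟧ N) (⟦ ePol ⟧ N))))
    (dup (false ∷ x) v fr N le ⟫ runs-pop∷ (runs-branch a x (false ∷ x) v fr N ≤-refl le))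
  rn ((true ∷ x) ∷ v) fr N le = runs≤ (cost≤ N (≤-trans (m≤n+m (⟦ branchPol b ⟧ N) (⟦ branchPol a ⟧ N)) (m≤n+m (⟦ branchPol a ⟧ N + ⟦ branchPol b ⟧ N) (⟦ ePol ⟧ N))))
    (dup (true ∷ x) v fr N le ⟫ runs-pop∷ (runs-branch b x (true ∷ x) v fr N ≤-refl le))

foldlV : {A : Set} → (Bool → A → A) → Str → A → A
foldlV S []      s = s
foldlV S (b ∷ x) s = foldlV S x (S b s)

bitF : {A : Set} → (A → A) → (A → A) → Bool → A → A
bitF f g b = bit f g b

module _ {n m} {I : Vec Str n → Vec Str (suc m)} {S₀ S₁ : Vec Str m → Vec Str m} (i : P I) (s₀ : P S₀) (s₁ : P S₁)
         (bnd : Pol) (hyp : ∀ v x₁ x₂ → V.head (I v) ≡ x₁ ++ x₂ → szV (foldlV (bitF S₀ S₁) x₁ (V.tail (I v))) ≤ ⟦ bnd ⟧ (szV v)) where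

  private
    stepV = bitF S₀ S₁

    body : Cmd → Cmd
    body c = copies 1 m ⨾ c ⨾ dels m m ⨾ pick m ⨾ dels (suc m) (suc m)

    bodyPol : Pol
    bodyPol = (K 1 ⊕ K m ⊗ pickPol ⊚ (pol i ⊕ bnd)) ⊕ (pol s₀ ⊕ pol s₁) ⊚ bnd ⊕ (K 1 ⊕ K m ⊗ delPol ⊚ (bnd ⊕ bnd))
              ⊕ pickPol ⊚ (bnd ⊕ pol i) ⊕ (K 1 ⊕ K (suc m) ⊗ delPol ⊚ ((pol i ⊕ bnd) ⊕ (pol i ⊕ bnd)))

    run-body : ∀ b t s R N → suc (length t) ≤ ⟦ pol i ⟧ N → szV s ≤ ⟦ bnd ⟧ N → szV (stepV b s) ≤ ⟦ bnd ⟧ N →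
      Runs (bit (body (code s₀)) (body (code s₁)) b) (t ∷ toList s ++ R) (⟦ bodyPol ⟧ N) (t ∷ toList (stepV b s) ++ R)
    run-body b t s R N lt le le′ = choose b refl
      where
      go : ∀ {S : Vec Str m → Vec Str m} (p : P S) → szV (S s) ≤ ⟦ bnd ⟧ N → ⟦ pol p ⟧ (⟦ bnd ⟧ N) ≤ ⟦ (pol s₀ ⊕ pol s₁) ⊚ bnd ⟧ N →
           Runs (body (code p)) (t ∷ toList s ++ R) (⟦ bodyPol ⟧ N) (t ∷ toList (S s) ++ R)
      go {S} p out≤ cost≤ =
          runs-copies (t ∷ []) (toList s) R refl (len-toList s) (+-mono-≤ (≤-trans (≤-reflexive (+-identityʳ _)) lt) le)
        ⟫ runs≤ cost≤ (runs p s (t ∷ toList s ++ R) (⟦ bnd ⟧ N) le)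
        ⟫ runs-dels (toList (S s)) (toList s) (t ∷ toList s ++ R) (len-toList (S s)) (len-toList s) (+-mono-≤ out≤ le)
        ⟫ runs-pick (toList (S s)) t (toList s ++ R) (len-toList (S s)) (+-mono-≤ out≤ lt)
        ⟫ runs-dels (t ∷ toList (S s)) (t ∷ toList s) R (cong suc (len-toList (S s))) (cong suc (len-toList s))
            (+-mono-≤ (+-mono-≤ lt out≤) (+-mono-≤ lt le))
      choose : ∀ b′ → b ≡ b′ → Runs (bit (body (code s₀)) (body (code s₁)) b′) (t ∷ toList s ++ R) (⟦ bodyPol ⟧ N) (t ∷ toList (stepV b′ s) ++ R)
      choose false refl = go s₀ le′ (m≤m+n _ _)
      choose true  refl = go s₁ le′ (m≤n+m _ _)

    looping : Cmd
    looping = loop (erase ⨾ body (code s₀) ⨾ mvl) (erase ⨾ body (code s₁) ⨾ mvl)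

    run-loop : ∀ x s R N m′ → length x ≤ ⟦ pol i ⟧ N → (∀ x₁ x₂ → x ≡ x₁ ++ x₂ → szV (foldlV stepV x₁ s) ≤ ⟦ bnd ⟧ N) →
      ∃ λ m″ → Exec looping (popped x (toList s ++ R) m′) (suc (length x * (3 + ⟦ bodyPol ⟧ N)))
                    (cfg (toList (foldlV stepV x s) ++ R) m″)
    run-loop []      s R N m′ lt h = suc m′ , loop0 refl
    run-loop (b ∷ x) s R N m′ lt h
      with exec (run-body b x s R N lt (h [] (b ∷ x) refl) (h (b ∷ []) x refl)) (suc m′)
    ... | m₁ , e with run-loop x (stepV b s) R N m₁ (≤-trans (n≤1+n _) lt) (λ x₁ x₂ eq → h (b ∷ x₁) x₂ (cong (b ∷_) eq))
    ...   | m₂ , e′ = m₂ , castE (arith (⟦ bodyPol ⟧ N) (length x * (3 + ⟦ bodyPol ⟧ N)))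
              (loop1 refl (once b e) e′)
      where
      once : ∀ b → Exec (bit (body (code s₀)) (body (code s₁)) b) (cfg (x ∷ toList s ++ R) (suc m′)) (⟦ bodyPol ⟧ N) (cfg (x ∷ toList (stepV b s) ++ R) m₁) →
             Exec (bit (erase ⨾ body (code s₀) ⨾ mvl) (erase ⨾ body (code s₁) ⨾ mvl) b) (popped (b ∷ x) (toList s ++ R) m′) (1 + (⟦ bodyPol ⟧ N + 1)) (popped x (toList (stepV b s) ++ R) m₁)
      once false e = seqE opE (seqE e (pop-E x (toList (stepV false s) ++ R) m₁))
      once true  e = seqE opE (seqE e (pop-E x (toList (stepV true s) ++ R) m₁))
      arith : ∀ k r → suc ((1 + (k + 1)) + suc r) ≡ suc ((3 + k) + r)
      arith = solve-∀

  -- Iterating a polynomial-time step could double the size in each round. The hypothesis bounds all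
  -- intermediate states by `bnd`, so each round costs at most `bodyPol`, as in Cobham's bounded
  -- recursion.
  fold-P : P (λ v → foldlV stepV (V.head (I v)) (V.tail (I v)))
  fold-P .code = code i ⨾ mvl ⨾ looping
  fold-P .pol = pol i ⊕ K 1 ⊕ (K 1 ⊕ pol i ⊗ (K 3 ⊕ bodyPol)) ⊕ bnd
  fold-P .bounded v N le = ≤-trans (hyp v (V.head (I v)) [] (sym (++-identityʳ _))) (≤-trans (pol-mono bnd le)
    (≤-trans (≤-trans (m≤n+m (⟦ bnd ⟧ N) (1 + ⟦ pol i ⟧ N * (3 + ⟦ bodyPol ⟧ N))) (n≤1+n _)) (m≤n+m _ (⟦ pol i ⟧ N))))
  fold-P .runs v fr N le = runs i v fr N le ⟫ go (I v) (bounded i v N le) sub≤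
    where
    R = toList v ++ fr
    sub≤ : ∀ x₁ x₂ → V.head (I v) ≡ x₁ ++ x₂ → szV (foldlV stepV x₁ (V.tail (I v))) ≤ ⟦ bnd ⟧ N
    sub≤ x₁ x₂ eq = ≤-trans (hyp v x₁ x₂ eq) (pol-mono bnd le)
    go : ∀ w → szV w ≤ ⟦ pol i ⟧ N → (∀ x₁ x₂ → V.head w ≡ x₁ ++ x₂ → szV (foldlV stepV x₁ (V.tail w)) ≤ ⟦ bnd ⟧ N) →
         Runs (mvl ⨾ looping) (toList w ++ R) (1 + ((1 + ⟦ pol i ⟧ N * (3 + ⟦ bodyPol ⟧ N)) + ⟦ bnd ⟧ N)) (toList (foldlV stepV (V.head w) (V.tail w)) ++ R)
    go (x ∷ s) x≤ h .exec m₀ with run-loop x s R N m₀ (≤-trans (n≤1+n _) (≤-trans (m≤m+n _ (szV s)) x≤)) h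
    ... | m₁ , e = m₁ , seqE (pop-E x (toList s ++ R) m₀)
          (leE (≤-trans (s≤s (*-monoˡ-≤ (3 + ⟦ bodyPol ⟧ N) (≤-trans (n≤1+n _) (≤-trans (m≤m+n _ (szV s)) x≤)))) (m≤m+n _ _)) e)

Fun : (n : ℕ) → (Vec Str n → Str) → Set
Fun n F = P {n} {1} (λ v → F v ∷ [])

record F1 (f : Str → Str) : Set where
  constructor mk1
  field un1 : Fun 1 (λ v → f (V.lookup v F.zero))

record F2 (f : Str → Str → Str) : Set where
  constructor mk2
  field un2 : Fun 2 (λ v → f (V.lookup v F.zero) (V.lookup v (F.suc F.zero)))

record F3 (f : Str → Str → Str → Str) : Set where
  constructor mk3
  field un3 : Fun 3 (λ v → f (V.lookup v F.zero) (V.lookup v (F.suc F.zero)) (V.lookup v (F.suc (F.suc F.zero))))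

open F1 public
open F2 public
open F3 public

arg : ∀ {n} (i : Fin n) → Fun n (λ v → V.lookup v i)
arg = var-P

pattern #0 = F.zero
pattern #1 = F.suc F.zero
pattern #2 = F.suc (F.suc F.zero)
pattern #3 = F.suc (F.suc (F.suc F.zero))
pattern #4 = F.suc (F.suc (F.suc (F.suc F.zero)))
pattern #5 = F.suc (F.suc (F.suc (F.suc (F.suc F.zero))))
pattern #6 = F.suc (F.suc (F.suc (F.suc (F.suc (F.suc F.zero)))))
pattern #7 = F.suc (F.suc (F.suc (F.suc (F.suc (F.suc (F.suc F.zero))))))
pattern #8 = F.suc (F.suc (F.suc (F.suc (F.suc (F.suc (F.suc (F.suc F.zero)))))))
pattern #9 = F.suc (F.suc (F.suc (F.suc (F.suc (F.suc (F.suc (F.suc (F.suc F.zero))))))))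
pattern #10 = F.suc (F.suc (F.suc (F.suc (F.suc (F.suc (F.suc (F.suc (F.suc (F.suc F.zero)))))))))
pattern #11 = F.suc (F.suc (F.suc (F.suc (F.suc (F.suc (F.suc (F.suc (F.suc (F.suc (F.suc F.zero))))))))))
pattern #12 = F.suc (F.suc (F.suc (F.suc (F.suc (F.suc (F.suc (F.suc (F.suc (F.suc (F.suc (F.suc F.zero)))))))))))
pattern #13 = F.suc (F.suc (F.suc (F.suc (F.suc (F.suc (F.suc (F.suc (F.suc (F.suc (F.suc (F.suc (F.suc F.zero))))))))))))
pattern #14 = F.suc (F.suc (F.suc (F.suc (F.suc (F.suc (F.suc (F.suc (F.suc (F.suc (F.suc (F.suc (F.suc (F.suc F.zero)))))))))))))

infixr 5 _∷P_
_∷P_ : ∀ {n m F} {S : Vec Str n → Vec Str m} → Fun n F → P S → P (λ v → F v ∷ S v)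
f ∷P s = fork-P f s

consF : ∀ {n F} b → Fun n F → Fun n (λ v → b ∷ F v)
consF b f = cons-P b ∘P f

constF : ∀ {n} (s : Str) → Fun n (λ _ → s)
constF []      = nil-P
constF (b ∷ s) = consF b (constF s)

ap1 : ∀ {n f G} → F1 f → Fun n G → Fun n (λ v → f (G v))
ap1 f g = un1 f ∘P g

ap2 : ∀ {n f G H} → F2 f → Fun n G → Fun n H → Fun n (λ v → f (G v) (H v))
ap2 f g h = un2 f ∘P (g ∷P h)

ap3 : ∀ {n f G H L} → F3 f → Fun n G → Fun n H → Fun n L → Fun n (λ v → f (G v) (H v) (L v))
ap3 f g h l = un3 f ∘P (g ∷P h ∷P l)

fun-ext : ∀ {n F G} → (∀ v → F v ≡ G v) → Fun n F → Fun n G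
fun-ext eq = P-ext (λ v → cong (_∷ []) (eq v))

sel-P : ∀ {n m} (σ : Fin m → Fin n) → P (λ v → V.tabulate (λ i → V.lookup v (σ i)))
sel-P {m = zero}  σ = empty-P
sel-P {m = suc m} σ = arg (σ F.zero) ∷P sel-P (λ i → σ (F.suc i))

id-P : ∀ {n} → P {n} (λ v → v)
id-P = P-ext VP.tabulate∘lookup (sel-P (λ i → i))

caseStr : {A : Set} → Str → A → (Str → A) → (Str → A) → A
caseStr []          e f g = e
caseStr (false ∷ x) e f g = f x
caseStr (true ∷ x)  e f g = g x

matchP : ∀ {n k G} {E : Vec Str n → Vec Str k} {A B} → Fun n G → P E → P A → P B →
         P (λ v → caseStr (G v) (E v) (λ t → A (t ∷ v)) (λ t → B (t ∷ v)))
matchP {G = G} {E} {A} {B} g e a b = P-ext (λ v → go (G v) v) (case-P e a b ∘P (g ∷P id-P))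
  where
  go : ∀ x v → caseV E A B (x ∷ v) ≡ caseStr x (E v) (λ t → A (t ∷ v)) (λ t → B (t ∷ v))
  go []          v = refl
  go (false ∷ x) v = refl
  go (true ∷ x)  v = refl

matchF : ∀ {n G E A B} → Fun n G → Fun n E → Fun (suc n) A → Fun (suc n) B →
         Fun n (λ v → caseStr (G v) (E v) (λ t → A (t ∷ v)) (λ t → B (t ∷ v)))
matchF {G = G} {E} {A} {B} g e a b = P-ext (λ v → go (G v) v) (matchP g e a b)
  where
  go : ∀ x v → caseStr x (E v ∷ []) (λ t → A (t ∷ v) ∷ []) (λ t → B (t ∷ v) ∷ []) ≡
               caseStr x (E v) (λ t → A (t ∷ v)) (λ t → B (t ∷ v)) ∷ []
  go []          v = refl
  go (false ∷ x) v = refl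
  go (true ∷ x)  v = refl

len≤sz : ∀ {n} (v : Vec Str n) i → length (V.lookup v i) ≤ szV v
len≤sz (x ∷ v) F.zero    = ≤-trans (n≤1+n _) (m≤m+n _ (szV v))
len≤sz (x ∷ v) (F.suc i) = ≤-trans (len≤sz v i) (m≤n+m (szV v) _)

-- Recursion on notation

foldl-snoc : ∀ {A : Set} (S : Bool → A → A) x b s → foldlV S (x ++ b ∷ []) s ≡ S b (foldlV S x s)
foldl-snoc S []      b s = refl
foldl-snoc S (c ∷ x) b s = foldl-snoc S x b (S c s)

rev-P : F1 reverse
rev-P = mk1 (P-ext (λ { (x ∷ []) → go x [] }) (fold-P {I = λ v → V.lookup v F.zero ∷ [] ∷ []} (arg #0 ∷P nil-P)
          (consF false (arg #0)) (consF true (arg #0)) (K 1 ⊕ X) hyp))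
  where
  step′ : Bool → Vec Str 1 → Vec Str 1
  step′ = bitF (λ v → (false ∷ V.lookup v F.zero) ∷ []) (λ v → (true ∷ V.lookup v F.zero) ∷ [])
  go : ∀ x a → foldlV step′ x (a ∷ []) ≡ (x ʳ++ a) ∷ []
  go []          a = refl
  go (false ∷ x) a = go x (false ∷ a)
  go (true ∷ x)  a = go x (true ∷ a)
  hyp : ∀ v x₁ x₂ → V.lookup v F.zero ≡ x₁ ++ x₂ → szV (foldlV step′ x₁ ([] ∷ [])) ≤ 1 + szV v
  hyp v x₁ x₂ eq rewrite go x₁ [] = s≤s (≤-trans (≤-reflexive (trans (+-identityʳ _) (length-reverse x₁)))
    (≤-trans (length-++-≤ˡ x₁) (≤-trans (≤-reflexive (cong length (sym eq))) (len≤sz v F.zero))))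

module _ {n m : ℕ} {E : Vec Str n → Vec Str m} {H₀ H₁ : Vec Str (suc (m + n)) → Vec Str m} where

  rec : Str → Vec Str n → Vec Str m
  rec []      v = E v
  rec (b ∷ x) v = bit (H₀ (x ∷ rec x v V.++ v)) (H₁ (x ∷ rec x v V.++ v)) b

  private
    others : Vec Str (suc (m + n)) → Vec Str n
    others w = V.tabulate (λ i → V.lookup w (F.suc (m ↑ʳ i)))

    result : Vec Str (suc (m + n)) → Vec Str m
    result w = V.tabulate (λ i → V.lookup w (F.suc (i ↑ˡ n)))

    recStep : Bool → Vec Str (suc (m + n)) → Vec Str (suc (m + n))
    recStep = bitF (λ w → (false ∷ V.lookup w F.zero) ∷ H₀ w V.++ others w) (λ w → (true ∷ V.lookup w F.zero) ∷ H₁ w V.++ others w)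

    others-≡ : ∀ x (s : Vec Str m) v → others (x ∷ s V.++ v) ≡ v
    others-≡ x s v = trans (VP.tabulate-cong (λ i → VP.lookup-++ʳ s v i)) (VP.tabulate∘lookup v)

    result-≡ : ∀ x (s : Vec Str m) (v : Vec Str n) → result (x ∷ s V.++ v) ≡ s
    result-≡ x s v = trans (VP.tabulate-cong (λ i → VP.lookup-++ˡ s v i)) (VP.tabulate∘lookup s)

    recState : ∀ x v → foldlV recStep (reverse x) ([] ∷ E v V.++ v) ≡ x ∷ rec x v V.++ v
    recState []      v = refl
    recState (b ∷ x) v = trans (cong (λ z → foldlV recStep z ([] ∷ E v V.++ v)) (unfold-reverse b x))
      (trans (foldl-snoc recStep (reverse x) b _) (trans (cong (recStep b) (recState x v)) (last b)))
      where
      last : ∀ b → recStep b (x ∷ rec x v V.++ v) ≡ (b ∷ x) ∷ rec (b ∷ x) v V.++ v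
      last false = cong (λ z → (false ∷ x) ∷ rec (false ∷ x) v V.++ z) (others-≡ x (rec x v) v)
      last true  = cong (λ z → (true ∷ x) ∷ rec (true ∷ x) v V.++ z) (others-≡ x (rec x v) v)

  -- `fold-P` takes the first bit first, while the recursion starts from the last one. When the
  -- reversed string is folded, the part already read is always a suffix of the argument, paired
  -- with its value (`recState`), and `hyp` bounds precisely these states.
  rec-P : P E → P H₀ → P H₁ → (bnd : Pol) → (∀ x v → szV (rec x v) ≤ ⟦ bnd ⟧ (szV (x ∷ v))) →
          P (λ w → rec (V.head w) (V.tail w))
  rec-P e h₀ h₁ bnd hyp = P-ext eq (sel-P (λ i → F.suc (i ↑ˡ n)) ∘P
      fold-P {I = I} {bitF₀} {bitF₁} (ap1 rev-P (arg F.zero) ∷P nil-P ∷P fork-P (e ∘P tail-P) tail-P)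
        (consF false (arg F.zero) ∷P fork-P h₀ others-P) (consF true (arg F.zero) ∷P fork-P h₁ others-P)
        (X ⊕ bnd) hyp′)
    where
    others-P : P others
    others-P = sel-P (λ i → F.suc (m ↑ʳ i))
    tail-P : P {suc n} {n} V.tail
    tail-P = P-ext (λ { (x ∷ v) → VP.tabulate∘lookup v }) (sel-P F.suc)
    bitF₀ bitF₁ : Vec Str (suc (m + n)) → Vec Str (suc (m + n))
    bitF₀ w = (false ∷ V.lookup w F.zero) ∷ H₀ w V.++ others w
    bitF₁ w = (true ∷ V.lookup w F.zero) ∷ H₁ w V.++ others w
    I : Vec Str (suc n) → Vec Str (suc (suc (m + n)))
    I w = reverse (V.lookup w F.zero) ∷ [] ∷ E (V.tail w) V.++ V.tail w
    eq : ∀ w → result (foldlV recStep (V.head (I w)) (V.tail (I w))) ≡ rec (V.head w) (V.tail w)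
    eq (x ∷ v) = trans (cong result (recState x v)) (result-≡ x (rec x v) v)
    hyp′ : ∀ w x₁ x₂ → V.head (I w) ≡ x₁ ++ x₂ → szV (foldlV recStep x₁ (V.tail (I w))) ≤ szV w + ⟦ bnd ⟧ (szV w)
    hyp′ (x ∷ v) x₁ x₂ eq = subst (λ z → szV z ≤ szV (x ∷ v) + ⟦ bnd ⟧ (szV (x ∷ v))) (sym state) (begin
        suc (length r) + szV (rec r v V.++ v)      ≡⟨ cong (suc (length r) +_) (szV-++ (rec r v) v) ⟩
        suc (length r) + (szV (rec r v) + szV v)   ≡⟨ arith (suc (length r)) _ (szV v) ⟩
        szV (r ∷ v) + szV (rec r v)                ≤⟨ +-mono-≤ r≤ (≤-trans (hyp r v) (pol-mono bnd r≤)) ⟩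
        szV (x ∷ v) + ⟦ bnd ⟧ (szV (x ∷ v)) ∎)
      where
      open ≤-Reasoning
      r = reverse x₁
      state : foldlV recStep x₁ ([] ∷ E v V.++ v) ≡ r ∷ rec r v V.++ v
      state = trans (cong (λ z → foldlV recStep z ([] ∷ E v V.++ v)) (sym (reverse-involutive x₁))) (recState r v)
      arith : ∀ a b c → a + (b + c) ≡ (a + c) + b
      arith = solve-∀
      r≤ : szV (r ∷ v) ≤ szV (x ∷ v)
      r≤ = +-monoˡ-≤ (szV v) (s≤s (≤-trans (≤-reflexive (length-reverse x₁)) (≤-trans (length-++-≤ˡ x₁)
             (≤-reflexive (trans (cong length (sym eq)) (length-reverse x))))))

rec1-P : ∀ {n} (f : Str → Vec Str n → Str) {H₀ H₁} → Fun n (f []) → Fun (2 + n) H₀ → Fun (2 + n) H₁ →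
         (∀ x v → f (false ∷ x) v ≡ H₀ (x ∷ f x v ∷ v)) → (∀ x v → f (true ∷ x) v ≡ H₁ (x ∷ f x v ∷ v)) →
         (bnd : Pol) → (∀ x v → length (f x v) ≤ ⟦ bnd ⟧ (szV (x ∷ v))) →
         Fun (suc n) (λ w → f (V.head w) (V.tail w))
rec1-P f {H₀} {H₁} e h₀ h₁ eq₀ eq₁ bnd hyp = P-ext (λ w → go (V.head w) (V.tail w))
    (rec-P e h₀ h₁ (K 1 ⊕ bnd) (λ x v → subst (λ z → szV z ≤ 1 + ⟦ bnd ⟧ (szV (x ∷ v))) (sym (go x v))
      (s≤s (≤-trans (≤-reflexive (+-identityʳ _)) (hyp x v)))))
  where
  go : ∀ x v → rec {E = λ v → f [] v ∷ []} {λ w → H₀ w ∷ []} {λ w → H₁ w ∷ []} x v ≡ f x v ∷ []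
  go []          v = refl
  go (false ∷ x) v = cong (_∷ []) (trans (cong (λ z → H₀ (x ∷ z V.++ v)) (go x v)) (sym (eq₀ x v)))
  go (true ∷ x)  v = cong (_∷ []) (trans (cong (λ z → H₁ (x ∷ z V.++ v)) (go x v)) (sym (eq₁ x v)))

-- From register programs to FP

-- The left end of the tape cannot be recognised, so cell 0 is blanked to become the lowest
-- separator and its bit is carried in the control state to the far end. The input therefore arrives
-- as two registers: its first bit, and the remainder in reverse.
load unload : Cmd
load = cond (mvr ⨾ mvr) (first false) (first true)
  where
  first : Bool → Cmd
  first b = wr nothing mvR ⨾ loop mvr mvr ⨾ mvr ⨾ wr (just b) mvR
unload = goL ⨾ mvr

scanR-end : ∀ s l → Exec (loop mvr mvr) (focusR l (map just s)) (suc (2 * length s)) (tape (map just s ʳ++ l) nothing [])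
scanR-end []      l = loop0 refl
scanR-end (b ∷ s) l = castE (arith (length s))
  (loop1 refl (bitE b (opE≡ (moveR-focus l (just b) _))) (scanR-end s (just b ∷ l)))
  where
  arith : ∀ n → suc (1 + suc (2 * n)) ≡ suc (2 * suc n)
  arith = solve-∀

loaded : Str → Vec Str 2
loaded []      = [] ∷ [] ∷ []
loaded (b ∷ x) = (b ∷ []) ∷ reverse x ∷ []

load-E : ∀ x → Exec load (inputTape x) (5 + 2 * length x) (cfg (toList (loaded x)) 0)
load-E []      = leE (s≤s (s≤s (s≤s z≤n))) (condE (seqE opE opE))
load-E (b ∷ x) = leE (≤-trans (≤-reflexive (arith (length x))) (+-monoʳ-≤ 5 (*-monoʳ-≤ 2 (n≤1+n _)))) (condE (go b))
  where
  first : ∀ b → Exec (wr nothing mvR ⨾ loop mvr mvr ⨾ mvr ⨾ wr (just b) mvR) (inputTape (b ∷ x))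
                     (1 + (suc (2 * length x) + 2)) (cfg (toList (loaded (b ∷ x))) 0)
  first b = seqE (opE≡ (moveR-focus [] nothing (map just x))) (seqE (scanR-end x (nothing ∷ []))
    (fromE (cong (λ z → tape z nothing []) (sym (map-reverse-++ x (nothing ∷ [])))) (seqE opE opE)))
  go : ∀ b → Exec (pick3 _ _ _ (just b)) (inputTape (b ∷ x)) (1 + (suc (2 * length x) + 2)) (cfg (toList (loaded (b ∷ x))) 0)
  go false = first false
  go true  = first true
  arith : ∀ n → suc (1 + (suc (2 * n) + 2)) ≡ 5 + 2 * n
  arith = solve-∀

boolPrefix-++ : ∀ (x : Str) l → boolPrefix (map just x ++ nothing ∷ l) ≡ x
boolPrefix-++ []      l = refl
boolPrefix-++ (b ∷ x) l = cong (b ∷_) (boolPrefix-++ x l)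

output-focusR : ∀ l (x : Str) r → output (focusR l (map just x ++ nothing ∷ r)) ≡ x
output-focusR l []      r = refl
output-focusR l (b ∷ x) r = cong (b ∷_) (boolPrefix-++ x r)

unload-E : ∀ s rs m → ∃ λ t → Exec unload (cfg (s ∷ rs) m) (2 * suc (length s) + 1) t × output t ≡ reverse s
unload-E s rs m = _ , seqE (goL-E s (encOn rs []) (blanks m)) (opE≡ (moveR-focus (encOn rs []) nothing _)) ,
  trans (cong (λ z → output (focusR (nothing ∷ encOn rs []) z)) (sym (map-reverse-++ s (nothing ∷ blanks m))))
        (output-focusR (nothing ∷ encOn rs []) (reverse s) (blanks m))

computes : ∀ {T : Vec Str 2 → Str} (f : Str → Str) → Fun 2 T → (∀ x → T (loaded x) ≡ reverse (f x)) → FP f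
computes {T} f p eq = machine c , proj₁ bd , proj₁ (proj₂ bd) , comp
  where
  c : Cmd
  c = load ⨾ code p ⨾ unload
  total : Pol
  total = (K 5 ⊕ K 2 ⊗ X) ⊕ pol p ⊚ (K 2 ⊕ X) ⊕ (K 2 ⊗ pol p ⊚ (K 2 ⊕ X) ⊕ K 1)
  bd : ∃ λ a → ∃ λ k → ∀ n → ⟦ total ⟧ n ≤ a * suc n ^ k
  bd = pol-bound total
  sz-loaded : ∀ x → szV (loaded x) ≤ 2 + length x
  sz-loaded []      = ≤-refl
  sz-loaded (b ∷ x) = s≤s (s≤s (≤-reflexive (cong suc (trans (+-identityʳ _) (length-reverse x)))))
  exec-c : ∀ x → ∃ λ t → Exec c (inputTape x) (⟦ total ⟧ (length x)) t × output t ≡ f x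
  exec-c x with exec (runs p (loaded x) [] (2 + length x) (sz-loaded x)) 0
  ... | m₁ , e₁ with unload-E (T (loaded x)) (toList (loaded x) ++ []) m₁
  ...   | t , e₂ , oeq = t ,
      seqE (load-E x) (seqE (fromE (cong (λ z → cfg z 0) (sym (++-identityʳ (toList (loaded x))))) e₁) (leE out≤ e₂)) ,
      trans oeq (trans (cong reverse (eq x)) (reverse-involutive (f x)))
    where
    out≤ : 2 * suc (length (T (loaded x))) + 1 ≤ 2 * ⟦ pol p ⟧ (2 + length x) + 1
    out≤ = +-monoˡ-≤ 1 (*-monoʳ-≤ 2 (≤-trans (s≤s (≤-reflexive (sym (+-identityʳ _)))) (bounded p (loaded x) (2 + length x) (sz-loaded x))))
  comp : ComputesIn (machine c) (proj₁ bd) (proj₁ (proj₂ bd)) f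
  comp x with exec-c x
  ... | t , e , oeq rewrite run-machine c (leE (≤-trans (proj₂ (proj₂ bd) (length x)) (m≤m+n _ (proj₁ bd))) e) = refl , oeq

-- Basic polynomial-time string functions

app-P : F2 _++_
app-P = mk2 (rec1-P (λ x v → x ++ V.lookup v #0) (arg #0) (consF false (arg #1)) (consF true (arg #1))
          (λ { x (y ∷ []) → refl }) (λ { x (y ∷ []) → refl }) X
          (λ { x (y ∷ []) → ≤-trans (≤-reflexive (length-++ x)) (+-mono-≤ (n≤1+n _) (≤-trans (n≤1+n _) (m≤m+n _ 0))) })
        ∘P (arg #0 ∷P arg #1 ∷P empty-P))

infixr 5 _++F_
_++F_ : ∀ {n G H} → Fun n G → Fun n H → Fun n (λ v → G v ++ H v)
g ++F h = ap2 app-P g h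

FP-fromF1 : ∀ {f} → F1 f → FP f
FP-fromF1 {f} p = computes f (ap1 rev-P (ap1 p (arg #0 ++F ap1 rev-P (arg #1))))
  (λ { [] → refl ; (b ∷ x) → cong (λ z → reverse (f (b ∷ z))) (reverse-involutive x) })

mkF1 : ∀ {F g} → Fun 1 F → (∀ x → F (x ∷ []) ≡ g x) → F1 g
mkF1 p eq = mk1 (fun-ext (λ { (x ∷ []) → eq x }) p)

rec-F1 : ∀ (f : Str → Str) {H₀ H₁} → Fun 2 H₀ → Fun 2 H₁ →
         (∀ x → f (false ∷ x) ≡ H₀ (x ∷ f x ∷ [])) → (∀ x → f (true ∷ x) ≡ H₁ (x ∷ f x ∷ [])) →
         (bnd : Pol) → (∀ x → length (f x) ≤ ⟦ bnd ⟧ (length x)) → F1 f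
rec-F1 f h₀ h₁ eq₀ eq₁ bnd hyp = mk1 (rec1-P (λ x v → f x) (constF (f [])) h₀ h₁
    (λ { x [] → eq₀ x }) (λ { x [] → eq₁ x }) bnd
    (λ { x [] → ≤-trans (hyp x) (pol-mono bnd (≤-trans (n≤1+n _) (m≤m+n _ 0))) }) ∘P (arg #0 ∷P empty-P))

rec-F2 : ∀ (f : Str → Str → Str) {E H₀ H₁} → Fun 1 E → Fun 3 H₀ → Fun 3 H₁ → (∀ y → f [] y ≡ E (y ∷ [])) →
         (∀ x y → f (false ∷ x) y ≡ H₀ (x ∷ f x y ∷ y ∷ [])) → (∀ x y → f (true ∷ x) y ≡ H₁ (x ∷ f x y ∷ y ∷ [])) →
         (bnd : Pol) → (∀ x y → length (f x y) ≤ ⟦ bnd ⟧ (length x + length y)) → F2 f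
rec-F2 f e h₀ h₁ eqₑ eq₀ eq₁ bnd hyp = mk2 (rec1-P (λ x v → f x (V.lookup v F.zero)) (fun-ext (λ { (y ∷ []) → sym (eqₑ y) }) e) h₀ h₁
    (λ { x (y ∷ []) → eq₀ x y }) (λ { x (y ∷ []) → eq₁ x y }) bnd
    (λ { x (y ∷ []) → ≤-trans (hyp x y) (pol-mono bnd (+-mono-≤ (n≤1+n _) (≤-trans (n≤1+n _) (m≤m+n _ 0)))) })
  ∘P (arg #0 ∷P arg #1 ∷P empty-P))

tailS headS : Str → Str
tailS []      = []
tailS (_ ∷ x) = x
headS []      = []
headS (b ∷ _) = b ∷ []

tail-F : F1 tailS
tail-F = mkF1 (matchF (arg #0) nil-P (arg #0) (arg #0)) (λ { [] → refl ; (false ∷ x) → refl ; (true ∷ x) → refl })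

head-F : F1 headS
head-F = mkF1 (matchF (arg #0) nil-P (constF (false ∷ [])) (constF (true ∷ [])))
  (λ { [] → refl ; (false ∷ x) → refl ; (true ∷ x) → refl })

-- Numbers are passed as lengths of strings, here and below.
dropS takeS : Str → Str → Str
dropS x y = List.drop (length x) y
takeS x y = List.take (length x) y

drop-step : ∀ k (y : Str) → List.drop (suc k) y ≡ tailS (List.drop k y)
drop-step zero    []      = refl
drop-step zero    (b ∷ y) = refl
drop-step (suc k) []      = refl
drop-step (suc k) (b ∷ y) = drop-step k y

take-step : ∀ k (y : Str) → List.take (suc k) y ≡ List.take k y ++ headS (List.drop k y)
take-step zero    []      = refl
take-step zero    (b ∷ y) = refl
take-step (suc k) []      = refl
take-step (suc k) (b ∷ y) = cong (b ∷_) (take-step k y)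

drop-F : F2 dropS
drop-F = rec-F2 dropS (arg #0) (ap1 tail-F (arg #1)) (ap1 tail-F (arg #1)) (λ y → refl)
  (λ x y → drop-step (length x) y) (λ x y → drop-step (length x) y) X
  (λ x y → ≤-trans (≤-reflexive (length-drop (length x) y)) (≤-trans (m∸n≤m (length y) (length x)) (m≤n+m _ (length x))))

take-F : F2 takeS
take-F = rec-F2 takeS nil-P (arg #1 ++F ap1 head-F (ap2 drop-F (arg #0) (arg #2))) (arg #1 ++F ap1 head-F (ap2 drop-F (arg #0) (arg #2)))
  (λ y → refl) (λ x y → take-step (length x) y) (λ x y → take-step (length x) y) X
  (λ x y → ≤-trans (≤-reflexive (length-take (length x) y)) (≤-trans (m⊓n≤m (length x) (length y)) (m≤m+n _ _)))

ones afterOnes : Str → Str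
ones []          = []
ones (false ∷ x) = []
ones (true ∷ x)  = true ∷ ones x
afterOnes []          = []
afterOnes (false ∷ x) = x
afterOnes (true ∷ x)  = afterOnes x

ones-≤ : ∀ x → length (ones x) ≤ length x
ones-≤ []          = z≤n
ones-≤ (false ∷ x) = z≤n
ones-≤ (true ∷ x)  = s≤s (ones-≤ x)

afterOnes-≤ : ∀ x → length (afterOnes x) ≤ length x
afterOnes-≤ []          = z≤n
afterOnes-≤ (false ∷ x) = n≤1+n _
afterOnes-≤ (true ∷ x)  = ≤-trans (afterOnes-≤ x) (n≤1+n _)

ones-F : F1 ones
ones-F = rec-F1 ones nil-P (consF true (arg #1)) (λ _ → refl) (λ _ → refl) X ones-≤

afterOnes-F : F1 afterOnes
afterOnes-F = rec-F1 afterOnes (arg #0) (arg #1) (λ _ → refl) (λ _ → refl) X afterOnes-≤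

un : ℕ → Str
un n = replicate n true

ones-enc : ∀ n x → ones (encℕ n ++ x) ≡ un n
ones-enc zero    x = refl
ones-enc (suc n) x = cong (true ∷_) (ones-enc n x)

afterOnes-enc : ∀ n x → afterOnes (encℕ n ++ x) ≡ x
afterOnes-enc zero    x = refl
afterOnes-enc (suc n) x = afterOnes-enc n x

unary : Str → Str
unary x = un (length x)

unary-F : F1 unary
unary-F = rec-F1 unary (consF true (arg #1)) (consF true (arg #1)) (λ _ → refl) (λ _ → refl) X
  (λ x → ≤-reflexive (length-replicate (length x)))

module _ (f : Str → Str) {H : Bool → Bool → Vec Str 2 → Str} (h : ∀ a c → Fun 2 (H a c))
         (eq[] : f [] ≡ []) (eq₁ : ∀ a → f (a ∷ []) ≡ [])
         (eq₂ : ∀ a c x → f (a ∷ c ∷ x) ≡ H a c (x ∷ f x ∷ [])) (hyp : ∀ x → length (f x) ≤ length x) where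

  private
    G : Bool → Vec Str 3 → Vec Str 2
    G b v = caseStr (V.lookup v #0) [] (λ t → H b false (t ∷ V.lookup v #2 ∷ [])) (λ t → H b true (t ∷ V.lookup v #2 ∷ [])) ∷ V.lookup v #1 ∷ []

    G-P : ∀ b → P (G b)
    G-P b = matchF (arg #0) nil-P (h b false ∘P (arg #0 ∷P arg #3 ∷P empty-P)) (h b true ∘P (arg #0 ∷P arg #3 ∷P empty-P)) ∷P arg #1

    first-eq : ∀ b x → f (b ∷ x) ≡ caseStr x [] (λ t → H b false (t ∷ f (tailS x) ∷ [])) (λ t → H b true (t ∷ f (tailS x) ∷ []))
    first-eq b []          = eq₁ b
    first-eq b (false ∷ x) = eq₂ b false x
    first-eq b (true ∷ x)  = eq₂ b true x

    rec₂ : ∀ x → rec {E = λ v → [] ∷ [] ∷ []} {G false} {G true} x [] ≡ f x ∷ f (tailS x) ∷ []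
    rec₂ []          = sym (cong₂ (λ a b → a ∷ b ∷ []) eq[] eq[])
    rec₂ (false ∷ x) = trans (cong (λ z → G false (x ∷ z V.++ [])) (rec₂ x)) (cong (_∷ f x ∷ []) (sym (first-eq false x)))
    rec₂ (true ∷ x)  = trans (cong (λ z → G true (x ∷ z V.++ [])) (rec₂ x)) (cong (_∷ f x ∷ []) (sym (first-eq true x)))

    tailS-≤ : ∀ x → length (tailS x) ≤ length x
    tailS-≤ []      = z≤n
    tailS-≤ (b ∷ x) = n≤1+n _

  -- Carrying `f x` and `f (tailS x)` together turns recursion by two bits into recursion by one, as
  -- for Fibonacci numbers.
  rec2-P : F1 f
  rec2-P = mk1 (P-ext (λ v → cong (λ z → V.lookup z #0 ∷ []) (rec₂ (V.lookup v #0)))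
    (arg #0 ∘P rec-P {E = λ v → [] ∷ [] ∷ []} (nil-P ∷P nil-P) (G-P false) (G-P true) (K 2 ⊗ X)
      (λ { x [] → ≤-trans (≤-reflexive (cong szV (rec₂ x)))
        (+-mono-≤ (≤-trans (s≤s (hyp x)) (m≤m+n _ 0)) (+-monoˡ-≤ 0 (≤-trans (s≤s (≤-trans (hyp (tailS x)) (tailS-≤ x))) (m≤m+n _ 0)))) })
      ∘P (arg #0 ∷P empty-P)))

rec2-F : ∀ f {H₀₀ H₀₁ H₁₀ H₁₁} → Fun 2 H₀₀ → Fun 2 H₀₁ → Fun 2 H₁₀ → Fun 2 H₁₁ → f [] ≡ [] → (∀ a → f (a ∷ []) ≡ []) →
         (∀ x → f (false ∷ false ∷ x) ≡ H₀₀ (x ∷ f x ∷ [])) → (∀ x → f (false ∷ true ∷ x) ≡ H₀₁ (x ∷ f x ∷ [])) →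
         (∀ x → f (true ∷ false ∷ x) ≡ H₁₀ (x ∷ f x ∷ [])) → (∀ x → f (true ∷ true ∷ x) ≡ H₁₁ (x ∷ f x ∷ [])) →
         (∀ x → length (f x) ≤ length x) → F1 f
rec2-F f {H₀₀} {H₀₁} {H₁₀} {H₁₁} h₀₀ h₀₁ h₁₀ h₁₁ eq[] eq₁ e₀₀ e₀₁ e₁₀ e₁₁ =
  rec2-P f {λ a c → bit (bit H₀₀ H₀₁ c) (bit H₁₀ H₁₁ c) a}
    (λ { false false → h₀₀ ; false true → h₀₁ ; true false → h₁₀ ; true true → h₁₁ }) eq[] eq₁
    (λ { false false → e₀₀ ; false true → e₀₁ ; true false → e₁₀ ; true true → e₁₁ })

fstS sndS : Str → Str
fstS []                  = []
fstS (a ∷ [])            = []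
fstS (false ∷ false ∷ x) = false ∷ fstS x
fstS (false ∷ true ∷ x)  = []
fstS (true ∷ false ∷ x)  = []
fstS (true ∷ true ∷ x)   = true ∷ fstS x
sndS []                  = []
sndS (a ∷ [])            = []
sndS (false ∷ false ∷ x) = sndS x
sndS (false ∷ true ∷ x)  = x
sndS (true ∷ false ∷ x)  = x
sndS (true ∷ true ∷ x)   = sndS x

fstS-sndS-≤ : ∀ x → 2 * length (fstS x) + length (sndS x) ≤ length x
fstS-sndS-≤ []                  = z≤n
fstS-sndS-≤ (a ∷ [])            = z≤n
fstS-sndS-≤ (false ∷ false ∷ x) = ≤-trans (≤-reflexive (arith (length (fstS x)) _)) (s≤s (s≤s (fstS-sndS-≤ x)))
  where
  arith : ∀ a b → 2 * suc a + b ≡ 2 + (2 * a + b)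
  arith = solve-∀
fstS-sndS-≤ (false ∷ true ∷ x)  = ≤-trans (n≤1+n _) (n≤1+n _)
fstS-sndS-≤ (true ∷ false ∷ x)  = ≤-trans (n≤1+n _) (n≤1+n _)
fstS-sndS-≤ (true ∷ true ∷ x)   = ≤-trans (≤-reflexive (arith (length (fstS x)) _)) (s≤s (s≤s (fstS-sndS-≤ x)))
  where
  arith : ∀ a b → 2 * suc a + b ≡ 2 + (2 * a + b)
  arith = solve-∀

sndS-≤ : ∀ x → length (sndS x) ≤ length x
sndS-≤ x = ≤-trans (m≤n+m _ (2 * length (fstS x))) (fstS-sndS-≤ x)

fstS-≤ : ∀ x → length (fstS x) ≤ length x
fstS-≤ x = ≤-trans (m≤m+n _ _) (≤-trans (m≤m+n (2 * length (fstS x)) (length (sndS x))) (fstS-sndS-≤ x))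

fst-F : F1 fstS
fst-F = rec2-F fstS (consF false (arg #1)) nil-P nil-P (consF true (arg #1))
  refl (λ _ → refl) (λ _ → refl) (λ _ → refl) (λ _ → refl) (λ _ → refl) fstS-≤

snd-F : F1 sndS
snd-F = rec2-F sndS (arg #1) (arg #0) (arg #0) (arg #1)
  refl (λ _ → refl) (λ _ → refl) (λ _ → refl) (λ _ → refl) (λ _ → refl) sndS-≤

fstS-pair : ∀ x y → fstS (pair x y) ≡ x
fstS-pair []          y = refl
fstS-pair (false ∷ x) y = cong (false ∷_) (fstS-pair x y)
fstS-pair (true ∷ x)  y = cong (true ∷_) (fstS-pair x y)

sndS-pair : ∀ x y → sndS (pair x y) ≡ y
sndS-pair []          y = refl
sndS-pair (false ∷ x) y = sndS-pair x y
sndS-pair (true ∷ x)  y = sndS-pair x y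

FP-fromF2 : ∀ {g} → F2 g → FP₂ g
FP-fromF2 {g} p = (λ w → g (fstS w) (sndS w)) , FP-fromF1 (mk1 (ap2 p (ap1 fst-F (arg #0)) (ap1 snd-F (arg #0)))) ,
  λ u y → cong₂ g (fstS-pair u y) (sndS-pair u y)

FP-fromF3 : ∀ {h} → F3 h → FP₃ h
FP-fromF3 {h} p = (λ w → h (fstS w) (fstS (sndS w)) (sndS (sndS w))) ,
  FP-fromF1 (mk1 (ap3 p (ap1 fst-F (arg #0)) (ap1 fst-F (ap1 snd-F (arg #0))) (ap1 snd-F (ap1 snd-F (arg #0))))) , eq
  where
  eq : ∀ u y w → h (fstS (triple u y w)) (fstS (sndS (triple u y w))) (sndS (sndS (triple u y w))) ≡ h u y w
  eq u y w rewrite fstS-pair u (encStr y ++ w) | sndS-pair u (encStr y ++ w) | fstS-pair y w | sndS-pair y w = refl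

-- The proper suffixes of the string act as a loop counter, the shortest one first: on a unary
-- string this concatenates the values of `e` at 0, 1, 2 and so on.
catS : ∀ {n} → (Vec Str (suc n) → Str) → Str → Vec Str n → Str
catS e []      v = []
catS e (b ∷ x) v = catS e x v ++ e (x ∷ v)

cat-P : ∀ {n e} → Fun (suc n) e → Fun (suc n) (λ w → catS e (V.head w) (V.tail w))
cat-P {n} {e} p = rec1-P (catS e) nil-P h h (λ _ _ → refl) (λ _ _ → refl) (X ⊗ pol p) bd
  where
  h : Fun (2 + n) (λ w → V.lookup w #1 ++ e (V.lookup w #0 ∷ V.tail (V.tail w)))
  h = arg #1 ++F (p ∘P (arg #0 ∷P P-ext (λ { (x ∷ y ∷ v) → VP.tabulate∘lookup v }) (sel-P (λ i → F.suc (F.suc i)))))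
  bd : ∀ x v → length (catS e x v) ≤ szV (x ∷ v) * ⟦ pol p ⟧ (szV (x ∷ v))
  bd []      v = z≤n
  bd (b ∷ x) v = ≤-trans (≤-reflexive (trans (length-++ (catS e x v)) (+-comm (length (catS e x v)) _)))
    (+-mono-≤ (≤-trans (≤-trans (n≤1+n _) (≤-reflexive (cong suc (sym (+-identityʳ _))))) (bounded p (x ∷ v) _ (n≤1+n _)))
              (≤-trans (bd x v) (*-monoʳ-≤ (szV (x ∷ v)) (pol-mono (pol p) (n≤1+n _)))))

iterV : {A : Set} → (A → A) → Str → A → A
iterV S []      s = s
iterV S (_ ∷ x) s = iterV S x (S s)

iter-P : ∀ {n m} {I : Vec Str n → Vec Str (suc m)} {S : Vec Str m → Vec Str m} → P I → P S → (bnd : Pol) →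
         (∀ v x₁ x₂ → V.head (I v) ≡ x₁ ++ x₂ → szV (iterV S x₁ (V.tail (I v))) ≤ ⟦ bnd ⟧ (szV v)) →
         P (λ v → iterV S (V.head (I v)) (V.tail (I v)))
iter-P {I = I} {S} i s bnd hyp = P-ext (λ v → eq (V.head (I v)) (V.tail (I v))) (fold-P i s s bnd
    (λ v x₁ x₂ e → subst (λ z → szV z ≤ _) (sym (eq x₁ _)) (hyp v x₁ x₂ e)))
  where
  eq : ∀ x s → foldlV (bitF S S) x s ≡ iterV S x s
  eq []          s = refl
  eq (false ∷ x) s = eq x (S s)
  eq (true ∷ x)  s = eq x (S s)

-- If a round adds at most `c` to the size, all iterates stay below a linear function of the number
-- of rounds, which provides the size hypothesis of `iter-P`.
iterGrow-P : ∀ {n m} {I : Vec Str n → Vec Str (suc m)} {S : Vec Str m → Vec Str m} → P I → P S → (c : ℕ) →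
             (∀ s → szV (S s) ≤ c + szV s) → P (λ v → iterV S (V.head (I v)) (V.tail (I v)))
iterGrow-P {I = I} {S} i s c grow = iter-P i s (pol i ⊗ K c ⊕ pol i) (λ v x₁ x₂ eq → bd v (I v) (bounded i v _ ≤-refl) x₁ x₂ eq)
  where
  it : ∀ x s → szV (iterV S x s) ≤ length x * c + szV s
  it []      s = ≤-refl
  it (b ∷ x) s = ≤-trans (it x (S s)) (≤-trans (+-monoʳ-≤ (length x * c) (grow s)) (≤-reflexive (arith (length x * c) c (szV s))))
    where
    arith : ∀ a c s → a + (c + s) ≡ (c + a) + s
    arith = solve-∀
  bd : ∀ {n} (v : Vec Str n) w {N} → szV w ≤ N → ∀ x₁ x₂ → V.head w ≡ x₁ ++ x₂ → szV (iterV S x₁ (V.tail w)) ≤ N * c + N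
  bd v (x ∷ w) le x₁ x₂ refl = ≤-trans (it x₁ w) (+-mono-≤
    (*-monoˡ-≤ c (≤-trans (length-++-≤ˡ x₁) (≤-trans (n≤1+n _) (≤-trans (m≤m+n _ (szV w)) le))))
    (≤-trans (m≤n+m _ _) le))

-- Straight-line gates with untyped wires; wire 0 is the most recent one

data Raw (I : Set) : Set where
  andR orR : I → I → Raw I
  notR     : I → Raw I

mapRaw : {I J : Set} → (I → J) → Raw I → Raw J
mapRaw f (andR i j) = andR (f i) (f j)
mapRaw f (orR i j)  = orR (f i) (f j)
mapRaw f (notR i)   = notR (f i)

data At {A : Set} : List A → ℕ → A → Set where
  at0 : ∀ {b w} → At (b ∷ w) 0 b
  at+ : ∀ {b c w i} → At w i b → At (c ∷ w) (suc i) b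

data EvalRaw (w : List Bool) : Raw ℕ → Bool → Set where
  andE : ∀ {i j x y} → At w i x → At w j y → EvalRaw w (andR i j) (x ∧ y)
  orE  : ∀ {i j x y} → At w i x → At w j y → EvalRaw w (orR i j) (x ∨ y)
  notE : ∀ {i x} → At w i x → EvalRaw w (notR i) (Data.Bool.not x)

data RunRaw : List (Raw ℕ) → List Bool → List Bool → Set where
  []  : ∀ {w} → RunRaw [] w w
  _∷_ : ∀ {r rs w b w′} → EvalRaw w r b → RunRaw rs (b ∷ w) w′ → RunRaw (r ∷ rs) w w′

_+++_ : ∀ {rs rs′ w w′ w″} → RunRaw rs w w′ → RunRaw rs′ w′ w″ → RunRaw (rs ++ rs′) w w″
[]      +++ q = q
(e ∷ p) +++ q = e ∷ (p +++ q)

infixr 5 _+++_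

at-++ : ∀ {A : Set} (x : List A) {n w i b} → length x ≡ n → At w i b → At (x ++ w) (n + i) b
at-++ []      refl a = a
at-++ (c ∷ x) refl a = at+ (at-++ x refl a)

at-cast : ∀ {A : Set} {w : List A} {i j b} → i ≡ j → At w i b → At w j b
at-cast refl a = a

at-cast-wires : ∀ {A : Set} {w w′ : List A} {i b} → w ≡ w′ → At w i b → At w′ i b
at-cast-wires refl a = a

run-cast : ∀ {rs rs′ w w₁ w₂} → rs ≡ rs′ → w₁ ≡ w₂ → RunRaw rs w w₁ → RunRaw rs′ w w₂
run-cast refl refl r = r

ValidRaw : ℕ → Raw ℕ → Set
ValidRaw m (andR i j) = (i < m) × (j < m)
ValidRaw m (orR i j)  = (i < m) × (j < m)
ValidRaw m (notR i)   = i < m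

Valid : ℕ → List (Raw ℕ) → Set
Valid m []       = ⊤
Valid m (r ∷ rs) = ValidRaw m r × Valid (suc m) rs

at-< : ∀ {A : Set} {w : List A} {i b} → At w i b → i < length w
at-< at0     = s≤s z≤n
at-< (at+ a) = s≤s (at-< a)

-- An evaluation looks up every operand, so one run on any input certifies that all indices are in
-- scope. No separate index arithmetic is required for building typed circuits.
run-valid : ∀ {rs w w′} → RunRaw rs w w′ → Valid (length w) rs
run-valid []             = tt
run-valid (andE a b ∷ p) = (at-< a , at-< b) , run-valid p
run-valid (orE a b ∷ p)  = (at-< a , at-< b) , run-valid p
run-valid (notE a ∷ p)   = at-< a , run-valid p

wires : List (Raw ℕ) → ℕ → ℕ
wires []       m = m
wires (_ ∷ rs) m = wires rs (suc m)

attach : ∀ rs {m} → Valid m rs → Gates (wires rs m) → Gates m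
attach []              _             g = g
attach (andR i j ∷ rs) ((p , q) , v) g = and (F.fromℕ< p) (F.fromℕ< q) (attach rs v g)
attach (orR i j ∷ rs)  ((p , q) , v) g = or (F.fromℕ< p) (F.fromℕ< q) (attach rs v g)
attach (notR i ∷ rs)   (p , v)       g = not (F.fromℕ< p) (attach rs v g)

encRaw : Raw ℕ → Str
encRaw (andR i j) = false ∷ true ∷ encℕ i ++ encℕ j
encRaw (orR i j)  = true ∷ false ∷ encℕ i ++ encℕ j
encRaw (notR i)   = true ∷ true ∷ encℕ i

encRaws : List (Raw ℕ) → Str
encRaws = concatMap encRaw

encFin-fromℕ< : ∀ {i m} (p : i < m) → encFin (F.fromℕ< p) ≡ encℕ i
encFin-fromℕ< p = cong encℕ (FP.toℕ-fromℕ< p)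

enc-attach : ∀ rs {m} (v : Valid m rs) g → encGates (attach rs v g) ≡ encRaws rs ++ encGates g
enc-attach []              _             g = refl
enc-attach (andR i j ∷ rs) ((p , q) , v) g = cong (λ x → false ∷ true ∷ x)
  (trans (cong₂ _++_ (encFin-fromℕ< p) (cong₂ _++_ (encFin-fromℕ< q) (enc-attach rs v g)))
  (trans (sym (++-assoc (encℕ i) (encℕ j) _)) (sym (++-assoc (encℕ i ++ encℕ j) (encRaws rs) _))))
enc-attach (orR i j ∷ rs)  ((p , q) , v) g = cong (λ x → true ∷ false ∷ x)
  (trans (cong₂ _++_ (encFin-fromℕ< p) (cong₂ _++_ (encFin-fromℕ< q) (enc-attach rs v g)))
  (trans (sym (++-assoc (encℕ i) (encℕ j) _)) (sym (++-assoc (encℕ i ++ encℕ j) (encRaws rs) _))))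
enc-attach (notR i ∷ rs)   (p , v)       g = cong (λ x → true ∷ true ∷ x)
  (trans (cong₂ _++_ (encFin-fromℕ< p) (enc-attach rs v g)) (sym (++-assoc (encℕ i) (encRaws rs) _)))

lookup-at : ∀ {m} (v : Vec Bool m) {i b} (p : i < m) → At (toList v) i b → V.lookup v (F.fromℕ< p) ≡ b
lookup-at (x ∷ v) {zero}  (s≤s p) at0     = refl
lookup-at (x ∷ v) {suc i} (s≤s p) (at+ a) = lookup-at v p a

eval-attach : ∀ rs {m} (v : Valid m rs) g (x : Vec Bool m) {w} → RunRaw rs (toList x) w →
              Σ (Vec Bool (wires rs m)) λ y → toList y ≡ w × evalG (attach rs v g) x ≡ evalG g y
eval-attach []              _             g x [] = x , refl , refl
eval-attach (andR i j ∷ rs) ((p , q) , v) g x (andE a b ∷ r)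
  rewrite lookup-at x p a | lookup-at x q b = eval-attach rs v g (_ ∷ x) r
eval-attach (orR i j ∷ rs)  ((p , q) , v) g x (orE a b ∷ r)
  rewrite lookup-at x p a | lookup-at x q b = eval-attach rs v g (_ ∷ x) r
eval-attach (notR i ∷ rs)   (p , v)       g x (notE a ∷ r)
  rewrite lookup-at x p a = eval-attach rs v g (_ ∷ x) r

-- Wire indices of the form a or a + ζ, for a parameter ζ.
Ix : Set
Ix = ℕ × Bool

val : ℕ → Ix → ℕ
val ζ (a , false) = a
val ζ (a , true)  = a + ζ

far : ℕ → Ix → Ix
far d (a , c) = d + a , c

val-far : ∀ ζ d i → val ζ (far d i) ≡ d + val ζ i
val-far ζ d (a , false) = refl
val-far ζ d (a , true)  = +-assoc d a ζ

fixed : ℕ → Ix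
fixed a = a , false

inst : ℕ → List (Raw Ix) → List (Raw ℕ)
inst ζ = map (mapRaw (val ζ))

inst-++ : ∀ ζ x y → inst ζ (x ++ y) ≡ inst ζ x ++ inst ζ y
inst-++ ζ = map-++ (mapRaw (val ζ))

-- Multiplexer trees. The number of gates depends only on the number of inputs.

γ⁻ γ : ℕ → ℕ
γ⁻ zero    = 1
γ⁻ (suc n) = 5 + (γ⁻ n + γ⁻ n)
γ n = suc (γ⁻ n)

mux : ℕ → ℕ → Ix → List (Raw Ix)
mux g d i = andR (far (g + (g + d)) i) (fixed 0) ∷ notR (far (1 + (g + (g + d))) i) ∷ andR (fixed 0) (fixed (2 + g)) ∷ orR (fixed 0) (fixed 2) ∷ []

-- Placed right after a negation of wire 0, so wires 0 and 1 carry opposite values, whose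
-- conjunction is 0 and whose disjunction is 1.
leaf : Bool → Raw Ix
leaf false = andR (fixed 0) (fixed 1)
leaf true  = orR (fixed 0) (fixed 1)

-- Shannon expansion in the first variable. `d` counts the wires created since the given distances
-- were correct, and `far` adds it to them. Both cofactors are always computed, which makes the gate
-- count independent of the function.
synth : ∀ {n} → (Vec Bool n → Bool) → Vec Ix n → ℕ → List (Raw Ix)
synth φ [] d = notR (fixed 0) ∷ leaf (φ []) ∷ []
synth {suc n} φ (i ∷ is) d = synth (λ v → φ (false ∷ v)) is d ++ synth (λ v → φ (true ∷ v)) is (γ n + d) ++ mux (γ n) d i

synth-run : ∀ {n} (φ : Vec Bool n → Bool) is ζ (v : Vec Bool n) b₀ w →
  (∀ j → At (b₀ ∷ w) (val ζ (V.lookup is j)) (V.lookup v j)) → ∀ e {d} → length e ≡ d →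
  ∃ λ E → length E ≡ γ⁻ n × RunRaw (inst ζ (synth φ is d)) (e ++ b₀ ∷ w) (φ v ∷ E ++ e ++ b₀ ∷ w)
synth-run φ [] ζ [] b₀ w h e refl = go e
  where
  lf : ∀ c x y → RunRaw (inst ζ (leaf c ∷ [])) (Data.Bool.not x ∷ x ∷ y) (c ∷ Data.Bool.not x ∷ x ∷ y)
  lf false false y = andE at0 (at+ at0) ∷ []
  lf false true  y = andE at0 (at+ at0) ∷ []
  lf true  false y = orE at0 (at+ at0) ∷ []
  lf true  true  y = orE at0 (at+ at0) ∷ []
  go : ∀ e → ∃ λ E → length E ≡ 1 × RunRaw (inst ζ (notR (fixed 0) ∷ leaf (φ []) ∷ [])) (e ++ b₀ ∷ w) (φ [] ∷ E ++ e ++ b₀ ∷ w)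
  go []      = Data.Bool.not b₀ ∷ [] , refl , (notE at0 ∷ lf (φ []) b₀ w)
  go (x ∷ e) = Data.Bool.not x ∷ [] , refl , (notE at0 ∷ lf (φ []) x (e ++ b₀ ∷ w))
synth-run {suc n} φ (i ∷ is) ζ (x ∷ v) b₀ w h e refl
  with synth-run (λ v → φ (false ∷ v)) is ζ v b₀ w (λ j → h (F.suc j)) e refl
... | E₀ , len₀ , run₀ with synth-run (λ v → φ (true ∷ v)) is ζ v b₀ w (λ j → h (F.suc j)) (φ (false ∷ v) ∷ E₀ ++ e) {γ n + length e}
                              (cong suc (trans (length-++ E₀) (cong (_+ length e) len₀)))
...   | E₁ , len₁ , run₁ = E , len , run-cast (sym insts) refl
          (run-cast refl (cong (λ l → φ (false ∷ v) ∷ l) (sym (++-assoc E₀ e _))) run₀ +++ run₁ +++ final)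
  where
  f₀ f₁ nx g₁ g₃ : Bool
  f₀ = φ (false ∷ v)
  f₁ = φ (true ∷ v)
  nx = Data.Bool.not x
  g₁ = x ∧ f₁
  g₃ = nx ∧ f₀
  E : List Bool
  E = g₃ ∷ nx ∷ g₁ ∷ f₁ ∷ E₁ ++ f₀ ∷ E₀
  len : length E ≡ γ⁻ (suc n)
  len = cong (4 +_) (trans (length-++ E₁) (trans (cong₂ (λ a b → a + suc b) len₁ len₀) (+-suc (γ⁻ n) (γ⁻ n))))
  insts : inst ζ (synth φ (i ∷ is) (length e)) ≡ inst ζ (synth (λ v → φ (false ∷ v)) is (length e)) ++
            inst ζ (synth (λ v → φ (true ∷ v)) is (γ n + length e)) ++ inst ζ (mux (γ n) (length e) i)
  insts = trans (inst-++ ζ (synth _ is _) _) (cong (inst ζ (synth _ is (length e)) ++_) (inst-++ ζ (synth _ is (γ n + length e)) _))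
  top : List Bool
  top = f₁ ∷ E₁ ++ (f₀ ∷ E₀ ++ e)
  len-top : length top ≡ γ n + (γ n + length e)
  len-top = cong suc (trans (length-++ E₁) (cong₂ _+_ len₁ (cong suc (trans (length-++ E₀) (cong (_+ length e) len₀)))))
  assoc-top : top ++ b₀ ∷ w ≡ f₁ ∷ E₁ ++ (f₀ ∷ E₀ ++ e) ++ b₀ ∷ w
  assoc-top = cong (f₁ ∷_) (++-assoc E₁ (f₀ ∷ E₀ ++ e) (b₀ ∷ w))
  assoc-E : f₁ ∷ E₁ ++ (f₀ ∷ E₀ ++ e) ++ b₀ ∷ w ≡ f₁ ∷ (E₁ ++ f₀ ∷ E₀) ++ e ++ b₀ ∷ w
  assoc-E = cong (f₁ ∷_) (trans (cong (λ l → E₁ ++ f₀ ∷ l) (++-assoc E₀ e (b₀ ∷ w))) (sym (++-assoc E₁ (f₀ ∷ E₀) _)))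
  at-x : At (f₁ ∷ E₁ ++ (f₀ ∷ E₀ ++ e) ++ b₀ ∷ w) (γ n + (γ n + length e) + val ζ i) x
  at-x = at-cast-wires assoc-top (at-++ top len-top (h F.zero))
  at-f₀ : At (f₁ ∷ E₁ ++ (f₀ ∷ E₀ ++ e) ++ b₀ ∷ w) (γ n) f₀
  at-f₀ = at+ (at-cast (+-identityʳ (γ⁻ n)) (at-++ E₁ len₁ at0))
  value : ∀ x → (Data.Bool.not x ∧ f₀) ∨ (x ∧ f₁) ≡ φ (x ∷ v)
  value false = ∨-identityʳ f₀
    where open import Data.Bool.Properties using (∨-identityʳ)
  value true  = refl
  final : RunRaw (inst ζ (mux (γ n) (length e) i)) (f₁ ∷ E₁ ++ (f₀ ∷ E₀ ++ e) ++ b₀ ∷ w) (φ (x ∷ v) ∷ E ++ e ++ b₀ ∷ w)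
  final = subst₂ (λ a l → RunRaw (inst ζ (mux (γ n) (length e) i)) (f₁ ∷ E₁ ++ (f₀ ∷ E₀ ++ e) ++ b₀ ∷ w) (a ∷ g₃ ∷ nx ∷ g₁ ∷ l)) (value x) assoc-E
    (andE (at-cast (sym (val-far ζ _ i)) at-x) at0 ∷ notE (at-cast (sym (val-far ζ _ i)) (at+ at-x)) ∷ andE at0 (at+ (at+ at-f₀)) ∷ orE at0 (at+ (at+ at0)) ∷ [])

-- Blocks of functions of the same inputs. Result j sits at wire j * γ after the block.

blockR : ∀ {n k} → Vec (Vec Bool n → Bool) k → Vec Ix n → List (Raw Ix)
blockR             []       is = []
blockR {n} {suc k} (φ ∷ φs) is = blockR φs is ++ synth φ is (k * γ n)

data Block (n : ℕ) : ∀ {k} → Vec Bool k → List Bool → Set where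
  []   : Block n [] []
  cons : ∀ {k b E L} {bs : Vec Bool k} → length E ≡ γ⁻ n → Block n bs L → Block n (b ∷ bs) (b ∷ E ++ L)

block-length : ∀ {n k L} {bs : Vec Bool k} → Block n bs L → length L ≡ k * γ n
block-length []                    = refl
block-length (cons {E = E} len bl) = cong suc (trans (length-++ E) (cong₂ _+_ len (block-length bl)))

block-at : ∀ {n k L} {bs : Vec Bool k} w → Block n bs L → ∀ j → At (L ++ w) (toℕ j * γ n) (V.lookup bs j)
block-at w (cons len bl) F.zero = at0
block-at w (cons {b = b} {E} {L} len bl) (F.suc j) =
  at-cast-wires (cong (b ∷_) (sym (++-assoc E L w))) (at-++ (b ∷ E) (cong suc len) (block-at w bl j))

block-run : ∀ {n k} (φs : Vec (Vec Bool n → Bool) k) is ζ (v : Vec Bool n) b₀ w →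
  (∀ j → At (b₀ ∷ w) (val ζ (V.lookup is j)) (V.lookup v j)) →
  ∃ λ L → Block n (V.map (λ φ → φ v) φs) L × RunRaw (inst ζ (blockR φs is)) (b₀ ∷ w) (L ++ b₀ ∷ w)
block-run []       is ζ v b₀ w h = [] , [] , []
block-run (φ ∷ φs) is ζ v b₀ w h with block-run φs is ζ v b₀ w h
... | L , bl , run with synth-run φ is ζ v b₀ w h L (block-length bl)
...   | E , len , run′ = φ v ∷ E ++ L , cons len bl ,
  run-cast (sym (inst-++ ζ (blockR φs is) _)) (cong (φ v ∷_) (sym (++-assoc E L (b₀ ∷ w)))) (run +++ run′)

-- Circuits for sequences of cells in which each new cell is a constant, an
-- input, or a function of the cells at distance 1, 1 + ω, 2 + ω and 3 + ω.

take-++ : ∀ {A : Set} {m n} (u : Vec A m) (v : Vec A n) → V.take m (u V.++ v) ≡ u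
take-++ []      v = refl
take-++ (x ∷ u) v = cong (x ∷_) (take-++ u v)

drop-++ : ∀ {A : Set} {m n} (u : Vec A m) (v : Vec A n) → V.drop m (u V.++ v) ≡ v
drop-++ []      v = refl
drop-++ (x ∷ u) v = drop-++ u v

module Sequences {A : Set} {k : ℕ} (enc : A → Vec Bool k) (dec : Vec Bool k → A) (dec-enc : ∀ a → dec (enc a) ≡ a)
                 (inputCell : Bool → A) (rule : A → A → A → A → A) where

  -- All three kinds of cells are synthesized over the same inputs, one single wire and four cells.
  -- So each cell occupies the same number `G` of wires and distances between cells are multiples of
  -- `G`. In an input cell the single wire is the input bit.
  N : ℕ
  N = suc (k + (k + (k + k)))

  data Wires (x : List Bool) : List A → List Bool → Set where
    base : Wires x [] x
    grow : ∀ {a h w L} → Wires x h w → Block N (enc a) L → Wires x (a ∷ h) (L ++ w)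

  opaque
    G : ℕ
    G = k * γ N

    bits : (Vec Bool N → A) → Vec (Vec Bool N → Bool) k
    bits f = V.tabulate (λ j v → V.lookup (enc (f v)) j)

    bits-≡ : ∀ f v → V.map (λ φ → φ v) (bits f) ≡ enc (f v)
    bits-≡ f v = trans (sym (VP.tabulate-∘ (λ φ → φ v) (λ j v → V.lookup (enc (f v)) j))) (VP.tabulate∘lookup (enc (f v)))

    cellIx : ℕ → Bool → Vec Ix k
    cellIx d c = V.tabulate (λ j → d * G + toℕ j * γ N , c)

    helixIx : Vec Ix N
    helixIx = fixed 0 ∷ cellIx 0 false V.++ (cellIx 0 true V.++ (cellIx 1 true V.++ cellIx 2 true))

    helixFn : Vec Bool N → A
    helixFn (_ ∷ v) = let v₁ = V.drop k v ; v₂ = V.drop k v₁ in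
      rule (dec (V.take k v)) (dec (V.take k v₁)) (dec (V.take k v₂)) (dec (V.drop k v₂))

    constR : A → List (Raw Ix)
    constR a = blockR (bits (λ _ → a)) (V.replicate N (fixed 0))

    inputR helixR : List (Raw Ix)
    inputR = blockR (bits (λ v → inputCell (V.head v))) ((0 , true) ∷ V.replicate (k + (k + (k + k))) (fixed 0))
    helixR = blockR (bits helixFn) helixIx

    wires-input : ∀ {x h w i b} → Wires x h w → At x i b → At w (length h * G + i) b
    wires-input base at = at
    wires-input {h = a ∷ h} (grow {L = L} ws bl) at = at-cast (sym (+-assoc G (length h * G) _))
      (at-++ L (block-length bl) (wires-input ws at))

    wires-cell : ∀ {x h w d a} → Wires x h w → At h d a → ∀ j → At w (d * G + toℕ j * γ N) (V.lookup (enc a) j)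
    wires-cell (grow {w = w} ws bl) at0 j = block-at w bl j
    wires-cell (grow {L = L} ws bl) (at+ {i = d} at) j = at-cast (sym (+-assoc G (d * G) _)) (at-++ L (block-length bl) (wires-cell ws at j))

    -- Supplies the wire from which `synth` makes its constants; this is why the circuits get at
    -- least one input.
    wires-∷ : ∀ {b x h w} → Wires (b ∷ x) h w → ∃ λ c → ∃ λ w′ → w ≡ c ∷ w′
    wires-∷ base = _ , _ , refl
    wires-∷ (grow {L = []} ws bl)    = wires-∷ ws
    wires-∷ (grow {L = c ∷ L} ws bl) = _ , _ , refl

    extend : ∀ {b x h w} f is ζ v → Wires (b ∷ x) h w → (∀ j → At w (val ζ (V.lookup is j)) (V.lookup v j)) →
             ∃ λ w′ → RunRaw (inst ζ (blockR (bits f) is)) w w′ × Wires (b ∷ x) (f v ∷ h) w′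
    extend f is ζ v ws at with wires-∷ ws
    ... | c , w , refl with block-run (bits f) is ζ v c w at
    ...   | L , bl , run = L ++ c ∷ w , run , grow ws (subst (λ e → Block N e L) (bits-≡ f v) bl)

    const-run : ∀ {b x h w} a ζ → Wires (b ∷ x) h w → ∃ λ w′ → RunRaw (inst ζ (constR a)) w w′ × Wires (b ∷ x) (a ∷ h) w′
    const-run {w = w} a ζ ws with wires-∷ ws
    ... | c , w₀ , refl = extend (λ _ → a) _ ζ (V.replicate N c) ws at
      where
      at : ∀ j → At (c ∷ w₀) (val ζ (V.lookup (V.replicate N (fixed 0)) j)) (V.lookup (V.replicate N c) j)
      at j rewrite VP.lookup-replicate j (fixed 0) | VP.lookup-replicate j c = at0

    input-run : ∀ {b x h w i c} → Wires (b ∷ x) h w → At (b ∷ x) i c →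
                ∃ λ w′ → RunRaw (inst (length h * G + i) inputR) w w′ × Wires (b ∷ x) (inputCell c ∷ h) w′
    input-run {h = h} {i = i} {c} ws at-i with wires-∷ ws
    ... | d , w₀ , refl = extend (λ v → inputCell (V.head v)) _ _ (c ∷ V.replicate (k + (k + (k + k))) d) ws at
      where
      at : ∀ j → At (d ∷ w₀) (val (length h * G + i) (V.lookup ((0 , true) ∷ V.replicate (k + (k + (k + k))) (fixed 0)) j)) (V.lookup (c ∷ V.replicate (k + (k + (k + k))) d) j)
      at F.zero = wires-input ws at-i
      at (F.suc j) rewrite VP.lookup-replicate j (fixed 0) | VP.lookup-replicate j d = at0

    at-++V : ∀ {m n w ζ} (i₁ : Vec Ix m) {i₂ : Vec Ix n} (v₁ : Vec Bool m) {v₂} →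
             (∀ j → At w (val ζ (V.lookup i₁ j)) (V.lookup v₁ j)) → (∀ j → At w (val ζ (V.lookup i₂ j)) (V.lookup v₂ j)) →
             ∀ j → At w (val ζ (V.lookup (i₁ V.++ i₂) j)) (V.lookup (v₁ V.++ v₂) j)
    at-++V []       []       p q j         = q j
    at-++V (i ∷ i₁) (b ∷ v₁) p q F.zero    = p F.zero
    at-++V (i ∷ i₁) (b ∷ v₁) p q (F.suc j) = at-++V i₁ v₁ (λ j → p (F.suc j)) q j

    helix-run : ∀ {b x h w a r m l} ω → Wires (b ∷ x) h w → At h 0 a → At h ω r → At h (1 + ω) m → At h (2 + ω) l →
                ∃ λ w′ → RunRaw (inst (ω * G) helixR) w w′ × Wires (b ∷ x) (rule a r m l ∷ h) w′
    helix-run {b} {x} {h} {w} {a} {r} {m} {l} ω ws pa pr pm pl with wires-∷ ws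
    ... | c , w₀ , refl = subst (λ y → ∃ λ w′ → RunRaw (inst (ω * G) helixR) (c ∷ w₀) w′ × Wires (b ∷ x) (y ∷ h) w′) value
        (extend helixFn helixIx (ω * G) (c ∷ enc a V.++ (enc r V.++ (enc m V.++ enc l))) ws at)
      where
      near : ∀ {a} → At h 0 a → ∀ j → At (c ∷ w₀) (val (ω * G) (V.lookup (cellIx 0 false) j)) (V.lookup (enc a) j)
      near p j = at-cast (cong (val (ω * G)) (sym (VP.lookup∘tabulate (λ j → 0 * G + toℕ j * γ N , false) j))) (wires-cell ws p j)
      distant : ∀ d {a} → At h (d + ω) a → ∀ j → At (c ∷ w₀) (val (ω * G) (V.lookup (cellIx d true) j)) (V.lookup (enc a) j)
      distant d p j = at-cast (trans (arith d ω G (toℕ j * γ N)) (cong (val (ω * G)) (sym (VP.lookup∘tabulate (λ j → d * G + toℕ j * γ N , true) j)))) (wires-cell ws p j)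
        where
        arith : ∀ d ω g j → (d + ω) * g + j ≡ (d * g + j) + ω * g
        arith = solve-∀
      at : ∀ j → At (c ∷ w₀) (val (ω * G) (V.lookup helixIx j)) (V.lookup (c ∷ enc a V.++ (enc r V.++ (enc m V.++ enc l))) j)
      at F.zero    = at0
      at (F.suc j) = at-++V (cellIx 0 false) (enc a) (near pa)
        (at-++V (cellIx 0 true) (enc r) (distant 0 pr) (at-++V (cellIx 1 true) (enc m) (distant 1 pm) (distant 2 pl))) j
      td : ∀ {n} (u : Vec Bool k) (v : Vec Bool n) → V.take k (u V.++ v) ≡ u × V.drop k (u V.++ v) ≡ v
      td u v = take-++ u v , drop-++ u v
      value : helixFn (c ∷ enc a V.++ (enc r V.++ (enc m V.++ enc l))) ≡ rule a r m l
      value rewrite proj₁ (td (enc a) (enc r V.++ (enc m V.++ enc l))) | proj₂ (td (enc a) (enc r V.++ (enc m V.++ enc l)))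
                  | proj₁ (td (enc r) (enc m V.++ enc l)) | proj₂ (td (enc r) (enc m V.++ enc l))
                  | proj₁ (td (enc m) (enc l)) | proj₂ (td (enc m) (enc l))
                  | dec-enc a | dec-enc r | dec-enc m | dec-enc l = refl

  constRs : List A → List (Raw ℕ)
  constRs = concatMap (λ a → inst 0 (constR a))

  const-runs : ∀ {b x w} as {h} → Wires (b ∷ x) h w → ∃ λ w′ → RunRaw (constRs as) w w′ × Wires (b ∷ x) (as ʳ++ h) w′
  const-runs []       ws = _ , [] , ws
  const-runs (a ∷ as) ws with const-run a 0 ws
  ... | w₁ , run₁ , ws₁ with const-runs as ws₁
  ...   | w₂ , run₂ , ws₂ = w₂ , run₁ +++ run₂ , ws₂

  -- κ is the number of cells before the first input.
  inputRs : ℕ → ℕ → List (Raw ℕ)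
  inputRs κ zero    = []
  inputRs κ (suc i) = inputRs κ i ++ inst ((i + κ) * G + i) inputR

  input-runs : ∀ {b x h w} n → Wires (b ∷ x) h w → n ≤ length (b ∷ x) →
               ∃ λ w′ → RunRaw (inputRs (length h) n) w w′ × Wires (b ∷ x) (map inputCell (List.take n (b ∷ x)) ʳ++ h) w′
  input-runs zero    ws le = _ , [] , ws
  input-runs {b} {x} {h} (suc n) ws le with input-runs n ws (≤-trans (n≤1+n n) le)
  ... | w₁ , run₁ , ws₁ with input-run {i = n} ws₁ (at-take (b ∷ x) n le)
    where
    at-take : ∀ (y : List Bool) n → (p : n < length y) → At y n (List.lookup y (F.fromℕ< p))
    at-take (c ∷ y) zero    (s≤s p) = at0
    at-take (c ∷ y) (suc n) (s≤s p) = at+ (at-take y n p)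
  ...   | w₂ , run₂ , ws₂ = w₂ , run₁ +++ run-cast (cong (λ q → inst (q * G + n) inputR) len) refl run₂ ,
            subst (λ q → Wires (b ∷ x) q w₂) (sym (eq n (b ∷ x) h le)) ws₂
    where
    len : length (map inputCell (List.take n (b ∷ x)) ʳ++ h) ≡ n + length h
    len = trans (length-ʳ++ (map inputCell (List.take n (b ∷ x)))) (cong (_+ length h)
      (trans (length-map inputCell (List.take n (b ∷ x))) (trans (length-take n (b ∷ x)) (m≤n⇒m⊓n≡m (≤-trans (n≤1+n n) le)))))
    eq : ∀ n (y : List Bool) h → (p : n < length y) → map inputCell (List.take (suc n) y) ʳ++ h
         ≡ inputCell (List.lookup y (F.fromℕ< p)) ∷ (map inputCell (List.take n y) ʳ++ h)
    eq zero    (c ∷ y) h (s≤s p) = refl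
    eq (suc n) (c ∷ y) h (s≤s p) = eq n y (inputCell c ∷ h) p

  helixRs : ℕ → ℕ → List (Raw ℕ)
  helixRs ω zero    = []
  helixRs ω (suc n) = inst (ω * G) helixR ++ helixRs ω n

  history : (ℕ → A) → ℕ → List A
  history f zero    = []
  history f (suc n) = f n ∷ history f n

  history-at : ∀ f {n} d i → n ≡ suc (d + i) → At (history f n) d (f i)
  history-at f zero    i refl = at0
  history-at f (suc d) i refl = at+ (history-at f d i refl)

  -- The operands of the recurrence lie at constant distances, so every round uses the same gates.
  -- `i` counts the rounds already done and `n` those to come.
  helix-runs : ∀ {b x w} f ω n i → Wires (b ∷ x) (history f (3 + ω + i)) w →
    (∀ j → j < i + n → f (3 + ω + j) ≡ rule (f (2 + ω + j)) (f (2 + j)) (f (1 + j)) (f j)) →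
    ∃ λ w′ → RunRaw (helixRs ω n) w w′ × Wires (b ∷ x) (history f (3 + ω + (i + n))) w′
  helix-runs f ω zero    i ws h = _ , [] , subst (λ q → Wires _ (history f (3 + ω + q)) _) (sym (+-identityʳ i)) ws
  helix-runs {b} {x} f ω (suc n) i ws h
    with helix-run ω ws (history-at f 0 (2 + ω + i) refl) (history-at f ω (2 + i) (arith₂ ω i)) (history-at f (1 + ω) (1 + i) (arith₁ ω i)) (history-at f (2 + ω) i refl)
    where
    arith₂ : ∀ ω i → 3 + ω + i ≡ suc (ω + (2 + i))
    arith₂ = solve-∀
    arith₁ : ∀ ω i → 3 + ω + i ≡ suc (1 + ω + (1 + i))
    arith₁ = solve-∀
  ... | w₁ , run₁ , ws₁ with helix-runs f ω n (suc i) (subst (λ q → Wires (b ∷ x) q w₁) (sym eq) ws₁) (λ j lt → h j (≤-trans lt (≤-reflexive (sym (+-suc i n)))))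
    where
    eq : history f (3 + ω + suc i) ≡ rule (f (2 + ω + i)) (f (2 + i)) (f (1 + i)) (f i) ∷ history f (3 + ω + i)
    eq = trans (cong (history f) (+-suc (3 + ω) i)) (cong (_∷ history f (3 + ω + i)) (h i (≤-trans (s≤s (m≤m+n i n)) (≤-reflexive (sym (+-suc i n))))))
  ...   | w₂ , run₂ , ws₂ = w₂ , run₁ +++ run₂ , subst (λ q → Wires (b ∷ x) (history f (3 + ω + q)) w₂) (sym (+-suc i n)) ws₂

-- The cells of a Turing machine's space-time diagram

-- Blank beyond the end, so that tapes are compared as infinite ones, whatever part of them has been
-- visited.
nthS : List Sym → ℕ → Sym
nthS []      p       = nothing
nthS (x ∷ l) zero    = x
nthS (x ∷ l) (suc p) = nthS l p

contents : Tape → List Sym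
contents (tape l h r) = l ʳ++ (h ∷ r)

symAt : Tape → ℕ → Sym
symAt t p = nthS (contents t) p

pos : Tape → ℕ
pos t = length (left t)

nthS-ʳ++ : ∀ l x i → nthS (l ʳ++ x) (length l + i) ≡ nthS x i
nthS-ʳ++ []      x i = refl
nthS-ʳ++ (a ∷ l) x i = trans (cong (nthS (l ʳ++ (a ∷ x))) (sym (+-suc (length l) i))) (nthS-ʳ++ l (a ∷ x) (suc i))

symAt-pos : ∀ t → symAt t (pos t) ≡ head t
symAt-pos (tape l h r) = trans (cong (nthS (l ʳ++ (h ∷ r))) (sym (+-identityʳ (length l)))) (nthS-ʳ++ l (h ∷ r) 0)

nthS-except : ∀ l {x y : List Sym} n → (∀ p → p ≢ n → nthS x p ≡ nthS y p) →
              ∀ p → p ≢ length l + n → nthS (l ʳ++ x) p ≡ nthS (l ʳ++ y) p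
nthS-except []      n h = h
nthS-except (a ∷ l) n h p ne = nthS-except l (suc n) (λ { zero _ → refl ; (suc p) ne → h p (λ e → ne (cong suc e)) }) p
  (λ e → ne (trans e (+-suc (length l) n)))

nthS-cong : ∀ l {x y : List Sym} → (∀ p → nthS x p ≡ nthS y p) → ∀ p → nthS (l ʳ++ x) p ≡ nthS (l ʳ++ y) p
nthS-cong []      h = h
nthS-cong (a ∷ l) h = nthS-cong l (λ { zero → refl ; (suc p) → h p })

symAt-move : ∀ m t p → symAt (moveTape m t) p ≡ symAt t p
symAt-move mvL (tape [] h r)      p = refl
symAt-move mvL (tape (s ∷ l) h r) p = refl
symAt-move mvR (tape l h [])      p = nthS-cong l (λ { zero → refl ; (suc zero) → refl ; (suc (suc p)) → refl }) p
symAt-move mvR (tape l h (s ∷ r)) p = refl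
symAt-move mvS t                  p = refl

symAt-write : ∀ s m t p → p ≢ pos t → symAt (writeMove s m t) p ≡ symAt t p
symAt-write s m (tape l h r) p ne = trans (symAt-move m (tape l s r) p)
  (nthS-except l 0 (λ { zero ne → ⊥-elim (ne refl) ; (suc p) _ → refl }) p (λ e → ne (trans e (+-identityʳ (length l)))))

symAt-written : ∀ s m t → symAt (writeMove s m t) (pos t) ≡ s
symAt-written s m (tape l h r) = trans (symAt-move m (tape l s r) (length l)) (symAt-pos (tape l s r))

movePos : Move → ℕ → ℕ
movePos mvL n = pred n
movePos mvR n = suc n
movePos mvS n = n

pos-move : ∀ s m t → pos (writeMove s m t) ≡ movePos m (pos t)
pos-move s mvL (tape [] h r)      = refl
pos-move s mvL (tape (x ∷ l) h r) = refl
pos-move s mvR (tape l h [])      = refl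
pos-move s mvR (tape l h (x ∷ r)) = refl
pos-move s mvS t                  = refl

_<∣>_ : {A : Set} → Maybe A → Maybe A → Maybe A
just a  <∣> _ = just a
nothing <∣> y = y

record Core (q : ℕ) : Set where
  constructor core
  field
    first : Bool
    symb  : Sym
    here? : Maybe (Fin q)
open Core public

module Diagram (M : TM) where
  open TM M

  -- Halting as a transition: the halted machine rewrites its symbol and stays, so the rule for
  -- cells needs no exception.
  δh : Fin nQ → Sym → Fin nQ × Sym × Move
  δh q s with q F.≟ halt
  ... | yes _ = q , s , mvS
  ... | no  _ = δ q s

  step-δh : ∀ q t → step M (conf q t) ≡ conf (proj₁ (δh q (head t))) (writeMove (proj₁ (proj₂ (δh q (head t)))) (proj₂ (proj₂ (δh q (head t)))) t)
  step-δh q t with q F.≟ halt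
  ... | yes _ = refl
  ... | no  _ = refl

  action : Core nQ → Maybe (Fin nQ × Sym × Move)
  action (core _ s nothing)  = nothing
  action (core _ s (just q)) = just (δh q s)

  newSym : Core nQ → Sym
  newSym c = maybe (proj₁ ∘ proj₂) (symb c) (action c)

  -- The Boolean is the flag of cell 0. There a left move stays put, and it must not be passed on to
  -- the cell before, which on the helix is the end of the preceding row.
  midF rightF : Maybe (Fin nQ × Sym × Move) → Bool → Maybe (Fin nQ)
  midF (just (q , _ , mvS)) _    = just q
  midF (just (q , _ , mvL)) true = just q
  midF _                    _    = nothing
  rightF (just (q , _ , mvL)) false = just q
  rightF _                    _     = nothing

  leftF : Maybe (Fin nQ × Sym × Move) → Maybe (Fin nQ)
  leftF (just (q , _ , mvR)) = just q
  leftF _                    = nothing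

  fromMid fromRight fromLeft : Core nQ → Maybe (Fin nQ)
  fromMid c   = midF (action c) (first c)
  fromRight c = rightF (action c) (first c)
  fromLeft c  = leftF (action c)

  isZero : ℕ → Bool
  isZero zero    = true
  isZero (suc _) = false

  headAt : ℕ → ℕ → Fin nQ → Maybe (Fin nQ)
  headAt n p q with p ≟ n
  ... | yes _ = just q
  ... | no  _ = nothing

  headAt-yes : ∀ n q → headAt n n q ≡ just q
  headAt-yes n q with n ≟ n
  ... | yes _ = refl
  ... | no ne = ⊥-elim (ne refl)

  headAt-no : ∀ {n p} q → p ≢ n → headAt n p q ≡ nothing
  headAt-no {n} {p} q ne with p ≟ n
  ... | yes e = ⊥-elim (ne e)
  ... | no _  = refl

  row : Conf M → ℕ → Core nQ
  row (conf q t) p = core (isZero p) (symAt t p) (headAt (pos t) p q)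

  fromPrev : Conf M → ℕ → Maybe (Fin nQ)
  fromPrev c zero    = nothing
  fromPrev c (suc p) = fromLeft (row c p)

  row-head : ∀ q t → row (conf q t) (pos t) ≡ core (isZero (pos t)) (head t) (just q)
  row-head q t = cong₂ (core (isZero (pos t))) (symAt-pos t) (headAt-yes (pos t) q)

  row-off : ∀ {q t p} → p ≢ pos t → row (conf q t) p ≡ core (isZero p) (symAt t p) nothing
  row-off {q} {t} {p} ne = cong (core (isZero p) (symAt t p)) (headAt-no q ne)

  -- The three sources belong to three different cells and only one cell holds the head, so at most
  -- one of them differs from `nothing` and `<∣>` never has to choose.
  row-step : ∀ c p → row (step M c) p ≡
    core (first (row c p)) (newSym (row c p)) (fromMid (row c p) <∣> (fromRight (row c (suc p)) <∣> fromPrev c p))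
  row-step c@(conf q t) p = trans (cong (λ c → row c p) (step-δh q t)) (cong₂ (core (isZero p)) syms (heads _ refl))
    where
    q′ = proj₁ (δh q (head t))
    s′ = proj₁ (proj₂ (δh q (head t)))
    m′ = proj₂ (proj₂ (δh q (head t)))
    syms : symAt (writeMove s′ m′ t) p ≡ newSym (row c p)
    syms = go (p ≟ pos t)
      where
      go : Dec (p ≡ pos t) → symAt (writeMove s′ m′ t) p ≡ newSym (row c p)
      go (yes refl) = trans (symAt-written s′ m′ t) (cong newSym (sym (row-head q t)))
      go (no ne)    = trans (symAt-write s′ m′ t p ne) (cong newSym (sym (row-off {q} {t} ne)))
    n = pos t
    on : ∀ {m p′} → m′ ≡ m → p′ ≡ n → action (row c p′) ≡ just (q′ , s′ , m)
    on refl refl = cong action (row-head q t)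
    off : ∀ {p′} → p′ ≢ n → action (row c p′) ≡ nothing
    off ne = cong action (row-off {q} {t} ne)
    target : ∀ {m} → m′ ≡ m → headAt (pos (writeMove s′ m′ t)) p q′ ≡ headAt (movePos m n) p q′
    target refl = cong (λ k → headAt k p q′) (pos-move s′ m′ t)
    prev-off : ∀ p → p ≢ suc n → fromPrev c p ≡ nothing
    prev-off zero    ne = refl
    prev-off (suc p) ne = cong leftF (off (λ e → ne (cong suc e)))
    prev-no : ∀ {m} p → m′ ≡ m → m ≢ mvR → fromPrev c p ≡ nothing
    prev-no zero    eq ne = refl
    prev-no {m} (suc p) eq ne = go (p ≟ n) m eq ne
      where
      go : Dec (p ≡ n) → ∀ m → m′ ≡ m → m ≢ mvR → fromLeft (row c p) ≡ nothing
      go (no ne′) m   eq ne = cong leftF (off ne′)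
      go (yes e)  mvL eq ne = cong leftF (on eq e)
      go (yes e)  mvR eq ne = ⊥-elim (ne refl)
      go (yes e)  mvS eq ne = cong leftF (on eq e)
    right-no : ∀ {m} → m′ ≡ m → m ≢ mvL → fromRight (row c (suc p)) ≡ nothing
    right-no {m} eq ne = go (suc p ≟ n) m eq ne
      where
      go : Dec (suc p ≡ n) → ∀ m → m′ ≡ m → m ≢ mvL → fromRight (row c (suc p)) ≡ nothing
      go (no ne′) m   eq ne = cong (λ o → rightF o false) (off ne′)
      go (yes e)  mvL eq ne = ⊥-elim (ne refl)
      go (yes e)  mvR eq ne = cong (λ o → rightF o false) (on eq e)
      go (yes e)  mvS eq ne = cong (λ o → rightF o false) (on eq e)
    mid-off : p ≢ n → fromMid (row c p) ≡ nothing
    mid-off ne = cong (λ o → midF o (isZero p)) (off ne)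
    mid-R : m′ ≡ mvR → fromMid (row c p) ≡ nothing
    mid-R eq = go (p ≟ n)
      where
      go : Dec (p ≡ n) → fromMid (row c p) ≡ nothing
      go (yes e) = cong (λ o → midF o (isZero p)) (on eq e)
      go (no ne) = mid-off ne
    mid-L : m′ ≡ mvL → ∀ {k} → n ≡ suc k → fromMid (row c p) ≡ nothing
    mid-L eq e′ = go (p ≟ n)
      where
      go : Dec (p ≡ n) → fromMid (row c p) ≡ nothing
      go (yes e) = trans (cong (λ o → midF o (isZero p)) (on eq e)) (cong (λ j → midF (just (q′ , s′ , mvL)) (isZero j)) (trans e e′))
      go (no ne) = mid-off ne
    Goal : Maybe (Fin nQ) → Set
    Goal a = a ≡ fromMid (row c p) <∣> (fromRight (row c (suc p)) <∣> fromPrev c p)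
    mid-just : ∀ {a} → fromMid (row c p) ≡ just a → Goal (just a)
    mid-just e = sym (cong (λ a → a <∣> (fromRight (row c (suc p)) <∣> fromPrev c p)) e)
    combine : ∀ {a b} → fromMid (row c p) ≡ nothing → fromRight (row c (suc p)) ≡ a → fromPrev c p ≡ b → Goal (a <∣> b)
    combine e₁ e₂ e₃ = sym (trans (cong (λ a → a <∣> (fromRight (row c (suc p)) <∣> fromPrev c p)) e₁) (cong₂ _<∣>_ e₂ e₃))
    byDec : ∀ k → (p ≡ k → Goal (just q′)) → (p ≢ k → Goal nothing) → Goal (headAt k p q′)
    byDec k f g = go (p ≟ k)
      where
      go : Dec (p ≡ k) → Goal (headAt k p q′)
      go (yes e) = subst Goal (sym (trans (cong (λ j → headAt k j q′) e) (headAt-yes k q′))) (f e)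
      go (no ne) = subst Goal (sym (headAt-no q′ ne)) (g ne)
    prev-on : ∀ p → p ≡ suc n → m′ ≡ mvR → fromPrev c p ≡ just q′
    prev-on (suc p) e eq = cong leftF (on eq (suc-injective e))
    heads : ∀ m → m′ ≡ m → Goal (headAt (pos (writeMove s′ m′ t)) p q′)
    heads mvS eq = subst Goal (sym (target eq)) (byDec n
      (λ e → mid-just (cong (λ o → midF o (isZero p)) (on eq e)))
      (λ ne → combine (mid-off ne) (right-no eq (λ ())) (prev-no p eq (λ ()))))
    heads mvL eq = subst Goal (sym (target eq)) (go n refl)
      where
      go : ∀ k → n ≡ k → Goal (headAt (pred k) p q′)
      go zero e = byDec 0
        (λ e′ → mid-just (trans (cong (λ o → midF o (isZero p)) (on eq (trans e′ (sym e)))) (cong (λ j → midF (just (q′ , s′ , mvL)) (isZero j)) e′)))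
        (λ ne → combine (mid-off (λ e′ → ne (trans e′ e))) (cong (λ o → rightF o false) (off (λ e′ → case trans e′ e of λ ()))) (prev-no p eq (λ ())))
      go (suc k) e = byDec k
        (λ e′ → combine (mid-L eq e) (cong (λ o → rightF o false) (on eq (trans (cong suc e′) (sym e)))) refl)
        (λ ne → combine (mid-L eq e) (cong (λ o → rightF o false) (off (λ e′ → ne (suc-injective (trans e′ e))))) (prev-no p eq (λ ())))
    heads mvR eq = subst Goal (sym (target eq)) (byDec (suc n)
      (λ e → combine (mid-R eq) (right-no eq (λ ())) (prev-on p e eq))
      (λ ne → combine (mid-R eq) (right-no eq (λ ())) (prev-off p ne)))

-- One-hot code of the state; the zero vector means that the head is elsewhere.
hot : ∀ {n} → Maybe (Fin n) → Vec Bool n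
hot {n} nothing          = V.replicate n false
hot (just F.zero)        = true ∷ hot nothing
hot (just (F.suc i))     = false ∷ hot (just i)

unhot : ∀ {n} → Vec Bool n → Maybe (Fin n)
unhot []          = nothing
unhot (true ∷ v)  = just F.zero
unhot (false ∷ v) = Data.Maybe.map F.suc (unhot v)

unhot-hot : ∀ {n} (x : Maybe (Fin n)) → unhot (hot x) ≡ x
unhot-hot {zero}  nothing          = refl
unhot-hot {suc n} nothing          rewrite unhot-hot {n} nothing = refl
unhot-hot         (just F.zero)    = refl
unhot-hot         (just (F.suc i)) rewrite unhot-hot (just i) = refl

isTrue : Str → Bool
isTrue (true ∷ _) = true
isTrue _          = false

module CookLevin (M : TM) where
  open TM M
  open Diagram M

  Cell : Set
  Cell = Bool × Core nQ

  enc : Cell → Vec Bool (4 + nQ)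
  enc (a , core f nothing  h) = a ∷ f ∷ false ∷ false ∷ hot h
  enc (a , core f (just b) h) = a ∷ f ∷ true ∷ b ∷ hot h

  dec : Vec Bool (4 + nQ) → Cell
  dec (a ∷ f ∷ c ∷ b ∷ h) = a , core f (if c then just b else nothing) (unhot h)

  dec-enc : ∀ c → dec (enc c) ≡ c
  dec-enc (a , core f nothing  h) rewrite unhot-hot h = refl
  dec-enc (a , core f (just b) h) rewrite unhot-hot h = refl

  -- The first component of a cell records whether the machine has been seen
  -- halting on a 1, anywhere and at any time so far.
  accepting : Core nQ → Bool
  accepting (core _ (just true) (just q)) with q F.≟ halt
  ... | yes _ = true
  ... | no  _ = false
  accepting _ = false

  -- Arguments by increasing distance: the predecessor on the helix, which contributes only the
  -- flag, then the upper right, upper and upper left neighbours. The cell above is `2 + ω` back,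
  -- one full row.
  rule : Cell → Cell → Cell → Cell → Cell
  rule (a , _) (_ , r) (_ , m) (_ , l) = a ∨ accepting m ,
    core (first m) (newSym m) (fromMid m <∣> (fromRight r <∣> fromLeft l))

  plain : Sym → Cell
  plain s = false , core false s nothing

  firstCell : Cell
  firstCell = false , core true (just true) (just start)

  open Sequences enc dec dec-enc (plain ∘ just) rule public

  module _ (x : Str) (T : ℕ) where

    -- A row holds the leading 1, the string `x` and more cells than the head can cross in `T`
    -- steps. `R` counts the cells of `T + 1` further rows, one more than the run has: a cell takes
    -- notice of acceptance in the cell above it, so row `T` is inspected only from the row after
    -- it.
    ω W R : ℕ
    ω = suc (length x) + T
    W = 2 + ω
    R = suc T * W

    at-time : ℕ → Conf M
    at-time t = run M t (conf start (inputTape (true ∷ x)))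

    at-time-suc : ∀ t → at-time (suc t) ≡ step M (at-time t)
    at-time-suc t = trans (cong (λ k → run M k (conf start (inputTape (true ∷ x)))) (+-comm 1 t)) (run-+ M t 1 (conf start (inputTape (true ∷ x))))

    pos-time : ∀ t → pos (Conf.tp (at-time t)) ≤ t
    pos-time zero    = z≤n
    pos-time (suc t) = subst (λ c → pos (Conf.tp c) ≤ suc t) (sym (at-time-suc t)) (go (at-time t) (pos-time t))
      where
      move≤ : ∀ m {n} → n ≤ t → movePos m n ≤ suc t
      move≤ mvL le = ≤-trans (pred[n]≤n {_}) (≤-trans le (n≤1+n t))
      move≤ mvR le = s≤s le
      move≤ mvS le = ≤-trans le (n≤1+n t)
      go : ∀ c → pos (Conf.tp c) ≤ t → pos (Conf.tp (step M c)) ≤ suc t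
      go (conf q tp) le rewrite step-δh q tp | pos-move (proj₁ (proj₂ (δh q (head tp)))) (proj₂ (proj₂ (δh q (head tp)))) tp =
        move≤ (proj₂ (proj₂ (δh q (head tp)))) le

    -- Index 0 is a dummy that serves as left neighbour of the very first cell; position `p` of row
    -- `t` has index `1 + p + t * W`.
    cellAt : ℕ → Core nQ
    cellAt zero    = core false nothing nothing
    cellAt (suc n) = row (at-time (n / W)) (n % W)

    cellAt-row : ∀ t {p} → p < W → cellAt (suc (p + t * W)) ≡ row (at-time t) p
    cellAt-row t {p} lt = cong₂ (λ a b → row (at-time a) b) quot rem
      where
      rem : (p + t * W) % W ≡ p
      rem = trans ([m+kn]%n≡m%n p t W) (m<n⇒m%n≡m lt)
      quot : (p + t * W) / W ≡ t
      quot = trans (+-distrib-/-∣ʳ p (divides t refl)) (cong₂ _+_ (m<n⇒m/n≡0 lt) (m*n/n≡m t W))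

    seen : ℕ → Bool
    seen zero    = false
    seen (suc i) = seen i ∨ accepting (cellAt (suc i))

    -- The flag lags one row behind the core. Truncated subtraction makes it false throughout row 0,
    -- as for the constant and input cells.
    cells : ℕ → Cell
    cells n = seen (n ∸ W) , cellAt n

    idle-right : ∀ t {p} → t < p → here? (row (at-time t) p) ≡ nothing
    idle-right t {p} lt = headAt-no (Conf.state (at-time t)) (λ e → <-irrefl refl (≤-trans lt (≤-trans (≤-reflexive e) (pos-time t))))

    T<W : T < W
    T<W = s≤s (≤-trans (m≤n+m T (suc (length x))) (n≤1+n _))

    idle⇒right : ∀ c → here? c ≡ nothing → fromRight c ≡ nothing
    idle⇒right (core f s nothing) refl = refl

    idle⇒left : ∀ c → here? c ≡ nothing → fromLeft c ≡ nothing
    idle⇒left (core f s nothing) refl = refl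

    first⇒right : ∀ c → first c ≡ true → fromRight c ≡ nothing
    first⇒right (core true s h) refl with action (core true s h)
    ... | nothing            = refl
    ... | just (_ , _ , mvL) = refl
    ... | just (_ , _ , mvR) = refl
    ... | just (_ , _ , mvS) = refl

    -- At the seam the next cell on the helix is cell 0 of the following row. Its flag keeps it from
    -- sending a head to the left, and the true right neighbour is idle as well, being too far out
    -- for time `t`.
    right-ok : ∀ t p → t ≤ T → p < W → fromRight (cellAt (suc (suc (p + t * W)))) ≡ fromRight (row (at-time t) (suc p))
    right-ok t p t≤ p< = go (m≤n⇒m<n∨m≡n p<)
      where
      go : (suc p < W) ⊎ (suc p ≡ W) → fromRight (cellAt (suc (suc (p + t * W)))) ≡ fromRight (row (at-time t) (suc p))
      go (inj₁ lt) = cong fromRight (cellAt-row t lt)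
      go (inj₂ e)  = trans (cong (λ n → fromRight (cellAt (suc (n + t * W)))) e)
        (trans (cong fromRight (cellAt-row (suc t) {0} (s≤s z≤n)))
        (trans (first⇒right (row (at-time (suc t)) 0) refl)
        (sym (idle⇒right _ (idle-right t (≤-trans (s≤s t≤) (≤-trans T<W (≤-reflexive (sym e)))))))))

    -- Before cell 0 the helix has the last cell of the preceding row, which the head cannot have
    -- reached, or the dummy; nothing arrives from there, as on the real tape.
    left-ok : ∀ t p → t ≤ T → p < W → fromLeft (cellAt (p + t * W)) ≡ fromPrev (at-time t) p
    left-ok zero    zero    t≤ p< = refl
    left-ok (suc t) zero    t≤ p< = trans (cong fromLeft (cellAt-row t {suc ω} ≤-refl))
      (idle⇒left _ (idle-right t (≤-trans t≤ (≤-trans (m≤n+m T (suc (length x))) (n≤1+n _)))))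
    left-ok t       (suc p) t≤ p< = cong fromLeft (cellAt-row t (≤-trans (n≤1+n _) p<))

    cells-helix : ∀ j → j < R → cells (3 + ω + j) ≡ rule (cells (2 + ω + j)) (cells (2 + j)) (cells (1 + j)) (cells j)
    cells-helix j lt = cong₂ _,_ accs cores
      where
      t p : ℕ
      t = j / W
      p = j % W
      t≤ : t ≤ T
      t≤ = ≤-pred (m<n*o⇒m/o<n {j} {suc T} {W} lt)
      p< : p < W
      p< = m%n<n j W
      j≡ : j ≡ p + t * W
      j≡ = m≡m%n+[m/n]*n j W
      over : ∀ i → W + i ∸ W ≡ i
      over i = m+n∸m≡n W i
      accs : seen (3 + ω + j ∸ W) ≡ seen (2 + ω + j ∸ W) ∨ accepting (cellAt (suc j))
      accs = trans (cong seen (trans (cong (_∸ W) (sym (+-suc W j))) (over (suc j)))) (cong (λ i → seen i ∨ accepting (cellAt (suc j))) (sym (over j)))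
      next : cellAt (3 + ω + j) ≡ row (step M (at-time t)) p
      next = trans (cong (λ i → cellAt (3 + ω + i)) j≡) (trans (cong (cellAt ∘ suc) (arith W p (t * W)))
               (trans (cellAt-row (suc t) p<) (cong (λ c → row c p) (at-time-suc t))))
        where
        arith : ∀ w p q → w + (p + q) ≡ p + (w + q)
        arith = solve-∀
      mid : cellAt (suc j) ≡ row (at-time t) p
      mid = trans (cong (cellAt ∘ suc) j≡) (cellAt-row t p<)
      cores : cellAt (3 + ω + j) ≡ core (first (cellAt (suc j))) (newSym (cellAt (suc j)))
                (fromMid (cellAt (suc j)) <∣> (fromRight (cellAt (2 + j)) <∣> fromLeft (cellAt j)))
      cores rewrite mid = trans next (trans (row-step (at-time t) p)
        (cong (core (first (row (at-time t) p)) (newSym (row (at-time t) p)))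
          (cong (fromMid (row (at-time t) p) <∣>_) (sym (cong₂ _<∣>_
            (trans (cong (λ i → fromRight (cellAt (2 + i))) j≡) (right-ok t p t≤ p<))
            (trans (cong (λ i → fromLeft (cellAt i)) j≡) (left-ok t p t≤ p<)))))))

    initial : List Cell
    initial = (plain nothing ∷ firstCell ∷ map (plain ∘ just) x) ++ replicate (2 + T) (plain nothing)

    at-blank : ∀ n {i a} → At (replicate n (plain nothing)) i a → a ≡ plain nothing
    at-blank (suc n) at0     = refl
    at-blank (suc n) (at+ p) = at-blank n p

    at-plain : ∀ y n {i a} → At (map (plain ∘ just) y ++ replicate n (plain nothing)) i a → a ≡ plain (nthS (map just y) i)
    at-plain []      n p       = at-blank n p
    at-plain (b ∷ y) n at0     = refl
    at-plain (b ∷ y) n (at+ p) = at-plain y n p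

    length-initial : length initial ≡ 3 + ω
    length-initial = cong (λ n → 2 + n) (trans (length-++ (map (plain ∘ just) x))
      (trans (cong₂ _+_ (length-map (plain ∘ just) x) (length-replicate (2 + T))) (arith (length x) T)))
      where
      arith : ∀ a t → a + (2 + t) ≡ 1 + (1 + a + t)
      arith = solve-∀

    seen-early : ∀ i → i ≤ W → seen (i ∸ W) ≡ false
    seen-early i le = cong seen (m≤n⇒m∸n≡0 le)

    initial-at : ∀ i a → At initial i a → i < 3 + ω → a ≡ cells i
    initial-at zero          a at0               lt = cong (_, core false nothing nothing) (sym (seen-early 0 z≤n))
    initial-at (suc zero)    a (at+ at0)         lt = cong₂ _,_ (sym (seen-early 1 (s≤s z≤n))) (sym (cellAt-row 0 {0} (s≤s z≤n)))
    initial-at (suc (suc i)) a (at+ (at+ p)) (s≤s lt) = trans (at-plain x (2 + T) p)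
      (cong₂ _,_ (sym (seen-early (2 + i) lt))
        (sym (trans (cong (cellAt ∘ suc) (sym (+-identityʳ (suc i)))) (trans (cellAt-row 0 {suc i} lt) (row-off {start} {inputTape (true ∷ x)} {suc i} (λ ()))))))

    history-initial : initial ʳ++ [] ≡ history cells (3 + ω)
    history-initial = trans (go initial 0 (λ i a p lt → initial-at i a p lt) (≤-reflexive length-initial)) (cong (history cells) length-initial)
      where
      go : ∀ l n → (∀ i a → At l i a → n + i < 3 + ω → a ≡ cells (n + i)) → n + length l ≤ 3 + ω → l ʳ++ history cells n ≡ history cells (n + length l)
      go []      n h le = cong (history cells) (sym (+-identityʳ n))
      go (a ∷ l) n h le = trans (cong (λ c → l ʳ++ (c ∷ history cells n)) (trans (h 0 a at0 (≤-trans (s≤s (+-monoʳ-≤ n z≤n)) le′)) (cong cells (+-identityʳ n))))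
        (trans (go l (suc n) (λ i b p lt → trans (h (suc i) b (at+ p) (≤-trans (s≤s (≤-reflexive (+-suc n i))) lt)) (cong cells (+-suc n i))) le′)
               (cong (history cells) (sym (+-suc n (length l)))))
        where
        le′ : suc n + length l ≤ 3 + ω
        le′ = ≤-trans (≤-reflexive (sym (+-suc n (length l)))) le

-- The tableau as a circuit

≡-Bool : ∀ {a b} → (a ≡ true → b ≡ true) → (b ≡ true → a ≡ true) → a ≡ b
≡-Bool {false} {false} f g = refl
≡-Bool {false} {true}  f g = g refl
≡-Bool {true}          f g = sym (f refl)

wires-≥ : ∀ rs m → m ≤ wires rs m
wires-≥ []       m = ≤-refl
wires-≥ (_ ∷ rs) m = ≤-trans (n≤1+n m) (wires-≥ rs (suc m))

toList-subst : ∀ {m n} (e : m ≡ n) (v : Vec Bool m) → toList (subst (Vec Bool) e v) ≡ toList v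
toList-subst refl v = refl

module CookLevinCircuit (M : TM) where
  open TM M
  open Diagram M
  open CookLevin M

  accepting-row : ∀ c p → accepting (row c p) ≡ true → Conf.state c ≡ halt × head (Conf.tp c) ≡ just true
  accepting-row c@(conf q t) p acc = go (p ≟ pos t)
    where
    idle : ∀ f s → accepting (core f s nothing) ≡ false
    idle f nothing      = refl
    idle f (just false) = refl
    idle f (just true)  = refl
    at-head : ∀ f s → accepting (core f s (just q)) ≡ true → q ≡ halt × s ≡ just true
    at-head f nothing ()
    at-head f (just false) ()
    at-head f (just true) acc with q F.≟ halt | acc
    ... | yes e | _ = e , refl
    ... | no _  | ()
    go : Dec (p ≡ pos t) → q ≡ halt × head t ≡ just true
    go (yes refl) = at-head _ _ (trans (cong accepting (sym (row-head q t))) acc)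
    go (no ne)    = case trans (sym (idle (isZero p) (symAt t p))) (trans (cong accepting (sym (row-off {q} {t} ne))) acc) of λ ()

  accepting-head : ∀ c → Conf.state c ≡ halt → head (Conf.tp c) ≡ just true → accepting (row c (pos (Conf.tp c))) ≡ true
  accepting-head (conf q t) refl e = trans (cong accepting (trans (row-head q t) (cong (λ s → core (isZero (pos t)) s (just q)) e))) (at-halt (isZero (pos t)))
    where
    at-halt : ∀ f → accepting (core f (just true) (just halt)) ≡ true
    at-halt f with halt F.≟ halt
    ... | yes _ = refl
    ... | no ne = ⊥-elim (ne refl)

  isTrue-output : ∀ t → isTrue (output t) ≡ true → head t ≡ just true
  isTrue-output (tape l (just true) r) e = refl
  isTrue-output (tape l nothing r) ()
  isTrue-output (tape l (just false) r) ()

  output-isTrue : ∀ t → head t ≡ just true → isTrue (output t) ≡ true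
  output-isTrue (tape l _ r) refl = refl

  module _ (x : Str) (T : ℕ) where

    seen-find : ∀ i → seen x T i ≡ true → ∃ λ j → j < i × accepting (cellAt x T (suc j)) ≡ true
    seen-find (suc i) e with seen x T i in eq
    ... | true  = let (j , lt , a) = seen-find i eq in j , ≤-trans lt (n≤1+n i) , a
    ... | false = i , ≤-refl , e

    seen-mono : ∀ i j → j < i → accepting (cellAt x T (suc j)) ≡ true → seen x T i ≡ true
    seen-mono (suc i) j (s≤s le) a with m≤n⇒m<n∨m≡n le
    ... | inj₁ lt   rewrite seen-mono i j lt a = refl
    ... | inj₂ refl rewrite a = ∨-true (seen x T i)
      where
      ∨-true : ∀ b → b ∨ true ≡ true
      ∨-true false = refl
      ∨-true true  = refl

    -- The position of the head at the end is not known in advance, so acceptance is collected over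
    -- the whole diagram. This reports the final verdict because a halted configuration does not
    -- change: an accepting one seen at any time is the final one.
    seen-accepts : Conf.state (at-time x T T) ≡ halt → seen x T (R x T) ≡ isTrue (output (Conf.tp (at-time x T T)))
    seen-accepts halted = ≡-Bool to from
      where
      to : seen x T (R x T) ≡ true → isTrue (output (Conf.tp (at-time x T T))) ≡ true
      to e with seen-find (R x T) e
      ... | j , lt , a with accepting-row (at-time x T (j / W x T)) (j % W x T) a
      ...   | st , hd = output-isTrue (Conf.tp (at-time x T T)) (trans (cong (head ∘ Conf.tp) same) hd)
        where
        t = j / W x T
        t≤ : t ≤ T
        t≤ = ≤-pred (m<n*o⇒m/o<n {j} {suc T} {W x T} lt)
        still : ∀ c k → Conf.state c ≡ halt → run M k c ≡ c
        still (conf q tp) k refl = run-halted M k tp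
        same : at-time x T T ≡ at-time x T t
        same = trans (cong (λ n → run M n (conf start (inputTape (true ∷ x)))) (sym (m+[n∸m]≡n t≤)))
          (trans (run-+ M t (T ∸ t) _) (still (at-time x T t) (T ∸ t) st))
      from : isTrue (output (Conf.tp (at-time x T T))) ≡ true → seen x T (R x T) ≡ true
      from e = seen-mono (R x T) (p + T * W x T) (+-monoˡ-≤ (T * W x T) p<)
          (trans (cong accepting (cellAt-row x T T p<)) (accepting-head (at-time x T T) halted (isTrue-output (Conf.tp (at-time x T T)) e)))
        where
        p = pos (Conf.tp (at-time x T T))
        p< : p < W x T
        p< = ≤-trans (s≤s (pos-time x T T)) (T<W x T)

  -- The gates for the input true ∷ e ++ y, where the m bits of y are the inputs of the circuit.
  gates : Str → ℕ → ℕ → List (Raw ℕ)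
  gates e m T = constRs (plain nothing ∷ firstCell ∷ map (plain ∘ just) e) ++ inputRs (2 + length e) m
    ++ constRs (replicate (2 + T) (plain nothing)) ++ helixRs (suc (length e + m) + T) (suc T * (2 + (suc (length e + m) + T)))

  -- The flag comes first in the code of a cell, so after the last cell it is wire 0, where the
  -- output gate reads it.
  top-wire : ∀ {x a c h w} → Wires x ((a , c) ∷ h) w → ∃ λ w′ → w ≡ a ∷ w′
  top-wire {c = core f nothing  h} (grow ws (cons _ _)) = _ , refl
  top-wire {c = core f (just b) h} (grow ws (cons _ _)) = _ , refl

  module _ (e : Str) (b : Bool) (y : Str) (T : ℕ) where

    private
      x : Str
      x = e ++ b ∷ y
      pj : Bool → Cell
      pj = plain ∘ just
      front back : List Cell
      front = plain nothing ∷ firstCell ∷ map pj e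
      back  = replicate (2 + T) (plain nothing)

      Run : List (Raw ℕ) → List Bool → List Cell → Set
      Run rs w h = ∃ λ w′ → RunRaw rs w w′ × Wires (b ∷ y) h w′

      run₁ : Run (constRs front) (b ∷ y) (front ʳ++ [])
      run₁ = const-runs front base

      w₁ : List Bool
      w₁ = proj₁ run₁

      run₂ : Run (inputRs (length (front ʳ++ [])) (suc (length y))) w₁ (map pj (List.take (suc (length y)) (b ∷ y)) ʳ++ (front ʳ++ []))
      run₂ = input-runs (suc (length y)) (proj₂ (proj₂ run₁)) ≤-refl

      w₂ : List Bool
      w₂ = proj₁ run₂

      run₃ : Run (constRs back) w₂ (back ʳ++ (map pj (List.take (suc (length y)) (b ∷ y)) ʳ++ (front ʳ++ [])))
      run₃ = const-runs back (proj₂ (proj₂ run₂))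

      w₃ : List Bool
      w₃ = proj₁ run₃

      hist : back ʳ++ (map pj (List.take (suc (length y)) (b ∷ y)) ʳ++ (front ʳ++ [])) ≡ history (cells x T) (3 + ω x T + 0)
      hist = trans (cong (λ q → back ʳ++ (map pj q ʳ++ (front ʳ++ []))) (take-all (suc (length y)) (b ∷ y) ≤-refl))
        (trans (cong (back ʳ++_) (sym (++-ʳ++ front {map pj (b ∷ y)} {[]})))
        (trans (sym (++-ʳ++ (front ++ map pj (b ∷ y)) {back} {[]}))
        (trans (cong (λ q → ((plain nothing ∷ firstCell ∷ q) ++ back) ʳ++ []) (sym (map-++ pj e (b ∷ y))))
        (trans (history-initial x T) (cong (history (cells x T)) (sym (+-identityʳ (3 + ω x T))))))))

      run₄ : Run (helixRs (ω x T) (R x T)) w₃ (history (cells x T) (3 + ω x T + (0 + R x T)))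
      run₄ = helix-runs (cells x T) (ω x T) (R x T) 0 (subst (λ h → Wires (b ∷ y) h w₃) hist (proj₂ (proj₂ run₃))) (cells-helix x T)

      front-length : length (front ʳ++ []) ≡ 2 + length e
      front-length = trans (length-ʳ++ front) (trans (+-identityʳ _) (cong (2 +_) (length-map pj e)))

      ω-eq : ω x T ≡ suc (length e + suc (length y)) + T
      ω-eq = cong (λ n → suc n + T) (length-++ e)

      gates-eq : constRs front ++ inputRs (length (front ʳ++ [])) (suc (length y)) ++ constRs back ++ helixRs (ω x T) (R x T)
                 ≡ gates e (suc (length y)) T
      gates-eq = cong₂ (λ n o → constRs front ++ inputRs n (suc (length y)) ++ constRs back ++ helixRs o (suc T * (2 + o))) front-length ω-eq

      top : ∃ λ w → proj₁ run₄ ≡ seen x T (W x T + R x T ∸ W x T) ∷ w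
      top = top-wire (proj₂ (proj₂ run₄))

    gates-run : ∃ λ w → RunRaw (gates e (suc (length y)) T) (b ∷ y) (seen (e ++ b ∷ y) T (R (e ++ b ∷ y) T) ∷ w)
    gates-run = proj₁ top , run-cast gates-eq (trans (proj₂ top) (cong (λ n → seen x T n ∷ proj₁ top) (m+n∸m≡n (W x T) (R x T))))
      (proj₁ (proj₂ run₁) +++ proj₁ (proj₂ run₂) +++ proj₁ (proj₂ run₃) +++ proj₁ (proj₂ run₄))

  module _ (e : Str) (m T : ℕ) where

    opaque
      valid : Valid (suc m) (gates e (suc m) T)
      -- The run on the input of all zeros certifies the scope of every gate.
      valid = subst (λ n → Valid (suc n) (gates e (suc n) T)) (length-replicate m)
                (run-valid (proj₂ (gates-run e false (replicate m false) T)))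

      circuit : Circuit (suc m)
      circuit = attach (gates e (suc m) T) valid (out (F.fromℕ< (≤-trans (s≤s z≤n) (wires-≥ (gates e (suc m) T) (suc m)))))

      enc-circuit : encCircuit circuit ≡ encℕ (suc m) ++ encRaws (gates e (suc m) T) ++ false ∷ false ∷ false ∷ []
      enc-circuit = cong (encℕ (suc m) ++_) (trans (enc-attach (gates e (suc m) T) valid _)
        (cong (λ i → encRaws (gates e (suc m) T) ++ false ∷ false ∷ i) (encFin-fromℕ< (≤-trans (s≤s z≤n) (wires-≥ (gates e (suc m) T) (suc m))))))

      eval-circuit : ∀ (v : Vec Bool (suc m)) → let x = e ++ toList v in evalG circuit v ≡ seen x T (R x T)
      eval-circuit (b ∷ u) = trans (proj₂ (proj₂ ev)) (lookup-at (proj₁ ev) (≤-trans (s≤s z≤n) (wires-≥ (gates e (suc m) T) (suc m))) (at-cast-wires (sym (proj₁ (proj₂ ev))) at0))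
        where
        r : ∃ λ w → RunRaw (gates e (suc m) T) (b ∷ toList u) (seen (e ++ b ∷ toList u) T (R (e ++ b ∷ toList u) T) ∷ w)
        r = subst (λ n → ∃ λ w → RunRaw (gates e (suc n) T) (b ∷ toList u) (seen (e ++ b ∷ toList u) T (R (e ++ b ∷ toList u) T) ∷ w))
              (VP.length-toList u) (gates-run e b (toList u) T)
        lt : 0 < wires (gates e (suc m) T) (suc m)
        lt = ≤-trans (s≤s z≤n) (wires-≥ (gates e (suc m) T) (suc m))
        ev : Σ (Vec Bool (wires (gates e (suc m) T) (suc m))) λ y → toList y ≡ seen (e ++ b ∷ toList u) T (R (e ++ b ∷ toList u) T) ∷ proj₁ r ×
               evalG (attach (gates e (suc m) T) valid (out (F.fromℕ< lt))) (b ∷ u) ≡ V.lookup y (F.fromℕ< lt)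
        ev = eval-attach (gates e (suc m) T) valid (out (F.fromℕ< lt)) (b ∷ u) (proj₂ r)

  module _ {f : Str → Str} {c k : ℕ} (comp : ComputesIn M c k f) (e : Str) (m : ℕ) where

    time : ℕ
    -- One successor stands for the leading 1 of the input, the other belongs to `ComputesIn`.
    time = c * suc (suc (length e + suc m)) ^ k + c

    inSet-circuit : ∀ y → length y ≡ suc m → (InSet (circuit e m time) y → isTrue (f (true ∷ e ++ y)) ≡ true) ×
                                             (isTrue (f (true ∷ e ++ y)) ≡ true → InSet (circuit e m time) y)
    inSet-circuit y len = (λ { (len′ , ev) → trans (sym (value len′)) ev }) , (λ acc → len , trans (value len) acc)
      where
      value : ∀ (len : length y ≡ suc m) → evalG (circuit e m time) (subst (Vec Bool) len (fromList y)) ≡ isTrue (f (true ∷ e ++ y))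
      value len = trans (eval-circuit e m time v) (trans (cong (λ q → seen (e ++ q) time (R (e ++ q) time)) list)
          (trans (seen-accepts (e ++ y) time (proj₁ run-end)) (cong isTrue (proj₂ run-end))))
        where
        v : Vec Bool (suc m)
        v = subst (Vec Bool) len (fromList y)
        list : toList v ≡ y
        list = trans (toList-subst len (fromList y)) (VP.toList∘fromList y)
        run-end : Conf.state (at-time (e ++ y) time time) ≡ halt × output (Conf.tp (at-time (e ++ y) time time)) ≡ f (true ∷ e ++ y)
        run-end = subst (λ n → let c′ = run M (c * suc (suc n) ^ k + c) (conf start (inputTape (true ∷ e ++ y))) in
                              Conf.state c′ ≡ halt × output (Conf.tp c′) ≡ f (true ∷ e ++ y))
                        (trans (length-++ e) (cong (length e +_) len)) (comp (true ∷ e ++ y))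

-- Writing the circuits down in polynomial time

encRaws-++ : ∀ a b → encRaws (a ++ b) ≡ encRaws a ++ encRaws b
encRaws-++ a b = concatMap-++ encRaw a b

un-+ : ∀ a b → un (a + b) ≡ un a ++ un b
un-+ zero    b = refl
un-+ (suc a) b = cong (true ∷_) (un-+ a b)

ix-F : ∀ i → Fun 1 (λ v → encℕ (val (length (V.lookup v #0)) i))
ix-F (a , false) = constF (encℕ a)
ix-F (a , true)  = fun-ext (λ v → cong (_++ false ∷ []) (sym (un-+ a _))) ((constF (un a) ++F ap1 unary-F (arg #0)) ++F constF (false ∷ []))

raw-F : ∀ r → Fun 1 (λ v → encRaw (mapRaw (val (length (V.lookup v #0))) r))
raw-F (andR i j) = consF false (consF true (ix-F i ++F ix-F j))
raw-F (orR i j)  = consF true (consF false (ix-F i ++F ix-F j))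
raw-F (notR i)   = consF true (consF true (ix-F i))

raws-F : ∀ rs → F1 (λ z → encRaws (inst (length z) rs))
raws-F rs = mk1 (go rs)
  where
  go : ∀ rs → Fun 1 (λ v → encRaws (inst (length (V.lookup v #0)) rs))
  go []       = nil-P
  go (r ∷ rs) = raw-F r ++F go rs

-- Multiplication of lengths. Together with `timesS` and `powS` it evaluates the time bound of a
-- machine in unary.
repS : Str → Str → Str
repS []      s = []
repS (_ ∷ x) s = s ++ repS x s

length-repS : ∀ x s → length (repS x s) ≡ length x * length s
length-repS []      s = refl
length-repS (_ ∷ x) s = trans (length-++ s) (cong (length s +_) (length-repS x s))

rep-F : F2 repS
rep-F = rec-F2 repS nil-P (arg #2 ++F arg #1) (arg #2 ++F arg #1) (λ _ → refl) (λ _ _ → refl) (λ _ _ → refl) (X ⊗ X)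
  (λ x y → ≤-trans (≤-reflexive (length-repS x y)) (*-mono-≤ (m≤m+n (length x) (length y)) (m≤n+m (length y) (length x))))

timesS : ℕ → Str → Str
timesS zero    x = []
timesS (suc c) x = x ++ timesS c x

times-F : ∀ c → F1 (timesS c)
times-F zero    = mk1 nil-P
times-F (suc c) = mk1 (arg #0 ++F ap1 (times-F c) (arg #0))

length-times : ∀ c x → length (timesS c x) ≡ c * length x
length-times zero    x = refl
length-times (suc c) x = trans (length-++ x) (cong (length x +_) (length-times c x))

powS : ℕ → Str → Str
powS zero    x = true ∷ []
powS (suc k) x = repS x (powS k x)

pow-F : ∀ k → F1 (powS k)
pow-F zero    = mk1 (constF (true ∷ []))
pow-F (suc k) = mk1 (ap2 rep-F (arg #0) (ap1 (pow-F k) (arg #0)))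

length-pow : ∀ k x → length (powS k x) ≡ length x ^ k
length-pow zero    x = refl
length-pow (suc k) x = trans (length-repS x (powS k x)) (cong (length x *_) (length-pow k x))

mapS : (Bool → Str) → Str → Str
mapS g []      = []
mapS g (b ∷ x) = g b ++ mapS g x

map-F : ∀ g → F1 (mapS g)
map-F g = rec-F1 (mapS g) (constF (g false) ++F arg #1) (constF (g true) ++F arg #1) (λ _ → refl) (λ _ → refl)
  (X ⊗ K (length (g false) + length (g true))) bd
  where
  g≤ : ∀ b → length (g b) ≤ length (g false) + length (g true)
  g≤ false = m≤m+n _ _
  g≤ true  = m≤n+m _ _
  bd : ∀ x → length (mapS g x) ≤ length x * (length (g false) + length (g true))
  bd []      = z≤n
  bd (b ∷ x) = ≤-trans (≤-reflexive (length-++ (g b))) (+-mono-≤ (g≤ b) (bd x))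

module CircuitString (M : TM) (c k : ℕ) where
  open TM M
  open CookLevin M
  open CookLevinCircuit M

  opaque
    constStr : Cell → Str
    constStr a = encRaws (inst 0 (constR a))

    constStr-≡ : ∀ a → encRaws (inst 0 (constR a)) ≡ constStr a
    constStr-≡ a = refl

    g : ℕ
    g = G

    g≡G : g ≡ G
    g≡G = refl

    inputStr helixStr : Str → Str
    inputStr z = encRaws (inst (length z) inputR)
    helixStr z = encRaws (inst (length z) helixR)

    inputStr-F : F1 inputStr
    inputStr-F = raws-F inputR

    helixStr-F : F1 helixStr
    helixStr-F = raws-F helixR

    inputStr-≡ : ∀ z {n} → length z ≡ n → encRaws (inst n inputR) ≡ inputStr z
    inputStr-≡ z refl = refl

    helixStr-≡ : ∀ z {n} → length z ≡ n → encRaws (inst n helixR) ≡ helixStr z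
    helixStr-≡ z refl = refl

  frontS : Str → Str
  frontS e = constStr (plain nothing) ++ constStr firstCell ++ mapS (constStr ∘ plain ∘ just) e

  front-≡ : ∀ e → encRaws (constRs (plain nothing ∷ firstCell ∷ map (plain ∘ just) e)) ≡ frontS e
  front-≡ e = trans (encRaws-++ (inst 0 (constR (plain nothing))) _) (cong₂ _++_ (constStr-≡ (plain nothing))
    (trans (encRaws-++ (inst 0 (constR firstCell)) _) (cong₂ _++_ (constStr-≡ firstCell) (go e))))
    where
    go : ∀ e → encRaws (constRs (map (plain ∘ just) e)) ≡ mapS (constStr ∘ plain ∘ just) e
    go []      = refl
    go (b ∷ e) = trans (encRaws-++ (inst 0 (constR (plain (just b)))) _) (cong₂ _++_ (constStr-≡ (plain (just b))) (go e))

  -- The string handed to `inputStr` has the distance of input `i` as its length: `g` wires for each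
  -- of the cells produced so far, and the `i` inputs in front of it, where `i` is the length of the
  -- current suffix.
  inputS : Vec Str 2 → Str
  inputS v = inputStr (timesS g (V.lookup v #0 ++ V.lookup v #1) ++ V.lookup v #0)

  inputs-≡ : ∀ x κ → encRaws (inputRs (length κ) (length x)) ≡ catS inputS x (κ ∷ [])
  inputs-≡ []      κ = refl
  inputs-≡ (b ∷ x) κ = trans (encRaws-++ (inputRs (length κ) (length x)) _)
    (cong₂ _++_ (inputs-≡ x κ) (inputStr-≡ (timesS g (x ++ κ) ++ x) (trans (length-++ (timesS g (x ++ κ)))
      (cong (_+ length x) (trans (length-times g (x ++ κ)) (trans (*-comm g _) (cong₂ _*_ (length-++ x) g≡G)))))))

  blanks-≡ : ∀ x → encRaws (constRs (replicate (length x) (plain nothing))) ≡ repS x (constStr (plain nothing))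
  blanks-≡ []      = refl
  blanks-≡ (_ ∷ x) = trans (encRaws-++ (inst 0 (constR (plain nothing))) _) (cong₂ _++_ (constStr-≡ (plain nothing)) (blanks-≡ x))

  helix-≡ : ∀ ω x → encRaws (helixRs ω (length x)) ≡ repS x (encRaws (inst (ω * G) helixR))
  helix-≡ ω []      = refl
  helix-≡ ω (_ ∷ x) = trans (encRaws-++ (inst (ω * G) helixR) _) (cong (encRaws (inst (ω * G) helixR) ++_) (helix-≡ ω x))

  -- Only the lengths matter: running time and `ω` for an input consisting of 1, `e` and one bit
  -- more than `z` has.
  timeS ωS : Str → Str → Str
  timeS e z = timesS c (powS k (true ∷ true ∷ e ++ true ∷ z)) ++ un c
  ωS e z = (true ∷ e ++ true ∷ z) ++ timeS e z

  time-F : F2 timeS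
  time-F = mk2 (ap1 (times-F c) (ap1 (pow-F k) (consF true (consF true (arg #0 ++F consF true (arg #1))))) ++F constF (un c))

  ω-F : F2 ωS
  ω-F = mk2 (consF true (arg #0 ++F consF true (arg #1)) ++F ap2 time-F (arg #0) (arg #1))

  bodyS circuitS : Str → Str → Str
  bodyS e z = frontS e ++ catS inputS (true ∷ z) ((true ∷ true ∷ e) ∷ [])
    ++ repS (true ∷ true ∷ timeS e z) (constStr (plain nothing))
    ++ repS (repS (true ∷ timeS e z) (true ∷ true ∷ ωS e z)) (helixStr (timesS g (ωS e z)))
  circuitS e z = (true ∷ unary z ++ false ∷ []) ++ bodyS e z ++ false ∷ false ∷ false ∷ []

  circuit-F : F2 circuitS
  circuit-F = mk2 (consF true (ap1 unary-F (arg #1) ++F constF (false ∷ [])) ++F (body ++F constF (false ∷ false ∷ false ∷ [])))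
    where
    front : Fun 2 (λ v → frontS (V.lookup v #0))
    front = constF (constStr (plain nothing)) ++F (constF (constStr firstCell) ++F ap1 (map-F (constStr ∘ plain ∘ just)) (arg #0))
    input : Fun 2 inputS
    input = ap1 inputStr-F (ap1 (times-F g) (arg #0 ++F arg #1) ++F arg #0)
    inputs : Fun 2 (λ v → catS inputS (true ∷ V.lookup v #1) ((true ∷ true ∷ V.lookup v #0) ∷ []))
    inputs = cat-P input ∘P (consF true (arg #1) ∷P consF true (consF true (arg #0)) ∷P empty-P)
    t : Fun 2 (λ v → timeS (V.lookup v #0) (V.lookup v #1))
    t = ap2 time-F (arg #0) (arg #1)
    w : Fun 2 (λ v → ωS (V.lookup v #0) (V.lookup v #1))
    w = ap2 ω-F (arg #0) (arg #1)
    body : Fun 2 (λ v → bodyS (V.lookup v #0) (V.lookup v #1))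
    body = front ++F (inputs ++F (ap2 rep-F (consF true (consF true t)) (constF (constStr (plain nothing)))
      ++F ap2 rep-F (ap2 rep-F (consF true t) (consF true (consF true w))) (ap1 helixStr-F (ap1 (times-F g) w))))

  time-≡ : ∀ e z → length (timeS e z) ≡ c * suc (suc (length e + suc (length z))) ^ k + c
  time-≡ e z = trans (length-++ (timesS c _)) (cong₂ _+_
    (trans (length-times c _) (cong (c *_) (trans (length-pow k _) (cong (λ n → suc (suc n) ^ k) (length-++ e)))))
    (length-replicate c))

  module _ (e z : Str) where

    private
      T o n : ℕ
      T = length (timeS e z)
      o = suc (length e + suc (length z)) + T
      n = suc T * (2 + o)

      ω-≡ : length (ωS e z) ≡ o
      ω-≡ = trans (length-++ (true ∷ e ++ true ∷ z)) (cong (λ n → suc n + T) (length-++ e))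

      rows : Str
      rows = repS (true ∷ timeS e z) (true ∷ true ∷ ωS e z)

      rows-≡ : length rows ≡ n
      rows-≡ = trans (length-repS (true ∷ timeS e z) (true ∷ true ∷ ωS e z)) (cong (λ n → suc T * (2 + n)) ω-≡)

      width-≡ : length (timesS g (ωS e z)) ≡ o * G
      width-≡ = trans (length-times g (ωS e z)) (trans (*-comm g (length (ωS e z))) (cong₂ _*_ ω-≡ g≡G))

      A B C D : List (Raw ℕ)
      A = constRs (plain nothing ∷ firstCell ∷ map (plain ∘ just) e)
      B = inputRs (2 + length e) (suc (length z))
      C = constRs (replicate (2 + T) (plain nothing))
      D = helixRs o n

      D-≡ : encRaws D ≡ repS rows (helixStr (timesS g (ωS e z)))
      D-≡ = trans (cong (λ n → encRaws (helixRs o n)) (sym rows-≡)) (trans (helix-≡ o rows)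
              (cong (repS rows) (helixStr-≡ (timesS g (ωS e z)) width-≡)))

      B-≡ : encRaws B ≡ catS inputS (true ∷ z) ((true ∷ true ∷ e) ∷ [])
      B-≡ = inputs-≡ (true ∷ z) (true ∷ true ∷ e)

      C-≡ : encRaws C ≡ repS (true ∷ true ∷ timeS e z) (constStr (plain nothing))
      C-≡ = blanks-≡ (true ∷ true ∷ timeS e z)

      split : ∀ (a b c d : List (Raw ℕ)) {x y u v} → encRaws a ≡ x → encRaws b ≡ y → encRaws c ≡ u → encRaws d ≡ v →
              encRaws (a ++ b ++ c ++ d) ≡ x ++ y ++ u ++ v
      split a b c d refl refl refl refl = trans (encRaws-++ a (b ++ c ++ d)) (cong (encRaws a ++_)
        (trans (encRaws-++ b (c ++ d)) (cong (encRaws b ++_) (encRaws-++ c d))))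

      body : encRaws (gates e (suc (length z)) T) ≡ bodyS e z
      body = split A B C D (front-≡ e) B-≡ C-≡ D-≡

    circuit-≡ : circuitS e z ≡ encCircuit (circuit e (length z) (length (timeS e z)))
    circuit-≡ = trans (cong (λ s → (true ∷ unary z ++ false ∷ []) ++ s ++ false ∷ false ∷ false ∷ []) (sym body))
                      (sym (enc-circuit e (length z) T))

-- Evaluation of encoded circuits. A state consists of the remaining gates, the
-- wires, and the output bit once it is known; an ill-formed gate empties it.

failed : Vec Str 3
failed = [] ∷ [] ∷ [] ∷ []

module _ (y w : Str) where

  -- An output gate must end the string: anything after the 0 that closes its index is rejected, so
  -- that only exact codes evaluate.
  outStep : Vec Str 3
  outStep = caseStr (dropS (ones y) y) failed
    (λ t → caseStr t ([] ∷ [] ∷ headS (dropS (ones y) w) ∷ []) (λ _ → failed) (λ _ → failed)) (λ _ → failed)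

  notStep : Vec Str 3
  notStep = caseStr (dropS (ones y) w) failed (λ _ → afterOnes y ∷ (true ∷ w) ∷ [] ∷ []) (λ _ → afterOnes y ∷ (false ∷ w) ∷ [] ∷ [])

  binStep₂ : (Bool → Bool) → Vec Str 3
  binStep₂ p = caseStr (dropS (ones (afterOnes y)) w) failed
    (λ _ → afterOnes (afterOnes y) ∷ (p false ∷ w) ∷ [] ∷ []) (λ _ → afterOnes (afterOnes y) ∷ (p true ∷ w) ∷ [] ∷ [])

  binStep : (Bool → Bool → Bool) → Vec Str 3
  binStep o = caseStr (dropS (ones y) w) failed (λ _ → binStep₂ (o false)) (λ _ → binStep₂ (o true))

gateStep : Str → Str → Vec Str 3
gateStep g w = caseStr g failed
  (λ x → caseStr x failed (λ y → outStep y w) (λ y → binStep y w _∧_))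
  (λ x → caseStr x failed (λ y → binStep y w _∨_) (λ y → notStep y w))

evalStep : Vec Str 3 → Vec Str 3
evalStep (g ∷ w ∷ r ∷ []) = caseStr r (gateStep g w) (λ _ → g ∷ w ∷ r ∷ []) (λ _ → g ∷ w ∷ r ∷ [])

evalStep-P : P evalStep
evalStep-P = P-ext (λ { (g ∷ w ∷ r ∷ []) → refl })
    (matchP (arg #2) gate (sel-P F.suc) (sel-P F.suc))
  where
  fail-P : ∀ {n} → P {n} (λ _ → failed)
  fail-P = nil-P ∷P nil-P ∷P nil-P
  gate : P {3} (λ v → gateStep (V.lookup v #0) (V.lookup v #1))
  gate = matchP (arg #0) fail-P
    (matchP (arg #0) fail-P out-P (bin-P _∧_)) (matchP (arg #0) fail-P (bin-P _∨_) not-P)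
    where
    -- y is variable 0 and the wires are variable 3
    out-P : P {5} (λ v → outStep (V.lookup v #0) (V.lookup v #3))
    out-P = matchP (ap2 drop-F (ap1 ones-F (arg #0)) (arg #0)) fail-P
      (matchP (arg #0) (nil-P ∷P nil-P ∷P ap1 head-F (ap2 drop-F (ap1 ones-F (arg #1)) (arg #4))) fail-P fail-P) fail-P
    not-P : P {5} (λ v → notStep (V.lookup v #0) (V.lookup v #3))
    not-P = matchP (ap2 drop-F (ap1 ones-F (arg #0)) (arg #3)) fail-P
      (ap1 afterOnes-F (arg #1) ∷P consF true (arg #4) ∷P nil-P) (ap1 afterOnes-F (arg #1) ∷P consF false (arg #4) ∷P nil-P)
    bin₂-P : ∀ p → P {6} (λ v → binStep₂ (V.lookup v #1) (V.lookup v #4) p)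
    bin₂-P p = matchP (ap2 drop-F (ap1 ones-F (ap1 afterOnes-F (arg #1))) (arg #4)) fail-P
      (ap1 afterOnes-F (ap1 afterOnes-F (arg #2)) ∷P consF (p false) (arg #5) ∷P nil-P)
      (ap1 afterOnes-F (ap1 afterOnes-F (arg #2)) ∷P consF (p true) (arg #5) ∷P nil-P)
    bin-P : ∀ o → P {5} (λ v → binStep (V.lookup v #0) (V.lookup v #3) o)
    bin-P o = matchP (ap2 drop-F (ap1 ones-F (arg #0)) (arg #3)) fail-P (bin₂-P (o false)) (bin₂-P (o true))

-- The result of the circuit q on the input a: [b], or [] if q is not a circuit with length a inputs.
evalS : Str → Str → Str
evalS q a = V.lookup (iterV evalStep (true ∷ q) (afterOnes q ∷ a ∷ [] ∷ [])) #2

iter-fixed : ∀ {A : Set} (S : A → A) x {s} → S s ≡ s → iterV S x s ≡ s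
iter-fixed S []      eq = refl
iter-fixed S (_ ∷ x) eq = trans (cong (iterV S x) eq) (iter-fixed S x eq)

caseStr-elim : ∀ {A : Set} (Q : A → Set) x {e f g} → Q e → (∀ t → length t ≤ length x → Q (f t)) →
               (∀ t → length t ≤ length x → Q (g t)) → Q (caseStr x e f g)
caseStr-elim Q []          e f g = e
caseStr-elim Q (false ∷ x) e f g = f x (n≤1+n _)
caseStr-elim Q (true ∷ x)  e f g = g x (n≤1+n _)

evalStep-size : ∀ v → szV (evalStep v) ≤ 4 + szV v
evalStep-size (g ∷ w ∷ r ∷ []) = caseStr-elim Q r
    (caseStr-elim Q g fail
      (λ x x≤ → caseStr-elim Q x fail
        (λ y y≤ → caseStr-elim Q (dropS (ones y) y) fail
          (λ t _ → caseStr-elim Q t (head≤ (dropS (ones y) w)) (λ _ _ → fail) (λ _ _ → fail)) (λ _ _ → fail))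
        (λ y y≤ → bin _∧_ y (≤-trans y≤ x≤)))
      (λ x x≤ → caseStr-elim Q x fail (λ y y≤ → bin _∨_ y (≤-trans y≤ x≤))
        (λ y y≤ → let le = ≤-trans (afterOnes-≤ y) (≤-trans y≤ x≤) in
           caseStr-elim Q (dropS (ones y) w) fail (λ _ _ → next (afterOnes y) true le) (λ _ _ → next (afterOnes y) false le))))
    (λ _ _ → m≤n+m _ 4) (λ _ _ → m≤n+m _ 4)
  where
  Q : Vec Str 3 → Set
  Q v = szV v ≤ 4 + szV (g ∷ w ∷ r ∷ [])
  fail : Q failed
  fail = ≤-trans (n≤1+n 3) (m≤m+n 4 _)
  head≤ : ∀ x → Q ([] ∷ [] ∷ headS x ∷ [])
  head≤ []      = fail
  head≤ (_ ∷ x) = m≤m+n 4 _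
  next : ∀ x b → length x ≤ length g → Q (x ∷ (b ∷ w) ∷ [] ∷ [])
  next x b le = ≤-trans (s≤s (+-mono-≤ le (s≤s (s≤s (+-monoʳ-≤ (length w) (s≤s z≤n))))))
    (≤-trans (≤-reflexive (cong suc (+-suc (length g) _))) (m≤n+m _ 3))
  bin : ∀ o y → length y ≤ length g → Q (binStep y w o)
  bin o y y≤ = caseStr-elim Q (dropS (ones y) w) fail (λ _ _ → bin₂ (o false)) (λ _ _ → bin₂ (o true))
    where
    le : length (afterOnes (afterOnes y)) ≤ length g
    le = ≤-trans (afterOnes-≤ (afterOnes y)) (≤-trans (afterOnes-≤ y) y≤)
    bin₂ : ∀ p → Q (binStep₂ y w p)
    bin₂ p = caseStr-elim Q (dropS (ones (afterOnes y)) w) fail (λ _ _ → next (afterOnes (afterOnes y)) (p false) le) (λ _ _ → next (afterOnes (afterOnes y)) (p true) le)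

eval-F : F2 evalS
eval-F = mk2 (arg #2 ∘P iterGrow-P {I = λ v → (true ∷ V.lookup v #0) ∷ afterOnes (V.lookup v #0) ∷ V.lookup v #1 ∷ [] ∷ []}
  (consF true (arg #0) ∷P ap1 afterOnes-F (arg #0) ∷P arg #1 ∷P nil-P) evalStep-P 4 evalStep-size)

dropS-enc : ∀ i y → dropS (ones (encℕ i ++ y)) (encℕ i ++ y) ≡ false ∷ y
dropS-enc zero    y = refl
dropS-enc (suc i) y = dropS-enc i y

drop-lookup : ∀ {m} (v : Vec Bool m) (i : Fin m) → ∃ λ t → List.drop (toℕ i) (toList v) ≡ V.lookup v i ∷ t
drop-lookup (b ∷ v) F.zero    = toList v , refl
drop-lookup (b ∷ v) (F.suc i) = drop-lookup v i

dropS-un : ∀ n y → dropS (un n) y ≡ List.drop n y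
dropS-un n y = cong (λ k → List.drop k y) (length-replicate n)

operand : ∀ {m} (i : Fin m) y (v : Vec Bool m) → ∃ λ t → dropS (ones (encFin i ++ y)) (toList v) ≡ V.lookup v i ∷ t
operand i y v with drop-lookup v i
... | t , e = t , trans (cong (λ s → dropS s (toList v)) (ones-enc (toℕ i) y)) (trans (dropS-un (toℕ i) (toList v)) e)

notStep-enc : ∀ {m} (v : Vec Bool m) i y → notStep (encFin i ++ y) (toList v) ≡ y ∷ (Data.Bool.not (V.lookup v i) ∷ toList v) ∷ [] ∷ []
notStep-enc v i y with operand i y v
... | t , e rewrite e | afterOnes-enc (toℕ i) y with V.lookup v i
...   | false = refl
...   | true  = refl

binStep-enc : ∀ {m} (o : Bool → Bool → Bool) (v : Vec Bool m) i j y →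
  binStep (encFin i ++ encFin j ++ y) (toList v) o ≡ y ∷ (o (V.lookup v i) (V.lookup v j) ∷ toList v) ∷ [] ∷ []
binStep-enc o v i j y with operand i (encFin j ++ y) v | operand j y v
... | t , e | t′ , e′ rewrite e | afterOnes-enc (toℕ i) (encFin j ++ y) | e′ | afterOnes-enc (toℕ j) y with V.lookup v i | V.lookup v j
...   | false | false = refl
...   | false | true  = refl
...   | true  | false = refl
...   | true  | true  = refl

outStep-enc : ∀ {m} (v : Vec Bool m) i → outStep (encFin i) (toList v) ≡ [] ∷ [] ∷ (V.lookup v i ∷ []) ∷ []
outStep-enc v i with operand i [] v
... | t , e = go (encFin i) (++-identityʳ (encFin i))
  where
  go : ∀ y → encFin i ++ [] ≡ y → outStep y (toList v) ≡ [] ∷ [] ∷ (V.lookup v i ∷ []) ∷ []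
  go y refl rewrite dropS-enc (toℕ i) [] | e = refl

evalStep-done : ∀ b → evalStep ([] ∷ [] ∷ (b ∷ []) ∷ []) ≡ [] ∷ [] ∷ (b ∷ []) ∷ []
evalStep-done false = refl
evalStep-done true  = refl

-- Every round consumes at least one symbol of the code and the final state is a fixed point, so the
-- length of the code is enough rounds.
eval-complete : ∀ {m} (C : Gates m) (v : Vec Bool m) x → length (encGates C) ≤ length x →
                iterV evalStep x (encGates C ∷ toList v ∷ [] ∷ []) ≡ [] ∷ [] ∷ (evalG C v ∷ []) ∷ []
eval-complete (out i) v (_ ∷ x) (s≤s le) = trans (cong (iterV evalStep x) (outStep-enc v i)) (iter-fixed evalStep x (evalStep-done _))
eval-complete (and i j C) v (_ ∷ x) (s≤s le) = trans (cong (iterV evalStep x) (binStep-enc _∧_ v i j (encGates C)))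
  (eval-complete C _ x (≤-trans (≤-trans (≤-trans (length-++-≤ʳ (encGates C) {encFin j}) (length-++-≤ʳ _ {encFin i})) (n≤1+n _)) le))
eval-complete (or i j C) v (_ ∷ x) (s≤s le) = trans (cong (iterV evalStep x) (binStep-enc _∨_ v i j (encGates C)))
  (eval-complete C _ x (≤-trans (≤-trans (≤-trans (length-++-≤ʳ (encGates C) {encFin j}) (length-++-≤ʳ _ {encFin i})) (n≤1+n _)) le))
eval-complete (not i C) v (_ ∷ x) (s≤s le) = trans (cong (iterV evalStep x) (notStep-enc v i (encGates C)))
  (eval-complete C _ x (≤-trans (≤-trans (length-++-≤ʳ (encGates C) {encFin i}) (n≤1+n _)) le))

evalS-complete : ∀ {n} (C : Circuit n) (v : Vec Bool n) → evalS (encCircuit C) (toList v) ≡ evalG C v ∷ []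
evalS-complete {n} C v = trans (cong (λ g → V.lookup (iterV evalStep (true ∷ encCircuit C) (g ∷ toList v ∷ [] ∷ [])) #2) (afterOnes-enc n (encGates C)))
  (cong (λ s → V.lookup s #2) (eval-complete C v (true ∷ encCircuit C) (≤-trans (length-++-≤ʳ (encGates C) {encℕ n}) (n≤1+n _))))

caseStr-split : ∀ {A : Set} (Q : A → Set) x {e f g} → Q (caseStr x e f g) →
                (x ≡ [] × Q e) ⊎ (∃ λ t → x ≡ false ∷ t × Q (f t)) ⊎ (∃ λ t → x ≡ true ∷ t × Q (g t))
caseStr-split Q []          q = inj₁ (refl , q)
caseStr-split Q (false ∷ x) q = inj₂ (inj₁ (x , refl , q))
caseStr-split Q (true ∷ x)  q = inj₂ (inj₂ (x , refl , q))

lookup-drop : ∀ {m} (v : Vec Bool m) (x : Str) {b t} → dropS x (toList v) ≡ b ∷ t → ∃ λ (i : Fin m) → toℕ i ≡ length x × V.lookup v i ≡ b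
lookup-drop (c ∷ v) []      refl = F.zero , refl , refl
lookup-drop (c ∷ v) (_ ∷ x) eq with lookup-drop v x eq
... | i , p , q = F.suc i , cong suc p , q

encℕ-ones : ∀ y {b t} → afterOnes y ≡ b ∷ t → y ≡ encℕ (length (ones y)) ++ b ∷ t
encℕ-ones (false ∷ y) eq = cong (false ∷_) eq
encℕ-ones (true ∷ y)  eq = cong (true ∷_) (encℕ-ones y eq)

out-ones : ∀ y {t} → dropS (ones y) y ≡ false ∷ t → y ≡ encℕ (length (ones y)) ++ t
out-ones (false ∷ y) refl = refl
out-ones (true ∷ y)  eq = cong (true ∷_) (out-ones y eq)

-- `afterOnes` returns the empty string when a unary index lacks its closing 0. A nonempty
-- remainder, as the code of gates is, shows that the index was well formed.
encGates-∷ : ∀ {m} (C : Gates m) → ∃ λ b → ∃ λ t → encGates C ≡ b ∷ t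
encGates-∷ (out i)     = _ , _ , refl
encGates-∷ (and i j C) = _ , _ , refl
encGates-∷ (or i j C)  = _ , _ , refl
encGates-∷ (not i C)   = _ , _ , refl

Accepts : ∀ {m} → Str → Vec Bool m → Set
Accepts {m} g v = Σ (Gates m) λ C → encGates C ≡ g × evalG C v ≡ true

fail-stays : ∀ x → iterV evalStep x failed ≡ failed
fail-stays x = iter-fixed evalStep x refl

-- The typed circuit is read off a successful run: each lookup that succeeds bounds an index by the
-- number of wires. Since `failed` is a fixed point without output, a run that ends in `true` never
-- met an ill-formed gate.
eval-sound : ∀ {m} x g (v : Vec Bool m) → V.lookup (iterV evalStep x (g ∷ toList v ∷ [] ∷ [])) #2 ≡ true ∷ [] → Accepts g v
eval-sound {m} (_ ∷ x) g v h = gate g h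
  where
  Result : Vec Str 3 → Set
  Result s = V.lookup (iterV evalStep x s) #2 ≡ true ∷ []
  absurd : {A : Set} → Result failed → A
  absurd q = case trans (sym (cong (λ s → V.lookup s #2) (fail-stays x))) q of λ ()
  IH : ∀ y b → Result (y ∷ (b ∷ toList v) ∷ [] ∷ []) → Accepts y (b ∷ v)
  IH y b = eval-sound x y (b ∷ v)
  index : ∀ y (g′ : Str) {m′} {u : Vec Bool m′} → Accepts (afterOnes y) u → y ≡ encℕ (length (ones y)) ++ afterOnes y
  index y g′ (C , e , _) with encGates-∷ C
  ... | b , t , e′ = trans (encℕ-ones y (trans (sym e) e′)) (cong (encℕ (length (ones y)) ++_) (trans (sym e′) e))
  unop : ∀ y → Result (notStep y (toList v)) → Accepts (true ∷ true ∷ y) v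
  unop y q with caseStr-split Result (dropS (ones y) (toList v)) q
  ... | inj₁ (_ , q′) = absurd q′
  ... | inj₂ (inj₁ (t , e , q′)) = finish e (IH (afterOnes y) true q′)
    where
    finish : dropS (ones y) (toList v) ≡ false ∷ t → Accepts (afterOnes y) (true ∷ v) → Accepts (true ∷ true ∷ y) v
    finish e acc@(C , eC , ev) with lookup-drop v (ones y) e
    ... | i , pi , li = not i C , cong (λ z → true ∷ true ∷ z) (trans (cong₂ (λ n z → encℕ n ++ z) pi eC) (sym (index y y acc))) ,
          trans (cong (λ b → evalG C (Data.Bool.not b ∷ v)) li) ev
  ... | inj₂ (inj₂ (t , e , q′)) = finish e (IH (afterOnes y) false q′)
    where
    finish : dropS (ones y) (toList v) ≡ true ∷ t → Accepts (afterOnes y) (false ∷ v) → Accepts (true ∷ true ∷ y) v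
    finish e acc@(C , eC , ev) with lookup-drop v (ones y) e
    ... | i , pi , li = not i C , cong (λ z → true ∷ true ∷ z) (trans (cong₂ (λ n z → encℕ n ++ z) pi eC) (sym (index y y acc))) ,
          trans (cong (λ b → evalG C (Data.Bool.not b ∷ v)) li) ev
  BinResult : (Bool → Bool → Bool) → Str → Set
  BinResult o y = ∃ λ (i : Fin m) → ∃ λ (j : Fin m) → Σ (Gates (suc m)) λ C →
    encFin i ++ encFin j ++ encGates C ≡ y × evalG C (o (V.lookup v i) (V.lookup v j) ∷ v) ≡ true
  binop : ∀ o y → Result (binStep y (toList v) o) → BinResult o y
  binop o y q = split₁ (caseStr-split Result (dropS (ones y) (toList v)) q)
    where
    y₁ = afterOnes y
    finish : ∀ {a b t t′} → dropS (ones y) (toList v) ≡ a ∷ t → dropS (ones y₁) (toList v) ≡ b ∷ t′ →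
             Accepts (afterOnes y₁) (o a b ∷ v) → BinResult o y
    finish {a} {b} e e′ acc@(C , eC , ev) with lookup-drop v (ones y) e | lookup-drop v (ones y₁) e′
    ... | i , pi , li | j , pj , lj = i , j , C ,
        trans (cong₂ (λ n z → encℕ n ++ z) pi (trans (cong₂ (λ n z → encℕ n ++ z) pj eC) (sym y₁-≡))) (sym y-≡) ,
        trans (cong₂ (λ p q → evalG C (o p q ∷ v)) li lj) ev
      where
      y₁-≡ : y₁ ≡ encℕ (length (ones y₁)) ++ afterOnes y₁
      y₁-≡ = index y₁ y₁ acc
      y-≡ : y ≡ encℕ (length (ones y)) ++ y₁
      y-≡ = go (length (ones y₁)) y₁-≡
        where
        go : ∀ n → y₁ ≡ encℕ n ++ afterOnes y₁ → y ≡ encℕ (length (ones y)) ++ y₁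
        go zero    eq = trans (encℕ-ones y eq) (cong (encℕ (length (ones y)) ++_) (sym eq))
        go (suc n) eq = trans (encℕ-ones y eq) (cong (encℕ (length (ones y)) ++_) (sym eq))
    split₂ : ∀ {a t} → dropS (ones y) (toList v) ≡ a ∷ t → Result (binStep₂ y (toList v) (o a)) → BinResult o y
    split₂ {a} e q′ with caseStr-split Result (dropS (ones y₁) (toList v)) q′
    ... | inj₁ (_ , q″) = absurd q″
    ... | inj₂ (inj₁ (t , e′ , q″)) = finish e e′ (IH (afterOnes y₁) (o a false) q″)
    ... | inj₂ (inj₂ (t , e′ , q″)) = finish e e′ (IH (afterOnes y₁) (o a true) q″)
    split₁ : _ → BinResult o y
    split₁ (inj₁ (_ , q′))            = absurd q′
    split₁ (inj₂ (inj₁ (t , e , q′))) = split₂ e q′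
    split₁ (inj₂ (inj₂ (t , e , q′))) = split₂ e q′
  output-gate : ∀ y → Result (outStep y (toList v)) → Accepts (false ∷ false ∷ y) v
  output-gate y q with caseStr-split Result (dropS (ones y) y) q
  ... | inj₁ (_ , q′) = absurd q′
  ... | inj₂ (inj₂ (_ , _ , q′)) = absurd q′
  ... | inj₂ (inj₁ (t , e , q′)) with caseStr-split Result t q′
  ...   | inj₂ (inj₁ (_ , _ , q″)) = absurd q″
  ...   | inj₂ (inj₂ (_ , _ , q″)) = absurd q″
  ...   | inj₁ (refl , q″) = go (dropS (ones y) (toList v)) refl q″
    where
    go : ∀ d → dropS (ones y) (toList v) ≡ d → Result ([] ∷ [] ∷ headS d ∷ []) → Accepts (false ∷ false ∷ y) v
    go []          eq r = absurd r
    go (false ∷ d) eq r = case trans (sym (cong (λ s → V.lookup s #2) (iter-fixed evalStep x (evalStep-done false)))) r of λ ()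
    go (true ∷ d)  eq r with lookup-drop v (ones y) eq
    ... | i , pi , li = out i , cong (λ z → false ∷ false ∷ z) (trans (cong encℕ pi) (trans (sym (++-identityʳ _)) (sym (out-ones y e)))) , li
  gate : ∀ g → Result (gateStep g (toList v)) → Accepts g v
  gate [] q = absurd q
  gate (false ∷ []) q = absurd q
  gate (true ∷ []) q = absurd q
  gate (false ∷ false ∷ y) q = output-gate y q
  gate (false ∷ true ∷ y) q = let (i , j , C , e , ev) = binop _∧_ y q in and i j C , cong (λ z → false ∷ true ∷ z) e , ev
  gate (true ∷ false ∷ y) q = let (i , j , C , e , ev) = binop _∨_ y q in or i j C , cong (λ z → true ∷ false ∷ z) e , ev
  gate (true ∷ true ∷ y) q = unop y q

satisfies : ∀ {n} (C : Circuit n) a → InSet C a → evalS (encCircuit C) a ≡ true ∷ []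
satisfies C a (refl , ev) = trans (cong (evalS (encCircuit C)) (sym (VP.toList∘fromList a))) (trans (evalS-complete C (fromList a)) (cong (_∷ []) ev))

evalS-complete-Sat : ∀ {q a} → SatWitness q a → evalS q a ≡ true ∷ []
evalS-complete-Sat (n , C , refl , i) = satisfies C _ i

-- `evalS` looks at the gates and not at the declared number of inputs, so the length of `a` has to
-- be compared with the declaration separately.
evalS-sound-Sat : ∀ q a → length a ≡ length (ones q) → evalS q a ≡ true ∷ [] → SatWitness q a
evalS-sound-Sat q a len eq with eval-sound (true ∷ q) (afterOnes q) (fromList a) (trans (cong (λ l → V.lookup (iterV evalStep (true ∷ q) (afterOnes q ∷ l ∷ [] ∷ [])) #2) (VP.toList∘fromList a)) eq)
... | C , e , ev with encGates-∷ C
...   | b , t , e′ = length a , C , trans (cong₂ (λ n z → encℕ n ++ z) len (trans e (trans (sym e) e′))) (sym (encℕ-ones q (trans (sym e) e′))) , refl , ev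

-- Simulation of an oracle machine whose replies are read from a string, in
-- blocks of length B: 0 and a witness for YES, 1 for NO.

replyOf : Str → Str → Reply
replyOf q (false ∷ ys) = just (takeS (ones q) ys)
replyOf q _            = nothing

EntryOk : Entry → Set
EntryOk (q , nothing) = ⊤
EntryOk (q , just a)  = evalS q a ≡ true ∷ []

AllOk : List Entry → Set
AllOk []      = ⊤
AllOk (e ∷ L) = EntryOk e × AllOk L

boolPrefix-length : ∀ l → length (boolPrefix l) ≤ length l
boolPrefix-length []            = z≤n
boolPrefix-length (nothing ∷ l) = z≤n
boolPrefix-length (just b ∷ l)  = s≤s (boolPrefix-length l)

-- Bounds the query length, and unlike the query length it grows by at most one per step: filling a
-- blank can suddenly lengthen the query.
extent : Tape → ℕ
extent t = length (left t) + length (right t)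

extent-move : ∀ s m t → extent (writeMove s m t) ≤ suc (extent t)
extent-move s mvL (tape [] h r)      = n≤1+n _
extent-move s mvL (tape (x ∷ l) h r) = ≤-trans (≤-reflexive (+-suc (length l) (length r))) (n≤1+n _)
extent-move s mvR (tape l h [])      = ≤-refl
extent-move s mvR (tape l h (x ∷ r)) = s≤s (+-monoʳ-≤ (length l) (n≤1+n _))
extent-move s mvS (tape l h r)       = n≤1+n _

query-length : ∀ t → length (fromLeftEnd t) ≤ suc (extent t)
query-length (tape l h r) = ≤-trans (boolPrefix-length (reverse l ++ h ∷ r)) (≤-reflexive
  (trans (length-++ (reverse l)) (trans (cong (_+ suc (length r)) (length-reverse l)) (+-suc (length l) (length r)))))

take-++-≤ : ∀ n (x y : Str) → n ≤ length x → List.take n (x ++ y) ≡ List.take n x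
take-++-≤ zero    x       y le       = refl
take-++-≤ (suc n) (b ∷ x) y (s≤s le) = cong (b ∷_) (take-++-≤ n x y le)

drop-un : ∀ n k → List.drop n (un k) ≡ un (k ∸ n)
drop-un zero    k       = refl
drop-un (suc n) zero    = refl
drop-un (suc n) (suc k) = drop-un n k

drop-++-≥ : ∀ n (x y : Str) → length x ≤ n → List.drop n (x ++ y) ≡ List.drop (n ∸ length x) y
drop-++-≥ n       []      y le       = refl
drop-++-≥ (suc n) (b ∷ x) y (s≤s le) = drop-++-≥ n x y le

lex-++ : ∀ x {y z} → y <lex z → (x ++ y) <lex (x ++ z)
lex-++ []      lt = lt
lex-++ (b ∷ x) lt = there (lex-++ x lt)

module Simulation (M : OTM) (B⁻ : ℕ) where
  open OTM M

  B : ℕ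
  B = suc B⁻

  queryOf : OConf M → Str
  queryOf c = fromLeftEnd (OConf.orac c)

  sim : ℕ → OConf M → Str → List Entry
  sim zero    c ys = []
  sim (suc t) c ys with OConf.state c F.≟ qry
  ... | yes _ = (queryOf c , replyOf (queryOf c) ys) ∷ sim t (answer M c (replyOf (queryOf c) ys)) (List.drop B ys)
  ... | no  _ = sim t (ostep M c) ys

  sim-at-query : ∀ t c ys → OConf.state c ≡ qry →
    sim (suc t) c ys ≡ (queryOf c , replyOf (queryOf c) ys) ∷ sim t (answer M c (replyOf (queryOf c) ys)) (List.drop B ys)
  sim-at-query t c ys e with OConf.state c F.≟ qry
  ... | yes _ = refl
  ... | no ne = ⊥-elim (ne e)

  sim-off-query : ∀ t c ys → OConf.state c ≢ qry → sim (suc t) c ys ≡ sim t (ostep M c) ys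
  sim-off-query t c ys ne with OConf.state c F.≟ qry
  ... | yes e = ⊥-elim (ne e)
  ... | no _  = refl

  sim-consistent : ∀ t c ys → Consistent M t c (sim t c ys)
  sim-consistent zero    c ys = refl
  sim-consistent (suc t) c ys with OConf.state c F.≟ qry
  ... | yes _ = refl , sim-consistent t _ _
  ... | no  _ = sim-consistent t _ ys

  -- A string of ones answers NO throughout, and NO is never checked. Such strings provide the given
  -- element of S and the padding after a corrected reply.
  sim-no : ∀ t c k → AllOk (sim t c (un k))
  sim-no zero    c k = tt
  sim-no (suc t) c k with OConf.state c F.≟ qry
  sim-no (suc t) c zero    | yes _ = tt , sim-no t _ 0
  sim-no (suc t) c (suc k) | yes _ = tt , subst (λ ys → AllOk (sim t _ ys)) (sym (drop-un B⁻ k)) (sim-no t _ _)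
  sim-no (suc t) c k       | no _  = sim-no t (ostep M c) k

  extent-ostep : ∀ c → extent (OConf.orac (ostep M c)) ≤ suc (extent (OConf.orac c))
  extent-ostep (oconf q w o) with q F.≟ halt
  ... | yes _ = n≤1+n _
  ... | no  _ = extent-move (proj₁ (proj₂ (proj₂ (δ q (head w) (head o))))) (proj₂ (proj₂ (proj₂ (δ q (head w) (head o))))) o

  answer-orac : ∀ c r → OConf.orac (answer M c r) ≡ OConf.orac c
  answer-orac (oconf _ w o) (just _) = refl
  answer-orac (oconf _ w o) nothing  = refl

  -- With t steps to go, every later query fits into the witness part of a block.
  Fits : ℕ → OConf M → Set
  Fits t c = extent (OConf.orac c) + t ≤ B⁻

  fits-answer : ∀ {t c} r → Fits (suc t) c → Fits t (answer M c r)
  fits-answer {t} {c} r f rewrite answer-orac c r = ≤-trans (+-monoʳ-≤ (extent (OConf.orac c)) (n≤1+n t)) f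

  fits-ostep : ∀ {t c} → Fits (suc t) c → Fits t (ostep M c)
  fits-ostep {t} {c} f = ≤-trans (+-monoˡ-≤ t (extent-ostep c)) (≤-trans (≤-reflexive (sym (+-suc (extent (OConf.orac c)) t))) f)

  fits-query : ∀ {t c} → Fits (suc t) c → length (queryOf c) ≤ B⁻
  fits-query {t} {c} f = ≤-trans (query-length (OConf.orac c)) (≤-trans (≤-reflexive (+-comm 1 _))
    (≤-trans (+-monoʳ-≤ (extent (OConf.orac c)) (s≤s (z≤n {t}))) f))

  drop-length : ∀ t (ys : Str) → suc t * B ≤ length ys → t * B ≤ length (List.drop B ys)
  drop-length t ys le = ≤-trans (≤-reflexive (sym (m+n∸m≡n B (t * B)))) (≤-trans (∸-monoˡ-≤ B le) (≤-reflexive (sym (length-drop B ys))))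

  -- A block is long enough for any query that can still occur, and a query declares at most as many
  -- inputs as it has symbols. Hence the witness cut from the block has exactly the declared length,
  -- as `evalS-sound-Sat` requires.
  sim-yes : ∀ t c ys → Fits t c → t * B ≤ length ys → AllOk (sim t c ys) → YesCorrect (sim t c ys)
  sim-yes zero    c ys f le ok = tt
  sim-yes (suc t) c ys f le ok with OConf.state c F.≟ qry
  sim-yes (suc t) c ys f le ok | no _ = sim-yes t _ ys (fits-ostep {t} {c} f) (≤-trans (m≤n+m _ B) le) ok
  sim-yes (suc t) c [] f le ok | yes _ = case ≤-trans (s≤s z≤n) le of λ ()
  sim-yes (suc t) c (true ∷ ys) f le (_ , ok) | yes _ =
    sim-yes t _ _ (fits-answer {t} {c} nothing f) (drop-length t (true ∷ ys) le) ok
  sim-yes (suc t) c (false ∷ ys) f le (ok₁ , ok) | yes _ =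
    evalS-sound-Sat (queryOf c) _ (trans (length-take (length (ones (queryOf c))) ys) (m≤n⇒m⊓n≡m fit)) ok₁ ,
    sim-yes t _ _ (fits-answer {t} {c} (just []) f) (drop-length t (false ∷ ys) le) ok
    where
    fit : length (ones (queryOf c)) ≤ length ys
    fit = ≤-trans (ones-≤ (queryOf c)) (≤-trans (fits-query {t} {c} f) (≤-trans (m≤m+n B⁻ (t * B)) (≤-pred le)))

  -- The string y with its i-th reply changed to YES with witness a and all later ones to NO.
  revise : ℕ → Str → Str → ℕ → Str
  revise i a ys k = List.take (i * B) ys ++ false ∷ a ++ un k

  Sat-length : ∀ {q a} → SatWitness q a → length a ≡ length (ones q)
  Sat-length (n , C , refl , (e , _)) = trans e (sym (trans (cong length (ones-enc n (encGates C))) (length-replicate n)))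

  replyOf-++ : ∀ q b blk ys zs → length (ones q) ≤ length blk → replyOf q (b ∷ blk ++ ys) ≡ replyOf q (b ∷ blk ++ zs)
  replyOf-++ q true  blk ys zs le = refl
  replyOf-++ q false blk ys zs le = cong just (trans (take-++-≤ (length (ones q)) blk ys le) (sym (take-++-≤ (length (ones q)) blk zs le)))

  -- The blocks before the i-th are kept, so the run reaches the same query. Its block began with 1,
  -- so the new 0 makes the string smaller; the new witness is correct, and afterwards there are
  -- only NO replies. The last two inequalities serve to compute the length of the revised string.
  sim-revise : ∀ t c ys i q a k → Fits t c → t * B ≤ length ys → AllOk (sim t c ys) →
               entryAt (sim t c ys) i ≡ just (q , nothing) → SatWitness q a →
               AllOk (sim t c (revise i a ys k)) × (revise i a ys k <lex ys) × suc i ≤ t × length a ≤ B⁻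
  sim-revise zero    c ys i q a k f le ok () sat
  sim-revise (suc t) c ys i q a k f le ok e sat with OConf.state c F.≟ qry
  sim-revise (suc t) c ys i q a k f le ok e sat | no _
    with sim-revise t _ ys i q a k (fits-ostep {t} {c} f) (≤-trans (m≤n+m _ B) le) ok e sat
  ... | ok′ , lt , i≤ , a≤ = ok′ , lt , ≤-trans i≤ (n≤1+n _) , a≤
  sim-revise (suc t) c [] i q a k f le ok e sat | yes _ = case ≤-trans (s≤s z≤n) le of λ ()
  sim-revise (suc t) c (false ∷ ys) zero q a k f le ok () sat | yes _
  sim-revise (suc t) c (true ∷ ys) zero q a k f le ok refl sat | yes _ = (ok₁ , ok₂) , here , s≤s z≤n , a≤
    where
    a≤ : length a ≤ B⁻
    a≤ = ≤-trans (≤-reflexive (Sat-length sat)) (≤-trans (ones-≤ (queryOf c)) (fits-query {t} {c} f))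
    ok₁ : evalS (queryOf c) (takeS (ones (queryOf c)) (a ++ un k)) ≡ true ∷ []
    ok₁ = trans (cong (evalS (queryOf c)) (trans (cong (λ n → List.take n (a ++ un k)) (sym (Sat-length sat)))
            (trans (take-++-≤ (length a) a (un k) ≤-refl) (take-all (length a) a ≤-refl)))) (evalS-complete-Sat sat)
    ok₂ : AllOk (sim t (answer M c (just (takeS (ones (queryOf c)) (a ++ un k)))) (List.drop B⁻ (a ++ un k)))
    ok₂ = subst (λ ys → AllOk (sim t _ ys)) (sym (trans (drop-++-≥ B⁻ a (un k) a≤) (drop-un (B⁻ ∸ length a) k))) (sim-no t _ _)
  sim-revise (suc t) c (b ∷ ys) (suc i) q a k f le (ok₀ , ok) e sat | yes _ = conclusion
    where
    blk rest : Str
    blk  = List.take B⁻ ys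
    rest = List.drop B⁻ ys
    ys-≡ : blk ++ rest ≡ ys
    ys-≡ = take++drop≡id B⁻ ys
    blk-length : length blk ≡ B⁻
    blk-length = trans (length-take B⁻ ys) (m≤n⇒m⊓n≡m (≤-trans (m≤m+n B⁻ (t * B)) (≤-pred le)))
    revised : revise (suc i) a (b ∷ ys) k ≡ b ∷ blk ++ revise i a rest k
    revised = cong (b ∷_) (trans (cong (_++ false ∷ a ++ un k) (take-split B⁻ (i * B) ys)) (++-assoc blk _ _))
      where
      take-split : ∀ m n (x : Str) → List.take (m + n) x ≡ List.take m x ++ List.take n (List.drop m x)
      take-split zero    n x       = refl
      take-split (suc m) n []      = sym (take-[] n)
      take-split (suc m) n (y ∷ x) = cong (y ∷_) (take-split m n x)
    same-reply : replyOf (queryOf c) (b ∷ blk ++ revise i a rest k) ≡ replyOf (queryOf c) (b ∷ ys)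
    same-reply = trans (replyOf-++ (queryOf c) b blk (revise i a rest k) rest
        (≤-trans (ones-≤ (queryOf c)) (≤-trans (fits-query {t} {c} f) (≤-reflexive (sym blk-length)))))
      (cong (λ z → replyOf (queryOf c) (b ∷ z)) ys-≡)
    after : List.drop B⁻ (blk ++ revise i a rest k) ≡ revise i a rest k
    after = trans (drop-++-≥ B⁻ blk _ (≤-reflexive blk-length)) (cong (λ n → List.drop n (revise i a rest k)) (trans (cong (B⁻ ∸_) blk-length) (n∸n≡0 B⁻)))
    conclusion : AllOk ((queryOf c , replyOf (queryOf c) (revise (suc i) a (b ∷ ys) k)) ∷
                    sim t (answer M c (replyOf (queryOf c) (revise (suc i) a (b ∷ ys) k))) (List.drop B (revise (suc i) a (b ∷ ys) k)))
             × (revise (suc i) a (b ∷ ys) k <lex (b ∷ ys)) × suc (suc i) ≤ suc t × length a ≤ B⁻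
    conclusion = subst Revised (sym revised)
        (subst₂ (λ r d → EntryOk (queryOf c , r) × AllOk (sim t (answer M c r) d)) (sym same-reply) (sym after) (ok₀ , proj₁ IH) ,
         subst ((b ∷ blk ++ revise i a rest k) <lex_) (cong (b ∷_) ys-≡) (there (lex-++ blk (proj₁ (proj₂ IH)))) ,
         s≤s (proj₁ (proj₂ (proj₂ IH))) , proj₂ (proj₂ (proj₂ IH)))
      where
      Revised : Str → Set
      Revised z = AllOk ((queryOf c , replyOf (queryOf c) z) ∷ sim t (answer M c (replyOf (queryOf c) z)) (List.drop B z))
                  × (z <lex (b ∷ ys)) × suc (suc i) ≤ suc t × length a ≤ B⁻
      IH : AllOk (sim t (answer M c (replyOf (queryOf c) (b ∷ ys))) (revise i a rest k)) × (revise i a rest k <lex rest) × suc i ≤ t × length a ≤ B⁻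
      IH = sim-revise t (answer M c (replyOf (queryOf c) (b ∷ ys))) rest i q a k (fits-answer {t} {c} (replyOf (queryOf c) (b ∷ ys)) f)
             (drop-length t (b ∷ ys) le) ok e sat

-- Simulating an oracle machine on encoded configurations. A symbol is coded by
-- two bits; left of a head the codes are reversed.

take2 drop2 hd2 : Str → Str
take2 x = headS x ++ headS (tailS x)
drop2 x = tailS (tailS x)
hd2 r = caseStr r (false ∷ false ∷ []) (λ x → false ∷ headS x) (λ x → true ∷ headS x)

take2-F : F1 take2
take2-F = mk1 (ap1 head-F (arg #0) ++F ap1 head-F (ap1 tail-F (arg #0)))

drop2-F : F1 drop2
drop2-F = mk1 (ap1 tail-F (ap1 tail-F (arg #0)))

hd2-F : F1 hd2
hd2-F = mk1 (matchF (arg #0) (constF (false ∷ false ∷ [])) (consF false (ap1 head-F (arg #0))) (consF true (ap1 head-F (arg #0))))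

module _ (l s r : Str) where

  leftS rightS : Vec Str 3
  leftS = caseStr l (l ∷ s ∷ r ∷ [])
    (λ x → caseStr x ([] ∷ s ∷ r ∷ []) (λ y → y ∷ (false ∷ false ∷ []) ∷ (s ++ r) ∷ []) (λ y → y ∷ (true ∷ false ∷ []) ∷ (s ++ r) ∷ []))
    (λ x → caseStr x ([] ∷ s ∷ r ∷ []) (λ y → y ∷ (false ∷ true ∷ []) ∷ (s ++ r) ∷ []) (λ y → y ∷ (true ∷ true ∷ []) ∷ (s ++ r) ∷ []))
  rightS = (reverse s ++ l) ∷ hd2 r ∷ drop2 r ∷ []

  moveS : Str → Vec Str 3
  moveS m = caseStr m (l ∷ s ∷ r ∷ []) (λ _ → leftS) (λ m′ → caseStr m′ (l ∷ s ∷ r ∷ []) (λ _ → rightS) (λ _ → l ∷ s ∷ r ∷ []))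

move-P : P {4} (λ v → moveS (V.lookup v #0) (V.lookup v #1) (V.lookup v #2) (V.lookup v #3))
move-P = matchP (arg #3) (arg #0 ∷P arg #1 ∷P arg #2)
  (matchP (arg #1) (arg #1 ∷P arg #2 ∷P arg #3)
    (matchP (arg #0) (nil-P ∷P arg #3 ∷P arg #4) (l-P #0 #4 #5 false false) (l-P #0 #4 #5 true false))
    (matchP (arg #0) (nil-P ∷P arg #3 ∷P arg #4) (l-P #0 #4 #5 false true) (l-P #0 #4 #5 true true)))
  (matchP (arg #0) (arg #1 ∷P arg #2 ∷P arg #3)
    ((ap1 rev-P (arg #3) ++F arg #2) ∷P ap1 hd2-F (arg #4) ∷P ap1 drop2-F (arg #4))
    (arg #2 ∷P arg #3 ∷P arg #4))
  where
  l-P : ∀ {n} (i j k : Fin n) b c → P (λ v → V.lookup v i ∷ (b ∷ c ∷ []) ∷ (V.lookup v j ++ V.lookup v k) ∷ [])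
  l-P i j k b c = arg i ∷P constF (b ∷ c ∷ []) ∷P (arg j ++F arg k)

tailS-≤ : ∀ x → length (tailS x) ≤ length x
tailS-≤ []      = z≤n
tailS-≤ (_ ∷ x) = n≤1+n _

headS-≤ : ∀ x → length (headS x) ≤ 1
headS-≤ []      = z≤n
headS-≤ (_ ∷ x) = ≤-refl

take2-≤ : ∀ x → length (take2 x) ≤ 2
take2-≤ x = ≤-trans (≤-reflexive (length-++ (headS x))) (+-mono-≤ (headS-≤ x) (headS-≤ (tailS x)))

drop2-≤ : ∀ x → length (drop2 x) ≤ length x
drop2-≤ x = ≤-trans (tailS-≤ (tailS x)) (tailS-≤ x)

move-size : ∀ l s r m → length s ≤ 2 → szV (moveS l s r m) ≤ 7 + (length l + length r)
move-size l s r m s≤2 = caseStr-elim Q m keep (λ _ _ → caseStr-elim Q l keep (λ x x≤ → back false x x≤) (λ x x≤ → back true x x≤))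
    (λ m′ _ → caseStr-elim Q m′ keep (λ _ _ → right≤) (λ _ _ → keep))
  where
  Q : Vec Str 3 → Set
  Q v = szV v ≤ 7 + (length l + length r)
  sum : ∀ {a b c : ℕ} → a + (b + c) ≤ 4 + (length l + length r) → suc a + (suc b + (suc c + 0)) ≤ 7 + (length l + length r)
  sum {a} {b} {c} le = ≤-trans (≤-reflexive (arith a b c)) (+-monoʳ-≤ 3 le)
    where
    arith : ∀ a b c → (1 + a) + ((1 + b) + ((1 + c) + 0)) ≡ 3 + (a + (b + c))
    arith = solve-∀
  swap : ∀ a b c → a + (b + c) ≡ b + (a + c)
  swap = solve-∀
  keep : Q (l ∷ s ∷ r ∷ [])
  keep = sum {length l} {length s} {length r} (≤-trans (≤-reflexive (swap (length l) (length s) (length r))) (+-monoˡ-≤ (length l + length r) (≤-trans s≤2 (m≤m+n 2 2))))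
  back : ∀ b x → length x ≤ length l → Q (caseStr x ([] ∷ s ∷ r ∷ []) (λ y → y ∷ (false ∷ b ∷ []) ∷ (s ++ r) ∷ []) (λ y → y ∷ (true ∷ b ∷ []) ∷ (s ++ r) ∷ []))
  back b x x≤ = caseStr-elim Q x (sum {0} {length s} {length r} (+-mono-≤ (≤-trans s≤2 (m≤m+n 2 2)) (m≤n+m (length r) (length l)))) (cell false) (cell true)
    where
    cell : ∀ c y → length y ≤ length x → Q (y ∷ (c ∷ b ∷ []) ∷ (s ++ r) ∷ [])
    cell c y y≤ = sum {length y} {2} {length (s ++ r)} (≤-trans (≤-reflexive (trans (cong (λ n → length y + (2 + n)) (length-++ s)) (arith (length y) (length s) (length r))))
      (+-mono-≤ (+-monoʳ-≤ 2 s≤2) (+-monoˡ-≤ (length r) (≤-trans y≤ x≤))))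
      where
      arith : ∀ a b c → a + (2 + (b + c)) ≡ (2 + b) + (a + c)
      arith = solve-∀
  hd2-≤ : ∀ r → length (hd2 r) ≤ 2
  hd2-≤ []          = ≤-refl
  hd2-≤ (false ∷ x) = s≤s (headS-≤ x)
  hd2-≤ (true ∷ x)  = s≤s (headS-≤ x)
  right≤ : Q (rightS l s r)
  right≤ = sum {length (reverse s ++ l)} {length (hd2 r)} {length (drop2 r)} (≤-trans
    (≤-reflexive (trans (cong (_+ (length (hd2 r) + length (drop2 r))) (trans (length-++ (reverse s)) (cong (_+ length l) (length-reverse s))))
      (arith (length s) (length l) (length (hd2 r)) (length (drop2 r)))))
    (+-mono-≤ (+-mono-≤ s≤2 (hd2-≤ r)) (+-monoʳ-≤ (length l) (drop2-≤ r))))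
    where
    arith : ∀ a b c d → (a + b) + (c + d) ≡ (a + c) + (b + d)
    arith = solve-∀

eqU : Str → Str → Str
eqU a b = caseStr (dropS a b) (caseStr (dropS b a) (true ∷ []) (λ _ → []) (λ _ → [])) (λ _ → []) (λ _ → [])

eqU-F : F2 eqU
eqU-F = mk2 (matchF (ap2 drop-F (arg #0) (arg #1)) (matchF (ap2 drop-F (arg #1) (arg #0)) (constF (true ∷ [])) nil-P nil-P) nil-P nil-P)

skipEntry : Str → Str
skipEntry x = drop2 (drop2 (drop2 (drop2 (afterOnes x))))

skipEntry-F : F1 skipEntry
skipEntry-F = mk1 (ap1 drop2-F (ap1 drop2-F (ap1 drop2-F (ap1 drop2-F (ap1 afterOnes-F (arg #0))))))

skipEntry-≤ : ∀ x → length (skipEntry x) ≤ length x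
skipEntry-≤ x = ≤-trans (drop2-≤ (drop2 (drop2 (drop2 y)))) (≤-trans (drop2-≤ (drop2 (drop2 y))) (≤-trans (drop2-≤ (drop2 y)) (≤-trans (drop2-≤ y) (afterOnes-≤ x))))
  where
  y = afterOnes x

skipS : Str → Str → Str
skipS []      x = x
skipS (_ ∷ n) x = skipEntry (skipS n x)

skipS-≤ : ∀ n x → length (skipS n x) ≤ length x
skipS-≤ []      x = ≤-refl
skipS-≤ (_ ∷ n) x = ≤-trans (skipEntry-≤ (skipS n x)) (skipS-≤ n x)

skip-F : F2 skipS
skip-F = rec-F2 skipS (arg #0) (ap1 skipEntry-F (arg #1)) (ap1 skipEntry-F (arg #1)) (λ _ → refl) (λ _ _ → refl) (λ _ _ → refl) X
  (λ n x → ≤-trans (skipS-≤ n x) (m≤n+m _ (length n)))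

symIx : Str → Str
symIx x = caseStr x [] (λ _ → []) (λ y → caseStr y [] (λ _ → true ∷ []) (λ _ → true ∷ true ∷ []))

symIx-F : F1 symIx
symIx-F = mk1 (matchF (arg #0) nil-P nil-P (matchF (arg #0) nil-P (constF (true ∷ [])) (constF (true ∷ true ∷ []))))

bpS : Str → Str
bpS []              = []
bpS (a ∷ [])        = []
bpS (false ∷ c ∷ x) = []
bpS (true ∷ c ∷ x)  = c ∷ bpS x

bp-F : F1 bpS
bp-F = rec2-F bpS nil-P nil-P (consF false (arg #1)) (consF true (arg #1)) refl (λ _ → refl) (λ _ → refl) (λ _ → refl) (λ _ → refl) (λ _ → refl) bd
  where
  bd : ∀ x → length (bpS x) ≤ length x
  bd []              = z≤n
  bd (a ∷ [])        = z≤n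
  bd (false ∷ c ∷ x) = z≤n
  bd (true ∷ c ∷ x)  = s≤s (≤-trans (bd x) (n≤1+n _))

encStr-mapS : ∀ x → mapS (λ b → b ∷ b ∷ []) x ++ (false ∷ true ∷ []) ≡ encStr x
encStr-mapS x = cong (_++ (false ∷ true ∷ [])) (go x)
  where
  go : ∀ x → mapS (λ b → b ∷ b ∷ []) x ≡ concatMap (λ b → b ∷ b ∷ []) x
  go []      = refl
  go (b ∷ x) = cong (λ z → b ∷ b ∷ z) (go x)

encStr-F : F1 encStr
encStr-F = mkF1 (ap1 (map-F (λ b → b ∷ b ∷ [])) (arg #0) ++F constF (false ∷ true ∷ [])) encStr-mapS

-- A state consists of the control state, the two tapes and the unread part of
-- the replies, and the constants halt, qry, yes, no, the table and the block length.
module _ (q wl wh wr ol oh or′ ys ha qr ye nn tab bl : Str) where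

  -- The table is sorted by state, work symbol and oracle symbol, so the entry has number 9 times
  -- the state plus 3 times the work symbol plus the oracle symbol.
  entryPtr queryStr : Str
  entryPtr = skipS (timesS 9 q ++ timesS 3 (symIx wh) ++ symIx oh) tab
  queryStr = bpS (reverse ol ++ oh ++ or′)

  normalD : Vec Str 8
  normalD = let e = afterOnes entryPtr in
    ones entryPtr ∷ (moveS wl (take2 e) wr (take2 (drop2 e)) V.++ (moveS ol (take2 (drop2 (drop2 e))) or′ (take2 (drop2 (drop2 (drop2 e)))) V.++ ys ∷ []))

  queryD : Vec Str 8
  queryD = caseStr ys nn (λ _ → ye) (λ _ → nn) ∷ wl ∷ wh ∷ wr ∷ ol ∷ oh ∷ or′ ∷ dropS bl ys ∷ []

  stepD : Vec Str 8
  stepD = caseStr (eqU q qr) (caseStr (eqU q ha) normalD (λ _ → q ∷ wl ∷ wh ∷ wr ∷ ol ∷ oh ∷ or′ ∷ ys ∷ []) (λ _ → q ∷ wl ∷ wh ∷ wr ∷ ol ∷ oh ∷ or′ ∷ ys ∷ []))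
    (λ _ → queryD) (λ _ → queryD)

  -- The contributions of one time step: `entryStr` gives its part of the transcript, and `failStr`
  -- a mark if a YES reply is wrong. Concatenated over all times, the marks form the empty string
  -- exactly if every YES passes the check.
  replyStr entryStr failStr : Str
  replyStr = caseStr ys (false ∷ []) (λ a → true ∷ encStr (takeS (ones queryStr) a)) (λ _ → false ∷ [])
  entryStr = caseStr (eqU q qr) [] (λ _ → true ∷ encStr queryStr ++ replyStr) (λ _ → true ∷ encStr queryStr ++ replyStr)
  failStr = caseStr (eqU q qr) [] (λ _ → check) (λ _ → check)
    where
    notTrue : Str → Str
    notTrue x = caseStr x (true ∷ []) (λ _ → true ∷ []) (λ _ → [])
    check : Str
    check = caseStr ys [] (λ a → notTrue (evalS queryStr (takeS (ones queryStr) a))) (λ _ → [])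

on14 : {A : Set} → (Str → Str → Str → Str → Str → Str → Str → Str → Str → Str → Str → Str → Str → Str → A) → Vec Str 14 → A
on14 f v = f (V.lookup v #0) (V.lookup v #1) (V.lookup v #2) (V.lookup v #3) (V.lookup v #4) (V.lookup v #5) (V.lookup v #6) (V.lookup v #7)
             (V.lookup v #8) (V.lookup v #9) (V.lookup v #10) (V.lookup v #11) (V.lookup v #12) (V.lookup v #13)

constsOf : Vec Str 14 → Vec Str 6
constsOf v = V.lookup v #8 ∷ V.lookup v #9 ∷ V.lookup v #10 ∷ V.lookup v #11 ∷ V.lookup v #12 ∷ V.lookup v #13 ∷ []

stepV14 : Vec Str 14 → Vec Str 14
stepV14 v = on14 stepD v V.++ constsOf v

ptr-F : ∀ {n} (q wh oh tab : Fin n) → Fun n (λ v → skipS (timesS 9 (V.lookup v q) ++ timesS 3 (symIx (V.lookup v wh)) ++ symIx (V.lookup v oh)) (V.lookup v tab))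
ptr-F q wh oh tab = ap2 skip-F (ap1 (times-F 9) (arg q) ++F (ap1 (times-F 3) (ap1 symIx-F (arg wh)) ++F ap1 symIx-F (arg oh))) (arg tab)

query-F : ∀ {n} (ol oh or′ : Fin n) → Fun n (λ v → bpS (reverse (V.lookup v ol) ++ V.lookup v oh ++ V.lookup v or′))
query-F ol oh or′ = ap1 bp-F (ap1 rev-P (arg ol) ++F (arg oh ++F arg or′))

step-P : P stepV14
step-P = fork-P (matchP (ap2 eqU-F (arg #0) (arg #9)) (matchP (ap2 eqU-F (arg #0) (arg #8)) normal-P same-P same-P) query-P query-P)
    (arg #8 ∷P arg #9 ∷P arg #10 ∷P arg #11 ∷P arg #12 ∷P arg #13)
  where
  same-P : P {15} (λ v → V.lookup v #1 ∷ V.lookup v #2 ∷ V.lookup v #3 ∷ V.lookup v #4 ∷ V.lookup v #5 ∷ V.lookup v #6 ∷ V.lookup v #7 ∷ V.lookup v #8 ∷ [])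
  same-P = arg #1 ∷P arg #2 ∷P arg #3 ∷P arg #4 ∷P arg #5 ∷P arg #6 ∷P arg #7 ∷P arg #8
  normal-P : P (on14 normalD)
  normal-P = ap1 ones-F ptr ∷P fork-P (move-P ∘P (arg #1 ∷P ap1 take2-F e ∷P arg #3 ∷P ap1 take2-F (d e)))
               (fork-P (move-P ∘P (arg #4 ∷P ap1 take2-F (d (d e)) ∷P arg #6 ∷P ap1 take2-F (d (d (d e))))) (arg #7))
    where
    ptr : Fun 14 (on14 entryPtr)
    ptr = ptr-F #0 #2 #5 #12
    e : Fun 14 (λ v → afterOnes (on14 entryPtr v))
    e = ap1 afterOnes-F ptr
    d : ∀ {F} → Fun 14 F → Fun 14 (λ v → drop2 (F v))
    d = ap1 drop2-F
  query-P : P {15} (λ v → on14 queryD (V.tail v))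
  query-P = P-ext (λ { (_ ∷ v) → refl }) (matchF (arg #8) (arg #12) (arg #12) (arg #13) ∷P arg #2 ∷P arg #3 ∷P arg #4 ∷P arg #5 ∷P arg #6 ∷P arg #7 ∷P ap2 drop-F (arg #14) (arg #8))

entry-F : Fun 14 (on14 entryStr)
entry-F = matchF (ap2 eqU-F (arg #0) (arg #9)) nil-P ent ent
  where
  ent : Fun 15 (λ v → true ∷ encStr (on14 queryStr (V.tail v)) ++ on14 replyStr (V.tail v))
  ent = fun-ext (λ { (_ ∷ v) → refl }) (consF true (ap1 encStr-F (query-F #5 #6 #7) ++F
    matchF (arg #8) (constF (false ∷ [])) (consF true (ap1 encStr-F (ap2 take-F (ap1 ones-F (query-F #6 #7 #8)) (arg #0)))) (constF (false ∷ []))))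

fail-F : Fun 14 (on14 failStr)
fail-F = matchF (ap2 eqU-F (arg #0) (arg #9)) nil-P check check
  where
  check : Fun 15 _
  check = matchF (arg #8) nil-P (matchF (ap2 eval-F (query-F #6 #7 #8) (ap2 take-F (ap1 ones-F (query-F #6 #7 #8)) (arg #0)))
    (constF (true ∷ [])) (constF (true ∷ [])) nil-P) nil-P

module _ (q wl wh wr ol oh or′ ys ha qr ye nn tab bl : Str) where

  private
    M D : ℕ
    M = szV (ha ∷ qr ∷ ye ∷ nn ∷ tab ∷ bl ∷ [])
    D = szV (wl ∷ wh ∷ wr ∷ ol ∷ oh ∷ or′ ∷ ys ∷ [])

    Small : Vec Str 8 → Set
    Small w = length (V.head w) ≤ length q ⊔ M × szV (V.tail w) ≤ 16 + D

    const≤ : ∀ i → length (V.lookup (ha ∷ qr ∷ ye ∷ nn ∷ tab ∷ bl ∷ []) i) ≤ length q ⊔ M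
    const≤ i = ≤-trans (len≤sz (ha ∷ qr ∷ ye ∷ nn ∷ tab ∷ bl ∷ []) i) (m≤n⊔m (length q) M)

    ptr : Str
    ptr = entryPtr q wl wh wr ol oh or′ ys ha qr ye nn tab bl

    ptr≤ : length ptr ≤ length q ⊔ M
    ptr≤ = ≤-trans (skipS-≤ (timesS 9 q ++ timesS 3 (symIx wh) ++ symIx oh) tab) (const≤ #4)

    total : ∀ a b c d e f g → (7 + (a + c)) + ((7 + (d + f)) + (suc g + 0)) + (3 + b + e) ≡
            16 + (suc a + (suc b + (suc c + (suc d + (suc e + (suc f + (suc g + 0)))))))  ∸ 5
    total a b c d e f g = cong (_∸ 5) {x = 5 + ((7 + (a + c)) + ((7 + (d + f)) + (suc g + 0)) + (3 + b + e))} (arith a b c d e f g)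
      where
      arith : ∀ a b c d e f g → 5 + ((7 + (a + c)) + ((7 + (d + f)) + ((1 + g) + 0)) + (3 + b + e)) ≡
              16 + ((1 + a) + ((1 + b) + ((1 + c) + ((1 + d) + ((1 + e) + ((1 + f) + ((1 + g) + 0)))))))
      arith = solve-∀

    move₂-size : ∀ (u v : Vec Str 3) → szV u ≤ 7 + (length wl + length wr) → szV v ≤ 7 + (length ol + length or′) →
                 szV (u V.++ (v V.++ ys ∷ [])) ≤ 16 + D
    move₂-size u v p r = ≤-trans (≤-reflexive (trans (szV-++ u (v V.++ ys ∷ [])) (cong (szV u +_) (szV-++ v (ys ∷ [])))))
      (≤-trans (+-mono-≤ p (+-monoˡ-≤ _ r)) (≤-trans (m≤m+n _ (3 + length wh + length oh))
      (≤-trans (≤-reflexive (total (length wl) (length wh) (length wr) (length ol) (length oh) (length or′) (length ys))) (m∸n≤m (16 + D) 5))))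

  stepD-size : Small (stepD q wl wh wr ol oh or′ ys ha qr ye nn tab bl)
  stepD-size = caseStr-elim Small (eqU q qr) (caseStr-elim Small (eqU q ha) normal (λ _ _ → same) (λ _ _ → same)) (λ _ _ → query) (λ _ _ → query)
    where
    same : Small (q ∷ wl ∷ wh ∷ wr ∷ ol ∷ oh ∷ or′ ∷ ys ∷ [])
    same = m≤m⊔n (length q) M , m≤n+m D 16
    normal : Small (normalD q wl wh wr ol oh or′ ys ha qr ye nn tab bl)
    normal = ≤-trans (ones-≤ ptr) ptr≤ , move₂-size (moveS wl (take2 e) wr (take2 (drop2 e))) (moveS ol (take2 (drop2 (drop2 e))) or′ (take2 (drop2 (drop2 (drop2 e)))))
        (move-size wl (take2 e) wr (take2 (drop2 e)) (take2-≤ e)) (move-size ol (take2 (drop2 (drop2 e))) or′ (take2 (drop2 (drop2 (drop2 e)))) (take2-≤ (drop2 (drop2 e))))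
      where
      e = afterOnes ptr
    query : Small (queryD q wl wh wr ol oh or′ ys ha qr ye nn tab bl)
    query = caseStr-elim (λ s → length s ≤ length q ⊔ M) ys (const≤ #3) (λ _ _ → const≤ #2) (λ _ _ → const≤ #3) ,
      ≤-trans (+-monoʳ-≤ (suc (length wl)) (+-monoʳ-≤ (suc (length wh)) (+-monoʳ-≤ (suc (length wr)) (+-monoʳ-≤ (suc (length ol)) (+-monoʳ-≤ (suc (length oh)) (+-monoʳ-≤ (suc (length or′))
        (+-monoˡ-≤ 0 (s≤s (≤-trans (≤-reflexive (length-drop (length bl) ys)) (m∸n≤m (length ys) (length bl))))))))))) (m≤n+m D 16)

-- A unary state number can jump by the length of the table in one step, so `iterGrow-P` does not
-- apply. But it is always read from the constants, whence the maximum; the remaining data grow by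
-- at most 16 per round.
iter-size : ∀ x (w : Vec Str 8) (c : Vec Str 6) →
            szV (iterV stepV14 x (w V.++ c)) ≤ length x * 16 + (suc (length (V.head w) ⊔ szV c) + (szV (V.tail w) + szV c))
iter-size [] (q ∷ d) c = ≤-trans (≤-reflexive (trans (szV-++ (q ∷ d) c) (cong suc (+-assoc (length q) (szV d) (szV c))))) (s≤s (+-monoˡ-≤ _ (m≤m⊔n (length q) (szV c))))
iter-size (b ∷ x) (q ∷ d@(wl ∷ wh ∷ wr ∷ ol ∷ oh ∷ or′ ∷ ys ∷ [])) c@(ha ∷ qr ∷ ye ∷ nn ∷ tab ∷ bl ∷ []) =
    go (stepD q wl wh wr ol oh or′ ys ha qr ye nn tab bl) (stepD-size q wl wh wr ol oh or′ ys ha qr ye nn tab bl)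
  where
  arith : ∀ a m d c → a + (1 + (m + ((16 + d) + c))) ≡ (16 + a) + (1 + (m + (d + c)))
  arith = solve-∀
  go : ∀ w → (length (V.head w) ≤ length q ⊔ szV c) × (szV (V.tail w) ≤ 16 + szV d) →
       szV (iterV stepV14 x (w V.++ c)) ≤ length (b ∷ x) * 16 + (suc (length q ⊔ szV c) + (szV d + szV c))
  go w (h≤ , t≤) = ≤-trans (iter-size x w c) (≤-trans
    (+-monoʳ-≤ (length x * 16) (s≤s (+-mono-≤ (⊔-lub h≤ (m≤n⊔m (length q) (szV c))) (+-monoˡ-≤ (szV c) t≤))))
    (≤-reflexive (arith (length x * 16) (length q ⊔ szV c) (szV d) (szV c))))

iterStep-P : P {15} (λ w → iterV stepV14 (V.head w) (V.tail w))
iterStep-P = iter-P {I = λ v → v} id-P step-P (X ⊗ K 16 ⊕ (K 1 ⊕ X) ⊕ X) bd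
  where
  bd : ∀ v x₁ x₂ → V.head v ≡ x₁ ++ x₂ → szV (iterV stepV14 x₁ (V.tail v)) ≤ szV v * 16 + ((1 + szV v) + szV v)
  bd v@(x ∷ q ∷ wl ∷ wh ∷ wr ∷ ol ∷ oh ∷ or′ ∷ ys ∷ c) x₁ x₂ refl =
    ≤-trans (iter-size x₁ (q ∷ d) c) (+-mono-≤ (*-monoˡ-≤ 16 x≤) (s≤s (+-mono-≤ (⊔-lub q≤ c≤) dc≤)))
    where
    d = wl ∷ wh ∷ wr ∷ ol ∷ oh ∷ or′ ∷ ys ∷ []
    x≤ : length x₁ ≤ szV v
    x≤ = ≤-trans (length-++-≤ˡ x₁) (len≤sz v #0)
    q≤ : length q ≤ szV v
    q≤ = len≤sz v #1
    split : szV v ≡ (suc (length x) + suc (length q)) + (szV d + szV c)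
    split = trans (cong (suc (length x) +_) (cong (suc (length q) +_) (szV-++ d c))) (sym (+-assoc (suc (length x)) (suc (length q)) _))
    dc≤ : szV d + szV c ≤ szV v
    dc≤ = ≤-trans (m≤n+m _ (suc (length x) + suc (length q))) (≤-reflexive (sym split))
    c≤ : szV c ≤ szV v
    c≤ = ≤-trans (m≤n+m (szV c) (szV d)) dc≤

-- Correctness of the simulation on strings

codeL codeR : List Sym → Str
codeL []      = []
codeL (s ∷ l) = reverse (encSym s) ++ codeL l
codeR []      = []
codeR (s ∷ r) = encSym s ++ codeR r

tapeV : Tape → Vec Str 3
tapeV t = codeL (left t) ∷ encSym (head t) ∷ codeR (right t) ∷ []

move-code : ∀ s m t → moveS (codeL (left t)) (encSym s) (codeR (right t)) (encMove m) ≡ tapeV (writeMove s m t)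
move-code s mvL (tape [] h r)                = refl
move-code s mvL (tape (nothing ∷ l) h r)     = refl
move-code s mvL (tape (just false ∷ l) h r)  = refl
move-code s mvL (tape (just true ∷ l) h r)   = refl
move-code s mvR (tape l h [])                = refl
move-code s mvR (tape l h (nothing ∷ r))     = refl
move-code s mvR (tape l h (just false ∷ r))  = refl
move-code s mvR (tape l h (just true ∷ r))   = refl
move-code s mvS (tape l h r)                 = refl

take2-sym : ∀ s x → take2 (encSym s ++ x) ≡ encSym s
take2-sym nothing      x = refl
take2-sym (just false) x = refl
take2-sym (just true)  x = refl

drop2-sym : ∀ s x → drop2 (encSym s ++ x) ≡ x
drop2-sym nothing      x = refl
drop2-sym (just false) x = refl
drop2-sym (just true)  x = refl

take2-move : ∀ m x → take2 (encMove m ++ x) ≡ encMove m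
take2-move mvL x = refl
take2-move mvR x = refl
take2-move mvS x = refl

drop2-move : ∀ m x → drop2 (encMove m ++ x) ≡ x
drop2-move mvL x = refl
drop2-move mvR x = refl
drop2-move mvS x = refl

codeR-++ : ∀ x y → codeR (x ++ y) ≡ codeR x ++ codeR y
codeR-++ []      y = refl
codeR-++ (s ∷ x) y = trans (cong (encSym s ++_) (codeR-++ x y)) (sym (++-assoc (encSym s) (codeR x) (codeR y)))

reverse-codeL : ∀ l → reverse (codeL l) ≡ codeR (reverse l)
reverse-codeL []      = refl
reverse-codeL (s ∷ l) = trans (reverse-++ (reverse (encSym s)) (codeL l)) (trans (cong₂ _++_ (reverse-codeL l) (reverse-involutive (encSym s)))
  (trans (cong (codeR (reverse l) ++_) (sym (++-identityʳ (encSym s)))) (trans (sym (codeR-++ (reverse l) (s ∷ []))) (cong codeR (sym (unfold-reverse s l))))))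

bpS-codeR : ∀ x → bpS (codeR x) ≡ boolPrefix x
bpS-codeR []               = refl
bpS-codeR (nothing ∷ x)    = refl
bpS-codeR (just false ∷ x) = cong (false ∷_) (bpS-codeR x)
bpS-codeR (just true ∷ x)  = cong (true ∷_) (bpS-codeR x)

query-code : ∀ t → bpS (reverse (codeL (left t)) ++ encSym (head t) ++ codeR (right t)) ≡ fromLeftEnd t
query-code (tape l h r) = trans (cong (λ z → bpS (z ++ codeR (h ∷ r))) (reverse-codeL l))
  (trans (cong bpS (sym (codeR-++ (reverse l) (h ∷ r)))) (bpS-codeR (reverse l ++ h ∷ r)))

dropS-un₂ : ∀ a b → dropS (un a) (un b) ≡ un (b ∸ a)
dropS-un₂ a b = trans (cong (λ n → List.drop n (un b)) (length-replicate a)) (drop-un a b)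

eqU-yes : ∀ n → eqU (un n) (un n) ≡ true ∷ []
eqU-yes n rewrite dropS-un₂ n n | n∸n≡0 n = refl

eqU-no : ∀ {m n} → m ≢ n → eqU (un m) (un n) ≡ []
eqU-no {m} {n} ne = trans (cong₂ (λ x y → caseStr {Str} x (caseStr y (true ∷ []) (λ _ → []) (λ _ → [])) (λ _ → []) (λ _ → [])) (dropS-un₂ m n) (dropS-un₂ n m))
  (go (n ∸ m) (m ∸ n) refl refl)
  where
  go : ∀ i j → n ∸ m ≡ i → m ∸ n ≡ j → caseStr {Str} (un i) (caseStr (un j) (true ∷ []) (λ _ → []) (λ _ → [])) (λ _ → []) (λ _ → []) ≡ []
  go zero    zero    p q = ⊥-elim (ne (≤-antisym (m∸n≡0⇒m≤n q) (m∸n≡0⇒m≤n p)))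
  go zero    (suc j) p q = refl
  go (suc i) j       p q = refl

skipN : ℕ → Str → Str
skipN zero    x = x
skipN (suc n) x = skipEntry (skipN n x)

skipS-N : ∀ n x → skipS n x ≡ skipN (length n) x
skipS-N []      x = refl
skipS-N (_ ∷ n) x = cong skipEntry (skipS-N n x)

at-concatMap : ∀ {A B : Set} {n k} (f : A → List B) (g : Fin n → A) → (∀ a → length (f a) ≡ k) →
               ∀ q {j o} → At (f (g q)) j o → At (concatMap f (List.tabulate g)) (toℕ q * k + j) o
at-concatMap f g len F.zero    at = at-left at
  where
  at-left : ∀ {A : Set} {x y : List A} {i a} → At x i a → At (x ++ y) i a
  at-left at0     = at0
  at-left (at+ p) = at+ (at-left p)
at-concatMap {k = k} f g len (F.suc q) {j} at = at-cast (sym (+-assoc k (toℕ q * k) j)) (at-++ (f (g F.zero)) (len (g F.zero)) (at-concatMap f (g ∘ F.suc) len q at))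

length-concatMap : ∀ {A B : Set} {n k} (f : A → List B) (g : Fin n → A) → (∀ a → length (f a) ≡ k) → length (concatMap f (List.tabulate g)) ≡ n * k
length-concatMap {n = zero}  f g len = refl
length-concatMap {n = suc n} f g len = trans (length-++ (f (g F.zero))) (cong₂ _+_ (len (g F.zero)) (length-concatMap f (g ∘ F.suc) len))

concatMap-concatMap : ∀ {A B C : Set} (f : B → List C) (g : A → List B) x → concatMap f (concatMap g x) ≡ concatMap (λ a → concatMap f (g a)) x
concatMap-concatMap f g []      = refl
concatMap-concatMap f g (a ∷ x) = trans (concatMap-++ f (g a) (concatMap g x)) (cong (concatMap f (g a) ++_) (concatMap-concatMap f g x))

drop-at : ∀ {A : Set} {x : List A} {i a} → At x i a → List.drop i x ≡ a ∷ List.drop (suc i) x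
drop-at at0     = refl
drop-at (at+ p) = drop-at p

at-exists : ∀ {A : Set} (x : List A) i → i < length x → ∃ (At x i)
at-exists (a ∷ x) zero    lt       = a , at0
at-exists (a ∷ x) (suc i) (s≤s lt) = let (b , p) = at-exists x i lt in b , at+ p

module Table (M : OTM) where
  open OTM M

  Outcome : Set
  Outcome = Fin nQ × (Sym × Move) × (Sym × Move)

  encOutcome : Outcome → Str
  encOutcome (q , (s , m) , (s′ , m′)) = encFin q ++ encSym s ++ encMove m ++ encSym s′ ++ encMove m′

  syms : List Sym
  syms = nothing ∷ just false ∷ just true ∷ []

  ofState : Fin nQ → List Outcome
  ofState q = concatMap (λ a → concatMap (λ b → δ q a b ∷ []) syms) syms

  outcomes : List Outcome
  outcomes = concatMap ofState (List.allFin nQ)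

  encOTM-≡ : encOTM M ≡ encℕ nQ ++ encFin start ++ encFin halt ++ encFin qry ++ encFin yesQ ++ encFin noQ ++ concatMap encOutcome outcomes
  encOTM-≡ = cong (λ z → encℕ nQ ++ encFin start ++ encFin halt ++ encFin qry ++ encFin yesQ ++ encFin noQ ++ z)
    (sym (trans (concatMap-concatMap encOutcome ofState (List.allFin nQ)) (concatMap-cong perState (List.allFin nQ))))
    where
    perState : ∀ q → concatMap encOutcome (ofState q) ≡ concatMap (λ a → concatMap (λ b → encOutcome (δ q a b)) syms) syms
    perState q = trans (concatMap-concatMap encOutcome (λ a → concatMap (λ b → δ q a b ∷ []) syms) syms)
      (concatMap-cong (λ a → trans (concatMap-concatMap encOutcome (λ b → δ q a b ∷ []) syms)
        (concatMap-cong (λ b → ++-identityʳ (encOutcome (δ q a b))) syms)) syms)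

  symNo : Sym → ℕ
  symNo s = length (symIx (encSym s))

  outcome-at : ∀ q a b → At outcomes (toℕ q * 9 + (3 * symNo a + symNo b)) (δ q a b)
  outcome-at q a b = at-concatMap ofState (λ q → q) (λ _ → refl) q (go a b)
    where
    go : ∀ a b → At (ofState q) (3 * symNo a + symNo b) (δ q a b)
    go nothing      nothing      = at0
    go nothing      (just false) = at+ at0
    go nothing      (just true)  = at+ (at+ at0)
    go (just false) nothing      = at+ (at+ (at+ at0))
    go (just false) (just false) = at+ (at+ (at+ (at+ at0)))
    go (just false) (just true)  = at+ (at+ (at+ (at+ (at+ at0))))
    go (just true)  nothing      = at+ (at+ (at+ (at+ (at+ (at+ at0)))))
    go (just true)  (just false) = at+ (at+ (at+ (at+ (at+ (at+ (at+ at0))))))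
    go (just true)  (just true)  = at+ (at+ (at+ (at+ (at+ (at+ (at+ (at+ at0)))))))

  fields : Outcome → Str → Str
  fields (q , (s , m) , (s′ , m′)) r = encSym s ++ encMove m ++ encSym s′ ++ encMove m′ ++ r

  encOutcome-++ : ∀ o r → encOutcome o ++ r ≡ encFin (proj₁ o) ++ fields o r
  encOutcome-++ (q , (s , m) , (s′ , m′)) r = trans (++-assoc (encFin q) _ r) (cong (encFin q ++_) (trans (++-assoc (encSym s) _ r) (cong (encSym s ++_)
    (trans (++-assoc (encMove m) _ r) (cong (encMove m ++_) (++-assoc (encSym s′) _ r))))))

  skipEntry-outcome : ∀ o r → skipEntry (encOutcome o ++ r) ≡ r
  skipEntry-outcome o@(q , (s , m) , (s′ , m′)) r
    rewrite encOutcome-++ o r | afterOnes-enc (toℕ q) (fields o r) | drop2-sym s (encMove m ++ encSym s′ ++ encMove m′ ++ r)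
          | drop2-move m (encSym s′ ++ encMove m′ ++ r) | drop2-sym s′ (encMove m′ ++ r) | drop2-move m′ r = refl

  skipN-outcomes : ∀ i r → i ≤ length outcomes → skipN i (concatMap encOutcome outcomes ++ r) ≡ concatMap encOutcome (List.drop i outcomes) ++ r
  skipN-outcomes zero    r le = refl
  skipN-outcomes (suc i) r le with at-exists outcomes i le
  ... | o , at = trans (cong skipEntry (trans (skipN-outcomes i r (≤-trans (n≤1+n i) le))
      (trans (cong (λ z → concatMap encOutcome z ++ r) (drop-at at)) (++-assoc (encOutcome o) _ r)))) (skipEntry-outcome o _)

  length-outcomes : length outcomes ≡ nQ * 9
  length-outcomes = length-concatMap ofState (λ q → q) (λ _ → refl)

  -- The time bound stands behind the table and is found by passing all entries.
  skip-all : ∀ r → skipN (nQ * 9) (concatMap encOutcome outcomes ++ r) ≡ r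
  skip-all r = trans (skipN-outcomes (nQ * 9) r (≤-reflexive (sym length-outcomes))) (cong (λ z → concatMap encOutcome z ++ r)
    (trans (cong (λ n → List.drop n outcomes) (sym length-outcomes)) (drop-all (length outcomes) outcomes ≤-refl)))

  ptr-code : ∀ q a b r → ∃ λ r′ → skipS (timesS 9 (un (toℕ q)) ++ timesS 3 (symIx (encSym a)) ++ symIx (encSym b)) (concatMap encOutcome outcomes ++ r)
             ≡ encFin (proj₁ (δ q a b)) ++ fields (δ q a b) r′
  ptr-code q a b r = _ , trans (skipS-N (timesS 9 (un (toℕ q)) ++ timesS 3 (symIx (encSym a)) ++ symIx (encSym b)) _)
      (trans (cong (λ n → skipN n (concatMap encOutcome outcomes ++ r)) len)
      (trans (skipN-outcomes i r (≤-trans (n≤1+n i) (at-< at))) (trans (cong (λ z → concatMap encOutcome z ++ r) (drop-at at))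
      (trans (++-assoc (encOutcome (δ q a b)) _ r) (encOutcome-++ (δ q a b) _)))))
    where
    i : ℕ
    i = toℕ q * 9 + (3 * symNo a + symNo b)
    at : At outcomes i (δ q a b)
    at = outcome-at q a b
    len : length (timesS 9 (un (toℕ q)) ++ timesS 3 (symIx (encSym a)) ++ symIx (encSym b)) ≡ i
    len = trans (length-++ (timesS 9 (un (toℕ q)))) (cong₂ _+_ (trans (length-times 9 (un (toℕ q))) (trans (cong (9 *_) (length-replicate (toℕ q))) (*-comm 9 (toℕ q))))
      (trans (length-++ (timesS 3 (symIx (encSym a)))) (cong (_+ symNo b) (length-times 3 (symIx (encSym a))))))

module StringSim (M : OTM) (bl rest : Str) where
  open OTM M
  open Table M

  -- The transition table is used where it stands in the instance, with the remainder `rest` behind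
  -- it; the computed entry numbers stay inside the table.
  consts : Vec Str 6
  consts = un (toℕ halt) ∷ un (toℕ qry) ∷ un (toℕ yesQ) ∷ un (toℕ noQ) ∷ (concatMap encOutcome outcomes ++ rest) ∷ bl ∷ []

  state8 : Fin nQ → Tape → Tape → Str → Vec Str 8
  state8 q w o ys = un (toℕ q) ∷ (tapeV w V.++ (tapeV o V.++ ys ∷ []))

  encC : OConf M → Str → Vec Str 14
  encC (oconf q w o) ys = state8 q w o ys V.++ consts

  differ : ∀ {i j : Fin nQ} → i ≢ j → toℕ i ≢ toℕ j
  differ ne e = ne (FP.toℕ-injective e)

  at-query : ∀ {A : Set} {q : Fin nQ} {a : A} {b c} → q ≡ qry → caseStr (eqU (un (toℕ q)) (un (toℕ qry))) a b c ≡ c []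
  at-query {a = a} {b} {c} refl = cong (λ e → caseStr e a b c) (eqU-yes (toℕ qry))

  off-query : ∀ {A : Set} {q : Fin nQ} {a : A} {b c} → q ≢ qry → caseStr (eqU (un (toℕ q)) (un (toℕ qry))) a b c ≡ a
  off-query {a = a} {b} {c} ne = cong (λ e → caseStr e a b c) (eqU-no (differ ne))

  step-query : ∀ c ys → OConf.state c ≡ qry →
    stepV14 (encC c ys) ≡ encC (answer M c (replyOf (fromLeftEnd (OConf.orac c)) ys)) (List.drop (length bl) ys)
  step-query c@(oconf q w o) ys e = trans (cong (V._++ consts) (at-query e)) (go ys)
    where
    go : ∀ ys → on14 queryD (encC c ys) V.++ consts ≡ encC (answer M c (replyOf (fromLeftEnd o) ys)) (List.drop (length bl) ys)
    go []           = refl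
    go (false ∷ ys) = refl
    go (true ∷ ys)  = refl

  step-normal : ∀ c ys → OConf.state c ≢ qry → stepV14 (encC c ys) ≡ encC (ostep M c) ys
  step-normal c@(oconf q w o) ys ne = trans (cong (V._++ consts) (off-query ne)) go
    where
    D : Vec Str 8
    D = on14 normalD (encC c ys)
    S : Vec Str 8
    S = state8 q w o ys
    q′ = proj₁ (δ q (head w) (head o))
    s₁ = proj₁ (proj₁ (proj₂ (δ q (head w) (head o))))
    m₁ = proj₂ (proj₁ (proj₂ (δ q (head w) (head o))))
    s₂ = proj₁ (proj₂ (proj₂ (δ q (head w) (head o))))
    m₂ = proj₂ (proj₂ (proj₂ (δ q (head w) (head o))))
    moves : Str → Str → Str → Str → Str → Vec Str 8
    moves p a b a′ b′ = p ∷ (moveS (codeL (left w)) a (codeR (right w)) b V.++ (moveS (codeL (left o)) a′ (codeR (right o)) b′ V.++ ys ∷ []))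
    after : Str → Str → Vec Str 8
    after p e = moves p (take2 e) (take2 (drop2 e)) (take2 (drop2 (drop2 e))) (take2 (drop2 (drop2 (drop2 e))))
    normal : D ≡ state8 q′ (writeMove s₁ m₁ w) (writeMove s₂ m₂ o) ys
    normal with ptr-code q (head w) (head o) rest
    ... | r , eq = trans (cong (λ p → after (ones p) (afterOnes p)) eq)
          (trans (cong₂ after (ones-enc (toℕ q′) _) (afterOnes-enc (toℕ q′) _))
          (trans (cong₂ (λ a x → moves (un (toℕ q′)) a (take2 x) (take2 (drop2 x)) (take2 (drop2 (drop2 x)))) (take2-sym s₁ _) (drop2-sym s₁ _))
          (trans (cong₂ (λ b x → moves (un (toℕ q′)) (encSym s₁) b (take2 x) (take2 (drop2 x))) (take2-move m₁ _) (drop2-move m₁ _))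
          (trans (cong₂ (λ a x → moves (un (toℕ q′)) (encSym s₁) (encMove m₁) a (take2 x)) (take2-sym s₂ _) (drop2-sym s₂ _))
          (trans (cong (moves (un (toℕ q′)) (encSym s₁) (encMove m₁) (encSym s₂)) (take2-move m₂ r))
          (cong₂ (λ a b → un (toℕ q′) ∷ (a V.++ (b V.++ ys ∷ []))) (move-code s₁ m₁ w) (move-code s₂ m₂ o)))))))
    go : caseStr (eqU (un (toℕ q)) (un (toℕ halt))) D (λ _ → S) (λ _ → S) V.++ consts ≡ encC (ostep M c) ys
    go with q F.≟ halt
    ... | yes e = cong (V._++ consts) (trans (cong (λ i → caseStr (eqU (un (toℕ i)) (un (toℕ halt))) D (λ _ → S) (λ _ → S)) e)
                    (cong (λ x → caseStr x D (λ _ → S) (λ _ → S)) (eqU-yes (toℕ halt))))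
    ... | no ne = cong (V._++ consts) (trans (cong (λ x → caseStr x D (λ _ → S) (λ _ → S)) (eqU-no (differ ne))) normal)

  entry-query : ∀ c ys → OConf.state c ≡ qry → let q = fromLeftEnd (OConf.orac c) in
                on14 entryStr (encC c ys) ≡ true ∷ encStr q ++ encReply (replyOf q ys)
  entry-query c@(oconf q w o) ys e = trans (at-query e) (trans (cong (λ z → true ∷ encStr z ++ reply z ys) (query-code o)) (go ys))
    where
    reply : Str → Str → Str
    reply z ys = caseStr ys (false ∷ []) (λ a → true ∷ encStr (takeS (ones z) a)) (λ _ → false ∷ [])
    go : ∀ ys → true ∷ encStr (fromLeftEnd o) ++ reply (fromLeftEnd o) ys ≡ true ∷ encStr (fromLeftEnd o) ++ encReply (replyOf (fromLeftEnd o) ys)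
    go []           = refl
    go (false ∷ ys) = refl
    go (true ∷ ys)  = refl

  entry-normal : ∀ c ys → OConf.state c ≢ qry → on14 entryStr (encC c ys) ≡ []
  entry-normal (oconf q w o) ys ne = off-query ne

  checkS : Str → Str → Str
  checkS z ys = caseStr ys [] (λ a → caseStr (evalS z (takeS (ones z) a)) (true ∷ []) (λ _ → true ∷ []) (λ _ → [])) (λ _ → [])

  fail-query : ∀ c ys → OConf.state c ≡ qry → on14 failStr (encC c ys) ≡ checkS (fromLeftEnd (OConf.orac c)) ys
  fail-query c@(oconf q w o) ys e = trans (at-query e) (cong (λ z → checkS z ys) (query-code o))

  fail-normal : ∀ c ys → OConf.state c ≢ qry → on14 failStr (encC c ys) ≡ []
  fail-normal (oconf q w o) ys ne = off-query ne

-- The check inspects only the first bit of the value. As nothing can follow that bit, passing the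
-- check means that the value is exactly `true ∷ []`.
evalS-shape : ∀ q a → evalS q a ≡ [] ⊎ (∃ λ b → evalS q a ≡ b ∷ [])
evalS-shape q a = go (true ∷ q) (afterOnes q ∷ a ∷ [] ∷ []) (inj₁ refl)
  where
  Good : Vec Str 3 → Set
  Good s = V.lookup s #2 ≡ [] ⊎ (∃ λ b → V.lookup s #2 ≡ b ∷ [])
  step-good : ∀ s → Good s → Good (evalStep s)
  step-good (g ∷ w ∷ r ∷ []) (inj₂ (false , refl)) = inj₂ (false , refl)
  step-good (g ∷ w ∷ r ∷ []) (inj₂ (true , refl))  = inj₂ (true , refl)
  step-good (g ∷ w ∷ r ∷ []) (inj₁ refl) =
    caseStr-elim Good g (inj₁ refl)
      (λ x _ → caseStr-elim Good x (inj₁ refl)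
        (λ y _ → caseStr-elim Good (dropS (ones y) y) (inj₁ refl) (λ t _ → caseStr-elim Good t (head-good (dropS (ones y) w)) (λ _ _ → inj₁ refl) (λ _ _ → inj₁ refl)) (λ _ _ → inj₁ refl))
        (λ y _ → bin _∧_ y))
      (λ x _ → caseStr-elim Good x (inj₁ refl) (λ y _ → bin _∨_ y)
        (λ y _ → caseStr-elim Good (dropS (ones y) w) (inj₁ refl) (λ _ _ → inj₁ refl) (λ _ _ → inj₁ refl)))
    where
    head-good : ∀ x → Good ([] ∷ [] ∷ headS x ∷ [])
    head-good []      = inj₁ refl
    head-good (b ∷ x) = inj₂ (b , refl)
    bin : ∀ o y → Good (binStep y w o)
    bin o y = caseStr-elim Good (dropS (ones y) w) (inj₁ refl) (λ _ _ → bin₂ (o false)) (λ _ _ → bin₂ (o true))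
      where
      bin₂ : ∀ p → Good (binStep₂ y w p)
      bin₂ p = caseStr-elim Good (dropS (ones (afterOnes y)) w) (inj₁ refl) (λ _ _ → inj₁ refl) (λ _ _ → inj₁ refl)
  go : ∀ x s → Good s → Good (iterV evalStep x s)
  go []      s h = h
  go (_ ∷ x) s h = go x (evalStep s) (step-good s h)

catIter : (Vec Str 14 → Str) → Vec Str 15 → Str
catIter f w = f (iterV stepV14 (V.head w) (V.tail w))

-- `catS` appends the last time step at the end, whereas `sim` unfolds from the first one.
cat-front : ∀ f t v → catS (catIter f) (un (suc t)) v ≡ f v ++ catS (catIter f) (un t) (stepV14 v)
cat-front f zero    v = sym (++-identityʳ (f v))
cat-front f (suc t) v = trans (cong (_++ f (iterV stepV14 (un t) (stepV14 v))) (cat-front f t v)) (++-assoc (f v) _ _)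

module SimCode (M : OTM) (B⁻ : ℕ) (bl rest : Str) (len : length bl ≡ suc B⁻) where
  open OTM M
  open Simulation M B⁻
  open StringSim M bl rest

  private
    Tail : (Vec Str 14 → Str) → ℕ → Vec Str 14 → Str
    Tail f t v = catS (catIter f) (un t) v

  entries-code : ∀ t c ys → catS (catIter (on14 entryStr)) (un t) (encC c ys) ++ false ∷ [] ≡ encEntries (sim t c ys)
  entries-code zero    c ys = refl
  entries-code (suc t) c ys = trans (cong (_++ false ∷ []) (cat-front (on14 entryStr) t (encC c ys))) (go (OConf.state c F.≟ qry))
    where
    q : Str
    q = fromLeftEnd (OConf.orac c)
    r : Reply
    r = replyOf q ys
    go : Dec (OConf.state c ≡ qry) → (on14 entryStr (encC c ys) ++ Tail (on14 entryStr) t (stepV14 (encC c ys))) ++ false ∷ [] ≡ encEntries (sim (suc t) c ys)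
    go (yes e) = trans (cong₂ (λ a b → (a ++ Tail (on14 entryStr) t b) ++ false ∷ []) (entry-query c ys e) (step-query c ys e))
        (trans (assoc (encStr q) (encReply r) (Tail (on14 entryStr) t (encC (answer M c r) (List.drop (length bl) ys))))
        (trans (cong (λ z → true ∷ encStr q ++ encReply r ++ z) (trans (cong (λ n → Tail (on14 entryStr) t (encC (answer M c r) (List.drop n ys)) ++ false ∷ []) len)
              (entries-code t (answer M c r) (List.drop B ys))))
          (cong encEntries (sym (sim-at-query t c ys e)))))
      where
      assoc : ∀ (a b d : Str) → ((true ∷ a ++ b) ++ d) ++ false ∷ [] ≡ true ∷ a ++ b ++ d ++ false ∷ []
      assoc a b d = cong (true ∷_) (trans (++-assoc (a ++ b) d _) (++-assoc a b _))
    go (no ne) = trans (cong₂ (λ a b → (a ++ Tail (on14 entryStr) t b) ++ false ∷ []) (entry-normal c ys ne) (step-normal c ys ne))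
          (trans (entries-code t (ostep M c) ys) (cong encEntries (sym (sim-off-query t c ys ne))))

  FailsNone : ℕ → OConf M → Str → Set
  FailsNone t c ys = catS (catIter (on14 failStr)) (un t) (encC c ys) ≡ []

  check-ok : ∀ q ys → (checkS q ys ≡ [] → EntryOk (q , replyOf q ys)) × (EntryOk (q , replyOf q ys) → checkS q ys ≡ [])
  check-ok q []           = (λ _ → tt) , (λ _ → refl)
  check-ok q (true ∷ ys)  = (λ _ → tt) , (λ _ → refl)
  check-ok q (false ∷ ys) = go (evalS q (takeS (ones q) ys)) (evalS-shape q (takeS (ones q) ys))
    where
    result-of : Str → Str
    result-of x = caseStr x (true ∷ []) (λ _ → true ∷ []) (λ _ → [])
    go : ∀ x → x ≡ [] ⊎ (∃ λ b → x ≡ b ∷ []) → (result-of x ≡ [] → x ≡ true ∷ []) × (x ≡ true ∷ [] → result-of x ≡ [])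
    go _ (inj₁ refl)           = (λ ()) , (λ ())
    go _ (inj₂ (false , refl)) = (λ ()) , (λ ())
    go _ (inj₂ (true , refl))  = (λ _ → refl) , (λ _ → refl)

  fails-code : ∀ t c ys → (FailsNone t c ys → AllOk (sim t c ys)) × (AllOk (sim t c ys) → FailsNone t c ys)
  fails-code zero    c ys = (λ _ → tt) , (λ _ → refl)
  fails-code (suc t) c ys = go (OConf.state c F.≟ qry)
    where
    q : Str
    q = fromLeftEnd (OConf.orac c)
    r : Reply
    r = replyOf q ys
    c′ : OConf M
    c′ = answer M c r
    ys′ : Str
    ys′ = List.drop B ys
    Both : Str → List Entry → Set
    Both x L = (x ≡ [] → AllOk L) × (AllOk L → x ≡ [])
    both : ∀ {x x′ L L′} → x ≡ x′ → L ≡ L′ → Both x′ L′ → Both x L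
    both refl refl b = b
    go : Dec (OConf.state c ≡ qry) → Both (catS (catIter (on14 failStr)) (un (suc t)) (encC c ys)) (sim (suc t) c ys)
    go (no ne) = both (trans (cat-front (on14 failStr) t (encC c ys)) (cong₂ (λ a b → a ++ Tail (on14 failStr) t b) (fail-normal c ys ne) (step-normal c ys ne)))
      (sim-off-query t c ys ne) (fails-code t (ostep M c) ys)
    go (yes e) = both (trans (cat-front (on14 failStr) t (encC c ys)) (trans (cong₂ (λ a b → a ++ Tail (on14 failStr) t b) (fail-query c ys e) (step-query c ys e))
                        (cong (λ n → checkS q ys ++ Tail (on14 failStr) t (encC c′ (List.drop n ys))) len)))
      (sim-at-query t c ys e) (to , from)
      where
      to : checkS q ys ++ Tail (on14 failStr) t (encC c′ ys′) ≡ [] → AllOk ((q , r) ∷ sim t c′ ys′)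
      to eq = proj₁ (check-ok q ys) (++-conicalˡ (checkS q ys) _ eq) , proj₁ (fails-code t c′ ys′) (++-conicalʳ (checkS q ys) _ eq)
      from : AllOk ((q , r) ∷ sim t c′ ys′) → checkS q ys ++ Tail (on14 failStr) t (encC c′ ys′) ≡ []
      from (ok , oks) = trans (cong (_++ Tail (on14 failStr) t (encC c′ ys′)) (proj₂ (check-ok q ys) ok)) (proj₂ (fails-code t c′ ys′) oks)

-- First reduction: PNPComputation to LeastNumber

after : ℕ → Str → Str
after zero    u = u
after (suc n) u = afterOnes (after n u)

after-F : ∀ n → F1 (after n)
after-F zero    = mk1 (arg #0)
after-F (suc n) = mk1 (ap1 afterOnes-F (ap1 (after-F n) (arg #0)))

-- In `t` steps there are at most `t` queries, each of length at most `t + 1`, because the extent of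
-- the oracle tape starts at 0. A block needs one more bit for the reply, which gives `t` blocks of
-- length `t + 2`.
timeOf blockOf inputsOf : Str → Str
timeOf u   = fstS (skipS (timesS 9 (ones u)) (after 6 u))
blockOf u  = true ∷ true ∷ timeOf u
inputsOf u = repS (timeOf u) (blockOf u)

initial-state : Str → Str → Vec Str 14
initial-state u y = ones (after 1 u) ∷ [] ∷ (false ∷ false ∷ []) ∷ [] ∷ [] ∷ (false ∷ false ∷ []) ∷ [] ∷ y ∷
  ones (after 2 u) ∷ ones (after 3 u) ∷ ones (after 4 u) ∷ ones (after 5 u) ∷ after 6 u ∷ blockOf u ∷ []

failures transcript : Str → Str → Str
failures u y   = catS (catIter (on14 failStr)) (timeOf u) (initial-state u y)
transcript u y = catS (catIter (on14 entryStr)) (timeOf u) (initial-state u y) ++ false ∷ []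

-- `tailS` removes the leading 1 that fills cell 0 of the tableau.
valid-replies : Str → Str
valid-replies w = caseStr (failures (fstS (tailS w)) (sndS (tailS w))) (true ∷ []) (λ _ → []) (λ _ → [])

-- This is `revise` on strings: the leading ones of `w` count the blocks to keep, and `a` is decoded
-- from the rest. Padding with ones brings the result to the common length of the elements of S.
counterexample : Str → Str → Str → Str
counterexample u y w = p ++ dropS p (true ∷ unary (inputsOf u))
  where
  p = takeS (repS (ones w) (blockOf u)) y ++ false ∷ fstS (afterOnes w)

opaque
  timeOf-F : F1 timeOf
  timeOf-F = mk1 (ap1 fst-F (ap2 skip-F (ap1 (times-F 9) (ap1 ones-F (arg #0))) (ap1 (after-F 6) (arg #0))))

  blockOf-F : F1 blockOf
  blockOf-F = mk1 (consF true (consF true (ap1 timeOf-F (arg #0))))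

  inputsOf-F : F1 inputsOf
  inputsOf-F = mk1 (ap2 rep-F (ap1 timeOf-F (arg #0)) (ap1 blockOf-F (arg #0)))

  initial-P : P {2} (λ v → timeOf (V.lookup v #0) ∷ initial-state (V.lookup v #0) (V.lookup v #1))
  initial-P = ap1 timeOf-F (arg #0) ∷P o 1 ∷P nil-P ∷P constF (false ∷ false ∷ []) ∷P nil-P ∷P nil-P ∷P constF (false ∷ false ∷ []) ∷P nil-P ∷P arg #1
    ∷P o 2 ∷P o 3 ∷P o 4 ∷P o 5 ∷P ap1 (after-F 6) (arg #0) ∷P ap1 blockOf-F (arg #0)
    where
    o : ∀ n → Fun 2 (λ v → ones (after n (V.lookup v #0)))
    o n = ap1 ones-F (ap1 (after-F n) (arg #0))

  failures-F : F2 failures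
  failures-F = mk2 (cat-P (fail-F ∘P iterStep-P) ∘P initial-P)

  transcript-F : F2 transcript
  transcript-F = mk2 ((cat-P (entry-F ∘P iterStep-P) ∘P initial-P) ++F constF (false ∷ []))

  valid-replies-FP : FP valid-replies
  valid-replies-FP = FP-fromF1 (mk1 (matchF (ap2 failures-F (ap1 fst-F (ap1 tail-F (arg #0))) (ap1 snd-F (ap1 tail-F (arg #0)))) (constF (true ∷ [])) nil-P nil-P))

  counterexample-F : F3 counterexample
  counterexample-F = mk3 (p ++F ap2 drop-F p (consF true (ap1 unary-F (ap1 inputsOf-F (arg #0)))))
    where
    p : Fun 3 (λ v → takeS (repS (ones (V.lookup v #2)) (blockOf (V.lookup v #0))) (V.lookup v #1) ++ false ∷ fstS (afterOnes (V.lookup v #2)))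
    p = ap2 take-F (ap2 rep-F (ap1 ones-F (arg #2)) (ap1 blockOf-F (arg #0))) (arg #1) ++F consF false (ap1 fst-F (ap1 afterOnes-F (arg #2)))

module Verifier where
  machineV : TM
  machineV = proj₁ valid-replies-FP
  cV kV : ℕ
  cV = proj₁ (proj₂ valid-replies-FP)
  kV = proj₁ (proj₂ (proj₂ valid-replies-FP))
  computesV : ComputesIn machineV cV kV valid-replies
  computesV = proj₂ (proj₂ (proj₂ valid-replies-FP))

  open CircuitString machineV cV kV public
  open CookLevinCircuit machineV public using (circuit)
  open CookLevinCircuit machineV using (inSet-circuit; time)

  timeV : Str → ℕ → ℕ
  timeV = time {valid-replies} {cV} {kV} computesV

  inSetV : ∀ e m y → length y ≡ suc m → (InSet (circuit e m (timeV e m)) y → isTrue (valid-replies (true ∷ e ++ y)) ≡ true) ×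
                                        (isTrue (valid-replies (true ∷ e ++ y)) ≡ true → InSet (circuit e m (timeV e m)) y)
  inSetV = inSet-circuit {valid-replies} {cV} {kV} computesV

open Verifier using (circuitS; circuit-F; circuit-≡; time-≡; circuit; inSetV; timeV)

-- The code of `u` is wired in as constants before the inputs, so the circuit sees a pair of `u` and
-- the candidate. The given element is the string of ones, on which every reply is NO.
instance-of : Str → Str
instance-of u = circuitS (encStr u) (inputsOf u) ++ encStr (true ∷ unary (inputsOf u))

opaque
  instance-FP : FP instance-of
  instance-FP = FP-fromF1 (mk1 (ap2 circuit-F (ap1 encStr-F (arg #0)) (ap1 inputsOf-F (arg #0)) ++F
    ap1 encStr-F (consF true (ap1 unary-F (ap1 inputsOf-F (arg #0))))))

module _ (M : OTM) (t : ℕ) where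
  open OTM M
  open Table M

  private
    u tab : Str
    u   = encPNP M t
    tab = concatMap encOutcome outcomes ++ encStr (un t)

    u-≡ : u ≡ encℕ nQ ++ encFin start ++ encFin halt ++ encFin qry ++ encFin yesQ ++ encFin noQ ++ tab
    u-≡ = trans (cong (_++ encStr (un t)) encOTM-≡) (re-assoc (encℕ nQ) (encFin start) (encFin halt) (encFin qry) (encFin yesQ) (encFin noQ) (concatMap encOutcome outcomes) (encStr (un t)))
      where
      re-assoc : ∀ (a b c d e f g h : Str) → (a ++ b ++ c ++ d ++ e ++ f ++ g) ++ h ≡ a ++ b ++ c ++ d ++ e ++ f ++ g ++ h
      re-assoc a b c d e f g h = trans (++-assoc a _ h) (cong (a ++_) (trans (++-assoc b _ h) (cong (b ++_) (trans (++-assoc c _ h) (cong (c ++_)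
        (trans (++-assoc d _ h) (cong (d ++_) (trans (++-assoc e _ h) (cong (e ++_) (++-assoc f g h))))))))))

    after₁ : after 1 u ≡ encFin start ++ encFin halt ++ encFin qry ++ encFin yesQ ++ encFin noQ ++ tab
    after₁ = trans (cong afterOnes u-≡) (afterOnes-enc nQ _)
    after₂ : after 2 u ≡ encFin halt ++ encFin qry ++ encFin yesQ ++ encFin noQ ++ tab
    after₂ = trans (cong afterOnes after₁) (afterOnes-enc (toℕ start) _)
    after₃ : after 3 u ≡ encFin qry ++ encFin yesQ ++ encFin noQ ++ tab
    after₃ = trans (cong afterOnes after₂) (afterOnes-enc (toℕ halt) _)
    after₄ : after 4 u ≡ encFin yesQ ++ encFin noQ ++ tab
    after₄ = trans (cong afterOnes after₃) (afterOnes-enc (toℕ qry) _)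
    after₅ : after 5 u ≡ encFin noQ ++ tab
    after₅ = trans (cong afterOnes after₄) (afterOnes-enc (toℕ yesQ) _)
    after₆ : after 6 u ≡ tab
    after₆ = trans (cong afterOnes after₅) (afterOnes-enc (toℕ noQ) _)

    time≡ : timeOf u ≡ un t
    time≡ = trans (cong₂ (λ a b → fstS (skipS (timesS 9 a) b)) (trans (cong ones u-≡) (ones-enc nQ _)) after₆)
      (trans (cong fstS (trans (skipS-N (timesS 9 (un nQ)) tab) (trans (cong (λ n → skipN n tab) (trans (length-times 9 (un nQ)) (trans (cong (9 *_) (length-replicate nQ)) (*-comm 9 nQ))))
        (skip-all (encStr (un t)))))) (trans (cong fstS (sym (++-identityʳ (encStr (un t))))) (fstS-pair (un t) [])))

    block-length-≡ : length (blockOf u) ≡ suc (suc t)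
    block-length-≡ = cong (λ n → suc (suc n)) (trans (cong length time≡) (length-replicate t))

    open Simulation M (suc t)
    open StringSim M (blockOf u) (encStr (un t))
    open SimCode M (suc t) (blockOf u) (encStr (un t)) block-length-≡

    initial-≡ : ∀ y → initial-state u y ≡ encC (oinit M) y
    initial-≡ y = vec (one (toℕ start) after₁) (one (toℕ halt) after₂) (one (toℕ qry) after₃) (one (toℕ yesQ) after₄) (one (toℕ noQ) after₅) after₆
      where
      one : ∀ {x r} n → x ≡ encℕ n ++ r → ones x ≡ un n
      one {r = r} n e = trans (cong ones e) (ones-enc n r)
      vec : ∀ {a b c d e f a′ b′ c′ d′ e′ f′ : Str} → a ≡ a′ → b ≡ b′ → c ≡ c′ → d ≡ d′ → e ≡ e′ → f ≡ f′ →
            _≡_ {A = Vec Str 14} (a ∷ [] ∷ (false ∷ false ∷ []) ∷ [] ∷ [] ∷ (false ∷ false ∷ []) ∷ [] ∷ y ∷ b ∷ c ∷ d ∷ e ∷ f ∷ blockOf u ∷ [])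
                (a′ ∷ [] ∷ (false ∷ false ∷ []) ∷ [] ∷ [] ∷ (false ∷ false ∷ []) ∷ [] ∷ y ∷ b′ ∷ c′ ∷ d′ ∷ e′ ∷ f′ ∷ blockOf u ∷ [])
      vec refl refl refl refl refl refl = refl

    transcript-≡ : ∀ y → transcript u y ≡ encEntries (sim t (oinit M) y)
    transcript-≡ y = trans (cong₂ (λ a b → catS (catIter (on14 entryStr)) a b ++ false ∷ []) time≡ (initial-≡ y)) (entries-code t (oinit M) y)

    failures-≡ : ∀ y → failures u y ≡ catS (catIter (on14 failStr)) (un t) (encC (oinit M) y)
    failures-≡ y = cong₂ (catS (catIter (on14 failStr))) time≡ (initial-≡ y)

    z : Str
    z = inputsOf u

    z-length : length z ≡ t * B
    z-length = trans (length-repS (timeOf u) (blockOf u)) (cong₂ _*_ (trans (cong length time≡) (length-replicate t)) block-length-≡)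

    T : ℕ
    T = timeV (encStr u) (length z)

    C : Circuit (suc (length z))
    C = circuit (encStr u) (length z) T

    instance-≡ : encLN C (true ∷ unary z) ≡ instance-of u
    instance-≡ = cong (_++ encStr (true ∷ unary z)) (sym (trans (circuit-≡ (encStr u) z)
      (cong (λ n → encCircuit (circuit (encStr u) (length z) n)) (time-≡ (encStr u) z))))

    replies-≡ : ∀ y → valid-replies (true ∷ encStr u ++ y) ≡ caseStr (failures u y) (true ∷ []) (λ _ → []) (λ _ → [])
    replies-≡ y = cong₂ (λ a b → caseStr (failures a b) (true ∷ []) (λ _ → []) (λ _ → [])) (fstS-pair u y) (sndS-pair u y)

    accept-ok : ∀ x → isTrue (caseStr x (true ∷ []) (λ _ → []) (λ _ → [])) ≡ true → x ≡ []
    accept-ok []          e = refl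
    accept-ok (false ∷ x) ()
    accept-ok (true ∷ x)  ()

    in→ok : ∀ y → InSet C y → length y ≡ suc (length z) × AllOk (sim t (oinit M) y)
    in→ok y i = proj₁ i , proj₁ (fails-code t (oinit M) y) (trans (sym (failures-≡ y)) (accept-ok (failures u y)
      (trans (cong isTrue (sym (replies-≡ y))) (proj₁ (inSetV (encStr u) (length z) y (proj₁ i)) i))))

    ok→in : ∀ y → length y ≡ suc (length z) → AllOk (sim t (oinit M) y) → InSet C y
    ok→in y len ok = proj₂ (inSetV (encStr u) (length z) y len)
      (trans (cong isTrue (replies-≡ y)) (cong (λ x → isTrue (caseStr x (true ∷ []) (λ _ → []) (λ _ → [])))
        (trans (failures-≡ y) (proj₂ (fails-code t (oinit M) y) ok))))

    fits : Fits t (oinit M)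
    fits = n≤1+n t

  reduces-PNP : ∀ y w → LeastNumber (instance-of u) y (counterexample u y w) →
    Σ (List Entry) λ L → (encEntries L ≡ transcript u y) × Consistent M t (oinit M) L × YesCorrect L × ¬ Refutes L w
  reduces-PNP y w ln = L , sym (transcript-≡ y) , sim-consistent t (oinit M) y , sim-yes t (oinit M) y fits long ok , unrefuted
    where
    L : List Entry
    L = sim t (oinit M) y
    base-in : InSet C (true ∷ unary z)
    base-in = ok→in (true ∷ unary z) (cong suc (length-replicate (length z))) (sim-no t (oinit M) (suc (length z)))
    sol : InSet C y × ¬ (InSet C (counterexample u y w) × (counterexample u y w <lex y))
    -- The hypothesis is used at the one circuit whose code is the instance by construction.
    sol = ln (suc (length z)) C (true ∷ unary z) instance-≡ base-in
    ok : AllOk L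
    ok = proj₂ (in→ok y (proj₁ sol))
    y-length : length y ≡ suc (length z)
    y-length = proj₁ (in→ok y (proj₁ sol))
    long : t * B ≤ length y
    long = ≤-trans (≤-reflexive (sym z-length)) (≤-trans (n≤1+n _) (≤-reflexive (sym y-length)))
    unrefuted : ¬ Refutes L w
    unrefuted (i , a , q , w≡ , e , sat) = proj₂ sol (ok→in _ cex-length (subst (λ x → AllOk (sim t (oinit M) x)) (sym cex-≡) (proj₁ rev)) ,
        subst (_<lex y) (sym cex-≡) (proj₁ (proj₂ rev)))
      where
      p : Str
      p = List.take (i * B) y ++ false ∷ a
      k : ℕ
      k = suc (length z) ∸ length p
      rev : AllOk (sim t (oinit M) (revise i a y k)) × (revise i a y k <lex y) × suc i ≤ t × length a ≤ suc t
      rev = sim-revise t (oinit M) y i q a k fits long ok e sat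
      p≡ : takeS (repS (ones w) (blockOf u)) y ++ false ∷ fstS (afterOnes w) ≡ p
      p≡ = cong₂ (λ n b → List.take n y ++ false ∷ b)
        (trans (length-repS (ones w) (blockOf u)) (cong₂ _*_ (trans (cong (length ∘ ones) (sym w≡)) (trans (cong length (ones-enc i (encStr a))) (length-replicate i))) block-length-≡))
        (trans (cong (fstS ∘ afterOnes) (sym w≡)) (trans (cong fstS (trans (afterOnes-enc i (encStr a)) (sym (++-identityʳ (encStr a))))) (fstS-pair a [])))
      cex-p : counterexample u y w ≡ p ++ un k
      cex-p = trans (cong (λ p → p ++ dropS p (un (suc (length z)))) p≡) (cong (p ++_) (drop-un (length p) (suc (length z))))
      cex-≡ : counterexample u y w ≡ revise i a y k
      cex-≡ = trans cex-p (++-assoc (List.take (i * B) y) (false ∷ a) (un k))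
      p-length : length p ≤ suc (length z)
      p-length = ≤-trans (≤-reflexive (length-++ (List.take (i * B) y))) (≤-trans
        (+-mono-≤ (≤-trans (≤-reflexive (length-take (i * B) y)) (m⊓n≤m (i * B) (length y))) (s≤s (proj₂ (proj₂ (proj₂ rev)))))
        (≤-trans (≤-reflexive (+-comm (i * B) B)) (≤-trans (*-monoˡ-≤ B (proj₁ (proj₂ (proj₂ rev)))) (≤-trans (≤-reflexive (sym z-length)) (n≤1+n _)))))
      cex-length : length (counterexample u y w) ≡ suc (length z)
      cex-length = trans (cong length cex-p) (trans (length-++ p) (trans (cong (length p +_) (length-replicate k)) (m+[n∸m]≡n p-length)))

PNP-to-LN : CexReducible PNPComputation LeastNumber
PNP-to-LN = instance-of , transcript , counterexample , instance-FP , FP-fromF2 transcript-F , FP-fromF3 counterexample-F ,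
  λ { u y w ln M t refl → reduces-PNP M t y w ln }

-- Second reduction: the queries of a bitwise search for the least element

maskBit : Bool → Bool → Bool
maskBit true  b = false
maskBit false b = b

mask : List Bool → Str → Str
mask []       a       = []
mask (o ∷ os) []      = []
mask (o ∷ os) (b ∷ a) = maskBit o b ∷ mask os a

mask-ʳ++ : ∀ os a {os′ a′} → length os ≡ length a → mask (os ʳ++ os′) (a ʳ++ a′) ≡ mask os a ʳ++ mask os′ a′
mask-ʳ++ []       []      e = refl
mask-ʳ++ (o ∷ os) (b ∷ a) e = mask-ʳ++ os a (suc-injective e)

mask-++ : ∀ os a {os′ a′} → length os ≡ length a → mask (os ++ os′) (a ++ a′) ≡ mask os a ++ mask os′ a′
mask-++ []       []      e = refl
mask-++ (o ∷ os) (b ∷ a) e = cong (maskBit o b ∷_) (mask-++ os a (suc-injective e))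

mask-none : ∀ a → mask (replicate (length a) false) a ≡ a
mask-none []      = refl
mask-none (b ∷ a) = cong (b ∷_) (mask-none a)

mask-length : ∀ os a → length os ≤ length a → length (mask os a) ≡ length os
mask-length []       a       le       = refl
mask-length (o ∷ os) (b ∷ a) (s≤s le) = cong suc (mask-length os a le)

-- Indices count from the newest wire, so additional wires further back change none of them. The
-- code of `C` can thus end a query verbatim.
weakenG : ∀ {m k} → m ≤ k → Gates m → Gates k
weakenG le (out i)     = out (F.inject≤ i le)
weakenG le (and i j g) = and (F.inject≤ i le) (F.inject≤ j le) (weakenG (s≤s le) g)
weakenG le (or i j g)  = or (F.inject≤ i le) (F.inject≤ j le) (weakenG (s≤s le) g)
weakenG le (not i g)   = not (F.inject≤ i le) (weakenG (s≤s le) g)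

enc-weakenG : ∀ {m k} (le : m ≤ k) (g : Gates m) → encGates (weakenG le g) ≡ encGates g
enc-weakenG le (out i)     = cong (λ n → false ∷ false ∷ encℕ n) (FP.toℕ-inject≤ i le)
enc-weakenG le (and i j g) = cong₂ (λ a b → false ∷ true ∷ a ++ b) (cong encℕ (FP.toℕ-inject≤ i le))
  (cong₂ _++_ (cong encℕ (FP.toℕ-inject≤ j le)) (enc-weakenG (s≤s le) g))
enc-weakenG le (or i j g)  = cong₂ (λ a b → true ∷ false ∷ a ++ b) (cong encℕ (FP.toℕ-inject≤ i le))
  (cong₂ _++_ (cong encℕ (FP.toℕ-inject≤ j le)) (enc-weakenG (s≤s le) g))
enc-weakenG le (not i g)   = cong₂ (λ a b → true ∷ true ∷ a ++ b) (cong encℕ (FP.toℕ-inject≤ i le)) (enc-weakenG (s≤s le) g)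

eval-weakenG : ∀ {m k} (le : m ≤ k) (g : Gates m) (u : Vec Bool m) (v : Vec Bool k) →
               (∀ i → V.lookup v (F.inject≤ i le) ≡ V.lookup u i) → evalG (weakenG le g) v ≡ evalG g u
eval-weakenG le (out i)     u v h = h i
eval-weakenG le (and i j g) u v h = eval-weakenG (s≤s le) g _ _
  (λ { F.zero → cong₂ _∧_ (h i) (h j) ; (F.suc l) → h l })
eval-weakenG le (or i j g)  u v h = eval-weakenG (s≤s le) g _ _
  (λ { F.zero → cong₂ _∨_ (h i) (h j) ; (F.suc l) → h l })
eval-weakenG le (not i g)   u v h = eval-weakenG (s≤s le) g _ _
  (λ { F.zero → cong Data.Bool.not (h i) ; (F.suc l) → h l })

lookup-prefix : ∀ {m k} (le : m ≤ k) (u : Vec Bool m) (v : Vec Bool k) {r} → toList v ≡ toList u ++ r → ∀ i → V.lookup v (F.inject≤ i le) ≡ V.lookup u i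
lookup-prefix (s≤s le) (b ∷ u) (c ∷ v) eq F.zero    = ∷-injectiveˡ eq
lookup-prefix (s≤s le) (b ∷ u) (c ∷ v) eq (F.suc i) = lookup-prefix le u v (∷-injectiveʳ eq) i

toList-inj : ∀ {k} (v w : Vec Bool k) → toList v ≡ toList w → v ≡ w
toList-inj []      []      e = refl
toList-inj (b ∷ v) (c ∷ w) e = cong₂ _∷_ (∷-injectiveˡ e) (toList-inj v w (∷-injectiveʳ e))

-- The query circuits have one extra input e, from which a constant 0 is made.
-- Row m then produces a copy of the (n − m)-th input, or 0 if its option is set,
-- so that the last n wires are the inputs of C with the chosen bits cleared.

module Queries (n : ℕ) (gs : Str) where

  -- Wire `m` is the constant 0: `or` with it copies a bit and `and` clears it. The other index is
  -- the same in all rows, because each row adds a wire while the next input to be treated is one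
  -- closer. Both forms have the same operands, so their codes differ in two bits only.
  rowR : ℕ → Bool → Raw ℕ
  rowR m false = orR (suc n) m
  rowR m true  = andR (suc n) m

  rowsR : ℕ → List Bool → List (Raw ℕ)
  rowsR m []       = []
  rowsR m (o ∷ os) = rowR m o ∷ rowsR (suc m) os

  gatesR : List Bool → List (Raw ℕ)
  gatesR os = notR n ∷ andR 0 (suc n) ∷ rowsR 0 os

  -- The options of the rows: all rows below m are free, row m is set, and ds are those above.
  options : ℕ → List Bool → List Bool
  options m ds = replicate m false ++ true ∷ ds

  query : ℕ → List Bool → Str
  query m ds = encℕ (suc n) ++ encRaws (gatesR (options m ds)) ++ gs

  rows-run : ∀ os ar xs D e → length os ≡ length ar → length xs + length ar ≡ n →
    RunRaw (rowsR (length xs) os) (xs ++ false ∷ Data.Bool.not e ∷ (ar ʳ++ D) ++ e ∷ [])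
           ((mask os ar ʳ++ xs) ++ false ∷ Data.Bool.not e ∷ (ar ʳ++ D) ++ e ∷ [])
  rows-run []       []       xs D e eq len = []
  rows-run (o ∷ os) (b ∷ ar) xs D e eq len = row o ∷ rows-run os ar (maskBit o b ∷ xs) (b ∷ D) e (suc-injective eq) (trans (sym (+-suc (length xs) (length ar))) len)
    where
    w : List Bool
    w = xs ++ false ∷ Data.Bool.not e ∷ (ar ʳ++ (b ∷ D)) ++ e ∷ []
    at-F : At w (length xs) false
    at-F = at-cast (+-identityʳ _) (at-++ xs refl at0)
    at-rev : ∀ ar D → At ((ar ʳ++ (b ∷ D)) ++ e ∷ []) (length ar) b
    at-rev ar D = at-cast-wires (sym (trans (cong (_++ e ∷ []) (ʳ++-defn ar)) (++-assoc (reverse ar) (b ∷ D) (e ∷ []))))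
      (at-cast (+-identityʳ _) (at-++ (reverse ar) (length-reverse ar) at0))
    at-b : At w (suc n) b
    at-b = at-cast (trans (arith (length xs) (length ar)) (cong suc len)) (at-++ xs refl (at+ (at+ (at-rev ar D))))
      where
      arith : ∀ a b → a + suc (suc b) ≡ suc (a + suc b)
      arith = solve-∀
    row : ∀ o → EvalRaw w (rowR (length xs) o) (maskBit o b)
    row false = subst (EvalRaw w (orR (suc n) (length xs))) (∨-false b) (orE at-b at-F)
      where
      ∨-false : ∀ b → b ∨ false ≡ b
      ∨-false false = refl
      ∨-false true  = refl
    row true = subst (EvalRaw w (andR (suc n) (length xs))) (∧-false b) (andE at-b at-F)
      where
      ∧-false : ∀ b → b ∧ false ≡ false
      ∧-false false = refl
      ∧-false true  = refl

  -- The 0 is the conjunction of `e` and its negation. Row 0 treats the last input and every later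
  -- result lands in front of it, so the inputs of `C` reappear in their order, with the options
  -- reversed.
  gates-run : ∀ os a e → length os ≡ n → length a ≡ n → RunRaw (gatesR os) (a ++ e ∷ []) (mask (reverse os) a ++ false ∷ Data.Bool.not e ∷ a ++ e ∷ [])
  gates-run os a e lo la = notE at-e ∷ (andE at0 (at+ at-e) ∷ rest (contra e))
    where
    w₁ : List Bool
    w₁ = Data.Bool.not e ∷ a ++ e ∷ []
    at-e : At (a ++ e ∷ []) n e
    at-e = at-cast (trans (+-identityʳ _) la) (at-++ a refl at0)
    contra : ∀ e → false ≡ Data.Bool.not e ∧ e
    contra false = refl
    contra true  = refl
    rev-a : reverse a ʳ++ [] ≡ a
    rev-a = trans (ʳ++-defn (reverse a)) (trans (++-identityʳ _) (reverse-involutive a))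
    masked : mask os (reverse a) ʳ++ [] ≡ mask (reverse os) a
    masked = trans (sym (mask-ʳ++ os (reverse a) (trans lo (trans (sym la) (sym (length-reverse a))))))
      (cong (mask (os ʳ++ [])) rev-a)
    rest : ∀ {b} → false ≡ b → RunRaw (rowsR 0 os) (b ∷ w₁) (mask (reverse os) a ++ false ∷ w₁)
    rest refl = subst₂ (λ x y → RunRaw (rowsR 0 os) (false ∷ Data.Bool.not e ∷ x ++ e ∷ []) (y ++ false ∷ Data.Bool.not e ∷ x ++ e ∷ [])) rev-a masked
      (rows-run os (reverse a) [] [] e (trans lo (trans (sym la) (sym (length-reverse a)))) (trans (length-reverse a) la))

  module _ (C : Gates n) (gs≡ : encGates C ≡ gs) (os : List Bool) (lo : length os ≡ n) where

    private
      valid : Valid (suc n) (gatesR os)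
      valid = subst (λ k → Valid k (gatesR os)) (trans (length-snoc (replicate n false) false) (cong suc (length-replicate n)))
        (run-valid (gates-run os (replicate n false) false lo (length-replicate n)))

      n≤ : n ≤ wires (gatesR os) (suc n)
      n≤ = ≤-trans (n≤1+n n) (wires-≥ (gatesR os) (suc n))

    queryC : Circuit (suc n)
    queryC = attach (gatesR os) valid (weakenG n≤ C)

    enc-queryC : encCircuit queryC ≡ encℕ (suc n) ++ encRaws (gatesR os) ++ gs
    enc-queryC = cong (encℕ (suc n) ++_) (trans (enc-attach (gatesR os) valid (weakenG n≤ C)) (cong (encRaws (gatesR os) ++_) (trans (enc-weakenG n≤ C) gs≡)))

    eval-queryC : ∀ (v : Vec Bool (suc n)) a e (u : Vec Bool n) → toList v ≡ a ++ e ∷ [] → length a ≡ n → toList u ≡ mask (reverse os) a →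
                  evalG queryC v ≡ evalG C u
    eval-queryC v a e u v≡ la u≡ =
        trans (proj₂ (proj₂ ev)) (eval-weakenG n≤ C u (proj₁ ev) (lookup-prefix n≤ u (proj₁ ev) (trans (proj₁ (proj₂ ev)) (cong (_++ false ∷ Data.Bool.not e ∷ a ++ e ∷ []) (sym u≡)))))
      where
      ev : Σ (Vec Bool (wires (gatesR os) (suc n))) λ y → toList y ≡ mask (reverse os) a ++ false ∷ Data.Bool.not e ∷ a ++ e ∷ [] ×
             evalG (attach (gatesR os) valid (weakenG n≤ C)) v ≡ evalG (weakenG n≤ C) y
      ev = eval-attach (gatesR os) valid (weakenG n≤ C) v (subst (λ w → RunRaw (gatesR os) w _) (sym v≡) (gates-run os a e lo la))

    inSet-eval : ∀ {k} (D : Circuit k) x → InSet D x → ∀ (v : Vec Bool k) → toList v ≡ x → evalG D v ≡ true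
    inSet-eval D x (refl , ev) v v≡ = trans (cong (evalG D) (toList-inj v (fromList x) (trans v≡ (sym (VP.toList∘fromList x))) )) ev

    eval-inSet : ∀ {k} (D : Circuit k) x (v : Vec Bool k) → toList v ≡ x → evalG D v ≡ true → InSet D x
    eval-inSet D x v refl ev = VP.length-toList v , trans (cong (evalG D) (toList-inj _ v (trans (toList-subst (VP.length-toList v) (fromList (toList v))) (VP.toList∘fromList (toList v))))) ev

    vecOf : ∀ {k} (x : Str) → length x ≡ k → Σ (Vec Bool k) λ v → toList v ≡ x
    vecOf x refl = fromList x , VP.toList∘fromList x

    -- The spare last input of the assignment disappears because `mask` stops with the options.
    sat-queryC : ∀ a → InSet queryC a → InSet C (mask (reverse os) a)
    sat-queryC a i with snoc a (proj₁ i)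
      where
      snoc : ∀ (a : Str) {k} → length a ≡ suc k → ∃ λ a₁ → ∃ λ e → a ≡ a₁ ++ e ∷ [] × length a₁ ≡ k
      snoc (b ∷ [])        refl = [] , b , refl , refl
      snoc (b ∷ a@(_ ∷ _)) refl with snoc a refl
      ... | a₁ , e , eq , l = b ∷ a₁ , e , cong (b ∷_) eq , cong suc l
    ... | a₁ , e , refl , la = subst (InSet C) drop-last
            (eval-inSet C (mask (reverse os) a₁) (proj₁ u) (proj₂ u) (trans (sym (eval-queryC (proj₁ v) a₁ e (proj₁ u) (proj₂ v) la (proj₂ u))) (inSet-eval queryC _ i (proj₁ v) (proj₂ v))))
      where
      v : Σ (Vec Bool (suc n)) λ v → toList v ≡ a₁ ++ e ∷ []
      v = vecOf (a₁ ++ e ∷ []) (proj₁ i)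
      same : length (reverse os) ≡ length a₁
      same = trans (length-reverse os) (trans lo (sym la))
      u : Σ (Vec Bool n) λ u → toList u ≡ mask (reverse os) a₁
      u = vecOf (mask (reverse os) a₁) (trans (mask-length (reverse os) a₁ (≤-reflexive same)) (trans (length-reverse os) lo))
      drop-last : mask (reverse os) a₁ ≡ mask (reverse os) (a₁ ++ e ∷ [])
      drop-last = sym (trans (cong (λ z → mask z (a₁ ++ e ∷ [])) (sym (++-identityʳ (reverse os)))) (trans (mask-++ (reverse os) a₁ same) (++-identityʳ _)))

    queryC-sat : ∀ w → InSet C w → mask (reverse os) w ≡ w → InSet queryC (w ++ false ∷ [])
    queryC-sat w i e = eval-inSet queryC (w ++ false ∷ []) (proj₁ v) (proj₂ v)
        (trans (eval-queryC (proj₁ v) w false (proj₁ u) (proj₂ v) (proj₁ i) (trans (proj₂ u) (sym e))) (inSet-eval C w i (proj₁ u) (proj₂ u)))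
      where
      v : Σ (Vec Bool (suc n)) λ v → toList v ≡ w ++ false ∷ []
      v = vecOf (w ++ false ∷ []) (trans (length-snoc w false) (cong suc (proj₁ i)))
      u : Σ (Vec Bool n) λ u → toList u ≡ w
      u = vecOf w (proj₁ i)

    -- The witness comes with some circuit `C′` that has the same code as `queryC`. Both are
    -- evaluated through their common string by `evalS`, so that the two circuits need not be
    -- identified.
    satWitness-query : ∀ {q a} → encℕ (suc n) ++ encRaws (gatesR os) ++ gs ≡ q → SatWitness q a → InSet C (mask (reverse os) a)
    satWitness-query {q} {a} q≡ sat@(n′ , C′ , e′ , i′) = sat-queryC a (eval-inSet queryC a (proj₁ v) (proj₂ v)
        (∷-injectiveˡ (trans (sym (trans (cong (λ x → evalS (encCircuit queryC) x) (sym (proj₂ v))) (evalS-complete queryC (proj₁ v))))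
          (trans (cong (λ x → evalS x a) (trans enc-queryC q≡)) (evalS-complete-Sat sat)))))
      where
      ones-eq : un n′ ≡ un (suc n)
      ones-eq = trans (sym (ones-enc n′ (encGates C′))) (trans (cong ones (trans e′ (sym q≡))) (ones-enc (suc n) _))
      v : Σ (Vec Bool (suc n)) λ v → toList v ≡ a
      v = vecOf a (trans (proj₁ i′) (trans (sym (length-replicate n′)) (trans (cong length ones-eq) (length-replicate (suc n)))))

    query-satWitness : ∀ {q} w → encℕ (suc n) ++ encRaws (gatesR os) ++ gs ≡ q → InSet C w → mask (reverse os) w ≡ w → SatWitness q (w ++ false ∷ [])
    query-satWitness w q≡ i e = suc n , queryC , trans enc-queryC q≡ , queryC-sat w i e

halted-consistent : ∀ M t c {L} → OConf.state c ≡ OTM.halt M → OTM.halt M ≢ OTM.qry M → Consistent M t c L → L ≡ []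
halted-consistent M zero    c e ne h = h
halted-consistent M (suc t) c@(oconf q w o) e ne h with q F.≟ OTM.qry M
... | yes e′ = ⊥-elim (ne (trans (sym e) e′))
... | no _   with q F.≟ OTM.halt M
...   | yes _ = halted-consistent M t c e ne h
...   | no ne′ = ⊥-elim (ne′ e)

consistent-step : ∀ M t c {L} → OConf.state c ≢ OTM.qry M → Consistent M (suc t) c L → Consistent M t (ostep M c) L
consistent-step M t c ne h with OConf.state c F.≟ OTM.qry M
... | yes e = ⊥-elim (ne e)
... | no _  = h

consistent-query : ∀ M t c {L} → OConf.state c ≡ OTM.qry M → Consistent M (suc t) c L →
  ∃ λ r → ∃ λ L′ → L ≡ (fromLeftEnd (OConf.orac c) , r) ∷ L′ × Consistent M t (answer M c r) L′
consistent-query M t c {L} e h with OConf.state c F.≟ OTM.qry M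
consistent-query M t c {[]} e h | yes _ = ⊥-elim h
consistent-query M t c {(q , r) ∷ L} e (refl , h) | yes _ = r , L , refl , h
... | no ne = ⊥-elim (ne e)

isYes : Reply → Bool
isYes (just _) = true
isYes nothing  = false

-- The oracle machine of the search

module Search (n : ℕ) (gs : Str) where
  open Queries n gs using (rowR; rowsR; options; query)

  -- A cell of the two tapes, which are moved in step: the marks on the work
  -- tape are at the second bits of the rows and at the end of the header.
  TwoCell : Set
  TwoCell = Sym × Bool

  plainC : Bool → TwoCell
  plainC b = nothing , b

  header : Str
  header = encℕ (suc n) ++ true ∷ true ∷ encℕ n ++ false ∷ true ∷ false ∷ un (suc n)

  operands : ℕ → Str
  operands m = false ∷ un m ++ false ∷ un (suc n)

  -- Cells are listed from the right end of the tape, so all strings appear reversed. Rows start in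
  -- their `or` form with a mark on the second bit of the code. The end mark sits on the 0 that
  -- closes the last index of the header, which `header` therefore omits.
  rowsRev : ℕ → List TwoCell
  rowsRev zero    = (just false , false) ∷ map plainC (reverse header)
  rowsRev (suc m) = map plainC (operands m) ++ (just true , false) ∷ plainC true ∷ rowsRev m

  revT : List TwoCell
  revT = map plainC (reverse gs) ++ rowsRev n

  -- State 5 scans to the left. At the mark of a row, 5 and 2 rewrite 10 as 01, which turns `or`
  -- into `and`, and 1 asks. A YES leads back to 5 and leaves the bit cleared; a NO leads to 3 and
  -- 4, which restore 10. The end mark stops the machine.
  special : ∀ {ℓ} → Sym → Sym → Fin 6 → Fin (6 + ℓ) × (Sym × Move) × (Sym × Move)
  special a b #0 = #0 , (a , mvS) , (b , mvS)
  special a b #1 = #0 , (a , mvS) , (b , mvS)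
  special a b #2 = #1 , (a , mvS) , (just false , mvS)
  special a b #3 = #4 , (a , mvR) , (just true , mvR)
  special a b #4 = #5 , (a , mvL) , (just false , mvL)
  special nothing      b #5 = #5 , (nothing , mvL) , (b , mvL)
  special (just false) b #5 = #0 , (just false , mvS) , (b , mvS)
  special (just true)  b #5 = #2 , (just true , mvL) , (just true , mvL)

  -- The states from 6 on form a countdown that writes the initial tape, one cell per state, and
  -- ends in state 5.
  δS : Fin (6 + length revT) → Sym → Sym → Fin (6 + length revT) × (Sym × Move) × (Sym × Move)
  δS #0 a b = special a b #0
  δS #1 a b = special a b #1
  δS #2 a b = special a b #2
  δS #3 a b = special a b #3
  δS #4 a b = special a b #4
  δS #5 a b = special a b #5
  δS (F.suc (F.suc (F.suc (F.suc (F.suc (F.suc k)))))) a b =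
    F.suc (F.suc (F.suc (F.suc (F.suc (F.inject₁ k))))) , (proj₁ (List.lookup revT k) , mvR) , (just (proj₂ (List.lookup revT k)) , mvR)

  M : OTM
  M = record { nQ = 6 + length revT ; start = F.fromℕ (5 + length revT) ; halt = #0 ; qry = #1 ; yesQ = #5 ; noQ = #3 ; δ = δS }

  marks bits : List TwoCell → List Sym
  marks = map proj₁
  bits  = map (just ∘ proj₂)

  after-R : Str → List Sym
  after-R r = map just r ++ nothing ∷ []

  scanning : List TwoCell → List Sym → Str → OConf M
  scanning l rw r = oconf #5 (focusL (marks l) rw) (focusL (bits l) (after-R r))

  step-scan : ∀ b ps c l rw r → ostep M (scanning (plainC b ∷ (map plainC ps ++ c ∷ l)) rw r) ≡ scanning (map plainC ps ++ c ∷ l) (nothing ∷ rw) (b ∷ r)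
  step-scan b []       c l rw r = refl
  step-scan b (p ∷ ps) c l rw r = refl

  scan : ∀ ps c l rw r t {L} → Consistent M (length ps + t) (scanning (map plainC ps ++ c ∷ l) rw r) L →
         ∃ λ rw′ → Consistent M t (scanning (c ∷ l) rw′ (ps ʳ++ r)) L
  scan []       c l rw r t h = rw , h
  scan (b ∷ ps) c l rw r t {L} h = scan ps c l (nothing ∷ rw) (b ∷ r) t
    (subst (λ c → Consistent M (length ps + t) c L) (step-scan b ps c l rw r) (consistent-step M (length ps + t) (scanning (plainC b ∷ (map plainC ps ++ c ∷ l)) rw r) {L} (λ ()) h))

  -- The form that every consistent list of entries must have, whatever the replies: `m` bits are
  -- still undecided, and `ds` holds the replies so far, the latest first, which determine the next
  -- query.
  Trace : ℕ → List Bool → List Entry → Set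
  Trace zero    ds L             = L ≡ []
  Trace (suc m) ds []            = ⊥
  Trace (suc m) ds ((q , r) ∷ L) = q ≡ query m ds × Trace m (isYes r ∷ ds) L

  prefixS : ℕ → Str
  prefixS zero    = header ++ false ∷ []
  prefixS (suc m) = prefixS m ++ encRaw (rowR m false)

  bits-plain : ∀ ps → map proj₂ (map plainC ps) ≡ ps
  bits-plain []       = refl
  bits-plain (b ∷ ps) = cong (b ∷_) (bits-plain ps)

  operands-rev : ∀ m r → operands m ʳ++ r ≡ encℕ (suc n) ++ encℕ m ++ r
  operands-rev m r = trans (++-ʳ++ (false ∷ un m) {false ∷ un (suc n)}) (trans (un-ʳ++ (suc n) _) (trans (cong (un (suc n) ++_) (cong (false ∷_) (un-ʳ++ m (false ∷ r))))
      (trans (sym (++-assoc (un (suc n)) (false ∷ []) _)) (cong (encℕ (suc n) ++_) (sym (++-assoc (un m) (false ∷ []) r))))))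
    where
    un-snoc : ∀ k (x : Str) → un k ++ true ∷ x ≡ true ∷ un k ++ x
    un-snoc zero    x = refl
    un-snoc (suc k) x = cong (true ∷_) (un-snoc k x)
    un-ʳ++ : ∀ k x → un k ʳ++ x ≡ un k ++ x
    un-ʳ++ zero    x = refl
    un-ʳ++ (suc k) x = trans (un-ʳ++ k (true ∷ x)) (un-snoc k x)

  rowsRev-bits : ∀ m → reverse (map proj₂ (rowsRev m)) ≡ prefixS m
  rowsRev-bits zero    = trans (unfold-reverse false (map proj₂ (map plainC (reverse header)))) (cong (_++ false ∷ []) (trans (cong reverse (bits-plain (reverse header))) (reverse-involutive header)))
  rowsRev-bits (suc m) = trans (cong reverse (trans (map-++ proj₂ (map plainC (operands m)) _) (cong (_++ false ∷ true ∷ map proj₂ (rowsRev m)) (bits-plain (operands m)))))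
    (trans (reverse-++ (operands m) (false ∷ true ∷ map proj₂ (rowsRev m)))
    (trans (cong₂ _++_ (trans (ʳ++-defn′ (map proj₂ (rowsRev m))) (cong (_++ true ∷ false ∷ []) (rowsRev-bits m))) (trans (sym (trans (ʳ++-defn (operands m)) (++-identityʳ _))) (trans (operands-rev m []) (cong (encℕ (suc n) ++_) (++-identityʳ (encℕ m))))))
    (++-assoc (prefixS m) (true ∷ false ∷ []) _)))
    where
    ʳ++-defn′ : ∀ (x : Str) → reverse (false ∷ true ∷ x) ≡ reverse x ++ true ∷ false ∷ []
    ʳ++-defn′ x = trans (unfold-reverse false (true ∷ x)) (trans (cong (_++ false ∷ []) (unfold-reverse true x)) (++-assoc (reverse x) _ _))

  query-split : ∀ m os → encℕ (suc n) ++ encRaws (notR n ∷ andR 0 (suc n) ∷ rowsR 0 (replicate m false ++ os)) ++ gs ≡ prefixS m ++ encRaws (rowsR m os) ++ gs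
  query-split zero os = trans (cong (encℕ (suc n) ++_) (re (encℕ n) (un (suc n)) (encRaws (rowsR 0 os))))
      (sym (trans (cong (_++ encRaws (rowsR 0 os) ++ gs) (++-assoc (encℕ (suc n)) _ (false ∷ []))) (++-assoc (encℕ (suc n)) _ _)))
    where
    re : ∀ (a b x : Str) → ((true ∷ true ∷ a) ++ (false ∷ true ∷ (false ∷ [] ++ (b ++ false ∷ []))) ++ x) ++ gs ≡
         ((true ∷ true ∷ a ++ false ∷ true ∷ false ∷ b) ++ false ∷ []) ++ x ++ gs
    re a b x = cong (λ z → true ∷ true ∷ z) (trans (cong (_++ gs) (sym (++-assoc a (false ∷ true ∷ false ∷ b ++ false ∷ []) x)))
      (trans (++-assoc (a ++ false ∷ true ∷ false ∷ b ++ false ∷ []) x gs) (cong (_++ x ++ gs) (sym (++-assoc a _ (false ∷ []))))))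
  query-split (suc m) os = trans (cong (λ l → encℕ (suc n) ++ encRaws (notR n ∷ andR 0 (suc n) ∷ rowsR 0 l) ++ gs) (rep m os)) (trans (query-split m (false ∷ os))
    (trans (cong (prefixS m ++_) (++-assoc (encRaw (rowR m false)) _ gs)) (sym (++-assoc (prefixS m) (encRaw (rowR m false)) _))))
    where
    rep : ∀ m (os : List Bool) → replicate (suc m) false ++ os ≡ replicate m false ++ false ∷ os
    rep zero    os = refl
    rep (suc m) os = cong (false ∷_) (rep m os)

  tape-query : ∀ m r → fromLeftEnd (tape (bits (rowsRev m)) (just false) (just true ∷ after-R r)) ≡ prefixS m ++ false ∷ true ∷ r
  tape-query m r = trans (cong (λ l → boolPrefix (l ++ map just (false ∷ true ∷ r) ++ nothing ∷ [])) rev)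
      (trans (cong boolPrefix (trans (sym (++-assoc (map just (prefixS m)) _ _)) (cong (_++ nothing ∷ []) (sym (map-++ just (prefixS m) _))))) (boolPrefix-++ (prefixS m ++ false ∷ true ∷ r) []))
    where
    rev : reverse (bits (rowsRev m)) ≡ map just (prefixS m)
    rev = trans (cong reverse (map-∘ {g = just} {f = proj₂} (rowsRev m))) (trans (sym (reverse-map just (map proj₂ (rowsRev m)))) (cong (map just) (rowsRev-bits m)))

  rowsRev-∷ : ∀ m → ∃ λ c → ∃ λ l → rowsRev m ≡ c ∷ l
  rowsRev-∷ zero    = _ , _ , refl
  rowsRev-∷ (suc m) = _ , _ , refl

  leave : ∀ m rw b r → ostep M (oconf #5 (tape (marks (rowsRev m)) nothing rw) (tape (bits (rowsRev m)) (just b) (after-R r)))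
          ≡ scanning (rowsRev m) (nothing ∷ rw) (b ∷ r)
  leave m rw b r with rowsRev m | rowsRev-∷ m
  ... | _ | c , l , refl = refl

  -- Besides scanning the operands, a row takes three steps for the mark, the other bit and the
  -- query, and three more after NO. After YES one step suffices and two are left over, so `search`
  -- assumes only a lower bound on the time.
  cost : ℕ → ℕ
  cost zero    = 0
  cost (suc m) = length (operands m) + (6 + cost m)

  -- The tape right of the head is the final part of the query, with rows shaped by the replies
  -- `ds`; to the left all rows still are in their `or` form. Together they spell `query m ds`
  -- whenever the machine asks.
  search : ∀ m ds rw r t L → cost m ≤ t → r ≡ encRaws (rowsR m ds) ++ gs →
           Consistent M t (scanning (rowsRev m) rw r) L → Trace m ds L
  search zero    ds rw r zero    L le eq h = h
  search zero    ds rw r (suc t) L le eq h = halted-consistent M t _ refl (λ ()) (consistent-step M t (scanning (rowsRev 0) rw r) {L} (λ ()) h)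
  search (suc m) ds rw r t L le eq h = go (t ∸ (length (operands m) + (6 + cost m))) refl
    where
    l : List TwoCell
    l = rowsRev m
    R : Str
    R = operands m ʳ++ r
    R-≡ : ∀ o → encRaw (rowR m o) ++ r ≡ encRaws (rowsR m (o ∷ ds)) ++ gs
    R-≡ o = trans (cong (encRaw (rowR m o) ++_) eq) (sym (++-assoc (encRaw (rowR m o)) (encRaws (rowsR (suc m) ds)) gs))
    row-true : false ∷ true ∷ R ≡ encRaws (rowsR m (true ∷ ds)) ++ gs
    row-true = trans (cong (λ z → false ∷ true ∷ z) (trans (operands-rev m r) (sym (++-assoc (encℕ (suc n)) (encℕ m) r)))) (R-≡ true)
    row-false : true ∷ false ∷ R ≡ encRaws (rowsR m (false ∷ ds)) ++ gs
    row-false = trans (cong (λ z → true ∷ false ∷ z) (trans (operands-rev m r) (sym (++-assoc (encℕ (suc n)) (encℕ m) r)))) (R-≡ false)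
    go : ∀ s → t ∸ (length (operands m) + (6 + cost m)) ≡ s → Trace (suc m) ds L
    go s es = marked (proj₂ scanned)
      where
      t-≡ : t ≡ length (operands m) + (6 + (cost m + s))
      t-≡ = trans (sym (m+[n∸m]≡n le)) (trans (cong (length (operands m) + (6 + cost m) +_) es) (trans (+-assoc (length (operands m)) (6 + cost m) s) (cong (length (operands m) +_) (+-assoc 6 (cost m) s))))
      scanned : ∃ λ rw′ → Consistent M (6 + (cost m + s)) (scanning ((just true , false) ∷ plainC true ∷ l) rw′ R) L
      scanned = scan (operands m) (just true , false) (plainC true ∷ l) rw r (6 + (cost m + s)) (subst (λ t → Consistent M t (scanning (rowsRev (suc m)) rw r) L) t-≡ h)
      rw₁ : List Sym
      rw₁ = just true ∷ proj₁ scanned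
      orc : Bool → Tape
      orc b = tape (bits l) (just b) (just true ∷ after-R R)
      wrk : Tape
      wrk = tape (marks l) nothing rw₁
      replied : ∀ ρ L′ → L ≡ (fromLeftEnd (orc false) , ρ) ∷ L′ → Consistent M (3 + (cost m + s)) (answer M (oconf #1 wrk (orc false)) ρ) L′ → Trace (suc m) ds L
      replied (just a) L′ refl h = trans (tape-query m R) (trans (cong (prefixS m ++_) row-true) (sym (query-split m (true ∷ ds)))) ,
        search m (true ∷ ds) (nothing ∷ rw₁) (false ∷ true ∷ R) (2 + (cost m + s)) L′ (≤-trans (m≤m+n (cost m) s) (m≤n+m _ 2)) row-true
          (subst (λ c → Consistent M (2 + (cost m + s)) c L′) (leave m rw₁ false (true ∷ R)) (consistent-step M (2 + (cost m + s)) (oconf #5 wrk (orc false)) {L′} (λ ()) h))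
      replied nothing L′ refl h = trans (tape-query m R) (trans (cong (prefixS m ++_) row-true) (sym (query-split m (true ∷ ds)))) ,
        search m (false ∷ ds) (nothing ∷ rw₁) (true ∷ false ∷ R) (cost m + s) L′ (m≤m+n (cost m) s) row-false
          (subst (λ c → Consistent M (cost m + s) c L′) (leave m rw₁ true (false ∷ R))
            (consistent-step M (cost m + s) (oconf #5 wrk (tape (bits l) (just true) (just false ∷ after-R R))) {L′} (λ ())
            (consistent-step M (1 + (cost m + s)) (oconf #4 (tape (nothing ∷ marks l) (just true) (proj₁ scanned)) (tape (just true ∷ bits l) (just true) (after-R R))) {L′} (λ ())
            (consistent-step M (2 + (cost m + s)) (oconf #3 wrk (orc false)) {L′} (λ ()) h))))
      marked : Consistent M (6 + (cost m + s)) (scanning ((just true , false) ∷ plainC true ∷ l) (proj₁ scanned) R) L → Trace (suc m) ds L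
      marked h = let (ρ , L′ , e , h′) = asked in replied ρ L′ e h′
        where
        asked : ∃ λ ρ → ∃ λ L′ → L ≡ (fromLeftEnd (orc false) , ρ) ∷ L′ × Consistent M (3 + (cost m + s)) (answer M (oconf #1 wrk (orc false)) ρ) L′
        asked = consistent-query M (3 + (cost m + s)) (oconf #1 wrk (orc false)) {L} refl
          (consistent-step M (4 + (cost m + s)) (oconf #2 wrk (orc true)) {L} (λ ())
          (consistent-step M (5 + (cost m + s)) (scanning ((just true , false) ∷ plainC true ∷ l) (proj₁ scanned) R) {L} (λ ()) h))

  drop-lookup-list : ∀ {A : Set} (x : List A) (k : Fin (length x)) → List.drop (toℕ k) x ≡ List.lookup x k ∷ List.drop (suc (toℕ k)) x
  drop-lookup-list (a ∷ x) F.zero    = refl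
  drop-lookup-list (a ∷ x) (F.suc k) = drop-lookup-list x k

  written : Fin (6 + length revT) → ℕ → OConf M
  written q k = oconf q (tape (marks (List.drop k revT)) nothing []) (tape (bits (List.drop k revT)) nothing [])

  -- In state `5 + k` the first `k` cells of `revT` are still missing; they are the rightmost ones
  -- on the tape.
  writing : ∀ k (q : Fin (6 + length revT)) t {L} → toℕ q ≡ 5 + k → Consistent M (k + t) (written q k) L → Consistent M t (written #5 0) L
  writing zero q t {L} e h = subst (λ q → Consistent M t (written q 0) L) (FP.toℕ-injective e) h
  writing (suc k) (F.suc (F.suc (F.suc (F.suc (F.suc (F.suc i)))))) t {L} e h =
    writing k (F.suc (F.suc (F.suc (F.suc (F.suc (F.inject₁ i)))))) t (trans (cong (5 +_) (FP.toℕ-inject₁ i)) (cong (5 +_) k≡))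
      (subst (λ l → Consistent M (k + t) (oconf (F.suc (F.suc (F.suc (F.suc (F.suc (F.inject₁ i)))))) (tape (marks l) nothing []) (tape (bits l) nothing [])) L) here′
        (consistent-step M (k + t) (written (F.suc (F.suc (F.suc (F.suc (F.suc (F.suc i)))))) (suc k)) {L} (λ ()) h))
    where
    k≡ : toℕ i ≡ k
    k≡ = suc-injective (suc-injective (suc-injective (suc-injective (suc-injective (suc-injective e)))))
    here′ : List.lookup revT i ∷ List.drop (suc k) revT ≡ List.drop k revT
    here′ = subst (λ j → List.lookup revT i ∷ List.drop (suc j) revT ≡ List.drop j revT) k≡ (sym (drop-lookup-list revT i))

  trace : ∀ t L → length revT + (1 + (length gs + cost n)) ≤ t → Consistent M t (oinit M) L → Trace n [] L
  trace t L le h = search n [] (proj₁ scanned) gs (cost n + s) L (m≤m+n (cost n) s) refl (subst (λ r → Consistent M (cost n + s) (scanning (rowsRev n) (proj₁ scanned) r) L) rev-gs (sc′ (proj₂ scanned)))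
    where
    s : ℕ
    s = t ∸ (length revT + (1 + (length gs + cost n)))
    t-≡ : t ≡ length revT + (1 + (length (reverse gs) + (cost n + s)))
    t-≡ = trans (sym (m+[n∸m]≡n le)) (trans (arith (length revT) (length gs) (cost n) s) (cong (λ g → length revT + (1 + (g + (cost n + s)))) (sym (length-reverse gs))))
      where
      arith : ∀ a b c d → (a + (1 + (b + c))) + d ≡ a + (1 + (b + (c + d)))
      arith = solve-∀
    start-≡ : oinit M ≡ written (F.fromℕ (5 + length revT)) (length revT)
    start-≡ = cong (λ l → oconf (F.fromℕ (5 + length revT)) (tape (marks l) nothing []) (tape (bits l) nothing [])) (sym (drop-all (length revT) revT ≤-refl))
    done : Consistent M (1 + (length (reverse gs) + (cost n + s))) (written #5 0) L
    done = writing (length revT) (F.fromℕ (5 + length revT)) _ (FP.toℕ-fromℕ (5 + length revT))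
      (subst (λ c → Consistent M (length revT + (1 + (length (reverse gs) + (cost n + s)))) c L) start-≡ (subst (λ t → Consistent M t (oinit M) L) t-≡ h))
    first-scan : Consistent M (length (reverse gs) + (cost n + s)) (scanning revT (nothing ∷ []) []) L
    first-scan = subst (λ c → Consistent M (length (reverse gs) + (cost n + s)) c L) (go revT refl) (consistent-step M (length (reverse gs) + (cost n + s)) (written #5 0) {L} (λ ()) done)
      where
      go : ∀ x → revT ≡ x → ostep M (oconf #5 (tape (marks x) nothing []) (tape (bits x) nothing [])) ≡ scanning x (nothing ∷ []) []
      go (c ∷ x) e = refl
      go []      e = ⊥-elim (nonempty (reverse gs) e)
        where
        nonempty : ∀ x → map plainC x ++ rowsRev n ≢ []
        nonempty []      e = case trans (sym (proj₂ (proj₂ (rowsRev-∷ n)))) e of λ ()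
        nonempty (b ∷ x) ()
    scanned : ∃ λ rw′ → Consistent M (cost n + s) (scanning (proj₁ (rowsRev-∷ n) ∷ proj₁ (proj₂ (rowsRev-∷ n))) rw′ (reverse gs ʳ++ [])) L
    scanned = scan (reverse gs) (proj₁ (rowsRev-∷ n)) (proj₁ (proj₂ (rowsRev-∷ n))) (nothing ∷ []) [] (cost n + s)
      (subst (λ l → Consistent M (length (reverse gs) + (cost n + s)) (scanning (map plainC (reverse gs) ++ l) (nothing ∷ []) []) L) (proj₂ (proj₂ (rowsRev-∷ n))) first-scan)
    sc′ : ∀ {rw r} → Consistent M (cost n + s) (scanning (proj₁ (rowsRev-∷ n) ∷ proj₁ (proj₂ (rowsRev-∷ n))) rw r) L → Consistent M (cost n + s) (scanning (rowsRev n) rw r) L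
    sc′ {rw} {r} = subst (λ l → Consistent M (cost n + s) (scanning l rw r) L) (sym (proj₂ (proj₂ (rowsRev-∷ n))))
    rev-gs : reverse gs ʳ++ [] ≡ gs
    rev-gs = trans (ʳ++-defn (reverse gs)) (trans (++-identityʳ _) (reverse-involutive gs))

-- Splitting off the gates of an encoded circuit

skipGate : Vec Str 2 → Vec Str 2
skipGate (r ∷ d ∷ []) = caseStr d (caseStr r ([] ∷ [] ∷ [])
    (λ x → caseStr x ([] ∷ [] ∷ []) (λ y → afterOnes y ∷ (true ∷ []) ∷ []) (λ y → afterOnes (afterOnes y) ∷ [] ∷ []))
    (λ x → caseStr x ([] ∷ [] ∷ []) (λ y → afterOnes (afterOnes y) ∷ [] ∷ []) (λ y → afterOnes y ∷ [] ∷ [])))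
  (λ _ → r ∷ d ∷ []) (λ _ → r ∷ d ∷ [])

skipGate-P : P skipGate
skipGate-P = P-ext (λ { (r ∷ d ∷ []) → refl }) (matchP (arg #1)
  (matchP (arg #0) none (matchP (arg #0) none (ap1 afterOnes-F (arg #0) ∷P constF (true ∷ [])) two)
    (matchP (arg #0) none two (ap1 afterOnes-F (arg #0) ∷P nil-P)))
  (sel-P F.suc) (sel-P F.suc))
  where
  none : ∀ {n} → P {n} (λ _ → [] ∷ [] ∷ [])
  none = nil-P ∷P nil-P
  two : ∀ {n} → P {suc n} (λ v → afterOnes (afterOnes (V.lookup v #0)) ∷ [] ∷ [])
  two = ap1 afterOnes-F (ap1 afterOnes-F (arg #0)) ∷P nil-P

skipGate-size : ∀ v → szV (skipGate v) ≤ 3 + szV v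
skipGate-size (r ∷ d ∷ []) = caseStr-elim Small d
    (caseStr-elim Small r none
      (λ x x≤ → caseStr-elim Small x none (λ y y≤ → out-gate y (≤-trans y≤ x≤)) (λ y y≤ → two y (≤-trans y≤ x≤)))
      (λ x x≤ → caseStr-elim Small x none (λ y y≤ → two y (≤-trans y≤ x≤)) (λ y y≤ → one y (≤-trans y≤ x≤))))
    (λ _ _ → m≤n+m _ 3) (λ _ _ → m≤n+m _ 3)
  where
  Small : Vec Str 2 → Set
  Small v = szV v ≤ 3 + szV (r ∷ d ∷ [])
  short : ∀ x y → length x ≤ length r → length y ≤ 1 → Small (x ∷ y ∷ [])
  short x y x≤ y≤ = ≤-trans (s≤s (+-mono-≤ x≤ (s≤s (≤-trans (≤-reflexive (+-identityʳ _)) y≤)))) (≤-trans (≤-reflexive (arith (length r))) (+-monoʳ-≤ 3 (≤-trans (n≤1+n _) (m≤m+n (suc (length r)) _))))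
    where
    arith : ∀ a → 1 + (a + 2) ≡ 3 + a
    arith = solve-∀
  none : Small ([] ∷ [] ∷ [])
  none = short [] [] z≤n z≤n
  one : ∀ y → length y ≤ length r → Small (afterOnes y ∷ [] ∷ [])
  one y y≤ = short (afterOnes y) [] (≤-trans (afterOnes-≤ y) y≤) z≤n
  out-gate : ∀ y → length y ≤ length r → Small (afterOnes y ∷ (true ∷ []) ∷ [])
  out-gate y y≤ = short (afterOnes y) (true ∷ []) (≤-trans (afterOnes-≤ y) y≤) ≤-refl
  two : ∀ y → length y ≤ length r → Small (afterOnes (afterOnes y) ∷ [] ∷ [])
  two y y≤ = short (afterOnes (afterOnes y)) [] (≤-trans (afterOnes-≤ (afterOnes y)) (≤-trans (afterOnes-≤ y) y≤)) z≤n

afterOnes-operands : ∀ {m k} (i j : Fin m) (C : Gates k) r → afterOnes (afterOnes ((encFin i ++ encFin j ++ encGates C) ++ r)) ≡ encGates C ++ r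
afterOnes-operands i j C r = trans (cong (λ y → afterOnes (afterOnes y)) (trans (++-assoc (encFin i) _ r) (cong (encFin i ++_) (++-assoc (encFin j) _ r))))
  (trans (cong afterOnes (afterOnes-enc (toℕ i) _)) (afterOnes-enc (toℕ j) _))

skipGates-enc : ∀ {m} (C : Gates m) r x → length (encGates C) ≤ length x → iterV skipGate x ((encGates C ++ r) ∷ [] ∷ []) ≡ r ∷ (true ∷ []) ∷ []
skipGates-enc (out i) r (_ ∷ x) (s≤s le) = trans (cong (λ y → iterV skipGate x (y ∷ (true ∷ []) ∷ [])) (afterOnes-enc (toℕ i) r)) (iter-fixed skipGate x refl)
skipGates-enc (and i j C) r (_ ∷ x) (s≤s le) = trans (cong (λ y → iterV skipGate x (y ∷ [] ∷ [])) (afterOnes-operands i j C r))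
    (skipGates-enc C r x (≤-trans (≤-trans (≤-trans (length-++-≤ʳ (encGates C) {encFin j}) (length-++-≤ʳ _ {encFin i})) (n≤1+n _)) le))
skipGates-enc (or i j C) r (_ ∷ x) (s≤s le) = trans (cong (λ y → iterV skipGate x (y ∷ [] ∷ [])) (afterOnes-operands i j C r))
    (skipGates-enc C r x (≤-trans (≤-trans (≤-trans (length-++-≤ʳ (encGates C) {encFin j}) (length-++-≤ʳ _ {encFin i})) (n≤1+n _)) le))
skipGates-enc (not i C) r (_ ∷ x) (s≤s le) = trans (cong (λ y → iterV skipGate x (y ∷ [] ∷ [])) (trans (cong afterOnes (++-assoc (encFin i) _ r)) (afterOnes-enc (toℕ i) _)))
    (skipGates-enc C r x (≤-trans (≤-trans (length-++-≤ʳ (encGates C) {encFin i}) (n≤1+n _)) le))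

-- The gates have no end mark of their own, so the remainder is found by passing gate after gate,
-- and the prefix by cutting off as many symbols as the remainder has.
afterGates gatesPart : Str → Str
afterGates s = V.lookup (iterV skipGate s (s ∷ [] ∷ [])) #0
gatesPart s = takeS (dropS (afterGates s) s) s

afterGates-F : F1 afterGates
afterGates-F = mk1 (arg #0 ∘P iterGrow-P {I = λ v → V.lookup v #0 ∷ V.lookup v #0 ∷ [] ∷ []} (arg #0 ∷P arg #0 ∷P nil-P) skipGate-P 3 skipGate-size)

gatesPart-F : F1 gatesPart
gatesPart-F = mk1 (ap2 take-F (ap2 drop-F (ap1 afterGates-F (arg #0)) (arg #0)) (arg #0))

afterGates-enc : ∀ {m} (C : Gates m) r → afterGates (encGates C ++ r) ≡ r
afterGates-enc C r = cong (λ v → V.lookup v #0) (skipGates-enc C r (encGates C ++ r) (length-++-≤ˡ (encGates C)))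

gatesPart-enc : ∀ {m} (C : Gates m) r → gatesPart (encGates C ++ r) ≡ encGates C
gatesPart-enc C r = trans (cong (λ n → List.take n (encGates C ++ r)) len) (trans (take-++-≤ (length (encGates C)) (encGates C) r ≤-refl) (take-all (length (encGates C)) (encGates C) ≤-refl))
  where
  len : length (dropS (afterGates (encGates C ++ r)) (encGates C ++ r)) ≡ length (encGates C)
  len = trans (cong (λ y → length (dropS y (encGates C ++ r))) (afterGates-enc C r)) (trans (length-drop (length r) (encGates C ++ r))
    (trans (cong (_∸ length r) (length-++ (encGates C))) (m+n∸n≡m (length (encGates C)) (length r))))

-- Writing down the search machine

catD : ∀ {n} → (Vec Str (suc n) → Str) → Str → Vec Str n → Str
catD e []      v = []
catD e (b ∷ x) v = e (x ∷ v) ++ catD e x v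

catD-P : ∀ {n e} → Fun (suc n) e → Fun (suc n) (λ w → catD e (V.head w) (V.tail w))
catD-P {n} {e} p = rec1-P (catD e) nil-P h h (λ _ _ → refl) (λ _ _ → refl) (X ⊗ pol p) bd
  where
  h : Fun (2 + n) (λ w → e (V.lookup w #0 ∷ V.tail (V.tail w)) ++ V.lookup w #1)
  h = (p ∘P (arg #0 ∷P P-ext (λ { (x ∷ y ∷ v) → VP.tabulate∘lookup v }) (sel-P (λ i → F.suc (F.suc i))))) ++F arg #1
  bd : ∀ x v → length (catD e x v) ≤ szV (x ∷ v) * ⟦ pol p ⟧ (szV (x ∷ v))
  bd []      v = z≤n
  bd (b ∷ x) v = ≤-trans (≤-reflexive (length-++ (e (x ∷ v))))
    (+-mono-≤ (≤-trans (≤-trans (n≤1+n _) (≤-reflexive (cong suc (sym (+-identityʳ _))))) (bounded p (x ∷ v) _ (n≤1+n _)))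
              (≤-trans (bd x v) (*-monoʳ-≤ (szV (x ∷ v)) (pol-mono (pol p) (n≤1+n _)))))

-- `catS` recurses at its end, a concatenation over `Fin` at its front; moving a successor into `e`
-- reconciles them.
cat-shift : ∀ {n} (e : Vec Str (suc n) → Str) ℓ v → catS e (un (suc ℓ)) v ≡ e ([] ∷ v) ++ catS (λ w → e ((true ∷ V.head w) ∷ V.tail w)) (un ℓ) v
cat-shift e zero    v = sym (++-identityʳ (e ([] ∷ v)))
cat-shift e (suc ℓ) v = trans (cong (_++ e (un (suc ℓ) ∷ v)) (cat-shift e ℓ v)) (++-assoc (e ([] ∷ v)) _ _)

cat-tabulate : ∀ {n} {A : Set} (e : Vec Str (suc n) → Str) ℓ v (f : A → Str) (h : Fin ℓ → A) → (∀ k → e (un (toℕ k) ∷ v) ≡ f (h k)) → catS e (un ℓ) v ≡ concatMap f (List.tabulate h)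
cat-tabulate e zero    v f h eq = refl
cat-tabulate e (suc ℓ) v f h eq = trans (cat-shift e ℓ v) (cong₂ _++_ (eq F.zero) (cat-tabulate (λ w → e ((true ∷ V.head w) ∷ V.tail w)) ℓ v f (h ∘ F.suc) (λ k → eq (F.suc k))))

plainCode : Bool → Str
plainCode b = false ∷ b ∷ []

headerS : Str → Str
headerS N = (true ∷ N ++ false ∷ []) ++ true ∷ true ∷ (N ++ false ∷ []) ++ false ∷ true ∷ false ∷ true ∷ N

rowCode : Vec Str 2 → Str
rowCode v = mapS plainCode (false ∷ V.lookup v #0 ++ false ∷ true ∷ V.lookup v #1) ++ true ∷ true ∷ false ∷ true ∷ []

cellsCode : Str → Str → Str
cellsCode N gs = mapS plainCode (reverse gs) ++ catD rowCode N (N ∷ []) ++ true ∷ false ∷ mapS plainCode (reverse (headerS N))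

half : Str → Str
half []          = []
half (a ∷ [])    = []
half (a ∷ c ∷ x) = true ∷ half x

half-F : F1 half
half-F = rec2-F half (consF true (arg #1)) (consF true (arg #1)) (consF true (arg #1)) (consF true (arg #1)) refl (λ _ → refl) (λ _ → refl) (λ _ → refl) (λ _ → refl) (λ _ → refl) bd
  where
  bd : ∀ x → length (half x) ≤ length x
  bd []          = z≤n
  bd (a ∷ [])    = z≤n
  bd (a ∷ c ∷ x) = s≤s (≤-trans (bd x) (n≤1+n _))

entryOf : Str → Str → Str
entryOf k c = (true ∷ true ∷ true ∷ true ∷ true ∷ k ++ false ∷ []) ++
  caseStr c [] (λ d → false ∷ false ∷ true ∷ false ∷ true ∷ headS d ++ true ∷ false ∷ []) (λ d → true ∷ headS d ++ true ∷ false ∷ true ∷ false ∷ true ∷ false ∷ [])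

-- A writing state ignores both scanned symbols, so its nine table entries coincide. A cell has a
-- code of two bits, hence the offset of twice its number.
chainS : Vec Str 2 → Str
chainS v = timesS 9 (entryOf (V.lookup v #0) (take2 (dropS (V.lookup v #0 ++ V.lookup v #0) (V.lookup v #1))))

cell-F : F2 cellsCode
cell-F = mk2 (ap1 (map-F plainCode) (ap1 rev-P (arg #1)) ++F ((catD-P row ∘P (arg #0 ∷P arg #0)) ++F consF true (consF false (ap1 (map-F plainCode) (ap1 rev-P hdr)))))
  where
  row : Fun 2 rowCode
  row = ap1 (map-F plainCode) (consF false (arg #0 ++F consF false (consF true (arg #1)))) ++F constF (true ∷ true ∷ false ∷ true ∷ [])
  hdr : Fun 2 (λ v → headerS (V.lookup v #0))
  hdr = consF true (arg #0 ++F constF (false ∷ [])) ++F consF true (consF true ((arg #0 ++F constF (false ∷ [])) ++F consF false (consF true (consF false (consF true (arg #0))))))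

chain-F : Fun 2 chainS
chain-F = ap1 (times-F 9) (consF true (consF true (consF true (consF true (consF true (arg #0 ++F constF (false ∷ [])))))) ++F
  matchF (ap1 take2-F (ap2 drop-F (arg #0 ++F arg #0) (arg #1))) nil-P
    (consF false (consF false (consF true (consF false (consF true (ap1 head-F (arg #0) ++F constF (true ∷ false ∷ [])))))))
    (consF true (ap1 head-F (arg #0) ++F constF (true ∷ false ∷ true ∷ false ∷ true ∷ false ∷ []))))

module SearchCode (n : ℕ) (gs : Str) where
  open Search n gs
  open OTM M using (nQ)
  open Table M

  codeC : TwoCell → Str
  codeC (nothing , b) = plainCode b
  codeC (just m , _)  = true ∷ m ∷ []

  codeOf : List TwoCell → Str
  codeOf = concatMap codeC

  code-plain : ∀ ps → codeOf (map plainC ps) ≡ mapS plainCode ps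
  code-plain []       = refl
  code-plain (b ∷ ps) = cong (plainCode b ++_) (code-plain ps)

  code-rows : ∀ m → codeOf (rowsRev m) ≡ catD rowCode (un m) (un n ∷ []) ++ true ∷ false ∷ mapS plainCode (reverse header)
  code-rows zero    = cong (λ z → true ∷ false ∷ z) (code-plain (reverse header))
  code-rows (suc m) = trans (concatMap-++ codeC (map plainC (operands m)) _) (trans (cong₂ _++_ (code-plain (operands m)) (cong (λ z → true ∷ true ∷ false ∷ true ∷ z) (code-rows m)))
    (trans (sym (++-assoc (mapS plainCode (operands m)) (true ∷ true ∷ false ∷ true ∷ []) _)) (sym (++-assoc (rowCode (un m ∷ un n ∷ [])) _ _))))

  code-≡ : cellsCode (un n) gs ≡ codeOf revT
  code-≡ = sym (trans (concatMap-++ codeC (map plainC (reverse gs)) (rowsRev n)) (cong₂ _++_ (code-plain (reverse gs)) (code-rows n)))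

  half-code : ∀ l → half (codeOf l) ≡ un (length l)
  half-code []                = refl
  half-code ((nothing , b) ∷ l) = cong (true ∷_) (half-code l)
  half-code ((just m , b) ∷ l)  = cong (true ∷_) (half-code l)

  -- The code of a marked cell omits its bit, which is always 0.
  Good : TwoCell → Set
  Good (nothing , b) = ⊤
  Good (just m , b)  = b ≡ false

  good-lookup : ∀ (l : List TwoCell) → (∀ i c → At l i c → Good c) → ∀ k → Good (List.lookup l k)
  good-lookup (c ∷ l) h F.zero    = h 0 c at0
  good-lookup (c ∷ l) h (F.suc k) = good-lookup l (λ i c at → h (suc i) c (at+ at)) k

  good-plain : ∀ ps {l} → (∀ i c → At l i c → Good c) → ∀ i c → At (map plainC ps ++ l) i c → Good c
  good-plain []       h i       c at       = h i c at
  good-plain (b ∷ ps) h .0      c at0      = tt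
  good-plain (b ∷ ps) h (suc i) c (at+ at) = good-plain ps h i c at

  good-rows : ∀ m i c → At (rowsRev m) i c → Good c
  good-rows zero .0 c at0 = refl
  good-rows zero (suc i) c (at+ at) = good-plain (reverse header) {[]} (λ _ _ ()) i c (subst (λ l → At l i c) (sym (++-identityʳ _)) at)
  good-rows (suc m) i c at = good-plain (operands m) rest i c at
    where
    rest : ∀ i c → At ((just true , false) ∷ plainC true ∷ rowsRev m) i c → Good c
    rest .0 c at0 = refl
    rest .1 c (at+ at0) = tt
    rest (suc (suc i)) c (at+ (at+ at)) = good-rows m i c at

  drop-code : ∀ l (k : Fin (length l)) → ∃ λ r → dropS (un (toℕ k) ++ un (toℕ k)) (codeOf l) ≡ codeC (List.lookup l k) ++ r
  drop-code l k = let (r , e) = go l k in r , trans (cong (λ j → List.drop j (codeOf l)) (trans (length-++ (un (toℕ k))) (cong₂ _+_ (length-replicate (toℕ k)) (length-replicate (toℕ k))))) e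
    where
    go : ∀ l (k : Fin (length l)) → ∃ λ r → List.drop (toℕ k + toℕ k) (codeOf l) ≡ codeC (List.lookup l k) ++ r
    go (c ∷ l) F.zero = codeOf l , refl
    go ((nothing , b) ∷ l) (F.suc k) rewrite +-suc (toℕ k) (toℕ k) = go l k
    go ((just m , b) ∷ l)  (F.suc k) rewrite +-suc (toℕ k) (toℕ k) = go l k

  take2-code : ∀ c r → take2 (codeC c ++ r) ≡ codeC c
  take2-code (nothing , b) r = refl
  take2-code (just m , b)  r = refl

  entry-≡ : ∀ k c → Good c → entryOf (un k) (codeC c) ≡ encℕ (5 + k) ++ encSym (proj₁ c) ++ encMove mvR ++ encSym (just (proj₂ c)) ++ encMove mvR
  entry-≡ k (nothing , false)    g    = refl
  entry-≡ k (nothing , true)     g    = refl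
  entry-≡ k (just false , false) refl = refl
  entry-≡ k (just true , false)  refl = refl

  later : Fin (length revT) → Fin nQ
  later k = F.suc (F.suc (F.suc (F.suc (F.suc (F.suc k)))))

  stateStr : Fin nQ → Str
  stateStr q = concatMap encOutcome (ofState q)

  chain-≡ : catS chainS (half (cellsCode (un n) gs)) (cellsCode (un n) gs ∷ []) ≡ concatMap stateStr (List.tabulate later)
  chain-≡ = trans (cong (λ c → catS chainS (half c) (c ∷ [])) code-≡) (trans (cong (λ x → catS chainS x (codeOf revT ∷ [])) (half-code revT))
      (cat-tabulate chainS (length revT) (codeOf revT ∷ []) stateStr later entry-k))
    where
    entry-k : ∀ k → chainS (un (toℕ k) ∷ codeOf revT ∷ []) ≡ stateStr (later k)
    entry-k k = trans (cong (λ c → timesS 9 (entryOf (un (toℕ k)) c)) (trans (cong take2 (proj₂ (drop-code revT k))) (take2-code (List.lookup revT k) _)))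
      (trans (cong (timesS 9) (trans (entry-≡ (toℕ k) (List.lookup revT k) (good-lookup revT (good-plain (reverse gs) (good-rows n)) k))
        (cong (λ j → encℕ (5 + j) ++ encSym (proj₁ (List.lookup revT k)) ++ encMove mvR ++ encSym (just (proj₂ (List.lookup revT k))) ++ encMove mvR) (sym (FP.toℕ-inject₁ k)))))
      refl)

-- The targets of `special` have the same numbers whatever the length of the chain, so this part of
-- the table is a constant string.
specialStr : Str
specialStr = concatMap (λ i → concatMap (λ a → concatMap (λ b → enc (Search.special 0 [] {0} a b i)) syms) syms)
               (#0 ∷ #1 ∷ #2 ∷ #3 ∷ #4 ∷ #5 ∷ [])
  where
  syms : List Sym
  syms = nothing ∷ just false ∷ just true ∷ []
  enc : Fin 6 × (Sym × Move) × (Sym × Move) → Str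
  enc (q , (s , m) , (s′ , m′)) = encFin q ++ encSym s ++ encMove m ++ encSym s′ ++ encMove m′

machineS searchInstance : Str → Str → Str
machineS ℓ cs = (true ∷ true ∷ true ∷ true ∷ true ∷ true ∷ ℓ ++ false ∷ []) ++ (true ∷ true ∷ true ∷ true ∷ true ∷ ℓ ++ false ∷ []) ++
  -- The unary codes of the states halt 0, query 1, yes 5 and no 3.
  (false ∷ true ∷ false ∷ true ∷ true ∷ true ∷ true ∷ true ∷ false ∷ true ∷ true ∷ true ∷ false ∷ []) ++ specialStr ++ catS chainS ℓ (cs ∷ [])
searchInstance N gs = machineS (half cs) cs ++ encStr (unary (true ∷ timesS 5 (half cs)))
  where
  cs = cellsCode N gs

module _ (n : ℕ) (gs : Str) where
  open Search n gs
  open SearchCode n gs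
  open Table M

  private
    t : ℕ
    t = suc (5 * length revT)

  table-≡ : concatMap encOutcome outcomes ≡ specialStr ++ concatMap stateStr (List.tabulate later)
  table-≡ = trans (concatMap-concatMap encOutcome ofState (List.allFin (6 + length revT))) refl

  machine-≡ : encOTM M ≡ machineS (un (length revT)) (codeOf revT)
  machine-≡ = trans encOTM-≡ (cong₂ (λ s tab → encℕ (6 + length revT) ++ s ++ encFin {6 + length revT} #0 ++ encFin {6 + length revT} #1 ++ encFin {6 + length revT} #5 ++ encFin {6 + length revT} #3 ++ tab)
      (cong encℕ (FP.toℕ-fromℕ (5 + length revT)))
      (trans table-≡ (cong (specialStr ++_) (sym (trans (cong₂ (λ x c → catS chainS x (c ∷ [])) (sym (trans (cong half code-≡) (half-code revT))) (sym code-≡)) chain-≡)))))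

  searchInstance-≡ : encPNP M t ≡ searchInstance (un n) gs
  searchInstance-≡ = cong₂ _++_ (trans machine-≡ (cong₂ machineS (sym (trans (cong half code-≡) (half-code revT))) (sym code-≡)))
    (cong (λ k → encStr (un (suc k))) (sym (trans (length-times 5 (half (cellsCode (un n) gs))) (cong (5 *_) (trans (cong length (trans (cong half code-≡) (half-code revT))) (length-replicate (length revT)))))))

  -- Each cell is written once, the turn takes one step, `gs` is scanned once, and a row costs at
  -- most three steps per cell. This gives the bound of five steps per cell and one more.
  enough-time : length revT + (1 + (length gs + cost n)) ≤ t
  enough-time = ≤-trans (+-monoʳ-≤ (length revT) (s≤s (+-mono-≤ gs≤ (≤-trans (cost≤ n) (*-monoʳ-≤ 3 rows≤))))) (≤-trans (≤-reflexive (arith (length revT))) ≤-refl)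
    where
    arith : ∀ l → l + (1 + (l + 3 * l)) ≡ suc (5 * l)
    arith = solve-∀
    split : length revT ≡ length gs + length (rowsRev n)
    split = trans (length-++ (map plainC (reverse gs))) (cong (_+ length (rowsRev n)) (trans (length-map plainC (reverse gs)) (length-reverse gs)))
    gs≤ : length gs ≤ length revT
    gs≤ = ≤-trans (m≤m+n _ _) (≤-reflexive (sym split))
    rows≤ : length (rowsRev n) ≤ length revT
    rows≤ = ≤-trans (m≤n+m _ (length gs)) (≤-reflexive (sym split))
    cost≤ : ∀ m → cost m ≤ 3 * length (rowsRev m)
    cost≤ zero    = z≤n
    cost≤ (suc m) = ≤-trans (+-monoʳ-≤ (length (operands m)) (+-monoʳ-≤ 6 (cost≤ m))) (≤-trans (+-monoˡ-≤ _ (m≤n*m (length (operands m)) 3))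
      (≤-reflexive (trans (arith₂ (length (operands m)) (length (rowsRev m))) (cong (3 *_) (sym (trans (length-++ (map plainC (operands m))) (cong (_+ suc (suc (length (rowsRev m)))) (length-map plainC (operands m)))))))))
      where
      arith₂ : ∀ a b → 3 * a + (6 + 3 * b) ≡ 3 * (a + (2 + b))
      arith₂ = solve-∀

  searchTrace : ∀ L → Consistent M t (oinit M) L → Trace n [] L
  searchTrace L h = trace t L enough-time h

searchInstance-F : F2 searchInstance
searchInstance-F = mk2 ((consF true (consF true (consF true (consF true (consF true (consF true (ℓ ++F constF (false ∷ []))))))) ++F
    (consF true (consF true (consF true (consF true (consF true (ℓ ++F constF (false ∷ [])))))) ++F
    (constF (false ∷ true ∷ false ∷ true ∷ true ∷ true ∷ true ∷ true ∷ false ∷ true ∷ true ∷ true ∷ false ∷ []) ++F (constF specialStr ++F (cat-P chain-F ∘P (ℓ ∷P code′))))))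
    ++F ap1 encStr-F (ap1 unary-F (consF true (ap1 (times-F 5) ℓ))))
  where
  code′ : Fun 2 (λ v → cellsCode (V.lookup v #0) (V.lookup v #1))
  code′ = ap2 cell-F (arg #0) (arg #1)
  ℓ : Fun 2 (λ v → half (cellsCode (V.lookup v #0) (V.lookup v #1)))
  ℓ = ap1 half-F code′

-- Reading the answer and its refutations from a computation

maskStep : Vec Str 3 → Vec Str 3
maskStep (os ∷ a ∷ acc ∷ []) = caseStr os (os ∷ a ∷ acc ∷ [])
  (λ os′ → caseStr a (os ∷ a ∷ acc ∷ []) (λ a′ → os′ ∷ a′ ∷ (false ∷ acc) ∷ []) (λ a′ → os′ ∷ a′ ∷ (true ∷ acc) ∷ []))
  (λ os′ → caseStr a (os ∷ a ∷ acc ∷ []) (λ a′ → os′ ∷ a′ ∷ (false ∷ acc) ∷ []) (λ a′ → os′ ∷ a′ ∷ (false ∷ acc) ∷ []))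

maskS : Str → Str → Str
maskS os a = reverse (V.lookup (iterV maskStep os (os ∷ a ∷ [] ∷ [])) #2)

maskS-≡ : ∀ os a → maskS os a ≡ mask os a
maskS-≡ os a = trans (cong reverse (go os a [])) (reverse-involutive (mask os a))
  where
  go : ∀ os a acc → V.lookup (iterV maskStep os (os ∷ a ∷ acc ∷ [])) #2 ≡ mask os a ʳ++ acc
  go []           a           acc = refl
  go (false ∷ os) []          acc = cong (λ v → V.lookup v #2) (iter-fixed maskStep os {(false ∷ os) ∷ [] ∷ acc ∷ []} refl)
  go (true ∷ os)  []          acc = cong (λ v → V.lookup v #2) (iter-fixed maskStep os {(true ∷ os) ∷ [] ∷ acc ∷ []} refl)
  go (false ∷ os) (false ∷ a) acc = go os a (false ∷ acc)
  go (false ∷ os) (true ∷ a)  acc = go os a (true ∷ acc)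
  go (true ∷ os)  (false ∷ a) acc = go os a (false ∷ acc)
  go (true ∷ os)  (true ∷ a)  acc = go os a (false ∷ acc)

shift-size : ∀ x y acc {k l} b → length x ≤ k → length y ≤ l →
             szV (x ∷ y ∷ (b ∷ acc) ∷ []) ≤ 1 + (suc k + (suc l + (suc (length acc) + 0)))
shift-size x y acc {k} {l} b p q = ≤-trans (s≤s (+-mono-≤ p (s≤s (+-monoˡ-≤ _ q)))) (≤-reflexive (arith k l (length acc)))
  where
  arith : ∀ a b c → (1 + a) + ((1 + b) + ((2 + c) + 0)) ≡ 1 + ((1 + a) + ((1 + b) + ((1 + c) + 0)))
  arith = solve-∀

maskStep-size : ∀ v → szV (maskStep v) ≤ 1 + szV v
maskStep-size (os ∷ a ∷ acc ∷ []) = caseStr-elim Small os (n≤1+n _)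
    (λ os′ p → caseStr-elim Small a (n≤1+n _) (λ a′ q → shift-size os′ a′ acc false p q) (λ a′ q → shift-size os′ a′ acc true p q))
    (λ os′ p → caseStr-elim Small a (n≤1+n _) (λ a′ q → shift-size os′ a′ acc false p q) (λ a′ q → shift-size os′ a′ acc false p q))
  where
  Small : Vec Str 3 → Set
  Small v = szV v ≤ 1 + szV (os ∷ a ∷ acc ∷ [])

maskS-F : F2 maskS
maskS-F = mk2 (ap1 rev-P (arg #2 ∘P iterGrow-P {I = λ v → V.lookup v #0 ∷ V.lookup v #0 ∷ V.lookup v #1 ∷ [] ∷ []}
    (arg #0 ∷P arg #0 ∷P arg #1 ∷P nil-P) step′ 1 maskStep-size))
  where
  step′ : P maskStep
  step′ = P-ext (λ { (os ∷ a ∷ acc ∷ []) → refl }) (matchP (arg #0) (arg #0 ∷P arg #1 ∷P arg #2)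
    (matchP (arg #2) (arg #1 ∷P arg #2 ∷P arg #3) (arg #1 ∷P arg #0 ∷P consF false (arg #4)) (arg #1 ∷P arg #0 ∷P consF true (arg #4)))
    (matchP (arg #2) (arg #1 ∷P arg #2 ∷P arg #3) (arg #1 ∷P arg #0 ∷P consF false (arg #4)) (arg #1 ∷P arg #0 ∷P consF false (arg #4))))

agreeStep : Vec Str 3 → Vec Str 3
agreeStep (a ∷ b ∷ acc ∷ []) = caseStr a (a ∷ b ∷ acc ∷ [])
  (λ a′ → caseStr b (a ∷ b ∷ acc ∷ []) (λ b′ → a′ ∷ b′ ∷ (true ∷ acc) ∷ []) (λ _ → a ∷ b ∷ acc ∷ []))
  (λ a′ → caseStr b (a ∷ b ∷ acc ∷ []) (λ _ → a ∷ b ∷ acc ∷ []) (λ b′ → a′ ∷ b′ ∷ (true ∷ acc) ∷ []))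

-- Counts the bits before the first difference. As there is one query per bit, this is also the
-- number of the reply to be refuted.
agreement : Str → Str → Str
agreement a b = V.lookup (iterV agreeStep a (a ∷ b ∷ [] ∷ [])) #2

agreement-≡ : ∀ p s r → agreement (p ++ true ∷ s) (p ++ false ∷ r) ≡ un (length p)
agreement-≡ p s r = trans (go p 0) (cong un (+-identityʳ (length p)))
  where
  go : ∀ p j → V.lookup (iterV agreeStep (p ++ true ∷ s) ((p ++ true ∷ s) ∷ (p ++ false ∷ r) ∷ un j ∷ [])) #2 ≡ un (length p + j)
  go []          j = cong (λ v → V.lookup v #2) (iter-fixed agreeStep s {(true ∷ s) ∷ (false ∷ r) ∷ un j ∷ []} refl)
  go (false ∷ p) j = trans (go p (suc j)) (cong un (+-suc (length p) j))
  go (true ∷ p)  j = trans (go p (suc j)) (cong un (+-suc (length p) j))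

agreement-F : F2 agreement
agreement-F = mk2 (arg #2 ∘P iterGrow-P {I = λ v → V.lookup v #0 ∷ V.lookup v #0 ∷ V.lookup v #1 ∷ [] ∷ []}
    (arg #0 ∷P arg #0 ∷P arg #1 ∷P nil-P) step′ 1 size′)
  where
  step′ : P agreeStep
  step′ = P-ext (λ { (a ∷ b ∷ acc ∷ []) → refl }) (matchP (arg #0) (arg #0 ∷P arg #1 ∷P arg #2)
    (matchP (arg #2) (arg #1 ∷P arg #2 ∷P arg #3) (arg #1 ∷P arg #0 ∷P consF true (arg #4)) (arg #2 ∷P arg #3 ∷P arg #4))
    (matchP (arg #2) (arg #1 ∷P arg #2 ∷P arg #3) (arg #2 ∷P arg #3 ∷P arg #4) (arg #1 ∷P arg #0 ∷P consF true (arg #4))))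
  size′ : ∀ v → szV (agreeStep v) ≤ 1 + szV v
  size′ (a ∷ b ∷ acc ∷ []) = caseStr-elim Small a (n≤1+n _)
      (λ a′ p → caseStr-elim Small b (n≤1+n _) (λ b′ q → shift-size a′ b′ acc true p q) (λ _ _ → n≤1+n _))
      (λ a′ p → caseStr-elim Small b (n≤1+n _) (λ _ _ → n≤1+n _) (λ b′ q → shift-size a′ b′ acc true p q))
    where
    Small : Vec Str 3 → Set
    Small v = szV v ≤ 1 + szV (a ∷ b ∷ acc ∷ [])

-- The state consists of the remaining entries, the replies read so far in
-- reverse order, and the last witness.
entryStep : Vec Str 3 → Vec Str 3
entryStep (r ∷ ys ∷ l ∷ []) = caseStr r (r ∷ ys ∷ l ∷ []) (λ _ → r ∷ ys ∷ l ∷ [])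
  (λ x → caseStr (sndS x) ([] ∷ ys ∷ l ∷ []) (λ y → y ∷ (false ∷ ys) ∷ l ∷ []) (λ y → sndS y ∷ (true ∷ ys) ∷ fstS y ∷ []))

entryStep-P : P entryStep
entryStep-P = P-ext (λ { (r ∷ ys ∷ l ∷ []) → refl }) (matchP (arg #0) (arg #0 ∷P arg #1 ∷P arg #2) (arg #1 ∷P arg #2 ∷P arg #3)
  (matchP (ap1 snd-F (arg #0)) (nil-P ∷P arg #2 ∷P arg #3) (arg #0 ∷P consF false (arg #3) ∷P arg #4)
    (ap1 snd-F (arg #0) ∷P consF true (arg #3) ∷P ap1 fst-F (arg #0))))

entryStep-size : ∀ v → szV (entryStep v) ≤ 1 + szV v
entryStep-size (r ∷ ys ∷ l ∷ []) = caseStr-elim Small r (n≤1+n _) (λ _ _ → n≤1+n _)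
    (λ x x≤ → caseStr-elim Small (sndS x) (≤-trans (s≤s (≤-trans (n≤1+n _) (s≤s (m≤n+m _ (length r))))) ≤-refl)
      (λ y y≤ → ≤-trans (s≤s (+-mono-≤ (≤-trans y≤ (≤-trans (sndS-≤ x) x≤)) ≤-refl)) (≤-reflexive (arith (length r) (length ys) (length l))))
      (λ y y≤ → ≤-trans (s≤s (≤-trans (≤-reflexive (arith₂ (length (sndS y)) (length ys) (length (fstS y))))
        (+-monoˡ-≤ _ (≤-trans (≤-trans (+-monoˡ-≤ _ (m≤m+n (length (fstS y)) _)) (fstS-sndS-≤ y)) (≤-trans y≤ (≤-trans (sndS-≤ x) x≤))))))
        (≤-trans (≤-reflexive (arith₃ (length r) (length ys))) (+-monoʳ-≤ (suc (suc (length r))) (+-monoʳ-≤ (suc (length ys)) (s≤s (z≤n {length l + 0})))))))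
  where
  Small : Vec Str 3 → Set
  Small v = szV v ≤ 1 + szV (r ∷ ys ∷ l ∷ [])
  arith : ∀ a b c → (1 + a) + ((2 + b) + ((1 + c) + 0)) ≡ 1 + ((1 + a) + ((1 + b) + ((1 + c) + 0)))
  arith = solve-∀
  arith₂ : ∀ a b c → a + ((2 + b) + ((1 + c) + 0)) ≡ (c + a) + (3 + b)
  arith₂ = solve-∀
  arith₃ : ∀ a b → 1 + (a + (3 + b)) ≡ (2 + a) + ((1 + b) + 1)
  arith₃ = solve-∀

yesList : List Entry → List Bool
yesList = map (isYes ∘ proj₂)

lastWitness : List Entry → Str → Str
lastWitness []                 a = a
lastWitness ((_ , nothing) ∷ L) a = lastWitness L a
lastWitness ((_ , just b) ∷ L)  a = lastWitness L b

entries-read : ∀ L x ys l → length L ≤ length x →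
  iterV entryStep x (encEntries L ∷ ys ∷ l ∷ []) ≡ (false ∷ []) ∷ (yesList L ʳ++ ys) ∷ lastWitness L l ∷ []
entries-read [] x ys l le = iter-fixed entryStep x refl
entries-read ((q , nothing) ∷ L) (_ ∷ x) ys l (s≤s le) =
  trans (cong (λ s → iterV entryStep x (caseStr s ([] ∷ ys ∷ l ∷ []) (λ y → y ∷ (false ∷ ys) ∷ l ∷ []) (λ y → sndS y ∷ (true ∷ ys) ∷ fstS y ∷ []))) (sndS-pair q (false ∷ encEntries L)))
    (entries-read L x (false ∷ ys) l le)
entries-read ((q , just a) ∷ L) (_ ∷ x) ys l (s≤s le) =
  trans (cong (λ s → iterV entryStep x (caseStr s ([] ∷ ys ∷ l ∷ []) (λ y → y ∷ (false ∷ ys) ∷ l ∷ []) (λ y → sndS y ∷ (true ∷ ys) ∷ fstS y ∷ []))) (sndS-pair q (true ∷ encStr a ++ encEntries L)))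
    (trans (cong₂ (λ u v → iterV entryStep x (u ∷ (true ∷ ys) ∷ v ∷ [])) (sndS-pair a (encEntries L)) (fstS-pair a (encEntries L)))
      (entries-read L x (true ∷ ys) a le))

length-entries : ∀ L → length L ≤ length (encEntries L)
length-entries []            = z≤n
length-entries ((q , r) ∷ L) = s≤s (≤-trans (length-entries L) (≤-trans (length-++-≤ʳ (encEntries L) {encReply r}) (length-++-≤ʳ _ {encStr q})))

-- Stands in for the last witness when every reply is NO.
givenElement : Str → Str
givenElement u = fstS (afterGates (afterOnes u))

readEntries : Str → Str → Vec Str 3
readEntries u w = iterV entryStep w (w ∷ [] ∷ givenElement u ∷ [])

-- A query applies its mask to the assignment before evaluating `C`, so a witness belongs to S only
-- after masking.
leastFound : Str → Str → Str
leastFound u w = maskS (reverse (V.lookup (readEntries u w) #1)) (V.lookup (readEntries u w) #2)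

-- The appended bit is a value for the spare input of the query circuits.
refutation : Str → Str → Str → Str
refutation u y w = (agreement (leastFound u y) w ++ false ∷ []) ++ encStr (w ++ false ∷ [])

searchFor : Str → Str
searchFor u = searchInstance (ones u) (gatesPart (afterOnes u))

opaque
  searchFor-FP : FP searchFor
  searchFor-FP = FP-fromF1 (mk1 (ap2 searchInstance-F (ap1 ones-F (arg #0)) (ap1 gatesPart-F (ap1 afterOnes-F (arg #0)))))

  leastFound-F : F2 leastFound
  leastFound-F = mk2 (ap2 maskS-F (ap1 rev-P (arg #1 ∘P entries)) (arg #2 ∘P entries))
    where
    entries : P {2} (λ v → readEntries (V.lookup v #0) (V.lookup v #1))
    entries = iterGrow-P {I = λ v → V.lookup v #1 ∷ V.lookup v #1 ∷ [] ∷ givenElement (V.lookup v #0) ∷ []}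
      (arg #1 ∷P arg #1 ∷P nil-P ∷P ap1 fst-F (ap1 afterGates-F (ap1 afterOnes-F (arg #0)))) entryStep-P 1 entryStep-size

  refutation-F : F3 refutation
  refutation-F = mk3 ((ap2 agreement-F (ap2 leastFound-F (arg #0) (arg #1)) (arg #2) ++F constF (false ∷ [])) ++F ap1 encStr-F (arg #2 ++F constF (false ∷ [])))

lex-split : ∀ {w y} → w <lex y → length w ≡ length y → ∃ λ p → ∃ λ s → ∃ λ r → w ≡ p ++ false ∷ s × y ≡ p ++ true ∷ r
lex-split here eq = [] , _ , _ , refl , refl
lex-split (there {b} lt) eq with lex-split lt (suc-injective eq)
... | p , s , r , refl , refl = b ∷ p , s , r , refl , refl

reverse-replicate : ∀ m (b : Bool) → reverse (replicate m b) ≡ replicate m b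
reverse-replicate m b = trans (sym (++-identityʳ _)) (trans (sym (ʳ++-defn (replicate m b))) (trans (go m []) (++-identityʳ _)))
  where
  snoc : ∀ m (x : Str) → replicate m b ++ b ∷ x ≡ b ∷ replicate m b ++ x
  snoc zero    x = refl
  snoc (suc m) x = cong (b ∷_) (snoc m x)
  go : ∀ m x → replicate m b ʳ++ x ≡ replicate m b ++ x
  go zero    x = refl
  go (suc m) x = trans (go m (b ∷ x)) (snoc m x)

-- Masking is idempotent, so an initial part of a masked string is fixed by its own options.
mask-split : ∀ os a p b r → mask os a ≡ p ++ b ∷ r → ∃ λ os₁ → ∃ λ o → ∃ λ os₂ → ∃ λ c →
             os ≡ os₁ ++ o ∷ os₂ × length os₁ ≡ length p × mask os₁ p ≡ p × b ≡ maskBit o c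
mask-split (o ∷ os) (c ∷ a) []      b r eq = [] , o , os , c , refl , refl , refl , sym (∷-injectiveˡ eq)
mask-split (o ∷ os) (c ∷ a) (d ∷ p) b r eq with mask-split os a p b r (∷-injectiveʳ eq)
... | os₁ , o′ , os₂ , c′ , e , l , m , b≡ = o ∷ os₁ , o′ , os₂ , c′ , cong (o ∷_) e , cong suc l ,
      cong₂ _∷_ (trans (cong (maskBit o) (sym (∷-injectiveˡ eq))) (trans (idem o c) (∷-injectiveˡ eq))) m , b≡
  where
  idem : ∀ o c → maskBit o (maskBit o c) ≡ maskBit o c
  idem false c = refl
  idem true  c = refl
mask-split []       a       []      b r ()
mask-split []       a       (d ∷ p) b r ()
mask-split (o ∷ os) []      []      b r ()
mask-split (o ∷ os) []      (d ∷ p) b r ()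

-- Correctness of the search

module _ (n : ℕ) (C : Circuit n) where
  open Search n (encGates C)
  open Queries n (encGates C)

  reverse-options : ∀ m ds → reverse (options m ds) ≡ reverse ds ++ true ∷ replicate m false
  reverse-options m ds = trans (reverse-++ (replicate m false) (true ∷ ds)) (trans (cong₂ _++_ (unfold-reverse true ds) (reverse-replicate m false)) (++-assoc (reverse ds) _ _))

  length-options : ∀ m ds → suc m + length ds ≡ n → length (options m ds) ≡ n
  length-options m ds eq = trans (length-++ (replicate m false)) (trans (cong (_+ suc (length ds)) (length-replicate m)) (trans (+-suc m (length ds)) eq))

  -- Invariant: the current witness, masked by the replies so far, lies in S. A NO adds an option
  -- that changes nothing. A YES replaces the witness, and the new one respects the earlier options
  -- because the query imposed them.
  best-in : ∀ m ds L best → m + length ds ≡ n → Trace m ds L → YesCorrect L →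
            InSet C (mask (reverse ds ++ replicate m false) best) → InSet C (mask (reverse ds ++ yesList L) (lastWitness L best))
  best-in zero    ds []                  best eq refl ok i = i
  best-in (suc m) ds ((q , nothing) ∷ L) best eq (_ , tr) ok i =
    subst (λ os → InSet C (mask os (lastWitness L best))) (shiftʳ (yesList L)) (best-in m (false ∷ ds) L best (trans (+-suc m (length ds)) eq) tr ok
      (subst (λ os → InSet C (mask os best)) (sym (shiftʳ (replicate m false))) i))
    where
    shiftʳ : ∀ x → reverse (false ∷ ds) ++ x ≡ reverse ds ++ false ∷ x
    shiftʳ x = trans (cong (_++ x) (unfold-reverse false ds)) (++-assoc (reverse ds) _ x)
  best-in (suc m) ds ((q , just a) ∷ L) best eq (q≡ , tr) (sat , ok) i =
    subst (λ os → InSet C (mask os (lastWitness L a))) (shiftʳ (yesList L)) (best-in m (true ∷ ds) L a (trans (+-suc m (length ds)) eq) tr ok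
      (subst (λ os → InSet C (mask os a)) (trans (reverse-options m ds) (sym (shiftʳ (replicate m false))))
        (satWitness-query C refl (options m ds) (length-options m ds eq) (sym q≡) sat)))
    where
    shiftʳ : ∀ x → reverse (true ∷ ds) ++ x ≡ reverse ds ++ true ∷ x
    shiftʳ x = trans (cong (_++ x) (unfold-reverse true ds)) (++-assoc (reverse ds) _ x)

  trace-length : ∀ m ds L → Trace m ds L → length (yesList L) ≡ m
  trace-length zero    ds []            refl     = refl
  trace-length (suc m) ds ((q , r) ∷ L) (_ , tr) = cong suc (trace-length m _ L tr)

  trace-at : ∀ m ds L os b os′ → Trace m ds L → yesList L ≡ os ++ b ∷ os′ →
             ∃ λ r → entryAt L (length os) ≡ just (query (length os′) (os ʳ++ ds) , r) × isYes r ≡ b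
  trace-at (suc m) ds ((q , r) ∷ L) [] b os′ (q≡ , tr) eq = r , cong (λ z → just (z , r)) (trans q≡ (cong (λ k → query k ds) m≡)) , ∷-injectiveˡ eq
    where
    m≡ : m ≡ length os′
    m≡ = trans (sym (trace-length m _ L tr)) (cong length (∷-injectiveʳ eq))
  trace-at (suc m) ds ((q , r) ∷ L) (o ∷ os) b os′ (q≡ , tr) eq with trace-at m (isYes r ∷ ds) L os b os′ tr (∷-injectiveʳ eq)
  ... | r′ , e , y = r′ , trans e (cong (λ z → just (query (length os′) (os ʳ++ (z ∷ ds)) , r′)) (∷-injectiveˡ eq)) , y
  trace-at zero ds .[] []       b os′ refl ()
  trace-at zero ds .[] (o ∷ os) b os′ refl ()

  -- Up to the first difference `w` agrees with a masked string and so has 0 at all bits answered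
  -- YES. There the found string has a 1, so the reply was NO; and `w` has a 0, which meets the
  -- option tested. Later bits are free in that query.
  refuted : ∀ L best w → Trace n [] L → InSet C (mask (yesList L) best) → InSet C w → w <lex mask (yesList L) best →
            Refutes L ((agreement (mask (yesList L) best) w ++ false ∷ []) ++ encStr (w ++ false ∷ []))
  refuted L best w tr i-y i-w lt with lex-split lt (trans (proj₁ i-w) (sym (proj₁ i-y)))
  ... | p , s , r , refl , y≡ with mask-split (yesList L) best p true r y≡
  ...   | os₁ , true , os₂ , c , yl , len , m , ()
  ...   | os₁ , false , os₂ , c , yl , len , m , refl with trace-at n [] L os₁ false os₂ tr yl
  ...     | just _  , e , ()
  ...     | nothing , e , refl = length p , w ++ false ∷ [] , query (length os₂) (reverse os₁) ,
              cong (λ a → (a ++ false ∷ []) ++ encStr (w ++ false ∷ [])) (sym (trans (cong (λ y → agreement y w) y≡) (agreement-≡ p r s))) ,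
              trans (cong (entryAt L) (sym len)) e ,
              query-satWitness C refl (options (length os₂) (reverse os₁)) (length-options (length os₂) (reverse os₁) lengths) w refl i-w masked
    where
    w-length : length p + suc (length s) ≡ n
    w-length = trans (sym (length-++ p)) (proj₁ i-w)
    os-length : length os₁ + suc (length os₂) ≡ n
    os-length = trans (sym (length-++ os₁)) (trans (cong length (sym yl)) (trace-length n [] L tr))
    lengths : suc (length os₂) + length (reverse os₁) ≡ n
    lengths = trans (cong (suc (length os₂) +_) (length-reverse os₁)) (trans (+-comm (suc (length os₂)) (length os₁)) os-length)
    rest : length os₂ ≡ length s
    rest = suc-injective (+-cancelˡ-≡ (length p) _ _ (trans (cong (_+ suc (length os₂)) (sym len)) (trans os-length (sym w-length))))
    masked : mask (reverse (options (length os₂) (reverse os₁))) w ≡ w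
    masked = trans (cong (λ os → mask os w) (trans (reverse-options (length os₂) (reverse os₁)) (cong₂ (λ a k → a ++ true ∷ replicate k false) (reverse-involutive os₁) rest)))
      (trans (mask-++ os₁ p len) (cong₂ (λ a b → a ++ false ∷ b) m (mask-none s)))

reduces-LN : ∀ {n} (C : Circuit n) x y z → InSet C x → let u = encLN C x in PNPComputation (searchFor u) y (refutation u y z) →
             InSet C (leastFound u y) × ¬ (InSet C z × (z <lex leastFound u y))
reduces-LN {n} C x y z i pnp = found , (λ (i-z , lt) → unrefuted (subst (Refutes L) (cong (λ v → (agreement v z ++ false ∷ []) ++ encStr (z ++ false ∷ [])) (sym found-≡))
    (refuted n C L (lastWitness L x) z tr (subst (InSet C) found-≡ found) i-z (subst (z <lex_) found-≡ lt))))
  where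
  open Search n (encGates C) using (M; revT; Trace)
  u : Str
  u = encLN C x
  u≡ : u ≡ encℕ n ++ encGates C ++ encStr x
  u≡ = ++-assoc (encℕ n) (encGates C) (encStr x)
  after≡ : afterOnes u ≡ encGates C ++ encStr x
  after≡ = trans (cong afterOnes u≡) (afterOnes-enc n _)
  search≡ : searchInstance (un n) (encGates C) ≡ searchFor u
  search≡ = sym (cong₂ searchInstance (trans (cong ones u≡) (ones-enc n _)) (trans (cong gatesPart after≡) (gatesPart-enc C (encStr x))))
  given≡ : givenElement u ≡ x
  given≡ = trans (cong (λ s → fstS (afterGates s)) after≡) (trans (cong fstS (trans (afterGates-enc C (encStr x)) (sym (++-identityʳ (encStr x))))) (fstS-pair x []))
  sol : Σ (List Entry) λ L → (encEntries L ≡ y) × Consistent M (suc (5 * length revT)) (oinit M) L × YesCorrect L × ¬ Refutes L (refutation u y z)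
  sol = pnp M (suc (5 * length revT)) (trans (searchInstance-≡ n (encGates C)) search≡)
  L : List Entry
  L = proj₁ sol
  unrefuted : ¬ Refutes L (refutation u y z)
  unrefuted = proj₂ (proj₂ (proj₂ (proj₂ sol)))
  tr : Trace n [] L
  tr = searchTrace n (encGates C) L (proj₁ (proj₂ (proj₂ sol)))
  read≡ : readEntries u y ≡ (false ∷ []) ∷ (yesList L ʳ++ []) ∷ lastWitness L x ∷ []
  read≡ = trans (cong₂ (λ w a → iterV entryStep w (w ∷ [] ∷ a ∷ [])) (sym (proj₁ (proj₂ sol))) given≡) (entries-read L (encEntries L) [] x (length-entries L))
  found-≡ : leastFound u y ≡ mask (yesList L) (lastWitness L x)
  found-≡ = trans (cong (λ v → maskS (reverse (V.lookup v #1)) (V.lookup v #2)) read≡) (trans (maskS-≡ (reverse (reverse (yesList L))) (lastWitness L x))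
    (cong (λ os → mask os (lastWitness L x)) (reverse-involutive (yesList L))))
  found : InSet C (leastFound u y)
  found = subst (InSet C) (sym found-≡) (best-in n C n [] L x (+-identityʳ n) tr (proj₁ (proj₂ (proj₂ (proj₂ sol))))
    -- Before the first query no bit is masked, so the given element `x` starts the invariant.
    (subst (InSet C) (sym (trans (cong (λ k → mask (replicate k false) x) (sym (proj₁ i))) (mask-none x))) i))

LN-to-PNP : CexReducible LeastNumber PNPComputation
LN-to-PNP = searchFor , leastFound , refutation , searchFor-FP , FP-fromF2 leastFound-F , FP-fromF3 refutation-F ,
  λ { u y w pnp n C x refl i → reduces-LN C x y w i pnp }

theorem6p3 : CexReducible PNPComputation LeastNumber × CexReducible LeastNumber PNPComputation
theorem6p3 = PNP-to-LN , LN-to-PNP
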